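{- Let $d$ be one of the square-free positive integers $23,31,59,83,107,139,211,283,307,331,379,499,547,643,883,907$ (these are exactly the $d$ for which $E=\mathbb{Q}(\sqrt{ -d})$ has class number $3$; all satisfy $d\equiv 3\pmod 4$). Let $\mathfrak{U}_2,\mathfrak{U}_3$ be the integral ideals and $k$ the positive integer given in the list below (so $\mathfrak{U}_j\overline{\mathfrak{U}_j}=k\mathcal{O}$ and $\mathcal{O},\mathfrak{U}_2,\mathfrak{U}_3$ represent the three ideal classes). For a positive integer $r_1$ let $L_1^{r_1}=\mathcal{O}v_1^{r_1}$ with $h(v_1^{r_1})=r_1$, and for $j=2,3$ and a positive integer $r_j$ let $L_j^{r_j}=\mathfrak{U}_jv_j^{r_j}$ with $h(v_j^{r_j})=r_j/k$. Then a positive definite integral unary Hermitian lattice over $\mathcal{O}$ belongs to $\mathfrak{S}_d(1)$ if and only if it is isometric to some $L_1^{r_1}$ with $r_1\geq1$, or to some $L_j^{r_j}$ with $j\in\{2,3\}$ and $r_j\in R_d$, where $R_d$ is listed below; moreover $g_d(1)$ is as listed: \begin{itemize} \item $d=23$: $\mathfrak{U}_2=(2,\omega)$, $\mathfrak{U}_3=(2,-1+\omega)$, $k=2$, $R_d=\{r\geq2\}$, $g_d(1)=3$. \item $d=31$: $(2,\omega)$, $(2,-1+\omega)$, $k=2$, $R_d=\{r\geq2,\ r\neq3\}$, $g_d(1)=4$. \item $d=59$: $(3,\omega)$, $(3,-1+\omega)$, $k=3$, $R_d=\{r\geq3,\ r\neq4\}$, $g_d(1)=4$. \item $d=83$: $(3,\omega)$,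 $(3,-1+\omega)$, $k=3$, $R_d=\{r\geq3,\ r\neq4,5,8\}$, $g_d(1)=4$. \item $d=107$: $(3,\omega)$, $(3,-1+\omega)$, $k=3$, $R_d=\{r\geq3,\ r\neq4,5,7,8,10\}$, $g_d(1)=4$. \item $d=139$: $(5,\omega)$, $(5,-1+\omega)$, $k=5$, $R_d=\{r\geq5,\ r\neq6,8,9\}$, $g_d(1)=4$. \item $d=211$: $(5,1+\omega)$, $(5,-2+\omega)$, $k=5$, $R_d=\{r\geq5,\ r\neq6,7,8,9,12,14,17\}$, $g_d(1)=4$. \item $d=283$: $(7,2+\omega)$, $(7,-3+\omega)$, $k=7$, $R_d=\{r\geq7,\ r\neq8,9,10,12,15,16,17,19\}$, $g_d(1)=4$. \item $d=307$: $(7,\omega)$, $(7,-1+\omega)$, $k=7$, $R_d=\{r\geq7,\ r\neq8,9,10,12,13,15,16,20,23,27\}$, $g_d(1)=4$. \item $d=331$: $(5,1+\omega)$, $(5,-2+\omega)$, $k=5$, $R_d=\{r\geq5,\ r\neq6,7,8,9,11,12,13,14,16,18,21,23,26,28,33\}$, $g_d(1)=4$. \item $d=379$: $(5,\omega)$, $(5,-1+\omega)$, $k=5$, $R_d=\{r\geq5,\ r\neq6,7,8,9,11,12,13,14,16,17,18,21,22,26,27,31,32,36\}$, $g_d(1)=4$. \item $d=499$: $(5,\omega)$, $(5,-1+\omega)$, $k=5$, $R_d=\{r\geq5,\ r\neq6,7,8,9,11,12,13,14,16,17,18,19,21,22,23,24,26,27,28,32,33,37,38,42\}$, $g_d(1)=4$.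 \item $d=547$: $(11,2+\omega)$, $(11,-3+\omega)$, $k=11$, $R_d=\{r\geq11,\ r\neq12,14,15,16,17,18,20,21,23,25,27,28,31,34,36\}$, $g_d(1)=4$. \item $d=643$: $(7,\omega)$, $(7,-1+\omega)$, $k=7$, $R_d=\{r\geq7,\ r\neq8,9,10,11,12,13,15,16,17,18,19,20,22,24,25,26,27,32,33,34,39,40,41,47,48,55\}$, $g_d(1)=4$. \item $d=883$: $(13,\omega)$, $(13,-1+\omega)$, $k=13$, $R_d=\{r\geq13,\ r\neq14,15,16,18,19,20,21,22,23,24,25,27,28,32,33,35,36,37,38,40,41,45,49,50,53,54,66\}$, $g_d(1)=4$. \item $d=907$: $(13,4+\omega)$, $(13,-5+\omega)$, $k=13$, $R_d=\{r\geq13,\ r\neq14,15,16,17,18,20,21,22,24,25,27,28,29,30,31,33,34,35,37,40,43,44,47,48,50,56,63\}$, $g_d(1)=5$. \end{itemize}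
   Context: $E=\mathbb{Q}(\sqrt{ -d})$ with $d$ a square-free positive integer, $\mathcal{O}=\mathbb{Z}+\mathbb{Z}\omega$ its ring of integers, where $\omega=\sqrt{ -d}$ if $d\equiv1,2\pmod 4$ and $\omega=(1+\sqrt{ -d})/2$ if $d\equiv3\pmod 4$; $(a,b)$ denotes the ideal $a\mathcal{O}+b\mathcal{O}$. A Hermitian space is an $E$-vector space $V$ with a form $h:V\times V\to E$, $E$-linear in the first variable and with $h(v,w)=\overline{h(w,v)}$; write $h(v)=h(v,v)\in\mathbb{Q}$. A Hermitian lattice is a finitely generated $\mathcal{O}$-submodule of such a space; it is positive definite integral if $h(v)\in\mathbb{Z}_{>0}$ for all nonzero $v$ in it and $h(v,w)\in\mathcal{O}$ for all $v,w$ in it. A unary lattice $\mathfrak{U}v$ ($\mathfrak{U}$ a fractional ideal) lies in the one-dimensional space $Ev$. A lattice $L$ is represented by $K$ if there is an injective $\mathcal{O}$-linear map $L\to K$ preserving $h$; isometric means such a map is bijective. For $m\geq1$, $I_m$ is the free Hermitian lattice of rank $m$ with an orthonormal basis. $\mathfrak{S}_d(1)$ is the set of positive definite integral unary Hermitian lattices over $\mathcal{O}$ which are represented by $I_m$ for some $m\geq1$, and $g_d(1)$ is the smallest positive integer $g$ such that every lattice in $\mathfrak{S}_d(1)$ is represented by $I_g$. -}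

module Defs where

open import Data.Nat as ℕ using (ℕ; zero; suc; _≤_; _≡ᵇ_)
open import Data.Nat.DivMod using (_%_)
import Data.Nat.DivMod as ℕD
open import Data.Integer as Int using (ℤ; +_; -[1+_])
open import Data.Rational as ℚ using (ℚ)
open import Data.Product using (Σ; ∃; _×_; _,_; proj₁; proj₂)
open import Data.Sum using (_⊎_)
open import Data.Fin using (Fin)
open import Data.List using (List; []; _∷_)
open import Data.List.Relation.Unary.Any using (Any)
open import Data.List.Membership.Propositional using (_∉_)
open import Data.Bool using (if_then_else_)
open import Relation.Binary.PropositionalEquality using (_≡_; _≢_)
open import Relation.Nullary using (¬_)

ℕ→ℚ : ℕ → ℚ
ℕ→ℚ n = (+ n) ℚ./ 1

ℤ→ℚ : ℤ → ℚ
ℤ→ℚ z = z ℚ./ 1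

IsInt : ℚ → Set
IsInt q = Σ ℤ λ z → q ≡ ℤ→ℚ z

-- The field E = ℚ(√-d).  An element (x , y) stands for x + y·ω, where
-- ω = (1+√-d)/2 if d ≡ 3 (mod 4) and ω = √-d otherwise, so that
-- 𝒪 = ℤ + ℤω is exactly the set of elements with integral coordinates.
-- ω satisfies ω² = Tr·ω − Nm and ω̄ = Tr − ω, where
--   d ≡ 3 (mod 4) : Tr = 1, Nm = (1+d)/4 ;   otherwise : Tr = 0, Nm = d.

E : Set
E = ℚ × ℚ

Tr : ℕ → ℚ
Tr d = if (d % 4) ≡ᵇ 3 then ℚ.1ℚ else ℚ.0ℚ

Nm : ℕ → ℚ
Nm d = if (d % 4) ≡ᵇ 3 then ℕ→ℚ ((1 ℕ.+ d) ℕD./ 4) else ℕ→ℚ d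

module Field (d : ℕ) where

  0E : E
  0E = ℚ.0ℚ , ℚ.0ℚ

  1E : E
  1E = ℚ.1ℚ , ℚ.0ℚ

  ω : E
  ω = ℚ.0ℚ , ℚ.1ℚ

  ι : ℚ → E
  ι q = q , ℚ.0ℚ

  _+E_ : E → E → E
  (a , b) +E (c , e) = (a ℚ.+ c) , (b ℚ.+ e)

  -E_ : E → E
  -E (a , b) = ℚ.- a , ℚ.- b

  _-E_ : E → E → E
  x -E y = x +E (-E y)

  _*E_ : E → E → E
  (a , b) *E (c , e) =
    (a ℚ.* c ℚ.- Nm d ℚ.* (b ℚ.* e)) ,
    (a ℚ.* e ℚ.+ b ℚ.* c ℚ.+ Tr d ℚ.* (b ℚ.* e))

  conj : E → E
  conj (a , b) = (a ℚ.+ Tr d ℚ.* b) , ℚ.- b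

  Is𝒪 : E → Set
  Is𝒪 (a , b) = IsInt a × IsInt b

  -- Finitely generated 𝒪-submodules of E, given by a list of generators:
  -- x ∈ (g₁,…,gₙ) iff x = Σ cᵢ gᵢ with cᵢ ∈ 𝒪.

  InIdeal : List E → E → Set
  InIdeal [] x = x ≡ 0E
  InIdeal (g ∷ gs) x = Σ E λ c → Is𝒪 c × InIdeal gs (x -E (c *E g))

  record FracIdeal : Set where
    field
      gens    : List E
      nonzero : Any (λ g → g ≢ 0E) gens

  _∈ᴵ_ : E → FracIdeal → Set
  x ∈ᴵ 𝔘 = InIdeal (FracIdeal.gens 𝔘) x

  -- Unary Hermitian lattices  𝔘v  in the space Ev with h(v) = hv ∈ ℚ.
  -- The element x·v (x ∈ 𝔘) of the lattice is represented by x, and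
  -- h(xv, yv) = x·conj(y)·h(v).

  record Unary : Set where
    field
      ideal : FracIdeal
      hv    : ℚ

  open Unary public

  hU : Unary → E → E → E
  hU L x y = (x *E conj y) *E ι (hv L)

  PosDefIntegral : Unary → Set
  PosDefIntegral L =
    (∀ x → x ∈ᴵ ideal L → x ≢ 0E →
       Σ ℕ λ n → (0 ℕ.< n) × (hU L x x ≡ ι (ℕ→ℚ n)))
    × (∀ x y → x ∈ᴵ ideal L → y ∈ᴵ ideal L → Is𝒪 (hU L x y))

  sumE : (m : ℕ) → (Fin m → E) → E
  sumE zero f = 0E
  sumE (suc m) f = f Fin.zero +E sumE m (λ i → f (Fin.suc i))
    where import Data.Fin as Fin

  hI : (m : ℕ) → (Fin m → E) → (Fin m → E) → E
  hI m x y = sumE m (λ i → x i *E conj (y i))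

  -- L is represented by I_m: an injective 𝒪-linear map L → I_m
  -- preserving h.  (The map is given as a function on E whose
  -- restriction to the lattice is the map in question.)
  RepresentedBy : Unary → ℕ → Set
  RepresentedBy L m =
    Σ (E → Fin m → E) λ f →
      (∀ x → x ∈ᴵ 𝔘 → ∀ i → Is𝒪 (f x i))
    × (∀ x y → x ∈ᴵ 𝔘 → y ∈ᴵ 𝔘 → ∀ i → f (x +E y) i ≡ f x i +E f y i)
    × (∀ c x → Is𝒪 c → x ∈ᴵ 𝔘 → ∀ i → f (c *E x) i ≡ c *E f x i)
    × (∀ x y → x ∈ᴵ 𝔘 → y ∈ᴵ 𝔘 → (∀ i → f x i ≡ f y i) → x ≡ y)
    × (∀ x y → x ∈ᴵ 𝔘 → y ∈ᴵ 𝔘 → hI m (f x) (f y) ≡ hU L x y)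
    where 𝔘 = ideal L

  Isometric : Unary → Unary → Set
  Isometric L K =
    Σ (E → E) λ f →
      (∀ x → x ∈ᴵ 𝔘 → f x ∈ᴵ 𝔙)
    × (∀ x y → x ∈ᴵ 𝔘 → y ∈ᴵ 𝔘 → f (x +E y) ≡ f x +E f y)
    × (∀ c x → Is𝒪 c → x ∈ᴵ 𝔘 → f (c *E x) ≡ c *E f x)
    × (∀ x y → x ∈ᴵ 𝔘 → y ∈ᴵ 𝔘 → f x ≡ f y → x ≡ y)
    × (∀ y → y ∈ᴵ 𝔙 → Σ E λ x → x ∈ᴵ 𝔘 × f x ≡ y)
    × (∀ x y → x ∈ᴵ 𝔘 → y ∈ᴵ 𝔘 → hU K (f x) (f y) ≡ hU L x y)
    where 𝔘 = ideal L
          𝔙 = ideal K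

  InS : Unary → Set
  InS L = PosDefIntegral L × (Σ ℕ λ m → (1 ℕ.≤ m) × RepresentedBy L m)

  IsG : ℕ → Set
  IsG g = (1 ℕ.≤ g)
        × (∀ L → InS L → RepresentedBy L g)
        × (∀ g' → 1 ℕ.≤ g' → (∀ L → InS L → RepresentedBy L g') → g ℕ.≤ g')

-- The table of the theorem.  A row (d, k, c₂, c₃, excl, g) means
-- 𝔘₂ = (k, c₂ + ω), 𝔘₃ = (k, c₃ + ω), R_d = {r ≥ k, r ∉ excl}, g_d(1) = g.

record Row : Set where
  constructor row
  field
    d    : ℕ
    k    : ℕ
    {{k≢0}} : ℕ.NonZero k
    c₂   : ℤ
    c₃   : ℤ
    excl : List ℕ
    g    : ℕ


table : List Row
table =
    row 23  2  (+ 0) (-[1+ 0 ]) [] 3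
  ∷ row 31  2  (+ 0) (-[1+ 0 ]) (3 ∷ []) 4
  ∷ row 59  3  (+ 0) (-[1+ 0 ]) (4 ∷ []) 4
  ∷ row 83  3  (+ 0) (-[1+ 0 ]) (4 ∷ 5 ∷ 8 ∷ []) 4
  ∷ row 107 3  (+ 0) (-[1+ 0 ]) (4 ∷ 5 ∷ 7 ∷ 8 ∷ 10 ∷ []) 4
  ∷ row 139 5  (+ 0) (-[1+ 0 ]) (6 ∷ 8 ∷ 9 ∷ []) 4
  ∷ row 211 5  (+ 1) (-[1+ 1 ]) (6 ∷ 7 ∷ 8 ∷ 9 ∷ 12 ∷ 14 ∷ 17 ∷ []) 4
  ∷ row 283 7  (+ 2) (-[1+ 2 ]) (8 ∷ 9 ∷ 10 ∷ 12 ∷ 15 ∷ 16 ∷ 17 ∷ 19 ∷ []) 4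
  ∷ row 307 7  (+ 0) (-[1+ 0 ]) (8 ∷ 9 ∷ 10 ∷ 12 ∷ 13 ∷ 15 ∷ 16 ∷ 20 ∷ 23 ∷ 27 ∷ []) 4
  ∷ row 331 5  (+ 1) (-[1+ 1 ]) (6 ∷ 7 ∷ 8 ∷ 9 ∷ 11 ∷ 12 ∷ 13 ∷ 14 ∷ 16 ∷ 18 ∷ 21 ∷ 23 ∷ 26 ∷ 28 ∷ 33 ∷ []) 4
  ∷ row 379 5  (+ 0) (-[1+ 0 ]) (6 ∷ 7 ∷ 8 ∷ 9 ∷ 11 ∷ 12 ∷ 13 ∷ 14 ∷ 16 ∷ 17 ∷ 18 ∷ 21 ∷ 22 ∷ 26 ∷ 27 ∷ 31 ∷ 32 ∷ 36 ∷ []) 4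
  ∷ row 499 5  (+ 0) (-[1+ 0 ]) (6 ∷ 7 ∷ 8 ∷ 9 ∷ 11 ∷ 12 ∷ 13 ∷ 14 ∷ 16 ∷ 17 ∷ 18 ∷ 19 ∷ 21 ∷ 22 ∷ 23 ∷ 24 ∷ 26 ∷ 27 ∷ 28 ∷ 32 ∷ 33 ∷ 37 ∷ 38 ∷ 42 ∷ []) 4
  ∷ row 547 11 (+ 2) (-[1+ 2 ]) (12 ∷ 14 ∷ 15 ∷ 16 ∷ 17 ∷ 18 ∷ 20 ∷ 21 ∷ 23 ∷ 25 ∷ 27 ∷ 28 ∷ 31 ∷ 34 ∷ 36 ∷ []) 4
  ∷ row 643 7  (+ 0) (-[1+ 0 ]) (8 ∷ 9 ∷ 10 ∷ 11 ∷ 12 ∷ 13 ∷ 15 ∷ 16 ∷ 17 ∷ 18 ∷ 19 ∷ 20 ∷ 22 ∷ 24 ∷ 25 ∷ 26 ∷ 27 ∷ 32 ∷ 33 ∷ 34 ∷ 39 ∷ 40 ∷ 41 ∷ 47 ∷ 48 ∷ 55 ∷ []) 4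
  ∷ row 883 13 (+ 0) (-[1+ 0 ]) (14 ∷ 15 ∷ 16 ∷ 18 ∷ 19 ∷ 20 ∷ 21 ∷ 22 ∷ 23 ∷ 24 ∷ 25 ∷ 27 ∷ 28 ∷ 32 ∷ 33 ∷ 35 ∷ 36 ∷ 37 ∷ 38 ∷ 40 ∷ 41 ∷ 45 ∷ 49 ∷ 50 ∷ 53 ∷ 54 ∷ 66 ∷ []) 4
  ∷ row 907 13 (+ 4) (-[1+ 4 ]) (14 ∷ 15 ∷ 16 ∷ 17 ∷ 18 ∷ 20 ∷ 21 ∷ 22 ∷ 24 ∷ 25 ∷ 27 ∷ 28 ∷ 29 ∷ 30 ∷ 31 ∷ 33 ∷ 34 ∷ 35 ∷ 37 ∷ 40 ∷ 43 ∷ 44 ∷ 47 ∷ 48 ∷ 50 ∷ 56 ∷ 63 ∷ []) 5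
  ∷ []

module _ (ρ : Row) where
  open Row ρ
  open Field d

  ideal𝒪 : FracIdeal
  ideal𝒪 = record { gens = 1E ∷ [] ; nonzero = Any.here (λ ()) }
    where import Data.List.Relation.Unary.Any as Any

  idealU : ℤ → FracIdeal
  idealU c = record { gens = ι (ℕ→ℚ k) ∷ (ℤ→ℚ c , ℚ.1ℚ) ∷ []
                    ; nonzero = Any.there (Any.here (λ ())) }
    where import Data.List.Relation.Unary.Any as Any

  L₁ : ℕ → Unary
  L₁ r = record { ideal = ideal𝒪 ; hv = ℕ→ℚ r }

  Lⱼ : ℤ → ℕ → Unary
  Lⱼ c r = record { ideal = idealU c ; hv = (+ r) ℚ./ k }

  InR : ℕ → Set
  InR r = (k ≤ r) × (r ∉ excl)

  RowStatement : Set
  RowStatement =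
    (∀ (L : Unary) → PosDefIntegral L →
       (InS L →
          (Σ ℕ λ r → (1 ≤ r) × Isometric L (L₁ r))
        ⊎ (Σ ℤ λ c → (c ≡ c₂ ⊎ c ≡ c₃) × Σ ℕ λ r → InR r × Isometric L (Lⱼ c r)))
       × ((Σ ℕ λ r → (1 ≤ r) × Isometric L (L₁ r))
        ⊎ (Σ ℤ λ c → (c ≡ c₂ ⊎ c ≡ c₃) × Σ ℕ λ r → InR r × Isometric L (Lⱼ c r))
          → InS L))
    × IsG g

-- With N = (d + 1) / 4, every fractional ideal is a multiple of some ℤa + ℤ(b + ω) with a c = b² + b + N, and
-- Gauss reduction of the form (a, 2b + 1, c) leaves only a = 1 and a = k for the listed d. A unary
-- lattice on such an ideal is determined by a positive integer r, and it is represented by I_m exactly when r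
-- is a sum of m values of a X² + (2b + 1) X Y + c Y².
--
-- In each class modulo 32k every large r is v + k n, where v is a fixed value of the form and n ≡ 3 (mod 8) or
-- n ≡ 12 (mod 32), so that n is a sum of three squares; smaller r are settled by a finite search. The remaining
-- r are not sums of values because R_d ∪ {0} is closed under addition and contains all values.
--
-- For n ≡ 3 (mod 8) let T(n) count the representations of n by squares of three positive odd numbers, and F(n)
-- the solutions of AB + BC + CA = n in positive odd numbers. Both satisfy the same linear recurrence: for T by the
-- symmetry of sums of squares, for F by the class number relation Σ_s F(4m - s²) = σ(m) together with a windmill
-- identity for σ. Hence T = F, and F(n) > 0 because of A = B = 1.
{-# OPTIONS --safe #-}
module Submission where

open import Defs
open import Data.Bool.Base using (Bool; true; false; _∧_; _∨_; _xor_; not; if_then_else_)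
open import Data.Bool.Properties as 𝔹 using (T-∧; T-∨)
open import Data.Empty using (⊥; ⊥-elim)
open import Data.Fin.Base as Fin using (Fin)
open import Data.Integer.Base as ℤ using (ℤ; +_; -[1+_]; +[1+_]; 0ℤ; 1ℤ; ∣_∣; _⊖_)
open import Data.Integer.DivMod as ℤD using (_%ℕ_; _/ℕ_)
import Data.Integer.Properties as ℤₚ
open import Data.Integer.Tactic.RingSolver using (solve-∀)
open import Data.List.Base using (List; []; _∷_; _++_; map; upTo; applyUpTo; filterᵇ; cartesianProduct)
open import Data.List.Membership.Propositional using (_∈_; _∉_)
open import Data.List.Membership.Propositional.Properties using (∈-map⁺; ∈-map⁻; ∈-upTo⁺; ∈-cartesianProduct⁺; ∈-cartesianProduct⁻)
open import Data.List.Relation.Unary.All as All using (All; []; _∷_)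
open import Data.List.Relation.Unary.AllPairs using ([]; _∷_)
open import Data.List.Relation.Unary.Any using (Any; here; there)
open import Data.List.Relation.Unary.Unique.Propositional using (Unique)
import Data.List.Relation.Unary.Unique.Propositional.Properties as Uniqueₚ
open import Data.Nat.Base as ℕ using (ℕ; zero; suc; ⌊_/2⌋; _≡ᵇ_; _≤ᵇ_; _<ᵇ_; s≤s; z≤n)
import Data.Nat.DivMod as ℕD
open import Data.Nat.Induction using (<-wellFounded)
import Data.Nat.Properties as ℕₚ
open import Data.Nat.Tactic.RingSolver using () renaming (solve-∀ to solveℕ)
open import Data.Product using (Σ; _×_; _,_; proj₁; proj₂)
import Data.Product.Properties as ×
open import Data.Rational.Base as ℚ using (ℚ; 0ℚ; 1ℚ; mkℚ; toℚᵘ)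
import Data.Rational.Properties as ℚₚ
open import Data.Rational.Unnormalised.Base as ℚᵘ using (ℚᵘ; mkℚᵘ; *≡*; _≃_)
import Data.Rational.Unnormalised.Properties as ℚᵘₚ
open import Data.Sum.Base using (_⊎_; inj₁; inj₂)
open import Function.Bundles using (Equivalence)
open import Induction.WellFounded using (Acc; acc)
open import Level using (0ℓ)
open import Relation.Binary.Definitions using (DecidableEquality)
open import Relation.Binary.PropositionalEquality hiding (J)
open import Relation.Nullary using (Dec; yes; no; ¬_; does)
open import Relation.Nullary.Decidable using (_×-dec_; map′)
open import Relation.Nullary.Decidable.Core using (dec⇒maybe)
open import Tactic.RingSolver using () renaming (solve-∀ to solve-∀-over)
import Tactic.RingSolver.Core.AlmostCommutativeRing as ACR

-- Three squares is the one infinite statement behind the finite searches. It is asked only for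
-- numbers `8j + 3` and four times such numbers: in the first case every square is odd, and parity
-- keeps the relevant linear forms away from zero.
--
-- The class number relation is proved in the spirit of Kronecker's bilinear forms. A quadruple of
-- determinant `n` is the Gram matrix of a bilinear form, not assumed symmetric. A pointwise
-- identity between signs writes the indicator of reduced forms as terms that cancel in the sum
-- under unimodular substitutions, plus a term supported on triangular matrices. Summing it counts
-- reduced forms by divisors.
--
-- The recurrence, with `N = 8j + 5` and sums over positive odd `s`, `t`, is Σ (2N - 5s² - 5t²) u(N
-- - s² - t²) = 0 for `u = T` and `u = F`. The term `s = t = 1` carries `u(8j + 3)` with coefficient
-- `16j`, so everything is determined by `u(3)`.
--
-- Four summands leave room for one value and three squares. For `d = 23` only three are allowed,
-- and completing squares in the forms themselves takes over.

module Sums where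

  -- Finite sums over lists: guarded terms and reindexing.

  open import Data.Integer.Base using (_+_; _*_; -_; _-_)

  private variable
    A B : Set
    P Q : Set

  ∑ : List A → (A → ℤ) → ℤ
  ∑ []       f = 0ℤ
  ∑ (x ∷ xs) f = f x + ∑ xs f

  ∑-cong : ∀ (xs : List A) {f g} → (∀ x → f x ≡ g x) → ∑ xs f ≡ ∑ xs g
  ∑-cong []       h = refl
  ∑-cong (x ∷ xs) h = cong₂ _+_ (h x) (∑-cong xs h)

  ∑-cong-∈ : ∀ (xs : List A) {f g} → (∀ x → x ∈ xs → f x ≡ g x) → ∑ xs f ≡ ∑ xs g
  ∑-cong-∈ []       h = refl
  ∑-cong-∈ (x ∷ xs) h = cong₂ _+_ (h x (here refl)) (∑-cong-∈ xs λ y p → h y (there p))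

  ∑-zero : ∀ (xs : List A) {f} → (∀ x → f x ≡ 0ℤ) → ∑ xs f ≡ 0ℤ
  ∑-zero []       h = refl
  ∑-zero (x ∷ xs) h = cong₂ _+_ (h x) (∑-zero xs h)

  private
    interchange : ∀ a b c d → (a + b) + (c + d) ≡ (a + c) + (b + d)
    interchange = solve-∀

  ∑-+ : ∀ (xs : List A) f g → ∑ xs (λ x → f x + g x) ≡ ∑ xs f + ∑ xs g
  ∑-+ []       f g = refl
  ∑-+ (x ∷ xs) f g = trans (cong (_+_ (f x + g x)) (∑-+ xs f g)) (interchange (f x) (g x) (∑ xs f) (∑ xs g))

  ∑-* : ∀ c (xs : List A) f → ∑ xs (λ x → c * f x) ≡ c * ∑ xs f
  ∑-* c []       f = sym (ℤₚ.*-zeroʳ c)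
  ∑-* c (x ∷ xs) f = trans (cong (_+_ (c * f x)) (∑-* c xs f)) (sym (ℤₚ.*-distribˡ-+ c (f x) (∑ xs f)))

  ∑-neg : ∀ (xs : List A) f → ∑ xs (λ x → - f x) ≡ - ∑ xs f
  ∑-neg xs f = trans (∑-cong xs λ x → sym (ℤₚ.-1*i≡-i (f x))) (trans (∑-* (- 1ℤ) xs f) (ℤₚ.-1*i≡-i _))

  ∑-swap : ∀ (xs : List A) (ys : List B) (f : A → B → ℤ) → ∑ xs (λ x → ∑ ys (f x)) ≡ ∑ ys (λ y → ∑ xs (λ x → f x y))
  ∑-swap []       ys f = sym (∑-zero ys λ _ → refl)
  ∑-swap (x ∷ xs) ys f = trans (cong (_+_ (∑ ys (f x))) (∑-swap xs ys f)) (sym (∑-+ ys (f x) _))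

  ∑-++ : ∀ (xs ys : List A) f → ∑ (xs ++ ys) f ≡ ∑ xs f + ∑ ys f
  ∑-++ []       ys f = sym (ℤₚ.+-identityˡ _)
  ∑-++ (x ∷ xs) ys f = trans (cong (_+_ (f x)) (∑-++ xs ys f)) (sym (ℤₚ.+-assoc (f x) _ _))

  ∑-map : ∀ (h : A → B) xs f → ∑ (map h xs) f ≡ ∑ xs (λ x → f (h x))
  ∑-map h []       f = refl
  ∑-map h (x ∷ xs) f = cong (_+_ (f (h x))) (∑-map h xs f)

  ∑-× : ∀ (xs : List A) (ys : List B) (f : A × B → ℤ) →
        ∑ (cartesianProduct xs ys) f ≡ ∑ xs (λ x → ∑ ys (λ y → f (x , y)))
  ∑-× []       ys f = refl
  ∑-× (x ∷ xs) ys f = trans (∑-++ (map (x ,_) ys) _ f) (cong₂ _+_ (∑-map (x ,_) ys f) (∑-× xs ys f))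

  -- The Iverson bracket of a decidable statement, times `z`.
  guard : Dec P → ℤ → ℤ
  guard (yes _) z = z
  guard (no  _) z = 0ℤ

  guard-yes : ∀ (p : Dec P) {z} → P → guard p z ≡ z
  guard-yes (yes _) _ = refl
  guard-yes (no ¬p) p = ⊥-elim (¬p p)

  guard-no : ∀ (p : Dec P) {z} → ¬ P → guard p z ≡ 0ℤ
  guard-no (yes p) ¬p = ⊥-elim (¬p p)
  guard-no (no _)  _  = refl

  guard-≢0 : ∀ (p : Dec P) {z} → guard p z ≢ 0ℤ → P
  guard-≢0 (yes p) _ = p
  guard-≢0 (no _)  h = ⊥-elim (h refl)

  guard-⇔ : ∀ (p : Dec P) (q : Dec Q) {z z′} → (P → Q) → (Q → P) → (P → z ≡ z′) → guard p z ≡ guard q z′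
  guard-⇔ (yes p) q to from e = trans (e p) (sym (guard-yes q (to p)))
  guard-⇔ (no ¬p) q to from e = sym (guard-no q λ x → ¬p (from x))

  guard-distrib-+ : ∀ (p : Dec P) x y → guard p (x + y) ≡ guard p x + guard p y
  guard-distrib-+ (yes _) x y = refl
  guard-distrib-+ (no _)  x y = refl

  *-guard : ∀ (p : Dec P) c x → c * guard p x ≡ guard p (c * x)
  *-guard (yes _) c x = refl
  *-guard (no _)  c x = ℤₚ.*-zeroʳ c

  module _ (_≟_ : DecidableEquality A) where

    ∑-absent : ∀ {xs : List A} {y} c → All (y ≢_) xs → ∑ xs (λ x → guard (x ≟ y) c) ≡ 0ℤ
    ∑-absent c []       = refl
    ∑-absent c (n ∷ ns) = cong₂ _+_ (guard-no (_ ≟ _) λ e → n (sym e)) (∑-absent c ns)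

    ∑-point : ∀ {xs : List A} {y} c → Unique xs → y ∈ xs → ∑ xs (λ x → guard (x ≟ y) c) ≡ c
    ∑-point c (u ∷ us) (here refl) =
      trans (cong₂ _+_ (guard-yes (_ ≟ _) refl) (∑-absent c u)) (ℤₚ.+-identityʳ c)
    ∑-point c (u ∷ us) (there p) =
      trans (cong₂ _+_ (guard-no (_ ≟ _) (All.lookup u p)) (∑-point c us p)) (ℤₚ.+-identityˡ c)

  guard-0 : ∀ (p : Dec P) → guard p 0ℤ ≡ 0ℤ
  guard-0 (yes _) = refl
  guard-0 (no _)  = refl

  -- Both sums equal one double sum over the graph of `φ`, with the order of summation exchanged.
  -- Only nonzero terms have to correspond: the lists will be finite boxes that the maps need not
  -- preserve, and `φ`, `ψ` may do anything outside the supports.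
  ∑-transfer : (_≟A_ : DecidableEquality A) (_≟B_ : DecidableEquality B) →
    ∀ {xs ys} → Unique xs → Unique ys → (f : A → ℤ) (g : B → ℤ) (φ : A → B) (ψ : B → A) →
    (∀ x → x ∈ xs → f x ≢ 0ℤ → φ x ∈ ys × ψ (φ x) ≡ x × g (φ x) ≡ f x) →
    (∀ y → y ∈ ys → g y ≢ 0ℤ → ψ y ∈ xs × φ (ψ y) ≡ y × f (ψ y) ≡ g y) →
    ∑ xs f ≡ ∑ ys g
  ∑-transfer {A} {B} _≟A_ _≟B_ {xs} {ys} uxs uys f g φ ψ to from = begin
    ∑ xs f                                              ≡⟨ ∑-cong-∈ xs expand-f ⟨
    ∑ xs (λ x → ∑ ys λ y → guard (y ≟B φ x) (f x))      ≡⟨ ∑-cong-∈ xs (λ x p → ∑-cong-∈ ys (λ y q → match x p y q)) ⟩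
    ∑ xs (λ x → ∑ ys λ y → guard (x ≟A ψ y) (g y))      ≡⟨ ∑-swap xs ys _ ⟩
    ∑ ys (λ y → ∑ xs λ x → guard (x ≟A ψ y) (g y))      ≡⟨ ∑-cong-∈ ys expand-g ⟩
    ∑ ys g                                              ∎
    where
    open ≡-Reasoning
    expand-f : ∀ x → x ∈ xs → ∑ ys (λ y → guard (y ≟B φ x) (f x)) ≡ f x
    expand-f x p with f x ℤₚ.≟ 0ℤ
    ... | no h = ∑-point _≟B_ (f x) uys (proj₁ (to x p h))
    ... | yes e rewrite e = ∑-zero ys λ y → guard-0 (y ≟B φ x)
    expand-g : ∀ y → y ∈ ys → ∑ xs (λ x → guard (x ≟A ψ y) (g y)) ≡ g y
    expand-g y p with g y ℤₚ.≟ 0ℤ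
    ... | no h = ∑-point _≟A_ (g y) uxs (proj₁ (from y p h))
    ... | yes e rewrite e = ∑-zero xs λ x → guard-0 (x ≟A ψ y)
    match : ∀ x → x ∈ xs → ∀ y → y ∈ ys → guard (y ≟B φ x) (f x) ≡ guard (x ≟A ψ y) (g y)
    -- In the mixed cases a true guard would make the vanishing value equal to the nonvanishing one,
    -- so both guarded terms are zero.
    match x p y q with f x ℤₚ.≟ 0ℤ | g y ℤₚ.≟ 0ℤ
    ... | yes e | yes e′ rewrite e | e′ = trans (guard-0 (y ≟B φ x)) (sym (guard-0 (x ≟A ψ y)))
    ... | no h  | yes e′ rewrite e′ = trans (guard-no (y ≟B φ x) λ { refl →
            h (trans (sym (proj₂ (proj₂ (to x p h)))) e′) }) (sym (guard-0 (x ≟A ψ y)))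
    ... | yes e | no h rewrite e = trans (guard-0 (y ≟B φ x)) (sym (guard-no (x ≟A ψ y) λ { refl →
            h (trans (sym (proj₂ (proj₂ (from y q h)))) e) }))
    ... | no h  | no h′ = guard-⇔ (y ≟B φ x) (x ≟A ψ y)
      (λ { refl → sym (proj₁ (proj₂ (to x p h))) })
      (λ { refl → sym (proj₁ (proj₂ (from y q h′))) })
      (λ { refl → sym (proj₂ (proj₂ (to x p h))) })

  -- The two support conditions say that the nonzero terms of both sums lie in `xs`; the list itself
  -- need not be stable under `φ`.
  ∑-bijection : (_≟_ : DecidableEquality A) → ∀ {xs} → Unique xs → (f : A → ℤ) (φ ψ : A → A) →
    (∀ x → ψ (φ x) ≡ x) → (∀ x → φ (ψ x) ≡ x) →
    (∀ x → f x ≢ 0ℤ → x ∈ xs) → (∀ x → f x ≢ 0ℤ → ψ x ∈ xs) →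
    ∑ xs f ≡ ∑ xs (λ x → f (φ x))
  ∑-bijection _≟_ u f φ ψ ψφ φψ s s′ = ∑-transfer _≟_ _≟_ u u f (λ x → f (φ x)) ψ φ
    (λ x _ h → s′ x h , φψ x , cong f (φψ x))
    (λ y _ h → s (φ y) h , ψφ y , refl)

-- Sign patterns and the pointwise index formula.

module SignPatterns where

  open import Data.Integer.Base using (_+_; _*_; -_; _-_)

  data Sign : Set where
    neg zer pos : Sign

  sg : ℤ → Sign
  sg -[1+ _ ] = neg
  sg (+ 0)    = zer
  sg +[1+ _ ] = pos

  opp : Sign → Sign
  opp neg = pos
  opp zer = zer
  opp pos = neg

  isneg ispos iszer : Sign → Bool
  isneg neg = true
  isneg _   = false
  ispos pos = true
  ispos _   = false
  iszer zer = true
  iszer _   = false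

  sg-neg : ∀ x → sg (- x) ≡ opp (sg x)
  sg-neg -[1+ _ ] = refl
  sg-neg (+ 0)    = refl
  sg-neg +[1+ _ ] = refl

  -- The sign patterns (u , v , w) that occur for integers with u + v + w ≡ 0.
  balanced : Sign → Sign → Sign → Bool
  balanced zer zer zer = true
  balanced u v w = (ispos u ∨ ispos v ∨ ispos w) ∧ (isneg u ∨ isneg v ∨ isneg w)

  sg-balanced : ∀ u v w → u + v + w ≡ 0ℤ → balanced (sg u) (sg v) (sg w) ≡ true
  sg-balanced u v w e = go u v w e
    where
    go : ∀ u v w → u + v + w ≡ 0ℤ → balanced (sg u) (sg v) (sg w) ≡ true
    go -[1+ _ ] -[1+ _ ] -[1+ _ ] ()
    go -[1+ _ ] -[1+ _ ] (+ 0) ()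
    go -[1+ _ ] -[1+ _ ] +[1+ _ ] _ = refl
    go -[1+ _ ] (+ 0) -[1+ _ ] ()
    go -[1+ _ ] (+ 0) (+ 0) ()
    go -[1+ _ ] (+ 0) +[1+ _ ] _ = refl
    go -[1+ _ ] +[1+ _ ] -[1+ _ ] _ = refl
    go -[1+ _ ] +[1+ _ ] (+ 0) _ = refl
    go -[1+ _ ] +[1+ _ ] +[1+ _ ] _ = refl
    go (+ 0) -[1+ _ ] -[1+ _ ] ()
    go (+ 0) -[1+ _ ] (+ 0) ()
    go (+ 0) -[1+ _ ] +[1+ _ ] _ = refl
    go (+ 0) (+ 0) -[1+ _ ] ()
    go (+ 0) (+ 0) (+ 0) _ = refl
    go (+ 0) (+ 0) +[1+ _ ] ()
    go (+ 0) +[1+ _ ] -[1+ _ ] _ = refl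
    go (+ 0) +[1+ _ ] (+ 0) ()
    go (+ 0) +[1+ _ ] +[1+ _ ] ()
    go +[1+ _ ] -[1+ _ ] -[1+ _ ] _ = refl
    go +[1+ _ ] -[1+ _ ] (+ 0) _ = refl
    go +[1+ _ ] -[1+ _ ] +[1+ _ ] _ = refl
    go +[1+ _ ] (+ 0) -[1+ _ ] _ = refl
    go +[1+ _ ] (+ 0) (+ 0) ()
    go +[1+ _ ] (+ 0) +[1+ _ ] ()
    go +[1+ _ ] +[1+ _ ] -[1+ _ ] _ = refl
    go +[1+ _ ] +[1+ _ ] (+ 0) ()
    go +[1+ _ ] +[1+ _ ] +[1+ _ ] ()

  -- Nonzero exactly when `a`, `d` agree in sign, `b`, `c` are opposite and `|c| > |b|`, the fifth
  -- argument being the sign of `b + c`; the value is then the sign of `ab`. Negating `b` and `c`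
  -- therefore reverses it.
  crossing : Sign → Sign → Sign → Sign → Sign → ℤ
  crossing pos pos neg pos neg = 1ℤ
  crossing pos neg pos pos pos = - 1ℤ
  crossing neg neg pos neg pos = 1ℤ
  crossing neg pos neg neg neg = - 1ℤ
  crossing _   _   _   _   _   = 0ℤ

  -- Minus the sign of `ab` on the region `ad > 0 > bc`, without the comparison of `b` with `c`.
  descent : Sign → Sign → Sign → Sign → ℤ
  descent pos neg pos pos = 1ℤ
  descent pos pos neg pos = - 1ℤ
  descent neg pos neg neg = 1ℤ
  descent neg neg pos neg = - 1ℤ
  descent _   _   _   _   = 0ℤ

  -- The boundary terms: up to a common sign, the upper triangular matrices with `a`, `d` positive
  -- and `-(a + d) < b < 0`. The fifth argument is the sign of `a + b + c + d`.
  cusp : Sign → Sign → Sign → Sign → Sign → ℤ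
  cusp pos neg zer pos pos = 1ℤ
  cusp neg pos zer neg neg = 1ℤ
  cusp _   _   _   _   _   = 0ℤ

  reduced : Sign → Sign → Sign → ℤ
  reduced neg neg neg = 1ℤ
  reduced pos pos pos = 1ℤ
  reduced _   _   _   = 0ℤ

  -- A syntax for finite statements about signs, so that each is decided by one evaluation of
  -- `holds`. A failed premise cuts off all quantifiers below it, which prunes the enumeration.
  data Formula : Set where
    ∀± ∀₀ : (Sign → Formula) → Formula
    _⇒_   : Bool → Formula → Formula
    _≈_   : ℤ → ℤ → Formula

  infixr 3 _⇒_
  infix 4 _≈_

  ⟦_⟧ : Formula → Set
  ⟦ ∀± f ⟧  = ∀ s → s ≢ zer → ⟦ f s ⟧
  ⟦ ∀₀ f ⟧  = ∀ s → ⟦ f s ⟧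
  ⟦ p ⇒ f ⟧ = p ≡ true → ⟦ f ⟧
  ⟦ i ≈ j ⟧ = i ≡ j

  holds : Formula → Bool
  holds (∀± f)      = holds (f neg) ∧ holds (f pos)
  holds (∀₀ f)      = holds (f zer) ∧ holds (f neg) ∧ holds (f pos)
  holds (true  ⇒ f) = holds f
  holds (false ⇒ f) = true
  holds (i ≈ j)     = does (i ℤₚ.≟ j)

  ∧-elim : ∀ p {q} → (p ∧ q) ≡ true → p ≡ true × q ≡ true
  ∧-elim true {true} _ = refl , refl

  sound : ∀ f → holds f ≡ true → ⟦ f ⟧
  sound (∀± f) h neg _ = sound (f neg) (proj₁ (∧-elim (holds (f neg)) h))
  sound (∀± f) h pos _ = sound (f pos) (proj₂ (∧-elim (holds (f neg)) h))
  sound (∀± f) h zer n = ⊥-elim (n refl)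
  sound (∀₀ f) h zer = sound (f zer) (proj₁ (∧-elim (holds (f zer)) h))
  sound (∀₀ f) h neg = sound (f neg) (proj₁ (∧-elim (holds (f neg)) (proj₂ (∧-elim (holds (f zer)) h))))
  sound (∀₀ f) h pos = sound (f pos) (proj₂ (∧-elim (holds (f neg)) (proj₂ (∧-elim (holds (f zer)) h))))
  sound (true ⇒ f) h _ = sound f h
  sound (i ≈ j) h with i ℤₚ.≟ j
  ... | yes p = p

  -- The signs belong to the 3 by 3 matrix of values `B(eᵢ, eⱼ)` on the superbase `e₀`, `e₁`,
  -- `e₂ = -(e₀ + e₁)`, whose rows and columns sum to zero. Its corner is `a, b, c, d`, and
  -- `x, y, z` are the symmetrised entries outside the diagonal, tied to the diagonal by relations
  -- such as `2a + x + z = 0`. Only the balance of signs in such zero sums is assumed, and each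
  -- condition is placed as soon as its three signs are quantified. `∀±` marks the odd entries,
  -- which cannot vanish.
  index-statement : Formula
  index-statement =
    ∀± λ a → ∀± λ b → ∀₀ λ c → ∀± λ x → balanced b c (opp x) ⇒
                     ∀± λ z → balanced a x z ⇒ ∀± λ m₂₀ → balanced a c m₂₀ ⇒
                     ∀± λ d → ∀± λ m₁₂ → balanced c d m₁₂ ⇒
                     ∀± λ y → balanced d x y ⇒ ∀± λ m₂₂ → balanced m₂₂ y z ⇒
                     ∀₀ λ m₂₁ → balanced m₁₂ m₂₁ (opp y) ⇒
                     ∀₀ λ m₀₂ → balanced m₂₀ m₀₂ (opp z) ⇒
                     reduced x y z ≈
                     (crossing a b c d x + crossing d m₁₂ m₂₁ m₂₂ y + crossing m₂₂ m₂₀ m₀₂ a z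
                      + descent a b c d - descent (opp m₂₀) m₂₂ c (opp m₁₂) + cusp a b c d m₂₂)

  index-theorem : ⟦ index-statement ⟧
  index-theorem = sound index-statement refl

-- Parity, halving, and lists of bounded or odd integers.

module Parity where

  open import Data.Integer.Base using (_+_; _*_; -_; _-_)
  open SignPatterns

  odd : ℕ → Bool
  odd zero    = false
  odd (suc n) = not (odd n)

  par : ℤ → Bool
  par (+ n)    = odd n
  par -[1+ n ] = not (odd n)

  odd-+ : ∀ m n → odd (m ℕ.+ n) ≡ (odd m xor odd n)
  odd-+ zero    n = refl
  odd-+ (suc m) n = trans (cong not (odd-+ m n)) (𝔹.not-distribˡ-xor (odd m) (odd n))

  par-neg : ∀ x → par (- x) ≡ par x
  par-neg (+ 0)    = refl
  par-neg +[1+ n ] = refl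
  par-neg -[1+ n ] = refl

  xor-comm : ∀ p q → (p xor q) ≡ (q xor p)
  xor-comm false false = refl
  xor-comm false true  = refl
  xor-comm true  false = refl
  xor-comm true  true  = refl

  par-⊖ : ∀ m n → par (m ⊖ n) ≡ (odd m xor odd n)
  par-⊖ zero zero = refl
  par-⊖ zero (suc n) = refl
  par-⊖ (suc m) zero = sym (xor-comm (not (odd m)) false)
  par-⊖ (suc m) (suc n) = trans (cong par (ℤₚ.[1+m]⊖[1+n]≡m⊖n m n)) (trans (par-⊖ m n) (lem (odd m) (odd n)))
    where
    lem : ∀ p q → (p xor q) ≡ (not p xor not q)
    lem false false = refl
    lem false true  = refl
    lem true  false = refl
    lem true  true  = refl

  par-+ : ∀ x y → par (x + y) ≡ (par x xor par y)
  par-+ (+ m)    (+ n)    = odd-+ m n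
  par-+ (+ m)    -[1+ n ] = par-⊖ m (suc n)
  par-+ -[1+ m ] (+ n)    = trans (par-⊖ n (suc m)) (xor-comm (odd n) (not (odd m)))
  par-+ -[1+ m ] -[1+ n ] = trans (cong (λ b → not (not b)) (odd-+ m n)) (lem (odd m) (odd n))
    where
    lem : ∀ p q → not (not (p xor q)) ≡ (not p xor not q)
    lem false false = refl
    lem false true  = refl
    lem true  false = refl
    lem true  true  = refl

  odd-* : ∀ m n → odd (m ℕ.* n) ≡ (odd m ∧ odd n)
  odd-* zero    n = refl
  odd-* (suc m) n = trans (odd-+ n (m ℕ.* n)) (trans (cong (odd n xor_) (odd-* m n)) (lem (odd m) (odd n)))
    where
    lem : ∀ p q → (q xor (p ∧ q)) ≡ (not p ∧ q)
    lem false false = refl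
    lem false true  = refl
    lem true  false = refl
    lem true  true  = refl

  par-* : ∀ x y → par (x * y) ≡ (par x ∧ par y)
  par-* x y = trans (par-abs (x * y)) (trans (cong odd (ℤₚ.abs-* x y))
    (trans (odd-* ∣ x ∣ ∣ y ∣) (sym (cong₂ _∧_ (par-abs x) (par-abs y)))))
    where
    par-abs : ∀ x → par x ≡ odd ∣ x ∣
    par-abs (+ n)    = refl
    par-abs -[1+ n ] = refl

  par-sg : ∀ {x} → par x ≡ true → sg x ≢ zer
  par-sg {+ 0} ()
  par-sg {+[1+ n ]} _ ()
  par-sg { -[1+ n ]} _ ()

  half : ℤ → ℤ
  half (+ n)    = + ⌊ n /2⌋
  half -[1+ n ] = -[1+ ⌊ n /2⌋ ]

  private
    ⌊⌋-even : ∀ n → odd n ≡ false → ⌊ n /2⌋ ℕ.+ ⌊ n /2⌋ ≡ n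
    ⌊⌋-odd  : ∀ n → odd n ≡ true → suc (⌊ n /2⌋ ℕ.+ ⌊ n /2⌋) ≡ n
    ⌊⌋-even zero e = refl
    ⌊⌋-even (suc (suc n)) e = cong suc (trans (ℕₚ.+-suc _ _) (cong suc (⌊⌋-even n (trans (sym (𝔹.not-involutive _)) e))))
    ⌊⌋-odd (suc zero) e = refl
    ⌊⌋-odd (suc (suc n)) e = cong suc (cong suc (trans (ℕₚ.+-suc _ _) (⌊⌋-odd n (trans (sym (𝔹.not-involutive _)) e))))

  half-double : ∀ x → par x ≡ false → half x + half x ≡ x
  half-double (+ n)    e = cong +_ (⌊⌋-even n e)
  half-double -[1+ n ] e = cong -[1+_] (⌊⌋-odd n (trans (sym (𝔹.not-involutive _)) (cong not e)))

  double-injective : ∀ {x y} → x + x ≡ y + y → x ≡ y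
  double-injective {x} {y} e = ℤₚ.*-cancelˡ-≡ (+ 2) x y (trans (two x) (trans e (sym (two y))))
    where
    two : ∀ x → + 2 * x ≡ x + x
    two = solve-∀

  par-double : ∀ x → par (x + x) ≡ false
  par-double x = trans (par-+ x x) (𝔹.xor-same (par x))

  half-+ : ∀ x → half (x + x) ≡ x
  half-+ x = double-injective (half-double (x + x) (par-double x))

  +-minus : ∀ x b → (x + b) - b ≡ x
  +-minus = solve-∀

  +-cancelʳ-≡ : ∀ b {x y} → x + b ≡ y + b → x ≡ y
  +-cancelʳ-≡ b {x} {y} e = trans (sym (+-minus x b)) (trans (cong (_- b) e) (+-minus y b))

  opaque

    interval : ℕ → List ℤ
    interval B = map (λ i → + i - + B) (upTo (suc (B ℕ.+ B)))

    interval-unique : ∀ B → Unique (interval B)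
    interval-unique B = Uniqueₚ.map⁺ (λ {i} {j} e → ℤₚ.+-injective (+-cancelʳ-≡ (- + B) e)) (Uniqueₚ.upTo⁺ _)

    ∈-interval : ∀ {B} x → ∣ x ∣ ℕ.≤ B → x ∈ interval B
    ∈-interval {B} x h = subst (_∈ interval B) eq (∈-map⁺ _ (∈-upTo⁺ (ℕ.s≤s bound)))
      where
      shifted : ∀ x → ∣ x ∣ ℕ.≤ B → + ∣ x + + B ∣ ≡ x + + B × ∣ x + + B ∣ ℕ.≤ B ℕ.+ B
      shifted (+ n) h = refl , ℕₚ.+-monoˡ-≤ B h
      shifted -[1+ n ] h rewrite ℤₚ.⊖-≥ h = refl , ℕₚ.≤-trans (ℕₚ.m∸n≤m B (suc n)) (ℕₚ.m≤m+n B B)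
      bound : ∣ x + + B ∣ ℕ.≤ B ℕ.+ B
      bound = proj₂ (shifted x h)
      eq : + ∣ x + + B ∣ - + B ≡ x
      eq = trans (cong (_- + B) (proj₁ (shifted x h))) (+-minus x (+ B))

    odds : ℕ → List ℤ
    odds B = map (λ i → +[1+ i ℕ.+ i ]) (upTo B)

    odds-unique : ∀ B → Unique (odds B)
    odds-unique B = Uniqueₚ.map⁺ (λ {i} {j} e → ℤₚ.+-injective (double-injective (cong +_ (ℕₚ.suc-injective (ℤₚ.+-injective e))))) (Uniqueₚ.upTo⁺ _)

    ∈-odds⁺ : ∀ {B} x → sg x ≡ pos → par x ≡ true → ∣ x ∣ ℕ.≤ B → x ∈ odds B
    ∈-odds⁺ {B} +[1+ n ] _ o h = subst (_∈ odds B) (cong +[1+_] e)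
      (∈-map⁺ _ (∈-upTo⁺ (ℕₚ.≤-trans (ℕ.s≤s (ℕₚ.⌊n/2⌋≤n n)) h)))
      where
      e : ⌊ n /2⌋ ℕ.+ ⌊ n /2⌋ ≡ n
      e = ⌊⌋-even n (trans (sym (𝔹.not-involutive _)) (cong not o))

    ∈-odds⁻ : ∀ {B x} → x ∈ odds B → sg x ≡ pos × par x ≡ true
    ∈-odds⁻ p with ∈-map⁻ _ p
    ... | i , _ , refl = refl , cong not (par-double (+ i))

-- Bilinear forms on ℤ² and their unimodular substitutions.

module Index where

  open import Data.Integer.Base using (_+_; _*_; -_; _-_)
  open SignPatterns
  open Parity

  -- Read as the Gram matrix `a = B(e₀, e₀)`, `b = B(e₀, e₁)`, `c = B(e₁, e₀)`, `d = B(e₁, e₁)` of a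
  -- bilinear form.
  Quad : Set
  Quad = ℤ × ℤ × ℤ × ℤ

  _≟₂_ : DecidableEquality (ℤ × ℤ)
  _≟₂_ = ×.≡-dec ℤₚ._≟_ ℤₚ._≟_

  _≟₃_ : DecidableEquality (ℤ × ℤ × ℤ)
  _≟₃_ = ×.≡-dec ℤₚ._≟_ _≟₂_

  _≟₄_ : DecidableEquality Quad
  _≟₄_ = ×.≡-dec ℤₚ._≟_ _≟₃_

  cong₄ : ∀ {A : Set} {B : Set} {C : Set} {D : Set} {a a′ : A} {b b′ : B} {c c′ : C} {d d′ : D} →
          a ≡ a′ → b ≡ b′ → c ≡ c′ → d ≡ d′ → (a , b , c , d) ≡ (a′ , b′ , c′ , d′)
  cong₄ refl refl refl refl = refl

  -- `flip` replaces `e₁` by `-e₁`. `rotate` passes to the basis `e₁`, `-(e₀ + e₁)`, so it permutes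
  -- the superbase cyclically, has order three, and its inverse is its square. `shear` is the
  -- product `U M U` with `U` upper unipotent; unlike the others it changes the two arguments of the
  -- form differently.
  flip rotate rotate⁻¹ shear shear⁻¹ : Quad → Quad
  flip      (a , b , c , d) = a , - b , - c , d
  rotate    (a , b , c , d) = d , - (c + d) , - (b + d) , a + b + c + d
  rotate⁻¹  (a , b , c , d) = a + b + c + d , - (a + c) , - (a + b) , a
  shear     (a , b , c , d) = a + c , a + b + c + d , c , c + d
  shear⁻¹   (a , b , c , d) = a - c , b - a - d + c , c , d - c

  private
    r1a : ∀ a b c d → d + - (c + d) + - (b + d) + (a + b + c + d) ≡ a
    r1a = solve-∀
    r1b : ∀ a b c d → - (d + - (b + d)) ≡ b
    r1b = solve-∀
    r1c : ∀ a b c d → - (d + - (c + d)) ≡ c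
    r1c = solve-∀
    r2b : ∀ a b c d → - (- (a + b) + a) ≡ b
    r2b = solve-∀
    r2c : ∀ a b c d → - (- (a + c) + a) ≡ c
    r2c = solve-∀
    r2d : ∀ a b c d → a + b + c + d + - (a + c) + - (a + b) + a ≡ d
    r2d = solve-∀
    s1 : ∀ a c → (a + c) - c ≡ a
    s1 = solve-∀
    s2 : ∀ a b c d → (a + b + c + d) - (a + c) - (c + d) + c ≡ b
    s2 = solve-∀
    s3 : ∀ c d → (c + d) - c ≡ d
    s3 = solve-∀
    s4 : ∀ a c → (a - c) + c ≡ a
    s4 = solve-∀
    s5 : ∀ a b c d → (a - c) + (b - a - d + c) + c + (d - c) ≡ b
    s5 = solve-∀
    s6 : ∀ c d → c + (d - c) ≡ d
    s6 = solve-∀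

  rotate⁻¹-rotate : ∀ k → rotate⁻¹ (rotate k) ≡ k
  rotate⁻¹-rotate (a , b , c , d) = cong₄ (r1a a b c d) (r1b a b c d) (r1c a b c d) refl

  rotate-rotate⁻¹ : ∀ k → rotate (rotate⁻¹ k) ≡ k
  rotate-rotate⁻¹ (a , b , c , d) = cong₄ refl (r2b a b c d) (r2c a b c d) (r2d a b c d)

  shear⁻¹-shear : ∀ k → shear⁻¹ (shear k) ≡ k
  shear⁻¹-shear (a , b , c , d) = cong₄ (s1 a c) (s2 a b c d) refl (s3 c d)

  shear-shear⁻¹ : ∀ k → shear (shear⁻¹ k) ≡ k
  shear-shear⁻¹ (a , b , c , d) = cong₄ (s4 a c) (s5 a b c d) refl (s6 c d)

  flip-flip : ∀ k → flip (flip k) ≡ k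
  flip-flip (a , b , c , d) = cong₄ refl (ℤₚ.neg-involutive b) (ℤₚ.neg-involutive c) refl

  det : Quad → ℤ
  det (a , b , c , d) = a * d - b * c

  det-flip : ∀ k → det (flip k) ≡ det k
  det-flip (a , b , c , d) = eq a b c d
    where
    eq : ∀ a b c d → a * d - (- b) * (- c) ≡ a * d - b * c
    eq = solve-∀

  det-rotate : ∀ k → det (rotate k) ≡ det k
  det-rotate (a , b , c , d) = eq a b c d
    where
    eq : ∀ a b c d → d * (a + b + c + d) - (- (c + d)) * (- (b + d)) ≡ a * d - b * c
    eq = solve-∀

  det-shear : ∀ k → det (shear k) ≡ det k
  det-shear (a , b , c , d) = eq a b c d
    where
    eq : ∀ a b c d → (a + c) * (c + d) - (a + b + c + d) * c ≡ a * d - b * c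
    eq = solve-∀

  -- A record rather than the bare equation, so that `x` and `p` can be read off the type and `⊕`
  -- composes without explicit arguments.
  record HasParity (x : ℤ) (p : Bool) : Set where
    constructor ⟨_⟩
    field parity : par x ≡ p

  open HasParity

  -- This class modulo 2 is stable under all the substitutions. It makes the diagonal entries and
  -- the symmetrised entries on the superbase odd; among the nine values only `c`, `-(a + b)` and
  -- `-(b + d)` are even and may vanish.
  Parity : Quad → Set
  Parity (a , b , c , d) = HasParity a true × HasParity b true × HasParity c false × HasParity d true

  parity? : ∀ k → Dec (Parity k)
  parity? (a , b , c , d) = has? a true ×-dec has? b true ×-dec has? c false ×-dec has? d true
    where
    has? : ∀ x p → Dec (HasParity x p)
    has? x p = map′ ⟨_⟩ parity (par x 𝔹.≟ p)

  ⁻_ : ∀ {x p} → HasParity x p → HasParity (- x) p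
  ⁻_ {x} ⟨ e ⟩ = ⟨ trans (par-neg x) e ⟩

  _⊕_ : ∀ {x y p q} → HasParity x p → HasParity y q → HasParity (x + y) (p xor q)
  _⊕_ {x} {y} ⟨ refl ⟩ ⟨ refl ⟩ = ⟨ par-+ x y ⟩

  infixl 6 _⊕_

  par-flip : ∀ k → Parity k → Parity (flip k)
  par-flip _ (p , q , r , s) = p , ⁻ q , ⁻ r , s

  par-rotate : ∀ k → Parity k → Parity (rotate k)
  par-rotate _ (p , q , r , s) = s , ⁻ (r ⊕ s) , ⁻ (q ⊕ s) , p ⊕ q ⊕ r ⊕ s

  par-rotate⁻¹ : ∀ k → Parity k → Parity (rotate⁻¹ k)
  par-rotate⁻¹ _ (p , q , r , s) = p ⊕ q ⊕ r ⊕ s , ⁻ (p ⊕ r) , ⁻ (p ⊕ q) , p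

  par-shear : ∀ k → Parity k → Parity (shear k)
  par-shear _ (p , q , r , s) = p ⊕ r , p ⊕ q ⊕ r ⊕ s , r , r ⊕ s

  par-shear⁻¹ : ∀ k → Parity k → Parity (shear⁻¹ k)
  par-shear⁻¹ _ (p , q , r , s) = p ⊕ ⁻ r , q ⊕ ⁻ p ⊕ ⁻ s ⊕ r , r , s ⊕ ⁻ r

  sg≢zer : ∀ {x} → HasParity x true → sg x ≢ zer
  sg≢zer ⟨ e ⟩ = par-sg e

  -- For `reducedₖ` the arguments are the symmetrised values on the three pairs of the superbase.
  -- All negative is Selling's reduction condition for the symmetric part; all positive is the same
  -- condition for the negated form.
  crossingₖ descentₖ cuspₖ reducedₖ : Quad → ℤ
  crossingₖ (a , b , c , d) = crossing (sg a) (sg b) (sg c) (sg d) (sg (b + c))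
  descentₖ  (a , b , c , d) = descent (sg a) (sg b) (sg c) (sg d)
  cuspₖ     (a , b , c , d) = cusp (sg a) (sg b) (sg c) (sg d) (sg (a + b + c + d))
  reducedₖ  (a , b , c , d) = reduced (sg (b + c)) (sg (- (b + c + d + d))) (sg (- (a + a + b + c)))

  private
    e01 : ∀ b c → b + c + - (b + c) ≡ 0ℤ
    e01 = solve-∀
    e02 : ∀ a b c d → - (c + d) + - (b + d) + - (- (b + c + d + d)) ≡ 0ℤ
    e02 = solve-∀
    e03 : ∀ a b c → - (a + c) + - (a + b) + - (- (a + a + b + c)) ≡ 0ℤ
    e03 = solve-∀
    e07 : ∀ a c → a + c + - (a + c) ≡ 0ℤ
    e07 = solve-∀
    e09 : ∀ b c d → - (c + d) + - (b + d) ≡ - (b + c + d + d)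
    e09 = solve-∀
    e10 : ∀ a b c → - (a + c) + - (a + b) ≡ - (a + a + b + c)
    e10 = solve-∀
    g0 : ∀ a b c → a + a + (b + c) + - (a + a + b + c) ≡ 0ℤ
    g0 = solve-∀
    g1 : ∀ b c d → d + d + (b + c) + - (b + c + d + d) ≡ 0ℤ
    g1 = solve-∀
    g2 : ∀ a b c d → (a + b + c + d) + (a + b + c + d) + - (b + c + d + d) + - (a + a + b + c) ≡ 0ℤ
    g2 = solve-∀

  sg-double : ∀ x → sg (x + x) ≡ sg x
  sg-double (+ 0)    = refl
  sg-double +[1+ n ] = refl
  sg-double -[1+ n ] = refl

  balanced-double : ∀ u v w → u + u + v + w ≡ 0ℤ → balanced (sg u) (sg v) (sg w) ≡ true
  balanced-double u v w e = subst (λ s → balanced s (sg v) (sg w) ≡ true) (sg-double u) (sg-balanced (u + u) v w e)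

  balanced-opp : ∀ u v w → u + v + - w ≡ 0ℤ → balanced (sg u) (sg v) (opp (sg w)) ≡ true
  balanced-opp u v w e = subst (λ s → balanced (sg u) (sg v) s ≡ true) (sg-neg w) (sg-balanced u v (- w) e)

  index-formulaₖ : ∀ k → Parity k →
    reducedₖ k ≡ crossingₖ k + crossingₖ (rotate k) + crossingₖ (rotate⁻¹ k) + descentₖ k - descentₖ (shear k) + cuspₖ k
  index-formulaₖ k@(a , b , c , d) P@(p , q , r , s)
    -- These are the sums of second and third entry of `rotate k` and of `rotate⁻¹ k`, whose signs
    -- `crossingₖ` inspects.
    rewrite e09 b c d | e10 a b c =
    trans (index-theorem (sg a) (sg≢zer p) (sg b) (sg≢zer q) (sg c) (sg (b + c)) (sg≢zer (q ⊕ r))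
      (balanced-opp b c (b + c) (e01 b c))
      (sg (- (a + a + b + c))) (sg≢zer (⁻ (p ⊕ p ⊕ q ⊕ r)))
      (balanced-double a (b + c) (- (a + a + b + c)) (g0 a b c))
      (sg (- (a + c))) (sg≢zer (⁻ (p ⊕ r))) (sg-balanced a c (- (a + c)) (e07 a c))
      (sg d) (sg≢zer s) (sg (- (c + d))) (sg≢zer (⁻ (r ⊕ s))) (sg-balanced c d (- (c + d)) (e07 c d))
      (sg (- (b + c + d + d))) (sg≢zer (⁻ (q ⊕ r ⊕ s ⊕ s)))
      (balanced-double d (b + c) (- (b + c + d + d)) (g1 b c d))
      (sg (a + b + c + d)) (sg≢zer (p ⊕ q ⊕ r ⊕ s))
      (balanced-double (a + b + c + d) (- (b + c + d + d)) (- (a + a + b + c)) (g2 a b c d))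
      (sg (- (b + d))) (balanced-opp (- (c + d)) (- (b + d)) (- (b + c + d + d)) (e02 a b c d))
      (sg (- (a + b))) (balanced-opp (- (a + c)) (- (a + b)) (- (a + a + b + c)) (e03 a b c)))
    -- `shear k` contains `a + c` and `c + d`, the opposites of the matrix entries that occur in the
    -- sign theorem.
    (cong₂ (λ u v → crossing (sg a) (sg b) (sg c) (sg d) (sg (b + c))
        + crossing (sg d) (sg (- (c + d))) (sg (- (b + d))) (sg (a + b + c + d)) (sg (- (b + c + d + d)))
        + crossing (sg (a + b + c + d)) (sg (- (a + c))) (sg (- (a + b))) (sg a) (sg (- (a + a + b + c)))
        + descent (sg a) (sg b) (sg c) (sg d) - descent u (sg (a + b + c + d)) (sg c) v
        + cusp (sg a) (sg b) (sg c) (sg d) (sg (a + b + c + d))) (oppneg (a + c)) (oppneg (c + d)))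
    where
    oppneg : ∀ x → opp (sg (- x)) ≡ sg x
    oppneg x = trans (sym (sg-neg (- x))) (cong sg (ℤₚ.neg-involutive x))

-- Summation over the forms of fixed determinant: only cusps survive.

module Cusps where

  open import Data.Integer.Base using (_+_; _*_; -_; _-_)
  open Sums
  open SignPatterns
  open Parity
  open Index

  same : Sign → Sign → Bool
  same pos pos = true
  same neg neg = true
  same _   _   = false

  -- With the determinant fixed, `ad > 0 > bc` leaves finitely many quadruples. Hence these terms
  -- can be summed, although there are infinitely many forms of a given determinant.
  crossing-support : Formula
  crossing-support = ∀₀ λ a → ∀₀ λ b → ∀₀ λ c → ∀₀ λ d → ∀₀ λ x →
    not (same a d ∧ same b (opp c)) ⇒ crossing a b c d x ≈ 0ℤ

  descent-support : Formula
  descent-support = ∀₀ λ a → ∀₀ λ b → ∀₀ λ c → ∀₀ λ d →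
    not (same a d ∧ same b (opp c)) ⇒ descent a b c d ≈ 0ℤ

  same-abs : ∀ x y → same (sg x) (sg y) ≡ true → x * y ≡ + (∣ x ∣ ℕ.* ∣ y ∣) × 1 ℕ.≤ ∣ x ∣ × 1 ℕ.≤ ∣ y ∣
  same-abs +[1+ _ ] +[1+ _ ] e = refl , s≤s z≤n , s≤s z≤n
  same-abs -[1+ _ ] -[1+ _ ] e = refl , s≤s z≤n , s≤s z≤n
  same-abs -[1+ _ ] (+ 0) ()
  same-abs -[1+ _ ] +[1+ _ ] ()
  same-abs +[1+ _ ] (+ 0) ()
  same-abs (+ 0) (+ 0) ()

  m≤m*n : ∀ {m n} → 1 ℕ.≤ n → m ℕ.≤ m ℕ.* n
  m≤m*n {m} {suc n} _ = ℕₚ.≤-trans (ℕₚ.≤-reflexive (sym (ℕₚ.*-identityʳ m))) (ℕₚ.*-monoʳ-≤ m (s≤s z≤n))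

  n≤m*n : ∀ {m n} → 1 ℕ.≤ m → n ℕ.≤ m ℕ.* n
  n≤m*n {suc m} {n} _ = ℕₚ.m≤m+n n (m ℕ.* n)

  Bounded : ℕ → Quad → Set
  Bounded n (a , b , c , d) = ∣ a ∣ ℕ.≤ n × ∣ b ∣ ℕ.≤ n × ∣ c ∣ ℕ.≤ n × ∣ d ∣ ℕ.≤ n

  not-false : ∀ {p} → (not p ≡ true → ⊥) → p ≡ true
  not-false {true}  h = refl
  not-false {false} h = ⊥-elim (h refl)

  -- If ad > 0 > bc then the two terms of the determinant ad - bc do not cancel.
  hyperbolic-bounded : ∀ n a b c d → (same (sg a) (sg d) ∧ same (sg b) (opp (sg c))) ≡ true →
                       a * d - b * c ≡ + n → Bounded n (a , b , c , d)
  hyperbolic-bounded n a b c d s e = lower (ℕₚ.≤-trans (m≤m*n d≥1) ad) , lower (ℕₚ.≤-trans (m≤m*n c≥1) bc) ,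
    subst (ℕ._≤ n) (ℤₚ.∣-i∣≡∣i∣ c) (ℕₚ.≤-trans (n≤m*n b≥1) bc) , ℕₚ.≤-trans (n≤m*n a≥1) ad
    where
    lower : ∀ {m} → m ℕ.≤ n → m ℕ.≤ n
    lower h = h
    s₁ = same-abs a d (proj₁ (∧-elim _ s))
    s₂ = same-abs b (- c) (trans (cong (same (sg b)) (sg-neg c)) (proj₂ (∧-elim (same (sg a) (sg d)) s)))
    a≥1 = proj₁ (proj₂ s₁)
    d≥1 = proj₂ (proj₂ s₁)
    b≥1 = proj₁ (proj₂ s₂)
    c≥1 = proj₂ (proj₂ s₂)
    neg-* : ∀ b c → - (b * c) ≡ b * (- c)
    neg-* = solve-∀
    total : ∣ a ∣ ℕ.* ∣ d ∣ ℕ.+ ∣ b ∣ ℕ.* ∣ - c ∣ ≡ n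
    total = ℤₚ.+-injective (trans (sym (cong₂ _+_ (proj₁ s₁) (trans (neg-* b c) (proj₁ s₂)))) e)
    ad : ∣ a ∣ ℕ.* ∣ d ∣ ℕ.≤ n
    ad = subst (∣ a ∣ ℕ.* ∣ d ∣ ℕ.≤_) total (ℕₚ.m≤m+n _ _)
    bc : ∣ b ∣ ℕ.* ∣ - c ∣ ℕ.≤ n
    bc = subst (∣ b ∣ ℕ.* ∣ - c ∣ ℕ.≤_) total (ℕₚ.m≤n+m _ _)

  telescope : ∀ {A : Set} (xs : List A) (f e₁ e₂ e₃ g g′ h : A → ℤ) →
    (∀ x → f x ≡ e₁ x + e₂ x + e₃ x + g x + - g′ x + h x) →
    ∑ xs e₁ ≡ 0ℤ → ∑ xs e₂ ≡ 0ℤ → ∑ xs e₃ ≡ 0ℤ → ∑ xs g ≡ ∑ xs g′ → ∑ xs f ≡ ∑ xs h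
  telescope xs f e₁ e₂ e₃ g g′ h eq z₁ z₂ z₃ z = begin
    ∑ xs f ≡⟨ ∑-cong xs eq ⟩
    ∑ xs (λ x → e₁ x + e₂ x + e₃ x + g x + - g′ x + h x)
      ≡⟨ ∑-+ xs _ h ⟩
    ∑ xs (λ x → e₁ x + e₂ x + e₃ x + g x + - g′ x) + ∑ xs h
      ≡⟨ cong (_+ ∑ xs h) (∑-+ xs _ (λ x → - g′ x)) ⟩
    ∑ xs (λ x → e₁ x + e₂ x + e₃ x + g x) + ∑ xs (λ x → - g′ x) + ∑ xs h
      ≡⟨ cong₂ (λ s t → s + t + ∑ xs h) (trans (∑-+ xs _ g) (cong₂ _+_ (trans (∑-+ xs _ e₃) (cong₂ _+_
           (trans (∑-+ xs e₁ e₂) (cong₂ _+_ z₁ z₂)) z₃)) z)) (∑-neg xs g′) ⟩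
    0ℤ + 0ℤ + 0ℤ + ∑ xs g′ + - ∑ xs g′ + ∑ xs h ≡⟨ cancel (∑ xs g′) (∑ xs h) ⟩
    ∑ xs h ∎
    where
    open ≡-Reasoning
    cancel : ∀ x c → 0ℤ + 0ℤ + 0ℤ + x + - x + c ≡ c
    cancel = solve-∀

  -- A crossing or a descent has entries at most `n`, and its images under the substitutions have
  -- entries at most `4n`. A box of radius `B ≥ 4n` therefore contains every such term before and
  -- after reindexing. `B` is kept free because one box has to serve many determinants later.
  module Box (n B : ℕ) (on : odd n ≡ true) (4n≤B : 4 ℕ.* n ℕ.≤ B) where

    opaque

      box : List Quad
      box = cartesianProduct I (cartesianProduct I (cartesianProduct I I))
        where
        I : List ℤ
        I = interval B

      box-unique : Unique box
      box-unique = Uniqueₚ.cartesianProduct⁺ u (Uniqueₚ.cartesianProduct⁺ u (Uniqueₚ.cartesianProduct⁺ u u))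
        where
        u : Unique (interval B)
        u = interval-unique B

      ∈-box : ∀ {k} → Bounded B k → k ∈ box
      ∈-box (p , q , r , s) = ∈-cartesianProduct⁺ (∈-interval _ p)
        (∈-cartesianProduct⁺ (∈-interval _ q) (∈-cartesianProduct⁺ (∈-interval _ r) (∈-interval _ s)))

    Adm : Quad → Set
    Adm k = det k ≡ + n × Parity k

    adm? : ∀ k → Dec (Adm k)
    adm? k = (det k ℤₚ.≟ + n) ×-dec parity? k

    restrict : (Quad → ℤ) → Quad → ℤ
    restrict f k = guard (adm? k) (f k)

    restrict-≢0 : ∀ f k → restrict f k ≢ 0ℤ → Adm k × f k ≢ 0ℤ
    restrict-≢0 f k h with adm? k
    ... | yes u = u , h
    ... | no _  = ⊥-elim (h refl)

    bound₁ : ∀ {m} → m ℕ.≤ n → m ℕ.≤ B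
    bound₁ h = ℕₚ.≤-trans h (ℕₚ.≤-trans (ℕₚ.m≤m+n n _) 4n≤B)

    bound₂ : ∀ x y → ∣ x ∣ ℕ.≤ n → ∣ y ∣ ℕ.≤ n → ∣ x + y ∣ ℕ.≤ 2 ℕ.* n
    bound₂ x y p q = ℕₚ.≤-trans (ℤₚ.∣i+j∣≤∣i∣+∣j∣ x y)
      (subst (λ m → ∣ x ∣ ℕ.+ ∣ y ∣ ℕ.≤ n ℕ.+ m) (sym (ℕₚ.+-identityʳ n)) (ℕₚ.+-mono-≤ p q))

    2n≤B : ∀ {m} → m ℕ.≤ 2 ℕ.* n → m ℕ.≤ B
    2n≤B h = ℕₚ.≤-trans h (ℕₚ.≤-trans (ℕₚ.*-monoˡ-≤ n (s≤s (s≤s (z≤n {2})))) 4n≤B)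

    4n-split : 2 ℕ.* n ℕ.+ 2 ℕ.* n ≡ 4 ℕ.* n
    4n-split = sym (ℕₚ.*-distribʳ-+ n 2 2)

    bound₄ : ∀ x y z w → ∣ x ∣ ℕ.≤ n → ∣ y ∣ ℕ.≤ n → ∣ z ∣ ℕ.≤ n → ∣ w ∣ ℕ.≤ n → ∣ x + y + z + w ∣ ℕ.≤ B
    bound₄ x y z w p q r s = ℕₚ.≤-trans (ℕₚ.≤-reflexive (cong ∣_∣ (ℤₚ.+-assoc (x + y) z w)))
      (ℕₚ.≤-trans (ℤₚ.∣i+j∣≤∣i∣+∣j∣ (x + y) (z + w))
      (ℕₚ.≤-trans (ℕₚ.+-mono-≤ (bound₂ x y p q) (bound₂ z w r s))
      (ℕₚ.≤-trans (ℕₚ.≤-reflexive 4n-split) 4n≤B)))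

    neg-bound : ∀ {m} x → ∣ x ∣ ℕ.≤ m → ∣ - x ∣ ℕ.≤ m
    neg-bound x h = ℕₚ.≤-trans (ℕₚ.≤-reflexive (ℤₚ.∣-i∣≡∣i∣ x)) h

    inverse-symmetric-vanish : ∀ s → s ≡ - s → s ≡ 0ℤ
    inverse-symmetric-vanish (+ 0) _ = refl

    crossing-bounded : ∀ k → restrict crossingₖ k ≢ 0ℤ → Bounded n k
    crossing-bounded k@(a , b , c , d) h with restrict-≢0 crossingₖ k h
    ... | (e , _) , nz = hyperbolic-bounded n a b c d (not-false λ t → nz (sound crossing-support refl (sg a) (sg b) (sg c) (sg d) _ t)) e

    descent-bounded : ∀ k → restrict descentₖ k ≢ 0ℤ → Bounded n k
    descent-bounded k@(a , b , c , d) h with restrict-≢0 descentₖ k h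
    ... | (e , _) , nz = hyperbolic-bounded n a b c d (not-false λ t → nz (sound descent-support refl (sg a) (sg b) (sg c) (sg d) t)) e

    in-box : ∀ {k} → Bounded n k → k ∈ box
    in-box (p , q , r , s) = ∈-box (bound₁ p , bound₁ q , bound₁ r , bound₁ s)

    adm-rotate : ∀ k → Adm k → Adm (rotate k)
    adm-rotate k (e , p) = trans (det-rotate k) e , par-rotate k p

    adm-rotate⁻¹ : ∀ k → Adm k → Adm (rotate⁻¹ k)
    adm-rotate⁻¹ k (e , p) = trans (sym (det-rotate (rotate⁻¹ k))) (trans (cong det (rotate-rotate⁻¹ k)) e) , par-rotate⁻¹ k p

    adm-shear : ∀ k → Adm k → Adm (shear k)
    adm-shear k (e , p) = trans (det-shear k) e , par-shear k p

    adm-shear⁻¹ : ∀ k → Adm k → Adm (shear⁻¹ k)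
    adm-shear⁻¹ k (e , p) = trans (sym (det-shear (shear⁻¹ k))) (trans (cong det (shear-shear⁻¹ k)) e) , par-shear⁻¹ k p

    adm-flip : ∀ k → Adm k → Adm (flip k)
    adm-flip k (e , p) = trans (det-flip k) e , par-flip k p

    crossing-flip : Formula
    crossing-flip = ∀₀ λ a → ∀₀ λ b → ∀₀ λ c → ∀₀ λ d → ∀₀ λ x →
      crossing a (opp b) (opp c) d (opp x) ≈ - crossing a b c d x

    -- `flip` preserves the determinant and the parities and reverses `crossingₖ`, so the sum is its
    -- own negative.
    ∑crossing : ∑ box (restrict crossingₖ) ≡ 0ℤ
    ∑crossing = inverse-symmetric-vanish _ (trans
      (∑-bijection _≟₄_ box-unique (restrict crossingₖ) flip flip flip-flip flip-flip
        (λ k h → in-box (crossing-bounded k h))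
        (λ { k@(a , b , c , d) h → let (p , q , r , s) = crossing-bounded k h in
             in-box (p , neg-bound b q , neg-bound c r , s) }))
      (trans (∑-cong box odd-flip) (∑-neg box (restrict crossingₖ))))
      where
      neg-+ : ∀ b c → - b + - c ≡ - (b + c)
      neg-+ = solve-∀
      neg-guard : ∀ {P : Set} (p : Dec P) z → guard p (- z) ≡ - guard p z
      neg-guard (yes _) z = refl
      neg-guard (no _)  z = refl
      odd-flip : ∀ k → restrict crossingₖ (flip k) ≡ - restrict crossingₖ k
      odd-flip k@(a , b , c , d) = trans (guard-⇔ (adm? (flip k)) (adm? k)
        (λ u → subst Adm (flip-flip k) (adm-flip (flip k) u)) (adm-flip k)
        (λ _ → trans (cong₂ (λ s t → crossing (sg a) s t (sg d) (sg (- b + - c))) (sg-neg b) (sg-neg c))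
          (trans (cong (crossing (sg a) (opp (sg b)) (opp (sg c)) (sg d)) (trans (cong sg (neg-+ b c)) (sg-neg (b + c))))
          (sound crossing-flip refl (sg a) (sg b) (sg c) (sg d) (sg (b + c))))))
        (neg-guard (adm? k) (crossingₖ k))

    ∑crossing-rotate : ∑ box (λ k → restrict crossingₖ (rotate k)) ≡ 0ℤ
    ∑crossing-rotate = trans (sym (∑-bijection _≟₄_ box-unique (restrict crossingₖ) rotate rotate⁻¹ rotate⁻¹-rotate rotate-rotate⁻¹
        (λ k h → in-box (crossing-bounded k h))
        (λ { k@(a , b , c , d) h → let (p , q , r , s) = crossing-bounded k h in
             ∈-box (bound₄ a b c d p q r s , 2n≤B (neg-bound (a + c) (bound₂ a c p r)) ,
                    2n≤B (neg-bound (a + b) (bound₂ a b p q)) , bound₁ p) })))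
      ∑crossing

    ∑crossing-rotate⁻¹ : ∑ box (λ k → restrict crossingₖ (rotate⁻¹ k)) ≡ 0ℤ
    ∑crossing-rotate⁻¹ = trans (sym (∑-bijection _≟₄_ box-unique (restrict crossingₖ) rotate⁻¹ rotate rotate-rotate⁻¹ rotate⁻¹-rotate
        (λ k h → in-box (crossing-bounded k h))
        (λ { k@(a , b , c , d) h → let (p , q , r , s) = crossing-bounded k h in
             ∈-box (bound₁ s , 2n≤B (neg-bound (c + d) (bound₂ c d r s)) ,
                    2n≤B (neg-bound (b + d) (bound₂ b d q s)) , bound₄ a b c d p q r s) })))
      ∑crossing

    -- `shear` permutes the admissible quadruples, so the two descent terms of the index formula
    -- cancel in the sum.
    ∑descent-shear : ∑ box (restrict descentₖ) ≡ ∑ box (λ k → restrict descentₖ (shear k))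
    ∑descent-shear = ∑-bijection _≟₄_ box-unique (restrict descentₖ) shear shear⁻¹ shear⁻¹-shear shear-shear⁻¹
        (λ k h → in-box (descent-bounded k h))
        (λ { k@(a , b , c , d) h → let (p , q , r , s) = descent-bounded k h in
             ∈-box (2n≤B (bound₂ a (- c) p (neg-bound c r)) ,
                    bound₄ b (- a) (- d) c q (neg-bound a p) (neg-bound d s) r , bound₁ r ,
                    2n≤B (bound₂ d (- c) s (neg-bound c r))) })

    pointwise : ∀ k → restrict reducedₖ k ≡
      restrict crossingₖ k + restrict crossingₖ (rotate k) + restrict crossingₖ (rotate⁻¹ k)
      + restrict descentₖ k + - restrict descentₖ (shear k) + restrict cuspₖ k
    pointwise k = by (adm? k)
      where
      by : Dec (Adm k) → _
      by (yes u) = trans (guard-yes (adm? k) u) (trans (index-formulaₖ k (proj₂ u)) (sym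
        (cong₂ _+_ (cong₂ _+_ (cong₂ _+_ (cong₂ _+_ (cong₂ _+_ (guard-yes (adm? k) u)
          (guard-yes (adm? (rotate k)) (adm-rotate k u))) (guard-yes (adm? (rotate⁻¹ k)) (adm-rotate⁻¹ k u)))
          (guard-yes (adm? k) u)) (cong -_ (guard-yes (adm? (shear k)) (adm-shear k u)))) (guard-yes (adm? k) u))))
      by (no ¬u) = trans (guard-no (adm? k) ¬u) (sym
        (cong₂ _+_ (cong₂ _+_ (cong₂ _+_ (cong₂ _+_ (cong₂ _+_ (guard-no (adm? k) ¬u)
          (guard-no (adm? (rotate k)) λ u → ¬u (subst Adm (rotate⁻¹-rotate k) (adm-rotate⁻¹ (rotate k) u))))
          (guard-no (adm? (rotate⁻¹ k)) λ u → ¬u (subst Adm (rotate-rotate⁻¹ k) (adm-rotate (rotate⁻¹ k) u))))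
          (guard-no (adm? k) ¬u)) (cong -_ (guard-no (adm? (shear k)) λ u → ¬u (subst Adm (shear⁻¹-shear k) (adm-shear⁻¹ (shear k) u)))))
          (guard-no (adm? k) ¬u)))

    ∑reduced : ∑ box (restrict reducedₖ) ≡ ∑ box (restrict cuspₖ)
    ∑reduced = telescope box (restrict reducedₖ) (restrict crossingₖ) (λ k → restrict crossingₖ (rotate k))
      (λ k → restrict crossingₖ (rotate⁻¹ k)) (restrict descentₖ) (λ k → restrict descentₖ (shear k)) (restrict cuspₖ)
      pointwise ∑crossing ∑crossing-rotate ∑crossing-rotate⁻¹ ∑descent-shear

-- Odd coordinates for reduced forms.

module Quadruples where

  open import Data.Integer.Base using (_+_; _*_; -_; _-_)
  open SignPatterns
  open Parity
  open Index
  open Cusps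

  negate : Quad → Quad
  negate (a , b , c , d) = - a , - b , - c , - d

  negate-negate : ∀ k → negate (negate k) ≡ k
  negate-negate (a , b , c , d) = cong₄ (ℤₚ.neg-involutive a) (ℤₚ.neg-involutive b) (ℤₚ.neg-involutive c) (ℤₚ.neg-involutive d)

  det-negate : ∀ k → det (negate k) ≡ det k
  det-negate (a , b , c , d) = eq a b c d
    where
    eq : ∀ a b c d → (- a) * (- d) - (- b) * (- c) ≡ a * d - b * c
    eq = solve-∀

  par-negate : ∀ k → Parity k → Parity (negate k)
  par-negate _ (p , q , r , s) = ⁻ p , ⁻ q , ⁻ r , ⁻ s

  -- `reduced` and `cusp` do not distinguish `k` from `-k`; the versions with a plus pick one of the
  -- two.
  reduced⁺ : Sign → Sign → Sign → ℤ
  reduced⁺ neg neg neg = 1ℤ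
  reduced⁺ _   _   _   = 0ℤ

  cusp⁺ : Sign → Sign → Sign → Sign → Sign → ℤ
  cusp⁺ pos neg zer pos pos = 1ℤ
  cusp⁺ _   _   _   _   _   = 0ℤ

  reduced-split : Formula
  reduced-split = ∀₀ λ x → ∀₀ λ y → ∀₀ λ z → reduced x y z ≈ reduced⁺ x y z + reduced⁺ (opp x) (opp y) (opp z)

  cusp-split : Formula
  cusp-split = ∀₀ λ a → ∀₀ λ b → ∀₀ λ c → ∀₀ λ d → ∀₀ λ e →
    cusp a b c d e ≈ cusp⁺ a b c d e + cusp⁺ (opp a) (opp b) (opp c) (opp d) (opp e)

  reduced⁺ₖ cusp⁺ₖ : Quad → ℤ
  reduced⁺ₖ (a , b , c , d) = reduced⁺ (sg (b + c)) (sg (- (b + c + d + d))) (sg (- (a + a + b + c)))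
  cusp⁺ₖ    (a , b , c , d) = cusp⁺ (sg a) (sg b) (sg c) (sg d) (sg (a + b + c + d))

  private
    n2 : ∀ b c → - b + - c ≡ - (b + c)
    n2 = solve-∀
    n4 : ∀ a b c d → - a + - b + - c + - d ≡ - (a + b + c + d)
    n4 = solve-∀

  sg-opp : ∀ {x y} → x ≡ - y → sg x ≡ opp (sg y)
  sg-opp {y = y} refl = sg-neg y

  reducedₖ-split : ∀ k → reducedₖ k ≡ reduced⁺ₖ k + reduced⁺ₖ (negate k)
  reducedₖ-split k@(a , b , c , d) = trans
    (sound reduced-split refl (sg (b + c)) (sg (- (b + c + d + d))) (sg (- (a + a + b + c))))
    (cong (_+_ (reduced⁺ₖ k)) (sym (arguments (sg-opp (n2 b c)) (sg-opp (cong -_ (n4 b c d d))) (sg-opp (cong -_ (n4 a a b c))))))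
    where
    arguments : ∀ {x x′ y y′ z z′} → x ≡ x′ → y ≡ y′ → z ≡ z′ → reduced⁺ x y z ≡ reduced⁺ x′ y′ z′
    arguments refl refl refl = refl

  cuspₖ-split : ∀ k → cuspₖ k ≡ cusp⁺ₖ k + cusp⁺ₖ (negate k)
  cuspₖ-split k@(a , b , c , d) = trans
    (sound cusp-split refl (sg a) (sg b) (sg c) (sg d) (sg (a + b + c + d)))
    (cong (_+_ (cusp⁺ₖ k)) (sym (arguments (sg-neg a) (sg-neg b) (sg-neg c) (sg-neg d) (sg-opp (n4 a b c d)))))
    where
    arguments : ∀ {a a′ b b′ c c′ d d′ e e′} → a ≡ a′ → b ≡ b′ → c ≡ c′ → d ≡ d′ → e ≡ e′ →
                cusp⁺ a b c d e ≡ cusp⁺ a′ b′ c′ d′ e′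
    arguments refl refl refl refl refl = refl

  abs-double : ∀ {x m} → ∣ x + x ∣ ℕ.≤ m ℕ.+ m → ∣ x ∣ ℕ.≤ m
  abs-double {x} {m} h = ℕₚ.*-cancelˡ-≤ 2 (subst₂ ℕ._≤_ (trans (abs+ x) (two ∣ x ∣)) (two m) h)
    where
    two : ∀ m → m ℕ.+ m ≡ 2 ℕ.* m
    two m = cong (m ℕ.+_) (sym (ℕₚ.+-identityʳ m))
    abs+ : ∀ x → ∣ x + x ∣ ≡ ∣ x ∣ ℕ.+ ∣ x ∣
    abs+ (+ n) = refl
    abs+ -[1+ n ] = cong suc (sym (ℕₚ.+-suc n n))

  sg-pos-abs : ∀ {x} → sg x ≡ pos → + ∣ x ∣ ≡ x × 1 ℕ.≤ ∣ x ∣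
  sg-pos-abs {+[1+ n ]} _ = refl , s≤s z≤n

  square-abs : ∀ x → x * x ≡ + (∣ x ∣ ℕ.* ∣ x ∣)
  square-abs (+ 0)    = refl
  square-abs +[1+ _ ] = refl
  square-abs -[1+ _ ] = refl

  m≤m² : ∀ m → m ℕ.≤ m ℕ.* m
  m≤m² zero    = z≤n
  m≤m² (suc m) = ℕₚ.m≤m+n (suc m) _

  form-bounded : ∀ {X Y Z s m} → sg X ≡ pos → sg Y ≡ pos → sg Z ≡ pos → X * Y + Y * Z + Z * X + s * s ≡ + m →
                 ∣ X ∣ ℕ.≤ m × ∣ Y ∣ ℕ.≤ m × ∣ Z ∣ ℕ.≤ m × ∣ s ∣ ℕ.≤ m
  form-bounded {X} {Y} {Z} {s} {m} p q r e =
    fit (m≤m*n y≥1) (ℕₚ.m≤n⇒m≤n+o _ (ℕₚ.m≤n⇒m≤n+o _ (ℕₚ.m≤m+n xy yz))) ,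
    fit (m≤m*n z≥1) (ℕₚ.m≤n⇒m≤n+o _ (ℕₚ.m≤n⇒m≤n+o _ (ℕₚ.m≤n+m yz xy))) ,
    fit (m≤m*n x≥1) (ℕₚ.m≤n⇒m≤n+o _ (ℕₚ.m≤n+m zx (xy ℕ.+ yz))) ,
    fit (m≤m² _) (ℕₚ.m≤n+m _ _)
    where
    x≥1 = proj₂ (sg-pos-abs p)
    y≥1 = proj₂ (sg-pos-abs q)
    z≥1 = proj₂ (sg-pos-abs r)
    xy = ∣ X ∣ ℕ.* ∣ Y ∣
    yz = ∣ Y ∣ ℕ.* ∣ Z ∣
    zx = ∣ Z ∣ ℕ.* ∣ X ∣
    product : ∀ {x y} → sg x ≡ pos → sg y ≡ pos → + (∣ x ∣ ℕ.* ∣ y ∣) ≡ x * y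
    product {x} {y} a b = trans (ℤₚ.pos-* ∣ x ∣ ∣ y ∣) (cong₂ _*_ (proj₁ (sg-pos-abs a)) (proj₁ (sg-pos-abs b)))
    total : xy ℕ.+ yz ℕ.+ zx ℕ.+ ∣ s ∣ ℕ.* ∣ s ∣ ≡ m
    total = ℤₚ.+-injective (trans (cong₂ _+_ (cong₂ _+_ (cong₂ _+_ (product p q) (product q r)) (product r p)) (sym (square-abs s))) e)
    fit : ∀ {t u} → t ℕ.≤ u → u ℕ.≤ xy ℕ.+ yz ℕ.+ zx ℕ.+ ∣ s ∣ ℕ.* ∣ s ∣ → t ℕ.≤ m
    fit h h′ = ℕₚ.≤-trans h (ℕₚ.≤-trans h′ (ℕₚ.≤-reflexive total))

  four-injective : ∀ {x y} → + 4 * x ≡ + 4 * y → x ≡ y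
  four-injective {x} {y} = ℤₚ.*-cancelˡ-≡ (+ 4) x y

  -- The Selling parameters of the symmetric part, followed by the size of the skew part. In these
  -- coordinates four times the determinant becomes `form`.
  encode : Quad → Quad
  encode (a , b , c , d) = - (b + c) , b + c + d + d , a + a + b + c , + ∣ b - c ∣

  orient : Bool → ℤ → ℤ → ℤ → ℤ → Quad
  orient false a b c d = a , b , c , d
  orient true  a b c d = a , c , b , d

  -- From `b + c = -X` and `b - c = ±s` the two entries are `(-X ± s) / 2`. They differ by the odd
  -- number `s`, so exactly one of them is even, and that one must be `c`. This recovers the sign
  -- that the absolute value in `encode` forgets.
  decode : Quad → Quad
  decode (X , Y , Z , s) = orient (par c) (half (X + Z)) (half (s - X)) c (half (X + Y))
    where c = half (- X - s)

  form : Quad → ℤ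
  form (X , Y , Z , s) = X * Y + Y * Z + Z * X + s * s

  private
    abs-cases : ∀ x → (+ ∣ x ∣ ≡ x) ⊎ (+ ∣ x ∣ ≡ - x)
    abs-cases (+ n)    = inj₁ refl
    abs-cases -[1+ n ] = inj₂ refl

  form-encode : ∀ k → form (encode k) ≡ + 4 * det k
  form-encode (a , b , c , d) = trans (cong (λ t → - (b + c) * (b + c + d + d) + (b + c + d + d) * (a + a + b + c) + (a + a + b + c) * - (b + c) + t)
      (trans (sym (ℤₚ.pos-* ∣ b - c ∣ ∣ b - c ∣)) (sym (square-abs (b - c))))) (eq a b c d)
    where
    eq : ∀ a b c d → - (b + c) * (b + c + d + d) + (b + c + d + d) * (a + a + b + c) + (a + a + b + c) * - (b + c) + (b - c) * (b - c)
         ≡ + 4 * (a * d - b * c)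
    eq = solve-∀

  private
    i₁ : ∀ b c → - - (b + c) - (b - c) ≡ c + c
    i₁ = solve-∀
    i₂ : ∀ b c → b - c - - (b + c) ≡ b + b
    i₂ = solve-∀
    i₃ : ∀ a b c → - (b + c) + (a + a + b + c) ≡ a + a
    i₃ = solve-∀
    i₄ : ∀ b c d → - (b + c) + (b + c + d + d) ≡ d + d
    i₄ = solve-∀
    i₅ : ∀ b c → - - (b + c) - (- (b - c)) ≡ b + b
    i₅ = solve-∀
    i₆ : ∀ b c → - (b - c) - - (b + c) ≡ c + c
    i₆ = solve-∀

  decode-encode : ∀ k → Parity k → decode (encode k) ≡ k
  decode-encode (a , b , c , d) (_ , ⟨ pb ⟩ , ⟨ pc ⟩ , _) with abs-cases (b - c)
  ... | inj₁ e rewrite e | i₁ b c | half-+ c | pc =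
    cong₄ (trans (cong half (i₃ a b c)) (half-+ a)) (trans (cong half (i₂ b c)) (half-+ b)) refl (trans (cong half (i₄ b c d)) (half-+ d))
  ... | inj₂ e rewrite e | i₅ b c | half-+ b | pb =
    cong₄ (trans (cong half (i₃ a b c)) (half-+ a)) refl (trans (cong half (i₆ b c)) (half-+ c)) (trans (cong half (i₄ b c d)) (half-+ d))

  -- The relations between code and entries, stated once for both orientations that `decode` can
  -- choose.
  data Decoded (X Y Z s : ℤ) : Quad → Set where
    decoded : ∀ {a b c d} → a + a ≡ X + Z → d + d ≡ X + Y → b + c ≡ - X → + ∣ b - c ∣ ≡ s →
              par b ≡ true → par c ≡ false → Decoded X Y Z s (a , b , c , d)

  decode-decoded : ∀ X Y Z s → sg s ≡ pos → HasParity X true → HasParity Y true → HasParity Z true → HasParity s true →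
                   Decoded X Y Z s (decode (X , Y , Z , s))
  decode-decoded X Y Z s s⁺ oX oY oZ oS with par (half (- X - s)) in pc
  ... | false = decoded (hd (oX ⊕ oZ)) (hd (oX ⊕ oY)) b+c abs pb pc
    where
    hd : ∀ {x} → HasParity x false → half x + half x ≡ x
    hd ⟨ e ⟩ = half-double _ e
    b = half (s - X)
    c = half (- X - s)
    j₁ : ∀ b c → b + c + (b + c) ≡ (b + b) + (c + c)
    j₁ = solve-∀
    j₂ : ∀ X s → (s - X) + (- X - s) ≡ - X + - X
    j₂ = solve-∀
    j₃ : ∀ b c → b - c + (b - c) ≡ (b + b) - (c + c)
    j₃ = solve-∀
    j₄ : ∀ X s → (s - X) - (- X - s) ≡ s + s
    j₄ = solve-∀
    j₅ : ∀ b c → c + (b - c) ≡ b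
    j₅ = solve-∀
    b+c : b + c ≡ - X
    b+c = double-injective (trans (j₁ b c) (trans (cong₂ _+_ (hd (oS ⊕ ⁻ oX)) (hd (⁻ oX ⊕ ⁻ oS))) (j₂ X s)))
    b-c : b - c ≡ s
    b-c = double-injective (trans (j₃ b c) (trans (cong₂ _-_ (hd (oS ⊕ ⁻ oX)) (hd (⁻ oX ⊕ ⁻ oS))) (j₄ X s)))
    abs : + ∣ b - c ∣ ≡ s
    abs = trans (cong (λ t → + ∣ t ∣) b-c) (proj₁ (sg-pos-abs s⁺))
    pb : par b ≡ true
    pb = trans (cong par (sym (trans (cong (_+_ c) (sym b-c)) (j₅ b c)))) (HasParity.parity (⟨_⟩ {half (- X - s)} pc ⊕ oS))
  ... | true = decoded (hd (oX ⊕ oZ)) (hd (oX ⊕ oY)) b+c abs pc pb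
    where
    hd : ∀ {x} → HasParity x false → half x + half x ≡ x
    hd ⟨ e ⟩ = half-double _ e
    b = half (- X - s)
    c = half (s - X)
    j₁ : ∀ b c → b + c + (b + c) ≡ (b + b) + (c + c)
    j₁ = solve-∀
    j₂ : ∀ X s → (- X - s) + (s - X) ≡ - X + - X
    j₂ = solve-∀
    j₃ : ∀ b c → c - b + (c - b) ≡ (c + c) - (b + b)
    j₃ = solve-∀
    j₄ : ∀ X s → (s - X) - (- X - s) ≡ s + s
    j₄ = solve-∀
    j₅ : ∀ b c → b + (c - b) ≡ c
    j₅ = solve-∀
    b+c : b + c ≡ - X
    b+c = double-injective (trans (j₁ b c) (trans (cong₂ _+_ (hd (⁻ oX ⊕ ⁻ oS)) (hd (oS ⊕ ⁻ oX))) (j₂ X s)))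
    c-b : c - b ≡ s
    c-b = double-injective (trans (j₃ b c) (trans (cong₂ _-_ (hd (oS ⊕ ⁻ oX)) (hd (⁻ oX ⊕ ⁻ oS))) (j₄ X s)))
    abs : + ∣ b - c ∣ ≡ s
    abs = trans (cong +_ (ℤₚ.∣i-j∣≡∣j-i∣ b c)) (trans (cong (λ t → + ∣ t ∣) c-b) (proj₁ (sg-pos-abs s⁺)))
    pb : par c ≡ false
    pb = trans (cong par (sym (trans (cong (_+_ b) (sym c-b)) (j₅ b c)))) (HasParity.parity (⟨_⟩ {half (- X - s)} pc ⊕ oS))

  encode-decoded : ∀ {X Y Z s k} → Decoded X Y Z s k → encode k ≡ (X , Y , Z , s)
  encode-decoded {X} {Y} {Z} {s} (decoded {a} {b} {c} {d} ea ed bc abs _ _) = cong₄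
    (trans (cong -_ bc) (ℤₚ.neg-involutive X))
    (trans (ℤₚ.+-assoc (b + c) d d) (trans (cong₂ _+_ bc ed) (k₁ X Y)))
    (trans (k₂ a b c) (trans (cong₂ _+_ bc ea) (k₁ X Z))) abs
    where
    k₁ : ∀ X Y → - X + (X + Y) ≡ Y
    k₁ = solve-∀
    k₂ : ∀ a b c → a + a + b + c ≡ (b + c) + (a + a)
    k₂ = solve-∀

-- The class number relation.

module ClassNumberRelation where

  open import Data.Integer.Base using (_+_; _*_; -_; _-_)
  open Sums
  open SignPatterns
  open Parity
  open Index
  open Cusps
  open Quadruples

  unit : Sign → ℤ
  unit pos = 1ℤ
  unit _   = 0ℤ

  private
    ∑-applyUpTo : ∀ n (g : ℕ → ℕ) f → ∑ (applyUpTo g n) f ≡ ∑ (upTo n) (λ i → f (g i))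
    ∑-applyUpTo zero    g f = refl
    ∑-applyUpTo (suc n) g f = cong (_+_ (f (g 0))) (trans (∑-applyUpTo n (λ i → g (suc i)) f) (sym (∑-applyUpTo n suc (λ i → f (g i)))))

    shift : ∀ x y → + 2 + x - (+ 2 + y) ≡ x - y
    shift = solve-∀

  count-below : ∀ B j → j ℕ.≤ B → ∑ (upTo B) (λ i → unit (sg (+ (j ℕ.+ j) - +[1+ i ℕ.+ i ]))) ≡ + j
  count-below B zero _ = ∑-zero (upTo B) λ _ → refl
  count-below (suc B) (suc j) (s≤s h) = begin
    unit (sg (+ (suc j ℕ.+ suc j) - + 1)) + ∑ (applyUpTo suc B) v
      ≡⟨ cong₂ _+_ (cong (λ m → unit (sg (+ m - + 1))) (cong suc (ℕₚ.+-suc j j))) (∑-applyUpTo B suc v) ⟩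
    1ℤ + ∑ (upTo B) (λ i → v (suc i))
      ≡⟨ cong (_+_ 1ℤ) (∑-cong (upTo B) λ i → cong (λ t → unit (sg t)) (trans
           (cong₂ (λ s t → + s - + t) (cong suc (ℕₚ.+-suc j j)) (cong (λ t → suc (suc t)) (ℕₚ.+-suc i i)))
           (shift (+ (j ℕ.+ j)) +[1+ i ℕ.+ i ]))) ⟩
    1ℤ + ∑ (upTo B) (λ i → unit (sg (+ (j ℕ.+ j) - +[1+ i ℕ.+ i ])))
      ≡⟨ cong (_+_ 1ℤ) (count-below B j h) ⟩
    + suc j ∎
    where
    open ≡-Reasoning
    v : ℕ → ℤ
    v i = unit (sg (+ (suc j ℕ.+ suc j) - +[1+ i ℕ.+ i ]))

  opaque
    unfolding odds

    count-odds-below : ∀ B x → par x ≡ false → sg x ≡ pos → ∣ x ∣ ℕ.≤ B → ∑ (odds B) (λ e → unit (sg (x - e))) ≡ half x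
    count-odds-below B x@(+[1+ n ]) p _ h = trans (∑-map _ (upTo B) _)
      (trans (∑-cong (upTo B) λ i → cong (λ t → unit (sg (t - +[1+ i ℕ.+ i ]))) (sym (half-double x p)))
        (count-below B _ (ℕₚ.≤-trans (ℕₚ.⌊n/2⌋≤n (suc n)) h)))

  cubes : ℕ → List (ℤ × ℤ × ℤ)
  cubes B = cartesianProduct (odds B) (cartesianProduct (odds B) (odds B))

  tesseracts : ℕ → List Quad
  tesseracts B = cartesianProduct (odds B) (cubes B)

  cubes-unique : ∀ B → Unique (cubes B)
  cubes-unique B = Uniqueₚ.cartesianProduct⁺ (odds-unique B) (Uniqueₚ.cartesianProduct⁺ (odds-unique B) (odds-unique B))

  tesseracts-unique : ∀ B → Unique (tesseracts B)
  tesseracts-unique B = Uniqueₚ.cartesianProduct⁺ (odds-unique B) (cubes-unique B)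

  reduced⁺-pos : Formula
  reduced⁺-pos = ∀₀ λ x → ∀₀ λ y → ∀₀ λ z → not (isneg x ∧ isneg y ∧ isneg z) ⇒ reduced⁺ x y z ≈ 0ℤ

  cusp⁺-pos : Formula
  cusp⁺-pos = ∀₀ λ a → ∀₀ λ b → ∀₀ λ c → ∀₀ λ d → ∀₀ λ e →
    not (ispos a ∧ isneg b ∧ iszer c ∧ ispos d ∧ ispos e) ⇒ cusp⁺ a b c d e ≈ 0ℤ

  isneg-sound : ∀ {s} → isneg s ≡ true → s ≡ neg
  isneg-sound {neg} _ = refl

  ispos-sound : ∀ {s} → ispos s ≡ true → s ≡ pos
  ispos-sound {pos} _ = refl

  iszer-sound : ∀ {s} → iszer s ≡ true → s ≡ zer
  iszer-sound {zer} _ = refl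

  sg-zer : ∀ {x} → sg x ≡ zer → x ≡ 0ℤ
  sg-zer {+ 0} _ = refl

  sg-neg-pos : ∀ {x} → sg x ≡ neg → sg (- x) ≡ pos
  sg-neg-pos {x} e = trans (sg-neg x) (cong opp e)

  -- For positive odd `n ≤ B` this is σ(n): a divisor and its cofactor are both odd, and both occur
  -- in the list.
  divisor-sum : ℕ → ℤ → ℤ
  divisor-sum B n = ∑ (odds B) λ d → ∑ (odds B) λ e → guard (d * e ℤₚ.≟ n) d

  form-count : ℕ → ℤ → ℤ
  form-count B m = ∑ (tesseracts B) λ k → guard (form k ℤₚ.≟ m) 1ℤ

  module Count (n B : ℕ) (on : odd n ≡ true) (4n≤B : 4 ℕ.* n ℕ.≤ B) where

    open Box n B on 4n≤B

    cubes-⁺ : ∀ {a b c} → a ∈ odds B → b ∈ odds B → c ∈ odds B → (a , b , c) ∈ cubes B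
    cubes-⁺ p q r = ∈-cartesianProduct⁺ p (∈-cartesianProduct⁺ q r)

    tess-⁻ : ∀ {a b c d} → (a , b , c , d) ∈ tesseracts B → a ∈ odds B × b ∈ odds B × c ∈ odds B × d ∈ odds B
    tess-⁻ h = let (p , h₁) = ∈-cartesianProduct⁻ _ _ h
                   (q , h₂) = ∈-cartesianProduct⁻ _ _ h₁
                   (r , s)  = ∈-cartesianProduct⁻ _ _ h₂ in p , q , r , s

    form-det : ∀ {k} → det k ≡ + n → form (encode k) ≡ + (4 ℕ.* n)
    form-det {k} e = trans (form-encode k) (trans (cong (_*_ (+ 4)) e) (sym (ℤₚ.pos-* 4 n)))

    det-form : ∀ {k} → form (encode k) ≡ + (4 ℕ.* n) → det k ≡ + n
    det-form {k} e = four-injective (trans (sym (form-encode k)) (trans e (ℤₚ.pos-* 4 n)))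

    record Reduced (k : Quad) : Set where
      constructor red
      field
        adm : Adm k
        X⁺  : sg (proj₁ (encode k)) ≡ pos
        Y⁺  : sg (proj₁ (proj₂ (encode k))) ≡ pos
        Z⁺  : sg (proj₁ (proj₂ (proj₂ (encode k)))) ≡ pos

    reduced-≢0 : ∀ k → restrict reduced⁺ₖ k ≢ 0ℤ → Reduced k
    reduced-≢0 k@(a , b , c , d) h with restrict-≢0 reduced⁺ₖ k h
    ... | u , nz = red u (sg-neg-pos (isneg-sound (proj₁ t₁)))
                         (trans (cong sg (sym (ℤₚ.neg-involutive (b + c + d + d)))) (sg-neg-pos (isneg-sound (proj₁ t₂))))
                         (trans (cong sg (sym (ℤₚ.neg-involutive (a + a + b + c)))) (sg-neg-pos (isneg-sound (proj₂ t₂))))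
      where
      x = sg (b + c)
      y = sg (- (b + c + d + d))
      z = sg (- (a + a + b + c))
      t₁ = ∧-elim (isneg x) (not-false λ t → nz (sound reduced⁺-pos refl x y z t))
      t₂ = ∧-elim (isneg y) (proj₂ t₁)

    reduced-value : ∀ {k} → Reduced k → restrict reduced⁺ₖ k ≡ 1ℤ
    reduced-value {k@(a , b , c , d)} (red u p q r) = trans (guard-yes (adm? k) u) (arguments
      (trans (cong sg (sym (ℤₚ.neg-involutive (b + c)))) (trans (sg-neg (- (b + c))) (cong opp p)))
      (trans (sg-neg (b + c + d + d)) (cong opp q)) (trans (sg-neg (a + a + b + c)) (cong opp r)))
      where
      arguments : ∀ {x y z} → x ≡ neg → y ≡ neg → z ≡ neg → reduced⁺ x y z ≡ 1ℤ
      arguments refl refl refl = refl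

    reduced-bounds : ∀ {k} → Reduced k →
      let (X , Y , Z , s) = encode k in ∣ X ∣ ℕ.≤ B × ∣ Y ∣ ℕ.≤ B × ∣ Z ∣ ℕ.≤ B × ∣ s ∣ ℕ.≤ B
    reduced-bounds {k@(a , b , c , d)} (red (e , _) p q r) =
      let (h₁ , h₂ , h₃ , h₄) = form-bounded {s = + ∣ b - c ∣} p q r (form-det {k} e) in
      ℕₚ.≤-trans h₁ 4n≤B , ℕₚ.≤-trans h₂ 4n≤B , ℕₚ.≤-trans h₃ 4n≤B , ℕₚ.≤-trans h₄ 4n≤B

    bound-of-half : ∀ u v x → ∣ u ∣ ℕ.≤ B → ∣ v ∣ ℕ.≤ B → x + x ≡ u + v → ∣ x ∣ ℕ.≤ B
    bound-of-half u v x p q e = abs-double {x} (ℕₚ.≤-trans (ℕₚ.≤-reflexive (cong ∣_∣ e))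
      (ℕₚ.≤-trans (ℤₚ.∣i+j∣≤∣i∣+∣j∣ u v) (ℕₚ.+-mono-≤ p q)))

    bounds : ∀ {k} → Reduced k → Bounded B k
    bounds {k@(a , b , c , d)} R = (bound-of-half (- (b + c)) (a + a + b + c) a X Z (e₁ a b c) , bound-of-half (b - c) (- - (b + c)) b s X′ (e₂ b c) ,
                                 bound-of-half (- (b - c)) (- - (b + c)) c (neg-bound (b - c) s) X′ (e₃ b c) , bound-of-half (- (b + c)) (b + c + d + d) d X Y (e₄ b c d))
      where
      X : ∣ - (b + c) ∣ ℕ.≤ B
      X = proj₁ (reduced-bounds R)
      Y : ∣ b + c + d + d ∣ ℕ.≤ B
      Y = proj₁ (proj₂ (reduced-bounds R))
      Z : ∣ a + a + b + c ∣ ℕ.≤ B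
      Z = proj₁ (proj₂ (proj₂ (reduced-bounds R)))
      s : ∣ b - c ∣ ℕ.≤ B
      s = proj₂ (proj₂ (proj₂ (reduced-bounds R)))
      X′ : ∣ - - (b + c) ∣ ℕ.≤ B
      X′ = neg-bound (- (b + c)) X
      e₁ : ∀ a b c → a + a ≡ - (b + c) + (a + a + b + c)
      e₁ = solve-∀
      e₂ : ∀ b c → b + b ≡ (b - c) + - - (b + c)
      e₂ = solve-∀
      e₃ : ∀ b c → c + c ≡ - (b - c) + - - (b + c)
      e₃ = solve-∀
      e₄ : ∀ b c d → d + d ≡ - (b + c) + (b + c + d + d)
      e₄ = solve-∀

    reduced-in-box : ∀ {k} → Reduced k → k ∈ box
    reduced-in-box R = ∈-box (bounds R)

    abs-sg : ∀ {x} → sg x ≢ zer → sg (+ ∣ x ∣) ≡ pos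
    abs-sg {+ 0} h = ⊥-elim (h refl)
    abs-sg {+[1+ _ ]} h = refl
    abs-sg { -[1+ _ ]} h = refl

    abs-par : ∀ x → par (+ ∣ x ∣) ≡ par x
    abs-par (+ _) = refl
    abs-par -[1+ _ ] = refl

    encode-∈ : ∀ {k} → Reduced k → encode k ∈ tesseracts B
    encode-∈ {k@(a , b , c , d)} R@(red (_ , p , q , r , s) X⁺ Y⁺ Z⁺) =
      ∈-cartesianProduct⁺ (∈-odds⁺ (- (b + c)) X⁺ (HasParity.parity (⁻ (q ⊕ r))) X)
        (cubes-⁺ (∈-odds⁺ (b + c + d + d) Y⁺ (HasParity.parity (q ⊕ r ⊕ s ⊕ s)) Y)
          (∈-odds⁺ (a + a + b + c) Z⁺ (HasParity.parity (p ⊕ p ⊕ q ⊕ r)) Z)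
          (∈-odds⁺ (+ ∣ b - c ∣) (abs-sg (sg≢zer (q ⊕ ⁻ r))) (trans (abs-par (b - c)) (HasParity.parity (q ⊕ ⁻ r))) S))
      where
      X : ∣ - (b + c) ∣ ℕ.≤ B
      X = proj₁ (reduced-bounds R)
      Y : ∣ b + c + d + d ∣ ℕ.≤ B
      Y = proj₁ (proj₂ (reduced-bounds R))
      Z : ∣ a + a + b + c ∣ ℕ.≤ B
      Z = proj₁ (proj₂ (proj₂ (reduced-bounds R)))
      S : ∣ b - c ∣ ℕ.≤ B
      S = proj₂ (proj₂ (proj₂ (reduced-bounds R)))

    ∧-split : ∀ {p q} → (p ∧ q) ≡ true → p ≡ true × q ≡ true
    ∧-split {p} = ∧-elim p

    -- The code controls the parities of `b` and `c` only; `a` and `d` are odd because `ad = n + bc`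
    -- with `n` odd and `c` even.
    decoded-reduced : ∀ {X Y Z s k} → Decoded X Y Z s k → sg X ≡ pos → sg Y ≡ pos → sg Z ≡ pos →
                      form (X , Y , Z , s) ≡ + (4 ℕ.* n) → Reduced k
    decoded-reduced {X} {Y} {Z} {s} {k@(a , b , c , d)} D@(decoded _ _ _ _ pb pc) X⁺ Y⁺ Z⁺ e =
      red (dt , ⟨ proj₁ ad ⟩ , ⟨ pb ⟩ , ⟨ pc ⟩ , ⟨ proj₂ ad ⟩)
          (trans (cong (λ t → sg (proj₁ t)) enc) X⁺) (trans (cong (λ t → sg (proj₁ (proj₂ t))) enc) Y⁺)
          (trans (cong (λ t → sg (proj₁ (proj₂ (proj₂ t)))) enc) Z⁺)
      where
      enc = encode-decoded D
      dt : det k ≡ + n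
      dt = det-form {k} (trans (cong form enc) e)
      cancel : ∀ a b c d → a * d ≡ (a * d - b * c) + b * c
      cancel = solve-∀
      bc : par (b * c) ≡ false
      bc = trans (par-* b c) (cong₂ _∧_ pb pc)
      ad : par a ≡ true × par d ≡ true
      ad = ∧-split (trans (sym (par-* a d)) (trans (cong par (trans (cancel a b c d) (cong (_+ b * c) dt)))
             (HasParity.parity (⟨_⟩ {+ n} on ⊕ ⟨_⟩ {b * c} bc))))

    ∑reduced⁺ : ∑ box (restrict reduced⁺ₖ) ≡ form-count B (+ (4 ℕ.* n))
    ∑reduced⁺ = ∑-transfer _≟₄_ _≟₄_ box-unique (tesseracts-unique B) (restrict reduced⁺ₖ) _ encode decode to from
      where
      g : Quad → ℤ
      g k = guard (form k ℤₚ.≟ + (4 ℕ.* n)) 1ℤ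
      to : ∀ k → k ∈ box → restrict reduced⁺ₖ k ≢ 0ℤ → encode k ∈ tesseracts B × decode (encode k) ≡ k × g (encode k) ≡ restrict reduced⁺ₖ k
      to k _ h = let R = reduced-≢0 k h in
        encode-∈ R , decode-encode k (proj₂ (Reduced.adm R)) ,
        trans (guard-yes (form (encode k) ℤₚ.≟ + (4 ℕ.* n)) (form-det {k} (proj₁ (Reduced.adm R)))) (sym (reduced-value R))
      from : ∀ y → y ∈ tesseracts B → g y ≢ 0ℤ → decode y ∈ box × encode (decode y) ≡ y × restrict reduced⁺ₖ (decode y) ≡ g y
      from y@(X , Y , Z , s) m h =
        let (p , q , r , t) = tess-⁻ m
            (X⁺ , oX) = ∈-odds⁻ p ; (Y⁺ , oY) = ∈-odds⁻ q ; (Z⁺ , oZ) = ∈-odds⁻ r ; (s⁺ , os) = ∈-odds⁻ t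
            e = guard-≢0 (form y ℤₚ.≟ + (4 ℕ.* n)) h
            D = decode-decoded X Y Z s s⁺ ⟨ oX ⟩ ⟨ oY ⟩ ⟨ oZ ⟩ ⟨ os ⟩
            R = decoded-reduced D X⁺ Y⁺ Z⁺ e
        in reduced-in-box R , encode-decoded D , trans (reduced-value R) (sym (guard-yes (form y ℤₚ.≟ + (4 ℕ.* n)) e))

    adm-negate : ∀ k → Adm k → Adm (negate k)
    adm-negate k (e , p) = trans (det-negate k) e , par-negate k p

    bounded-negate : ∀ k → Bounded B k → Bounded B (negate k)
    bounded-negate (a , b , c , d) (p , q , r , s) = neg-bound a p , neg-bound b q , neg-bound c r , neg-bound d s

    -- Reindexing by `negate` carries the second half of the split into the first.
    twice : ∀ (f f⁺ : Quad → ℤ) → (∀ k → f k ≡ f⁺ k + f⁺ (negate k)) → (∀ k → restrict f⁺ k ≢ 0ℤ → k ∈ box × negate k ∈ box) →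
            ∑ box (restrict f) ≡ ∑ box (restrict f⁺) + ∑ box (restrict f⁺)
    twice f f⁺ eq supp = trans (∑-cong box split) (trans (∑-+ box _ _) (cong (_+_ (∑ box (restrict f⁺)))
      (sym (∑-bijection _≟₄_ box-unique (restrict f⁺) negate negate negate-negate negate-negate
        (λ k h → proj₁ (supp k h)) (λ k h → proj₂ (supp k h))))))
      where
      split : ∀ k → restrict f k ≡ restrict f⁺ k + restrict f⁺ (negate k)
      split k = trans (cong (guard (adm? k)) (eq k)) (trans (guard-distrib-+ (adm? k) _ _)
        (cong (_+_ (restrict f⁺ k)) (guard-⇔ (adm? k) (adm? (negate k)) (adm-negate k)
          (λ u → subst Adm (negate-negate k) (adm-negate (negate k) u)) λ _ → refl)))

    data Cuspidal : Quad → Set where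
      cuspidal : ∀ {a b d} → Adm (a , b , 0ℤ , d) → sg a ≡ pos → sg b ≡ neg → sg d ≡ pos → sg (a + b + 0ℤ + d) ≡ pos → Cuspidal (a , b , 0ℤ , d)

    cusp-≢0 : ∀ k → restrict cusp⁺ₖ k ≢ 0ℤ → Cuspidal k
    cusp-≢0 k@(a , b , c , d) h with restrict-≢0 cusp⁺ₖ k h
    ... | u , nz = go (sg-zer (iszer-sound (proj₁ t₃)))
      where
      t₁ = ∧-elim (ispos (sg a)) (not-false λ t → nz (sound cusp⁺-pos refl (sg a) (sg b) (sg c) (sg d) (sg (a + b + c + d)) t))
      t₂ = ∧-elim (isneg (sg b)) (proj₂ t₁)
      t₃ = ∧-elim (iszer (sg c)) (proj₂ t₂)
      t₄ = ∧-elim (ispos (sg d)) (proj₂ t₃)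
      go : c ≡ 0ℤ → Cuspidal k
      go refl = cuspidal u (ispos-sound (proj₁ t₁)) (isneg-sound (proj₁ t₂)) (ispos-sound (proj₁ t₄)) (ispos-sound (proj₂ t₄))

    det-zero : ∀ a b d → a * d ≡ + n → det (a , b , 0ℤ , d) ≡ + n
    det-zero a b d e = trans (eq a b d) e
      where
      eq : ∀ a b d → a * d - b * 0ℤ ≡ a * d
      eq = solve-∀

    zero-det : ∀ a b d → det (a , b , 0ℤ , d) ≡ + n → a * d ≡ + n
    zero-det a b d e = trans (eq a b d) e
      where
      eq : ∀ a b d → a * d ≡ a * d - b * 0ℤ
      eq = solve-∀

    cusp-value : ∀ {k} → Cuspidal k → restrict cusp⁺ₖ k ≡ 1ℤ
    cusp-value (cuspidal {a} {b} {d} u p q r s) = trans (guard-yes (adm? _) u) (arguments p q r s)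
      where
      arguments : ∀ {a b d e} → a ≡ pos → b ≡ neg → d ≡ pos → e ≡ pos → cusp⁺ a b zer d e ≡ 1ℤ
      arguments refl refl refl refl = refl

    -- With a, d > 0 and ad = n both are at most n, and -b lies strictly between 0 and a + d.
    factor-bounds : ∀ {a d} → sg a ≡ pos → sg d ≡ pos → a * d ≡ + n → ∣ a ∣ ℕ.≤ n × ∣ d ∣ ℕ.≤ n
    factor-bounds {a} {d} p r e = subst (∣ a ∣ ℕ.≤_) eq (m≤m*n (proj₂ (sg-pos-abs r))) , subst (∣ d ∣ ℕ.≤_) eq (n≤m*n (proj₂ (sg-pos-abs p)))
      where
      eq : ∣ a ∣ ℕ.* ∣ d ∣ ≡ n
      eq = trans (sym (ℤₚ.abs-* a d)) (cong ∣_∣ e)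

    below : ∀ x e → sg x ≡ pos → sg e ≡ pos → sg (x - e) ≡ pos → ∣ e ∣ ℕ.≤ ∣ x ∣
    below +[1+ m ] +[1+ k ] _ _ h with suc k ℕₚ.≤? suc m
    ... | yes q = q
    ... | no ¬q = ⊥-elim (bad (trans (cong sg (trans (ℤₚ.m-n≡m⊖n (suc m) (suc k)) (ℤₚ.⊖-≤ (ℕₚ.<⇒≤ (ℕₚ.≰⇒> ¬q))))) refl))
      where
      bad : sg (+[1+ m ] - +[1+ k ]) ≡ sg (- + (suc k ℕ.∸ suc m)) → ⊥
      bad e with suc k ℕ.∸ suc m
      ... | zero  with trans (sym h) e
      ...   | ()
      bad e | suc _ with trans (sym h) e
      ...   | ()

    cusp-bounded : ∀ {a b d} → Cuspidal (a , b , 0ℤ , d) → ∣ a ∣ ℕ.≤ n × ∣ d ∣ ℕ.≤ n × ∣ - b ∣ ℕ.≤ B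
    cusp-bounded {a} {b} {d} (cuspidal (e , _) p q r s) = proj₁ ad , proj₂ ad ,
      ℕₚ.≤-trans (below (a + d) (- b) (sum-pos p r) (sg-neg-pos q) (trans (cong sg (eq a b d)) s))
        (2n≤B (bound₂ a d (proj₁ ad) (proj₂ ad)))
      where
      ad = factor-bounds p r (zero-det a b d e)
      eq : ∀ a b d → (a + d) - (- b) ≡ a + b + 0ℤ + d
      eq = solve-∀
      sum-pos : ∀ {x y} → sg x ≡ pos → sg y ≡ pos → sg (x + y) ≡ pos
      sum-pos {+[1+ _ ]} {+[1+ _ ]} _ _ = refl

    cusp-in-box : ∀ {k} → Cuspidal k → k ∈ box × negate k ∈ box
    cusp-in-box c@(cuspidal {a} {b} {d} _ _ _ _ _) = ∈-box bd , ∈-box (bounded-negate (a , b , 0ℤ , d) bd)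
      where
      bd : Bounded B (a , b , 0ℤ , d)
      bd = let (p , q , r) = cusp-bounded c in bound₁ p , subst (ℕ._≤ B) (ℤₚ.∣-i∣≡∣i∣ b) r , z≤n , bound₁ q

    -- `e` stands for `-b`, and the unit records `e < a + d`, the condition that the last argument
    -- of `cusp` expresses.
    gap : ℤ × ℤ × ℤ → ℤ
    gap (a , d , e) = guard (a * d ℤₚ.≟ + n) (unit (sg (a + d - e)))

    ∑cusp⁺-cubes : ∑ box (restrict cusp⁺ₖ) ≡ ∑ (cubes B) gap
    ∑cusp⁺-cubes = ∑-transfer _≟₄_ _≟₃_ box-unique (cubes-unique B) (restrict cusp⁺ₖ) gap
      (λ { (a , b , _ , d) → a , d , - b }) (λ { (a , d , e) → a , - e , 0ℤ , d }) to from
      where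
      φ : Quad → ℤ × ℤ × ℤ
      φ (a , b , _ , d) = a , d , - b
      eq₁ : ∀ a b d → a + d - - b ≡ a + b + 0ℤ + d
      eq₁ = solve-∀
      eq₂ : ∀ a e d → a + - e + 0ℤ + d ≡ a + d - e
      eq₂ = solve-∀
      unit-pos : ∀ {s} → s ≡ pos → unit s ≡ 1ℤ
      unit-pos refl = refl
      to : ∀ k → k ∈ box → restrict cusp⁺ₖ k ≢ 0ℤ → _
      to k _ h with cusp-≢0 k h
      ... | C@(cuspidal {a} {b} {d} (e , p , q , r , s) a⁺ b⁻ d⁺ s⁺) = let (x , y , z) = cusp-bounded C in
        cubes-⁺ (∈-odds⁺ a a⁺ (HasParity.parity p) (bound₁ x)) (∈-odds⁺ d d⁺ (HasParity.parity s) (bound₁ y))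
                (∈-odds⁺ (- b) (sg-neg-pos b⁻) (HasParity.parity (⁻ q)) z) ,
        cong₄ refl (ℤₚ.neg-involutive b) refl refl ,
        trans (guard-yes (a * d ℤₚ.≟ + n) (zero-det a b d e)) (trans (unit-pos (trans (cong sg (eq₁ a b d)) s⁺)) (sym (cusp-value C)))
      from : ∀ y → y ∈ cubes B → gap y ≢ 0ℤ → _
      from (a , d , e) m h =
        let (p , m₁) = ∈-cartesianProduct⁻ _ _ m
            (q , r)  = ∈-cartesianProduct⁻ _ _ m₁
            (a⁺ , oa) = ∈-odds⁻ p ; (d⁺ , od) = ∈-odds⁻ q ; (e⁺ , oe) = ∈-odds⁻ r
            f = guard-≢0 (a * d ℤₚ.≟ + n) h
            s = unit-≢0 (λ z → h (trans (cong (guard (a * d ℤₚ.≟ + n)) z) (guard-0 (a * d ℤₚ.≟ + n))))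
            C = cuspidal (det-zero a (- e) d f , ⟨ oa ⟩ , ⁻ ⟨ oe ⟩ , ⟨ refl ⟩ , ⟨ od ⟩) a⁺
                  (trans (sg-neg e) (cong opp e⁺)) d⁺ (trans (cong sg (eq₂ a e d)) s)
        in proj₁ (cusp-in-box C) , cong (λ t → a , d , t) (ℤₚ.neg-involutive e) ,
           trans (cusp-value C) (sym (trans (guard-yes (a * d ℤₚ.≟ + n) f) (unit-pos s)))
        where
        unit-≢0 : ∀ {s} → unit s ≢ 0ℤ → s ≡ pos
        unit-≢0 {pos} _ = refl
        unit-≢0 {neg} h = ⊥-elim (h refl)
        unit-≢0 {zer} h = ⊥-elim (h refl)

    -- For `ad = n` there are `(a + d) / 2` odd numbers `e` below the even number `a + d`. Doubling
    -- avoids the half, and exchanging `a` with `d` turns the second summand into a divisor sum as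
    -- well.
    ∑cusp⁺ : ∑ box (restrict cusp⁺ₖ) + ∑ box (restrict cusp⁺ₖ) ≡ divisor-sum B (+ n) + divisor-sum B (+ n)
    ∑cusp⁺ = begin
      ∑ box (restrict cusp⁺ₖ) + ∑ box (restrict cusp⁺ₖ)
        ≡⟨ cong (λ s → s + s) (trans ∑cusp⁺-cubes (trans (∑-× O (cartesianProduct O O) gap) (∑-cong O λ a → ∑-× O O λ p → gap (a , p)))) ⟩
      G + G
        ≡⟨ ∑-+ O _ _ ⟨
      ∑ O (λ a → ∑ O (λ d → ∑ O (λ e → gap (a , d , e))) + ∑ O (λ d → ∑ O (λ e → gap (a , d , e))))
        ≡⟨ ∑-cong-∈ O (λ a p → trans (sym (∑-+ O _ _)) (∑-cong-∈ O λ d q → inner a d p q)) ⟩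
      ∑ O (λ a → ∑ O (λ d → guard (a * d ℤₚ.≟ + n) a + guard (a * d ℤₚ.≟ + n) d))
        ≡⟨ trans (∑-cong O λ a → ∑-+ O _ _) (∑-+ O _ _) ⟩
      divisor-sum B (+ n) + ∑ O (λ a → ∑ O (λ d → guard (a * d ℤₚ.≟ + n) d))
        ≡⟨ cong (_+_ (divisor-sum B (+ n))) (trans (∑-swap O O _) (∑-cong O λ d → ∑-cong O λ a →
             guard-⇔ (a * d ℤₚ.≟ + n) (d * a ℤₚ.≟ + n) (trans (ℤₚ.*-comm d a)) (trans (ℤₚ.*-comm a d)) λ _ → refl)) ⟩
      divisor-sum B (+ n) + divisor-sum B (+ n) ∎
      where
      open ≡-Reasoning
      O = odds B
      G = ∑ O (λ a → ∑ O (λ d → ∑ O (λ e → gap (a , d , e))))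
      ∑-guard : ∀ {P : Set} (p : Dec P) (f : ℤ → ℤ) → ∑ O (λ e → guard p (f e)) ≡ guard p (∑ O f)
      ∑-guard (yes _) f = refl
      ∑-guard (no _)  f = ∑-zero O λ _ → refl
      half-gap : ∀ a d → a ∈ O → d ∈ O → a * d ≡ + n → ∑ O (λ e → unit (sg (a + d - e))) ≡ half (a + d)
      half-gap a d p q e = count-odds-below B (a + d) (HasParity.parity a+d) (sum-pos (proj₁ (∈-odds⁻ p)) (proj₁ (∈-odds⁻ q)))
        (2n≤B (bound₂ a d (proj₁ ad) (proj₂ ad)))
        where
        a+d : HasParity (a + d) false
        a+d = ⟨_⟩ {a} (proj₂ (∈-odds⁻ p)) ⊕ ⟨_⟩ {d} (proj₂ (∈-odds⁻ q))
        ad : ∣ a ∣ ℕ.≤ n × ∣ d ∣ ℕ.≤ n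
        ad = factor-bounds (proj₁ (∈-odds⁻ p)) (proj₁ (∈-odds⁻ q)) e
        sum-pos : ∀ {x y} → sg x ≡ pos → sg y ≡ pos → sg (x + y) ≡ pos
        sum-pos {+[1+ _ ]} {+[1+ _ ]} _ _ = refl
      inner : ∀ a d → a ∈ O → d ∈ O → ∑ O (λ e → gap (a , d , e)) + ∑ O (λ e → gap (a , d , e))
              ≡ guard (a * d ℤₚ.≟ + n) a + guard (a * d ℤₚ.≟ + n) d
      inner a d p q = trans (cong (λ s → s + s) (∑-guard (a * d ℤₚ.≟ + n) (λ e → unit (sg (a + d - e)))))
        (trans (sym (guard-distrib-+ (a * d ℤₚ.≟ + n) _ _)) (trans (guard-⇔ (a * d ℤₚ.≟ + n) (a * d ℤₚ.≟ + n) (λ e → e) (λ e → e)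
          (λ e → trans (cong (λ s → s + s) (half-gap a d p q e)) (half-double (a + d) (HasParity.parity (a+d p q)))))
          (guard-distrib-+ (a * d ℤₚ.≟ + n) a d)))
        where
        a+d : a ∈ O → d ∈ O → HasParity (a + d) false
        a+d p q = ⟨_⟩ {a} (proj₂ (∈-odds⁻ p)) ⊕ ⟨_⟩ {d} (proj₂ (∈-odds⁻ q))

    -- Counting `k` and `-k` separately doubles both sides, and the summed index formula equates the
    -- doubled counts of reduced forms and of cusps.
    class-number-relation : form-count B (+ (4 ℕ.* n)) ≡ divisor-sum B (+ n)
    class-number-relation = double-injective (begin
      form-count B (+ (4 ℕ.* n)) + form-count B (+ (4 ℕ.* n))
        ≡⟨ cong (λ s → s + s) ∑reduced⁺ ⟨
      ∑ box (restrict reduced⁺ₖ) + ∑ box (restrict reduced⁺ₖ)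
        ≡⟨ twice reducedₖ reduced⁺ₖ reducedₖ-split (λ k h → let R = reduced-≢0 k h in reduced-in-box R ,
             ∈-box (bounded-negate k (bounds R))) ⟨
      ∑ box (restrict reducedₖ) ≡⟨ ∑reduced ⟩
      ∑ box (restrict cuspₖ) ≡⟨ twice cuspₖ cusp⁺ₖ cuspₖ-split (λ k h → cusp-in-box (cusp-≢0 k h)) ⟩
      ∑ box (restrict cusp⁺ₖ) + ∑ box (restrict cusp⁺ₖ) ≡⟨ ∑cusp⁺ ⟩
      divisor-sum B (+ n) + divisor-sum B (+ n) ∎)
      where open ≡-Reasoning

-- A windmill identity for weighted divisor sums.

module Windmill where

  open import Data.Integer.Base using (_+_; _*_; -_; _-_)
  open Sums
  open SignPatterns
  open Parity
  open Index
  open Cusps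
  open Quadruples
  open ClassNumberRelation

  Triple : Set
  Triple = ℤ × ℤ × ℤ

  -- All three preserve `norm`. `windmill` is the branch `(s + 2d, d, e - s - d)` of Zagier's map on
  -- the solutions of `s² + 4de = m`, with the sign of its first entry reversed, which makes this
  -- branch an involution by itself.
  mirror swap windmill : Triple → Triple
  mirror   (s , d , e) = - s , d , e
  swap     (s , d , e) = - s , e , d
  windmill (s , d , e) = - (s + d + d) , d , e - s - d

  cong₃ : ∀ {a a′ b b′ c c′ : ℤ} → a ≡ a′ → b ≡ b′ → c ≡ c′ → (a , b , c) ≡ (a′ , b′ , c′)
  cong₃ refl refl refl = refl

  mirror-mirror : ∀ t → mirror (mirror t) ≡ t
  mirror-mirror (s , d , e) = cong₃ (ℤₚ.neg-involutive s) refl refl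

  swap-swap : ∀ t → swap (swap t) ≡ t
  swap-swap (s , d , e) = cong₃ (ℤₚ.neg-involutive s) refl refl

  private
    w₁ : ∀ s d → - (- (s + d + d) + d + d) ≡ s
    w₁ = solve-∀
    w₂ : ∀ s d e → e - s - d - - (s + d + d) - d ≡ e
    w₂ = solve-∀

  windmill-windmill : ∀ t → windmill (windmill t) ≡ t
  windmill-windmill (s , d , e) = cong₃ (w₁ s d) refl (w₂ s d e)

  norm : Triple → ℤ
  norm (s , d , e) = s * s + + 4 * (d * e)

  -- The third entry of `windmill`. It is odd on admissible triples, hence nonzero, and `swap`
  -- reverses its sign, so the triples of positive excess represent the orbits of `swap`. `windmill`
  -- maps them to themselves, exchanging the excess with `e`.
  excess : Triple → ℤ
  excess (s , d , e) = e - s - d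

  ∑-guard-cong : ∀ {A : Set} (xs : List A) {P : A → Set} (p? : ∀ x → Dec (P x)) {f g : A → ℤ} → (∀ x → P x → f x ≡ g x) →
                 ∑ xs (λ x → guard (p? x) (f x)) ≡ ∑ xs (λ x → guard (p? x) (g x))
  ∑-guard-cong xs p? h = ∑-cong xs λ x → guard-⇔ (p? x) (p? x) (λ p → p) (λ p → p) (h x)

  guard-neg : ∀ {P : Set} (p : Dec P) z → guard p (- z) ≡ - guard p z
  guard-neg (yes _) z = refl
  guard-neg (no _)  z = refl

  vanish : ∀ s → s ≡ - s → s ≡ 0ℤ
  vanish (+ 0) _ = refl

  module Windmill (m B : ℕ) (m≤B : m ℕ.≤ B) where

    record Adm (t : Triple) : Set where
      constructor adm
      field
        eq : norm t ≡ + m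
        ps : HasParity (proj₁ t) true
        pd : HasParity (proj₁ (proj₂ t)) true
        pe : HasParity (proj₂ (proj₂ t)) true
        d⁺ : sg (proj₁ (proj₂ t)) ≡ pos
        e⁺ : sg (proj₂ (proj₂ t)) ≡ pos

    has? : ∀ x p → Dec (HasParity x p)
    has? x p = map′ ⟨_⟩ HasParity.parity (par x 𝔹.≟ p)

    pos? : ∀ x → Dec (sg x ≡ pos)
    pos? x with sg x
    ... | pos = yes refl
    ... | neg = no λ ()
    ... | zer = no λ ()

    adm? : ∀ t → Dec (Adm t)
    adm? t@(s , d , e) = map′ (λ (a , b , c , d , e , f) → adm a b c d e f) (λ (adm a b c d e f) → a , b , c , d , e , f)
      ((norm t ℤₚ.≟ + m) ×-dec has? s true ×-dec has? d true ×-dec has? e true ×-dec pos? d ×-dec pos? e)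

    Upper Lower : Triple → Set
    Upper t = Adm t × sg (excess t) ≡ pos
    Lower t = Adm t × sg (excess t) ≡ neg

    upper? : ∀ t → Dec (Upper t)
    upper? t = adm? t ×-dec pos? (excess t)

    opaque
      box : List Triple
      box = cartesianProduct (interval B) (cartesianProduct (interval B) (interval B))

      box-unique : Unique box
      box-unique = Uniqueₚ.cartesianProduct⁺ (interval-unique B) (Uniqueₚ.cartesianProduct⁺ (interval-unique B) (interval-unique B))

      ∈-box : ∀ {s d e} → ∣ s ∣ ℕ.≤ B → ∣ d ∣ ℕ.≤ B → ∣ e ∣ ℕ.≤ B → (s , d , e) ∈ box
      ∈-box p q r = ∈-cartesianProduct⁺ (∈-interval _ p) (∈-cartesianProduct⁺ (∈-interval _ q) (∈-interval _ r))

    adm-bounds : ∀ {s d e} → Adm (s , d , e) → ∣ s ∣ ℕ.≤ B × ∣ d ∣ ℕ.≤ B × ∣ e ∣ ℕ.≤ B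
    adm-bounds {s} {d} {e} (adm eq _ _ _ d⁺ e⁺) =
      fit (m≤m² _) (ℕₚ.m≤m+n _ _) ,
      fit (m≤m*n (proj₂ (sg-pos-abs e⁺))) (ℕₚ.≤-trans (ℕₚ.m≤m+n _ _) (ℕₚ.m≤n+m (4 ℕ.* (∣ d ∣ ℕ.* ∣ e ∣)) (∣ s ∣ ℕ.* ∣ s ∣))) ,
      fit (n≤m*n (proj₂ (sg-pos-abs d⁺))) (ℕₚ.≤-trans (ℕₚ.m≤m+n _ _) (ℕₚ.m≤n+m (4 ℕ.* (∣ d ∣ ℕ.* ∣ e ∣)) (∣ s ∣ ℕ.* ∣ s ∣)))
      where
      de : + (∣ d ∣ ℕ.* ∣ e ∣) ≡ d * e
      de = trans (ℤₚ.pos-* ∣ d ∣ ∣ e ∣) (cong₂ _*_ (proj₁ (sg-pos-abs d⁺)) (proj₁ (sg-pos-abs e⁺)))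
      total : ∣ s ∣ ℕ.* ∣ s ∣ ℕ.+ 4 ℕ.* (∣ d ∣ ℕ.* ∣ e ∣) ≡ m
      total = ℤₚ.+-injective (trans (cong₂ _+_ (sym (square-abs s)) (trans (ℤₚ.pos-* 4 (∣ d ∣ ℕ.* ∣ e ∣)) (cong (_*_ (+ 4)) de))) eq)
      fit : ∀ {t u} → t ℕ.≤ u → u ℕ.≤ ∣ s ∣ ℕ.* ∣ s ∣ ℕ.+ 4 ℕ.* (∣ d ∣ ℕ.* ∣ e ∣) → t ℕ.≤ B
      fit h h′ = ℕₚ.≤-trans h (ℕₚ.≤-trans h′ (ℕₚ.≤-trans (ℕₚ.≤-reflexive total) m≤B))

    adm-∈ : ∀ t → Adm t → t ∈ box
    adm-∈ t a = ∈-box (proj₁ (adm-bounds a)) (proj₁ (proj₂ (adm-bounds a))) (proj₂ (proj₂ (adm-bounds a)))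

    total upper : (Triple → ℤ) → ℤ
    total f = ∑ box λ t → guard (adm? t) (f t)
    upper f = ∑ box λ t → guard (upper? t) (f t)

    adm-mirror : ∀ t → Adm t → Adm (mirror t)
    adm-mirror (s , d , e) (adm eq a b c p q) = adm (trans (sq s d e) eq) (⁻ a) b c p q
      where
      sq : ∀ s d e → (- s) * (- s) + + 4 * (d * e) ≡ s * s + + 4 * (d * e)
      sq = solve-∀

    adm-swap : ∀ t → Adm t → Adm (swap t)
    adm-swap (s , d , e) (adm eq a b c p q) = adm (trans (sq s d e) eq) (⁻ a) c b q p
      where
      sq : ∀ s d e → (- s) * (- s) + + 4 * (e * d) ≡ s * s + + 4 * (d * e)
      sq = solve-∀

    excess-swap : ∀ t → excess (swap t) ≡ - excess t
    excess-swap (s , d , e) = eq s d e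
      where
      eq : ∀ s d e → d - - s - e ≡ - (e - s - d)
      eq = solve-∀

    upper-windmill : ∀ t → Upper t → Upper (windmill t)
    upper-windmill t@(s , d , e) (adm eq a b c p q , u) =
      adm (trans (nm s d e) eq) (⁻ (a ⊕ b ⊕ b)) b (c ⊕ ⁻ a ⊕ ⁻ b) p u , trans (cong sg (w₂ s d e)) q
      where
      nm : ∀ s d e → - (s + d + d) * - (s + d + d) + + 4 * (d * (e - s - d)) ≡ s * s + + 4 * (d * e)
      nm = solve-∀

    transport : ∀ {P Q : Triple → Set} (p? : ∀ t → Dec (P t)) (q? : ∀ t → Dec (Q t)) (φ : Triple → Triple) →
      (∀ t → φ (φ t) ≡ t) → (∀ t → P t → Adm t) → (∀ t → Q t → Adm t) → (∀ t → P t → Q (φ t)) → (∀ t → Q t → P (φ t)) →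
      ∀ (f : Triple → ℤ) → ∑ box (λ t → guard (p? t) (f t)) ≡ ∑ box (λ t → guard (q? t) (f (φ t)))
    transport {P} p? q? φ inv pa qa pq qp f = ∑-transfer _≟₃_ _≟₃_ box-unique box-unique
      (λ t → guard (p? t) (f t)) (λ t → guard (q? t) (f (φ t))) φ φ
      (λ t _ h → let p = guard-≢0 (p? t) h in adm-∈ _ (qa _ (pq t p)) , inv t ,
         trans (guard-yes (q? (φ t)) (pq t p)) (trans (cong f (inv t)) (sym (guard-yes (p? t) p))))
      (λ t _ h → let q = guard-≢0 (q? t) h in adm-∈ _ (pa _ (qp t q)) , inv t ,
         trans (guard-yes (p? (φ t)) (qp t q)) (sym (guard-yes (q? t) q)))

    total-mirror : ∀ f → total f ≡ total (λ t → f (mirror t))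
    total-mirror = transport adm? adm? mirror mirror-mirror (λ _ a → a) (λ _ a → a) adm-mirror adm-mirror

    upper-windmill-invariant : ∀ f → upper f ≡ upper (λ t → f (windmill t))
    upper-windmill-invariant = transport upper? upper? windmill windmill-windmill (λ _ → proj₁) (λ _ → proj₁) upper-windmill upper-windmill

    lower? : ∀ t → Dec (Lower t)
    lower? t = adm? t ×-dec neg? (excess t)
      where
      neg? : ∀ x → Dec (sg x ≡ neg)
      neg? x with sg x
      ... | neg = yes refl
      ... | pos = no λ ()
      ... | zer = no λ ()

    total-split : ∀ f → total f ≡ upper (λ t → f t + f (swap t))
    total-split f = begin
      total f ≡⟨ ∑-cong box split ⟩
      ∑ box (λ t → guard (upper? t) (f t) + guard (lower? t) (f t)) ≡⟨ ∑-+ box _ _ ⟩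
      upper f + ∑ box (λ t → guard (lower? t) (f t)) ≡⟨ cong (_+_ (upper f))
        (transport lower? upper? swap swap-swap (λ _ → proj₁) (λ _ → proj₁)
          (λ t (a , l) → adm-swap t a , trans (cong sg (excess-swap t)) (trans (sg-neg (excess t)) (cong opp l)))
          (λ t (a , u) → adm-swap t a , trans (cong sg (excess-swap t)) (trans (sg-neg (excess t)) (cong opp u))) f) ⟩
      upper f + upper (λ t → f (swap t)) ≡⟨ ∑-+ box _ _ ⟨
      ∑ box (λ t → guard (upper? t) (f t) + guard (upper? t) (f (swap t))) ≡⟨ ∑-cong box (λ t → guard-distrib-+ (upper? t) _ _) ⟨
      upper (λ t → f t + f (swap t)) ∎
      where
      open ≡-Reasoning
      split : ∀ t → guard (adm? t) (f t) ≡ guard (upper? t) (f t) + guard (lower? t) (f t)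
      split t = by (adm? t) (sg (excess t)) refl
        where
        by : Dec (Adm t) → ∀ σ → sg (excess t) ≡ σ → guard (adm? t) (f t) ≡ guard (upper? t) (f t) + guard (lower? t) (f t)
        by (no ¬a) _ _ = trans (guard-no (adm? t) ¬a) (sym (cong₂ _+_ (guard-no (upper? t) λ u → ¬a (proj₁ u)) (guard-no (lower? t) λ u → ¬a (proj₁ u))))
        by (yes a) pos e = trans (guard-yes (adm? t) a) (sym (trans (cong₂ _+_ (guard-yes (upper? t) (a , e))
          (guard-no (lower? t) λ u → pos≢neg (trans (sym e) (proj₂ u)))) (ℤₚ.+-identityʳ (f t))))
          where
          pos≢neg : pos ≢ neg
          pos≢neg ()
        by (yes a) neg e = trans (guard-yes (adm? t) a) (sym (trans (cong₂ _+_ (guard-no (upper? t) λ u → neg≢pos (trans (sym e) (proj₂ u)))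
          (guard-yes (lower? t) (a , e))) (ℤₚ.+-identityˡ (f t))))
          where
          neg≢pos : neg ≢ pos
          neg≢pos ()
        by (yes (adm _ a b c _ _)) zer e = ⊥-elim (sg≢zer (c ⊕ ⁻ a ⊕ ⁻ b) e)

    scaled : ∀ {P : Triple → Set} (p? : ∀ t → Dec (P t)) (f : Triple → ℤ) → ∑ box (λ t → guard (p? t) (- f t)) ≡ - ∑ box (λ t → guard (p? t) (f t))
    scaled p? f = trans (∑-cong box λ t → guard-neg (p? t) (f t)) (∑-neg box _)

    -- `cubic` changes sign under `windmill`, which exchanges the factors `d + e` and `e - s` and
    -- negates `d + s`; `odd-part` changes sign under `mirror`. `f₀` is made so that its
    -- symmetrisation under `swap` is four times the sum of `cubic` and the symmetrised `odd-part`;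
    -- hence its total vanishes.
    cubic odd-part f₀ : Triple → ℤ
    cubic    (s , d , e) = (d + e) * (d + s) * (e - s)
    odd-part (s , d , e) = s * (d * d)
    f₀       (s , d , e) = (+ m - + 5 * (s * s)) * d

    upper-cubic : upper cubic ≡ 0ℤ
    upper-cubic = vanish _ (trans (upper-windmill-invariant cubic) (trans (∑-guard-cong box upper? λ t _ → eq (proj₁ t) (proj₁ (proj₂ t)) (proj₂ (proj₂ t))) (scaled upper? cubic)))
      where
      eq : ∀ s d e → (d + (e - s - d)) * (d + - (s + d + d)) * ((e - s - d) - - (s + d + d)) ≡ - ((d + e) * (d + s) * (e - s))
      eq = solve-∀

    total-odd : total odd-part ≡ 0ℤ
    total-odd = vanish _ (trans (total-mirror odd-part) (trans (∑-guard-cong box adm? λ t _ → eq (proj₁ t) (proj₁ (proj₂ t))) (scaled adm? odd-part)))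
      where
      eq : ∀ s d → - s * (d * d) ≡ - (s * (d * d))
      eq = solve-∀

    total-f₀ : total f₀ ≡ 0ℤ
    total-f₀ = begin
      total f₀ ≡⟨ total-split f₀ ⟩
      upper (λ t → f₀ t + f₀ (swap t)) ≡⟨ ∑-guard-cong box upper? (λ t u → eq t (proj₁ u)) ⟩
      upper (λ t → + 4 * ((odd-part t + odd-part (swap t)) + cubic t)) ≡⟨ ∑-cong box (λ t → *-guard (upper? t) (+ 4) _) ⟨
      ∑ box (λ t → + 4 * guard (upper? t) ((odd-part t + odd-part (swap t)) + cubic t)) ≡⟨ ∑-* (+ 4) box _ ⟩
      + 4 * upper (λ t → (odd-part t + odd-part (swap t)) + cubic t) ≡⟨ cong (_*_ (+ 4)) (trans (∑-cong box λ t → guard-distrib-+ (upper? t) _ _) (∑-+ box _ _)) ⟩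
      + 4 * (upper (λ t → odd-part t + odd-part (swap t)) + upper cubic) ≡⟨ cong (_*_ (+ 4)) (cong₂ _+_ (trans (sym (total-split odd-part)) total-odd) upper-cubic) ⟩
      0ℤ ∎
      where
      open ≡-Reasoning
      ring : ∀ s d e → (s * s + + 4 * (d * e) - + 5 * (s * s)) * d + (s * s + + 4 * (d * e) - + 5 * (- s * - s)) * e
             ≡ + 4 * ((s * (d * d) + - s * (e * e)) + (d + e) * (d + s) * (e - s))
      ring = solve-∀
      eq : ∀ t → Adm t → f₀ t + f₀ (swap t) ≡ + 4 * ((odd-part t + odd-part (swap t)) + cubic t)
      eq t@(s , d , e) (adm n _ _ _ _ _) = trans (cong (λ x → (x - + 5 * (s * s)) * d + (x - + 5 * (- s * - s)) * e) (sym n)) (ring s d e)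

    Pos : Triple → Set
    Pos t = Adm t × sg (proj₁ t) ≡ pos

    pos₃? : ∀ t → Dec (Pos t)
    pos₃? t = adm? t ×-dec pos? (proj₁ t)

    -- `f₀` is even in `s`, so the sum over both signs is twice the sum over positive `s`. For
    -- `m ≡ 5 (mod 8)` it reads Σ (m - 5s²) σ((m - s²) / 4) = 0 over the odd `s > 0` with `s² < m`.
    windmill-identity : ∑ (cubes B) (λ t → guard (norm t ℤₚ.≟ + m) (f₀ t)) ≡ 0ℤ
    windmill-identity = vanish′ (trans (sym halves) total-f₀)
      where
      open ≡-Reasoning
      vanish′ : ∀ {x} → x + x ≡ 0ℤ → x ≡ 0ℤ
      vanish′ {+ 0} _ = refl
      vanish′ {+[1+ _ ]} ()
      vanish′ { -[1+ _ ]} ()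
      C = ∑ (cubes B) (λ t → guard (norm t ℤₚ.≟ + m) (f₀ t))
      P = ∑ box (λ t → guard (pos₃? t) (f₀ t))
      positive : P ≡ C
      positive = ∑-transfer _≟₃_ _≟₃_ box-unique (cubes-unique B) _ _ (λ t → t) (λ t → t)
        (λ t _ h → to t (guard-≢0 (pos₃? t) h)) from
        where
        to : ∀ t → Pos t → t ∈ cubes B × t ≡ t × guard (norm t ℤₚ.≟ + m) (f₀ t) ≡ guard (pos₃? t) (f₀ t)
        to t@(s , d , e) P@(A@(adm eq a b c p q) , s⁺) =
          ∈-cartesianProduct⁺ (∈-odds⁺ s s⁺ (HasParity.parity a) (proj₁ (adm-bounds A)))
            (∈-cartesianProduct⁺ (∈-odds⁺ d p (HasParity.parity b) (proj₁ (proj₂ (adm-bounds A))))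
                                 (∈-odds⁺ e q (HasParity.parity c) (proj₂ (proj₂ (adm-bounds A))))) , refl ,
          trans (guard-yes (norm t ℤₚ.≟ + m) eq) (sym (guard-yes (pos₃? t) P))
        from : ∀ t → t ∈ cubes B → guard (norm t ℤₚ.≟ + m) (f₀ t) ≢ 0ℤ → t ∈ box × t ≡ t × guard (pos₃? t) (f₀ t) ≡ guard (norm t ℤₚ.≟ + m) (f₀ t)
        from t@(s , d , e) i h = adm-∈ t A , refl , trans (guard-yes (pos₃? t) (A , proj₁ (∈-odds⁻ p))) (sym (guard-yes (norm t ℤₚ.≟ + m) eq))
          where
          eq = guard-≢0 (norm t ℤₚ.≟ + m) h
          p : s ∈ odds B
          p = proj₁ (∈-cartesianProduct⁻ (odds B) (cartesianProduct (odds B) (odds B)) i)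
          q′ : (d , e) ∈ cartesianProduct (odds B) (odds B)
          q′ = proj₂ (∈-cartesianProduct⁻ (odds B) (cartesianProduct (odds B) (odds B)) i)
          q : d ∈ odds B
          q = proj₁ (∈-cartesianProduct⁻ (odds B) (odds B) q′)
          r : e ∈ odds B
          r = proj₂ (∈-cartesianProduct⁻ (odds B) (odds B) q′)
          A : Adm t
          A = adm eq ⟨ proj₂ (∈-odds⁻ p) ⟩ ⟨ proj₂ (∈-odds⁻ q) ⟩ ⟨ proj₂ (∈-odds⁻ r) ⟩ (proj₁ (∈-odds⁻ q)) (proj₁ (∈-odds⁻ r))
      Neg : Triple → Set
      Neg t = Adm t × sg (- proj₁ t) ≡ pos
      neg? : ∀ t → Dec (Neg t)
      neg? t = adm? t ×-dec pos? (- proj₁ t)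
      split : ∀ t → guard (adm? t) (f₀ t) ≡ guard (pos₃? t) (f₀ t) + guard (neg? t) (f₀ t)
      split t@(s , _) = by (adm? t) (sg s) refl
        where
        neg≢pos : neg ≢ pos
        neg≢pos ()
        by : Dec (Adm t) → ∀ σ → sg s ≡ σ → guard (adm? t) (f₀ t) ≡ guard (pos₃? t) (f₀ t) + guard (neg? t) (f₀ t)
        by (no ¬a) _ _ = trans (guard-no (adm? t) ¬a) (sym (cong₂ _+_ (guard-no (pos₃? t) λ u → ¬a (proj₁ u)) (guard-no (neg? t) λ u → ¬a (proj₁ u))))
        by (yes a) pos e = trans (guard-yes (adm? t) a) (sym (trans (cong₂ _+_ (guard-yes (pos₃? t) (a , e))
          (guard-no (neg? t) λ u → neg≢pos (trans (sym (trans (sg-neg s) (cong opp e))) (proj₂ u)))) (ℤₚ.+-identityʳ (f₀ t))))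
        by (yes a) neg e = trans (guard-yes (adm? t) a) (sym (trans (cong₂ _+_ (guard-no (pos₃? t) λ u → neg≢pos (trans (sym e) (proj₂ u)))
          (guard-yes (neg? t) (a , trans (sg-neg s) (cong opp e)))) (ℤₚ.+-identityˡ (f₀ t))))
        by (yes (adm _ a _ _ _ _)) zer e = ⊥-elim (sg≢zer a e)
      halves : total f₀ ≡ C + C
      halves = begin
        total f₀ ≡⟨ ∑-cong box split ⟩
        ∑ box (λ t → guard (pos₃? t) (f₀ t) + guard (neg? t) (f₀ t)) ≡⟨ ∑-+ box _ _ ⟩
        P + ∑ box (λ t → guard (neg? t) (f₀ t)) ≡⟨ cong (_+_ P) (∑-guard-cong box neg? λ t _ → even (proj₁ t) (proj₁ (proj₂ t))) ⟨
        P + ∑ box (λ t → guard (neg? t) (f₀ (mirror t))) ≡⟨ cong (_+_ P) (transport pos₃? neg? mirror mirror-mirror (λ _ → proj₁) (λ _ → proj₁)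
            (λ t (a , u) → adm-mirror t a , trans (cong sg (ℤₚ.neg-involutive (proj₁ t))) u) (λ t (a , u) → adm-mirror t a , u) f₀) ⟨
        P + ∑ box (λ t → guard (pos₃? t) (f₀ t)) ≡⟨ cong₂ _+_ positive positive ⟩
        C + C ∎
        where
        even : ∀ s d → (+ m - + 5 * (- s * - s)) * d ≡ (+ m - + 5 * (s * s)) * d
        even s d = cong (λ x → (+ m - + 5 * x) * d) (square-neg s)
          where
          square-neg : ∀ s → - s * - s ≡ s * s
          square-neg = solve-∀

-- Sums of three odd squares.

module ThreeSquares where

  open import Data.Integer.Base using (_+_; _*_; -_; _-_)
  open Sums
  open SignPatterns
  open Parity
  open Index
  open Cusps
  open Quadruples
  open ClassNumberRelation
  open Windmill

  ∑-zero-∈ : ∀ {A : Set} (xs : List A) {f} → (∀ x → x ∈ xs → f x ≡ 0ℤ) → ∑ xs f ≡ 0ℤ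
  ∑-zero-∈ xs h = trans (∑-cong-∈ xs h) (∑-zero xs λ _ → refl)

  ∑-≢0 : ∀ {A : Set} (xs : List A) (f : A → ℤ) → ∑ xs f ≢ 0ℤ → Σ A λ x → x ∈ xs × f x ≢ 0ℤ
  ∑-≢0 []       f h = ⊥-elim (h refl)
  ∑-≢0 (x ∷ xs) f h with f x ℤₚ.≟ 0ℤ
  ... | no n  = x , here refl , n
  ... | yes e = let (y , p , q) = ∑-≢0 xs f (λ z → h (cong₂ _+_ e z)) in y , there p , q

  ∑-nonneg : ∀ {A : Set} (xs : List A) (f : A → ℤ) → (∀ x → 0ℤ ℤ.≤ f x) → 0ℤ ℤ.≤ ∑ xs f
  ∑-nonneg []       f h = ℤₚ.≤-refl
  ∑-nonneg (x ∷ xs) f h = ℤₚ.+-mono-≤ (h x) (∑-nonneg xs f h)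

  ∑-positive : ∀ {A : Set} (xs : List A) (f : A → ℤ) → (∀ x → 0ℤ ℤ.≤ f x) → ∀ {x} → x ∈ xs → 1ℤ ℤ.≤ f x → 1ℤ ℤ.≤ ∑ xs f
  ∑-positive (x ∷ xs) f h (here refl) q = ℤₚ.+-mono-≤ q (∑-nonneg xs f h)
  ∑-positive (x ∷ xs) f h (there p)   q = ℤₚ.+-mono-≤ (h x) (∑-positive xs f h p q)

  -- `t` is the triangular number `i (i + 1) / 2`, which vanishes only for the square of 1.
  odd-square : ∀ i → Σ ℕ λ t → (+[1+ i ℕ.+ i ] * +[1+ i ℕ.+ i ] ≡ + 8 * + t + 1ℤ) × (t ≡ 0 → i ≡ 0)
  odd-square zero = 0 , refl , λ _ → refl
  odd-square (suc i) = let (t , e , _) = odd-square i in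
    suc i ℕ.+ t , trans (cong (λ x → x * x) (shift (+ i) (cong +[1+_] (cong suc (ℕₚ.+-suc i i))))) (trans (expand (+ i)) (trans (cong (_+_ (+ 8 * (1ℤ + + i))) e) (collect (+ i) (+ t)))) , λ ()
    where
    shift : ∀ x {y} → y ≡ + 3 + (x + x) → y ≡ + 3 + (x + x)
    shift x e = e
    expand : ∀ x → (+ 3 + (x + x)) * (+ 3 + (x + x)) ≡ + 8 * (1ℤ + x) + (1ℤ + (x + x)) * (1ℤ + (x + x))
    expand = solve-∀
    collect : ∀ x t → + 8 * (1ℤ + x) + (+ 8 * t + 1ℤ) ≡ + 8 * (1ℤ + x + t) + 1ℤ
    collect = solve-∀

  opaque
    unfolding odds
    odds-square : ∀ {B s} → s ∈ odds B → Σ ℕ λ t → (s * s ≡ + 8 * + t + 1ℤ) × (t ≡ 0 → s ≡ 1ℤ)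
    odds-square {B} p = go (∈-map⁻ _ p)
      where
      go : ∀ {s} → Σ ℕ (λ i → i ∈ upTo B × s ≡ +[1+ i ℕ.+ i ]) → Σ ℕ λ t → (s * s ≡ + 8 * + t + 1ℤ) × (t ≡ 0 → s ≡ 1ℤ)
      go (i , _ , refl) = let (t , e , z) = odd-square i in t , e , λ q → cong (λ i → +[1+ i ℕ.+ i ]) (z q)

  odds-product : ∀ {B x y} → x ∈ odds B → y ∈ odds B → Σ ℕ λ n → x * y ≡ +[1+ n ]
  odds-product p q = go (proj₁ (∈-odds⁻ p)) (proj₁ (∈-odds⁻ q))
    where
    go : ∀ {x y} → sg x ≡ pos → sg y ≡ pos → Σ ℕ λ n → x * y ≡ +[1+ n ]
    go {+[1+ m ]} {+[1+ n ]} _ _ = _ , refl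

  squares products : Triple → ℤ
  squares  (x , y , z) = x * x + y * y + z * z
  products (x , y , z) = x * y + y * z + z * x

  cubes-⁻ : ∀ {B x y z} → (x , y , z) ∈ cubes B → x ∈ odds B × y ∈ odds B × z ∈ odds B
  cubes-⁻ {B} h = proj₁ h₁ , proj₁ h₂ , proj₂ h₂
    where
    h₁ = ∈-cartesianProduct⁻ (odds B) (cartesianProduct (odds B) (odds B)) h
    h₂ = ∈-cartesianProduct⁻ (odds B) (odds B) (proj₂ h₁)

  three-positive : ∀ {a b c : ℤ} → (Σ ℕ λ n → a ≡ +[1+ n ]) → (Σ ℕ λ n → b ≡ +[1+ n ]) → (Σ ℕ λ n → c ≡ +[1+ n ]) → sg (a + b + c) ≡ pos
  three-positive (_ , refl) (_ , refl) (_ , refl) = refl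

  squares-pos : ∀ {B t} → t ∈ cubes B → sg (squares t) ≡ pos
  squares-pos {B} {x , y , z} h = let (p , q , r) = cubes-⁻ h in three-positive (odds-product p p) (odds-product q q) (odds-product r r)

  products-pos : ∀ {B t} → t ∈ cubes B → sg (products t) ≡ pos
  products-pos {B} {x , y , z} h = let (p , q , r) = cubes-⁻ h in three-positive (odds-product p q) (odds-product q r) (odds-product r p)

  Pent : Set
  Pent = ℤ × ℤ × Triple

  _≟₅_ : DecidableEquality Pent
  _≟₅_ = ×.≡-dec ℤₚ._≟_ (×.≡-dec ℤₚ._≟_ _≟₃_)

  -- The name recalls Gauss's note on sums of three triangular numbers, an equivalent form of the
  -- three squares theorem for `8j + 3`.
  module Eureka (B : ℕ) where

    O = odds B
    T F : ℤ → ℤ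
    T n = ∑ (cubes B) λ t → guard (squares t ℤₚ.≟ n) 1ℤ
    F n = ∑ (cubes B) λ t → guard (products t ℤₚ.≟ n) 1ℤ

    T-neg : ∀ n → sg n ≢ pos → T n ≡ 0ℤ
    T-neg n h = ∑-zero-∈ (cubes B) λ t p → guard-no (squares t ℤₚ.≟ n) λ e → h (trans (cong sg (sym e)) (squares-pos p))

    F-neg : ∀ n → sg n ≢ pos → F n ≡ 0ℤ
    F-neg n h = ∑-zero-∈ (cubes B) λ t p → guard-no (products t ℤₚ.≟ n) λ e → h (trans (cong sg (sym e)) (products-pos p))

    form-count-neg : ∀ n → sg n ≢ pos → form-count B n ≡ 0ℤ
    form-count-neg n h = ∑-zero-∈ (tesseracts B) λ k p → guard-no (form k ℤₚ.≟ n) λ e → h (trans (cong sg (sym e)) (form-pos k p))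
      where
      form-pos : ∀ k → k ∈ tesseracts B → sg (form k) ≡ pos
      form-pos (X , Y , Z , s) p = go (odds-product q r₁) (odds-product r₁ r₂) (odds-product r₂ q) (odds-product r₃ r₃)
        where
        q = proj₁ (∈-cartesianProduct⁻ O (cubes B) p)
        rs = cubes-⁻ (proj₂ (∈-cartesianProduct⁻ O (cubes B) p))
        r₁ = proj₁ rs
        r₂ = proj₁ (proj₂ rs)
        r₃ = proj₂ (proj₂ rs)
        go : ∀ {a b c d : ℤ} → (Σ ℕ λ n → a ≡ +[1+ n ]) → (Σ ℕ λ n → b ≡ +[1+ n ]) → (Σ ℕ λ n → c ≡ +[1+ n ]) →
             (Σ ℕ λ n → d ≡ +[1+ n ]) → sg (a + b + c + d) ≡ pos
        go (_ , refl) (_ , refl) (_ , refl) (_ , refl) = refl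

    private
      minus-plus : ∀ x y z → x + y ≡ z → x ≡ z - y
      minus-plus x y z refl = sym (+-minus x y)
      plus-minus : ∀ x y z → x ≡ z - y → x + y ≡ z
      plus-minus x y z refl = minus+ z y
        where
        minus+ : ∀ z y → (z - y) + y ≡ z
        minus+ = solve-∀

    form-count-∑F : ∀ M → form-count B M ≡ ∑ O λ s → F (M - s * s)
    form-count-∑F M = trans (∑-transfer _≟₄_ _≟₄_ (tesseracts-unique B) (tesseracts-unique B) _
        (λ { (s , t) → guard (products t ℤₚ.≟ M - s * s) 1ℤ }) (λ { (X , Y , Z , s) → s , X , Y , Z }) (λ { (s , X , Y , Z) → X , Y , Z , s })
        (λ { (X , Y , Z , s) p _ → let (a , b) = ∈-cartesianProduct⁻ O (cubes B) p ; (c , d , e) = cubes-⁻ b in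
             ∈-cartesianProduct⁺ e (∈-cartesianProduct⁺ a (∈-cartesianProduct⁺ c d)) , refl , sym (eq X Y Z s) })
        (λ { (s , X , Y , Z) p _ → let (a , b) = ∈-cartesianProduct⁻ O (cubes B) p ; (c , d , e) = cubes-⁻ b in
             ∈-cartesianProduct⁺ c (∈-cartesianProduct⁺ d (∈-cartesianProduct⁺ e a)) , refl , eq X Y Z s }))
      (∑-× O (cubes B) _)
      where
      eq : ∀ X Y Z s → guard (form (X , Y , Z , s) ℤₚ.≟ M) 1ℤ ≡ guard (products (X , Y , Z) ℤₚ.≟ M - s * s) 1ℤ
      eq X Y Z s = guard-⇔ (form (X , Y , Z , s) ℤₚ.≟ M) (products (X , Y , Z) ℤₚ.≟ M - s * s)
        (minus-plus _ (s * s) M) (plus-minus _ (s * s) M) λ _ → refl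

    -- With `N = 8j + 5` and odd `s`, `t`, the quotient `(N - s²) / 4` is odd, as the class number
    -- relation demands, and `N - s² - t²` is again `3 (mod 8)`.
    module Stage (j : ℕ) (B≥ : 8 ℕ.* j ℕ.+ 5 ℕ.≤ B) where

      m : ℕ
      m = 8 ℕ.* j ℕ.+ 5
      N : ℤ
      N = + m

      N-eq : N ≡ + 8 * + j + + 5
      N-eq = cong (_+ + 5) (ℤₚ.pos-* 8 j)

      -- Five squares with sum `N` have mean `N / 5`, so this weight averages to zero over their
      -- permutations. It is also the factor in the windmill identity.
      weight : ℤ → ℤ
      weight s = N - + 5 * (s * s)

      -- With `s² = 8t + 1` one has `N - s² = 4 (2(j - t) + 1)`. For a natural quotient this is the
      -- class number relation; for a negative one neither side has a solution to count.
      fibre : ∀ s → s ∈ O → form-count B (N - s * s) ≡ ∑ O λ d → ∑ O λ e → guard (s * s + + 4 * (d * e) ℤₚ.≟ N) d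
      fibre s p = by (+ 2 * (+ j - + t) + 1ℤ) refl
        where
        sq = odds-square p
        t = proj₁ sq
        four : N - s * s ≡ + 4 * (+ 2 * (+ j - + t) + 1ℤ)
        four = trans (cong₂ _-_ N-eq (proj₁ (proj₂ sq))) (ring (+ j) (+ t))
          where
          ring : ∀ j t → (+ 8 * j + + 5) - (+ 8 * t + 1ℤ) ≡ + 4 * (+ 2 * (j - t) + 1ℤ)
          ring = solve-∀
        odd-quotient : par (+ 2 * (+ j - + t) + 1ℤ) ≡ true
        odd-quotient = trans (par-+ (+ 2 * (+ j - + t)) 1ℤ) (cong (_xor true) (par-* (+ 2) (+ j - + t)))
        shape : ∀ d e → s * s + + 4 * (d * e) ≡ N → + 4 * (d * e) ≡ N - s * s
        shape d e h = minus-plus _ (s * s) N (trans (ℤₚ.+-comm (+ 4 * (d * e)) (s * s)) h)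
        by : ∀ q → + 2 * (+ j - + t) + 1ℤ ≡ q → _
        by (+ n) e = trans (cong (form-count B) (trans four (trans (cong (_*_ (+ 4)) e) (sym (ℤₚ.pos-* 4 n)))))
          (trans (Count.class-number-relation n B (trans (cong par (sym e)) odd-quotient) 4n≤B)
          (∑-cong O λ d → ∑-cong O λ f → guard-⇔ (d * f ℤₚ.≟ + n) (s * s + + 4 * (d * f) ℤₚ.≟ N)
            (λ h → trans (ℤₚ.+-comm (s * s) _) (plus-minus _ (s * s) N (trans (cong (_*_ (+ 4)) h) (sym (trans four (cong (_*_ (+ 4)) e))))))
            (λ h → four-injective (trans (shape d f h) (trans four (cong (_*_ (+ 4)) e)))) λ _ → refl))
          where
          4n : + (4 ℕ.* n) ≡ N - s * s
          4n = trans (ℤₚ.pos-* 4 n) (sym (trans four (cong (_*_ (+ 4)) e)))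
          total : 4 ℕ.* n ℕ.+ ∣ s ∣ ℕ.* ∣ s ∣ ≡ m
          total = ℤₚ.+-injective (trans (cong₂ _+_ 4n (sym (square-abs s))) (minus+ N (s * s)))
            where
            minus+ : ∀ z y → (z - y) + y ≡ z
            minus+ = solve-∀
          4n≤B : 4 ℕ.* n ℕ.≤ B
          4n≤B = ℕₚ.≤-trans (ℕₚ.m≤m+n _ _) (ℕₚ.≤-trans (ℕₚ.≤-reflexive total) B≥)
        by -[1+ n ] e = trans (form-count-neg _ λ h → neg≢pos (trans (sym (cong sg (trans four (cong (_*_ (+ 4)) e)))) h))
          (sym (∑-zero-∈ O λ d p → ∑-zero-∈ O λ f q → guard-no (s * s + + 4 * (d * f) ℤₚ.≟ N) λ h →
            neg≢pos (trans (sym (cong sg (trans (shape d f h) (trans four (cong (_*_ (+ 4)) e))))) (pos4 (odds-product p q)))))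
          where
          neg≢pos : neg ≢ pos
          neg≢pos ()
          pos4 : ∀ {x} → (Σ ℕ λ n → x ≡ +[1+ n ]) → sg (+ 4 * x) ≡ pos
          pos4 (_ , refl) = refl

      cost : ℤ → ℤ → ℤ
      cost s t = weight s + weight t

      open ≡-Reasoning

      -- Summing `F` over `t` gives a form count, hence a divisor sum, and the weighted divisor sums
      -- cancel by the windmill identity.
      half-sum-F : ∑ O (λ s → ∑ O λ t → weight s * F (N - s * s - t * t)) ≡ 0ℤ
      half-sum-F = begin
        ∑ O (λ s → ∑ O λ t → weight s * F (N - s * s - t * t)) ≡⟨ ∑-cong O (λ s → ∑-* (weight s) O _) ⟩
        ∑ O (λ s → weight s * ∑ O λ t → F (N - s * s - t * t)) ≡⟨ ∑-cong-∈ O (λ s p → cong (_*_ (weight s)) (trans (sym (form-count-∑F (N - s * s))) (fibre s p))) ⟩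
        ∑ O (λ s → weight s * ∑ O λ d → ∑ O λ e → guard (s * s + + 4 * (d * e) ℤₚ.≟ N) d) ≡⟨ ∑-cong O (λ s → trans (sym (∑-* (weight s) O _))
            (∑-cong O λ d → trans (sym (∑-* (weight s) O _)) (∑-cong O λ e → *-guard (s * s + + 4 * (d * e) ℤₚ.≟ N) (weight s) d))) ⟩
        ∑ O (λ s → ∑ O λ d → ∑ O λ e → guard (s * s + + 4 * (d * e) ℤₚ.≟ N) (weight s * d)) ≡⟨ trans (∑-× O (cartesianProduct O O) _) (∑-cong O λ s → ∑-× O O _) ⟨
        ∑ (cubes B) (λ t → guard (norm t ℤₚ.≟ N) (Windmill.f₀ m B B≥ t)) ≡⟨ Windmill.windmill-identity m B B≥ ⟩
        0ℤ ∎

      sum-F : ∑ O (λ s → ∑ O λ t → cost s t * F (N - s * s - t * t)) ≡ 0ℤ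
      sum-F = begin
        ∑ O (λ s → ∑ O λ t → cost s t * F (N - s * s - t * t))
          ≡⟨ ∑-cong O (λ s → trans (∑-cong O λ t → ℤₚ.*-distribʳ-+ (F (N - s * s - t * t)) (weight s) (weight t)) (∑-+ O _ _)) ⟩
        ∑ O (λ s → ∑ O (λ t → weight s * F (N - s * s - t * t)) + ∑ O (λ t → weight t * F (N - s * s - t * t))) ≡⟨ ∑-+ O _ _ ⟩
        _ ≡⟨ cong₂ _+_ half-sum-F (trans (∑-swap O O _) (trans (∑-cong O λ t → ∑-cong O λ s → cong (λ x → weight t * F x) (comm N (s * s) (t * t))) half-sum-F)) ⟩
        0ℤ ∎
        where
        comm : ∀ N x y → N - x - y ≡ N - y - x
        comm = solve-∀

      pents : List Pent
      pents = cartesianProduct O (cartesianProduct O (cubes B))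

      pents-unique : Unique pents
      pents-unique = Uniqueₚ.cartesianProduct⁺ (odds-unique B) (tesseracts-unique B)

      total : Pent → ℤ
      total (s , t , x , y , z) = s * s + (t * t + (x * x + y * y + z * z))

      all₅ : ∀ {s t x y z} → (s , t , x , y , z) ∈ pents → s ∈ O × t ∈ O × x ∈ O × y ∈ O × z ∈ O
      all₅ h = let (a , h₁) = ∈-cartesianProduct⁻ O (cartesianProduct O (cubes B)) h ; (b , h₂) = ∈-cartesianProduct⁻ O (cubes B) h₁ in a , b , cubes-⁻ h₂

      make₅ : ∀ {s t x y z} → s ∈ O × t ∈ O × x ∈ O × y ∈ O × z ∈ O → (s , t , x , y , z) ∈ pents
      make₅ (a , b , c , d , e) = ∈-cartesianProduct⁺ a (∈-cartesianProduct⁺ b (∈-cartesianProduct⁺ c (∈-cartesianProduct⁺ d e)))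

      S : (Pent → ℤ) → ℤ
      S w = ∑ pents λ p → guard (total p ℤₚ.≟ N) (w p)

      permute : ∀ (φ : Pent → Pent) → (∀ p → φ (φ p) ≡ p) → (∀ p → p ∈ pents → φ p ∈ pents) → (∀ p → total (φ p) ≡ total p) →
                ∀ w → S w ≡ S (λ p → w (φ p))
      permute φ inv mem tot w = ∑-transfer _≟₅_ _≟₅_ pents-unique pents-unique _ _ φ φ
        (λ p h _ → mem p h , inv p , trans (sym (eq (φ p))) (cong (λ q → guard (total q ℤₚ.≟ N) (w q)) (inv p)))
        (λ p h _ → mem p h , inv p , eq p)
        where
        eq : ∀ p → guard (total (φ p) ℤₚ.≟ N) (w (φ p)) ≡ guard (total p ℤₚ.≟ N) (w (φ p))
        eq p = guard-⇔ (total (φ p) ℤₚ.≟ N) (total p ℤₚ.≟ N) (trans (sym (tot p))) (trans (tot p)) λ _ → refl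

      sq₁ sq₂ sq₃ sq₄ sq₅ : Pent → ℤ
      sq₁ (s , t , x , y , z) = s * s
      sq₂ (s , t , x , y , z) = t * t
      sq₃ (s , t , x , y , z) = x * x
      sq₄ (s , t , x , y , z) = y * y
      sq₅ (s , t , x , y , z) = z * z

      S₂ : S sq₁ ≡ S sq₂
      S₂ = permute (λ { (s , t , r) → t , s , r }) (λ _ → refl)
        (λ { (s , t , r) h → let (a , b , c) = all₅ h in make₅ (b , a , c) }) (λ { (s , t , x , y , z) → ring (s * s) (t * t) (x * x + y * y + z * z) }) sq₁
        where
        ring : ∀ s t r → t + (s + r) ≡ s + (t + r)
        ring = solve-∀

      S₃ : S sq₁ ≡ S sq₃
      S₃ = permute (λ { (s , t , x , y , z) → x , t , s , y , z }) (λ _ → refl)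
        (λ { (s , t , x , y , z) h → let (a , b , c , d , e) = all₅ h in make₅ (c , b , a , d , e) })
        (λ { (s , t , x , y , z) → ring (s * s) (t * t) (x * x) (y * y) (z * z) }) sq₁
        where
        ring : ∀ s t x y z → x + (t + (s + y + z)) ≡ s + (t + (x + y + z))
        ring = solve-∀

      S₄ : S sq₁ ≡ S sq₄
      S₄ = permute (λ { (s , t , x , y , z) → y , t , x , s , z }) (λ _ → refl)
        (λ { (s , t , x , y , z) h → let (a , b , c , d , e) = all₅ h in make₅ (d , b , c , a , e) })
        (λ { (s , t , x , y , z) → ring (s * s) (t * t) (x * x) (y * y) (z * z) }) sq₁
        where
        ring : ∀ s t x y z → y + (t + (x + s + z)) ≡ s + (t + (x + y + z))
        ring = solve-∀

      S₅ : S sq₁ ≡ S sq₅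
      S₅ = permute (λ { (s , t , x , y , z) → z , t , x , y , s }) (λ _ → refl)
        (λ { (s , t , x , y , z) h → let (a , b , c , d , e) = all₅ h in make₅ (e , b , c , d , a) })
        (λ { (s , t , x , y , z) → ring (s * s) (t * t) (x * x) (y * y) (z * z) }) sq₁
        where
        ring : ∀ s t x y z → z + (t + (x + y + s)) ≡ s + (t + (x + y + z))
        ring = solve-∀

      S-+ : ∀ f g → S (λ p → f p + g p) ≡ S f + S g
      S-+ f g = trans (∑-cong pents λ p → guard-distrib-+ (total p ℤₚ.≟ N) (f p) (g p)) (∑-+ pents _ _)

      S-* : ∀ c f → S (λ p → c * f p) ≡ c * S f
      S-* c f = trans (∑-cong pents λ p → sym (*-guard (total p ℤₚ.≟ N) c (f p))) (∑-* c pents _)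

      -- On the support the constant `N` is the sum of the five squares, and by symmetry each of
      -- them contributes the same amount.
      S-N : S (λ _ → N) ≡ + 5 * S sq₁
      S-N = begin
        S (λ _ → N) ≡⟨ ∑-cong pents (λ p → guard-⇔ (total p ℤₚ.≟ N) (total p ℤₚ.≟ N) (λ e → e) (λ e → e) sym) ⟩
        S total ≡⟨ trans (S-+ sq₁ _) (cong (_+_ (S sq₁)) (trans (S-+ sq₂ _) (cong (_+_ (S sq₂)) (trans (S-+ _ sq₅) (cong (_+ S sq₅) (S-+ sq₃ sq₄)))))) ⟩
        S sq₁ + (S sq₂ + (S sq₃ + S sq₄ + S sq₅)) ≡⟨ cong (_+_ (S sq₁)) (cong₂ _+_ (sym S₂) (cong₂ _+_ (cong₂ _+_ (sym S₃) (sym S₄)) (sym S₅))) ⟩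
        S sq₁ + (S sq₁ + (S sq₁ + S sq₁ + S sq₁)) ≡⟨ five (S sq₁) ⟩
        + 5 * S sq₁ ∎
        where
        five : ∀ x → x + (x + (x + x + x)) ≡ + 5 * x
        five = solve-∀

      S-cost : S (λ p → cost (proj₁ p) (proj₁ (proj₂ p))) ≡ 0ℤ
      S-cost = begin
        S (λ p → (N - + 5 * sq₁ p) + (N - + 5 * sq₂ p)) ≡⟨ ∑-cong pents (λ p → cong (guard (total p ℤₚ.≟ N)) (ring N (sq₁ p) (sq₂ p))) ⟩
        S (λ p → (N + N) + - + 5 * (sq₁ p + sq₂ p)) ≡⟨ trans (S-+ _ _) (cong₂ _+_ (S-+ _ _) (trans (S-* (- + 5) _) (cong (_*_ (- + 5)) (S-+ sq₁ sq₂)))) ⟩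
        S (λ _ → N) + S (λ _ → N) + - + 5 * (S sq₁ + S sq₂) ≡⟨ cong₂ (λ a b → a + a + - + 5 * (S sq₁ + b)) S-N (sym S₂) ⟩
        + 5 * S sq₁ + + 5 * S sq₁ + - + 5 * (S sq₁ + S sq₁) ≡⟨ zero′ (S sq₁) ⟩
        0ℤ ∎
        where
        ring : ∀ N x y → (N - + 5 * x) + (N - + 5 * y) ≡ (N + N) + - + 5 * (x + y)
        ring = solve-∀
        zero′ : ∀ x → + 5 * x + + 5 * x + - + 5 * (x + x) ≡ 0ℤ
        zero′ = solve-∀

      -- Expanding `T` gives a sum over the representations of `N` by five odd squares, where the
      -- weights cancel by symmetry.
      sum-T : ∑ O (λ s → ∑ O λ t → cost s t * T (N - s * s - t * t)) ≡ 0ℤ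
      sum-T = begin
        ∑ O (λ s → ∑ O λ t → cost s t * T (N - s * s - t * t)) ≡⟨ ∑-cong O (λ s → ∑-cong O λ t → trans (sym (∑-* (cost s t) (cubes B) _))
            (∑-cong (cubes B) λ c → trans (*-guard (squares c ℤₚ.≟ N - s * s - t * t) (cost s t) 1ℤ)
              (guard-⇔ (squares c ℤₚ.≟ N - s * s - t * t) (total (s , t , c) ℤₚ.≟ N) (to s t (squares c)) (from s t (squares c)) λ _ → ℤₚ.*-identityʳ _))) ⟩
        ∑ O (λ s → ∑ O λ t → ∑ (cubes B) λ c → guard (total (s , t , c) ℤₚ.≟ N) (cost s t)) ≡⟨ trans (∑-× O (cartesianProduct O (cubes B)) _) (∑-cong O λ s → ∑-× O (cubes B) _) ⟨
        S (λ p → cost (proj₁ p) (proj₁ (proj₂ p))) ≡⟨ S-cost ⟩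
        0ℤ ∎
        where
        to : ∀ s t q → q ≡ N - s * s - t * t → s * s + (t * t + q) ≡ N
        to s t q refl = ring N (s * s) (t * t)
          where
          ring : ∀ N x y → x + (y + (N - x - y)) ≡ N
          ring = solve-∀
        from : ∀ s t q → s * s + (t * t + q) ≡ N → q ≡ N - s * s - t * t
        from s t q e = trans (ring (s * s) (t * t) q) (cong (λ n → n - s * s - t * t) e)
          where
          ring : ∀ x y q → q ≡ (x + (y + q)) - x - y
          ring = solve-∀

    δ : ℤ → ℤ
    δ n = T n - F n

    δ-neg : ∀ n → sg n ≢ pos → δ n ≡ 0ℤ
    δ-neg n h = cong₂ _-_ (T-neg n h) (F-neg n h)

    -- For odd positive entries both equations force x = y = z = 1.
    δ-three : δ (+ 3) ≡ 0ℤ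
    δ-three = trans (cong (_- F (+ 3)) same-count) (ℤₚ.+-inverseʳ (F (+ 3)))
      where
      ones : ∀ {a b c : ℤ} → (Σ ℕ λ n → a ≡ +[1+ n ]) → (Σ ℕ λ n → b ≡ +[1+ n ]) → (Σ ℕ λ n → c ≡ +[1+ n ]) →
             a + b + c ≡ + 3 → a ≡ 1ℤ × b ≡ 1ℤ × c ≡ 1ℤ
      ones (zero , refl) (zero , refl) (zero , refl) e = refl , refl , refl
      ones (zero , refl) (zero , refl) (suc _ , refl) ()
      ones (zero , refl) (suc zero , refl) (_ , refl) ()
      ones (zero , refl) (suc (suc _) , refl) (_ , refl) ()
      ones (suc zero , refl) (zero , refl) (_ , refl) ()
      ones (suc zero , refl) (suc _ , refl) (_ , refl) ()
      ones (suc (suc a) , refl) (b , refl) (c , refl) e = ⊥-elim (big a b c (ℤₚ.+-injective e))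
        where
        big : ∀ a b c → 3 ℕ.+ a ℕ.+ suc b ℕ.+ suc c ≢ 3
        big a b c e rewrite ℕₚ.+-suc (a ℕ.+ suc b) c = λ′ e
          where
          λ′ : 3 ℕ.+ suc (a ℕ.+ suc b ℕ.+ c) ≡ 3 → ⊥
          λ′ ()
      unit-factor : ∀ {x y} → sg x ≡ pos → sg y ≡ pos → x * y ≡ 1ℤ → x ≡ 1ℤ
      unit-factor {x} {y} p q e = trans (sym (proj₁ (sg-pos-abs p)))
        (cong +_ (ℕₚ.m*n≡1⇒m≡1 ∣ x ∣ ∣ y ∣ (trans (sym (ℤₚ.abs-* x y)) (cong ∣_∣ e))))
      ones-eq : ∀ {x y z : ℤ} → x ≡ 1ℤ → y ≡ 1ℤ → z ≡ 1ℤ → squares (x , y , z) ≡ + 3 × products (x , y , z) ≡ + 3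
      ones-eq refl refl refl = refl , refl
      from-squares : ∀ t → t ∈ cubes B → squares t ≡ + 3 → products t ≡ + 3
      from-squares (x , y , z) h e =
        let (p , q , r) = cubes-⁻ h
            (a , b , c) = ones (odds-product p p) (odds-product q q) (odds-product r r) e
            x⁺ = proj₁ (∈-odds⁻ p) ; y⁺ = proj₁ (∈-odds⁻ q) ; z⁺ = proj₁ (∈-odds⁻ r)
        in proj₂ (ones-eq (unit-factor x⁺ x⁺ a) (unit-factor y⁺ y⁺ b) (unit-factor z⁺ z⁺ c))
      from-products : ∀ t → t ∈ cubes B → products t ≡ + 3 → squares t ≡ + 3
      from-products (x , y , z) h e =
        let (p , q , r) = cubes-⁻ h
            (a , b , c) = ones (odds-product p q) (odds-product q r) (odds-product r p) e
            x⁺ = proj₁ (∈-odds⁻ p) ; y⁺ = proj₁ (∈-odds⁻ q) ; z⁺ = proj₁ (∈-odds⁻ r)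
        in proj₁ (ones-eq (unit-factor x⁺ y⁺ a) (unit-factor y⁺ z⁺ b) (unit-factor z⁺ x⁺ c))
      same-count : T (+ 3) ≡ F (+ 3)
      same-count = ∑-cong-∈ (cubes B) λ t h → guard-⇔ (squares t ℤₚ.≟ + 3) (products t ℤₚ.≟ + 3) (from-squares t h) (from-products t h) λ _ → refl

    one∈O : 1 ℕ.≤ B → 1ℤ ∈ O
    one∈O h = ∈-odds⁺ 1ℤ refl refl h

    -- In the difference of the two recurrences every pair `(s, t)` other than `(1, 1)` contributes
    -- `δ` at a smaller number `3 (mod 8)`, zero by induction, or at a negative number, where
    -- nothing is counted. What remains is `16j δ(8j + 3) = 0`. For `j = 0` the coefficient
    -- vanishes, so that case is settled directly.
    δ-zero : ∀ j → 8 ℕ.* j ℕ.+ 5 ℕ.≤ B → δ (+ 8 * + j + + 3) ≡ 0ℤ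
    δ-zero j = go j (<-wellFounded j)
      where
      go : ∀ j → Acc ℕ._<_ j → 8 ℕ.* j ℕ.+ 5 ℕ.≤ B → δ (+ 8 * + j + + 3) ≡ 0ℤ
      go zero _ _ = δ-three
      go j@(suc j₀) (acc rec) h = trans (cong δ (trans (ring₁ (+ j)) (cong (λ n → n - 1ℤ * 1ℤ - 1ℤ * 1ℤ) (sym N-eq)))) (cancel nonzero isolated)
        where
        open Stage j h
        open ≡-Reasoning
        _≟ₚ_ : DecidableEquality (ℤ × ℤ)
        _≟ₚ_ = ×.≡-dec ℤₚ._≟_ ℤₚ._≟_
        ring₁ : ∀ j → + 8 * j + + 3 ≡ + 8 * j + + 5 - 1ℤ * 1ℤ - 1ℤ * 1ℤ
        ring₁ = solve-∀
        C = cost 1ℤ 1ℤ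
        D = δ (N - 1ℤ * 1ℤ - 1ℤ * 1ℤ)
        lower : ∀ t u → t ℕ.+ u ≢ 0 → δ (+ 8 * (+ j - + t - + u) + + 3) ≡ 0ℤ
        lower t u nz = by (+ j - + t - + u) refl
          where
          sum : ∀ {k} → + j - + t - + u ≡ + k → k ℕ.+ (t ℕ.+ u) ≡ j
          sum {k} e = ℤₚ.+-injective (trans (cong (_+ (+ t + + u)) (sym e)) (ring (+ j) (+ t) (+ u)))
            where
            ring : ∀ j t u → (j - t - u) + (t + u) ≡ j
            ring = solve-∀
          by : ∀ q → + j - + t - + u ≡ q → δ (+ 8 * (+ j - + t - + u) + + 3) ≡ 0ℤ
          by (+ k) e = trans (cong (λ q → δ (+ 8 * q + + 3)) e) (go k (rec k<j) (ℕₚ.≤-trans (ℕₚ.+-monoˡ-≤ 5 (ℕₚ.*-monoʳ-≤ 8 (ℕₚ.<⇒≤ k<j))) h))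
            where
            k<j : k ℕ.< j
            k<j = ℕₚ.≤-trans (subst (ℕ._≤ k ℕ.+ (t ℕ.+ u)) (ℕₚ.+-comm k 1) (ℕₚ.+-monoʳ-≤ k (ℕₚ.n≢0⇒n>0 nz))) (ℕₚ.≤-reflexive (sum e))
          by -[1+ k ] e = δ-neg _ λ p → neg≢pos (trans (sym (negative k)) (trans (cong (λ q → sg (+ 8 * q + + 3)) (sym e)) p))
            where
            neg≢pos : neg ≢ pos
            neg≢pos ()
            negative : ∀ k → sg (+ 8 * -[1+ k ] + + 3) ≡ neg
            negative k = cong sg (trans (ring (+ k)) (small k))
              where
              ring : ∀ k → + 8 * - (1ℤ + k) + + 3 ≡ - (1ℤ + (+ 4 + + 8 * k))
              ring = solve-∀
              small : ∀ k → - (1ℤ + (+ 4 + + 8 * + k)) ≡ -[1+ 4 ℕ.+ 8 ℕ.* k ]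
              small k = cong (λ x → - (1ℤ + (+ 4 + x))) (sym (ℤₚ.pos-* 8 k))
        pointwise : ∀ s → s ∈ O → ∀ t → t ∈ O → cost s t * δ (N - s * s - t * t) ≡ guard ((s , t) ≟ₚ (1ℤ , 1ℤ)) (C * D)
        pointwise s p t q = by ((s , t) ≟ₚ (1ℤ , 1ℤ))
          where
          a = odds-square p
          b = odds-square q
          by : Dec ((s , t) ≡ (1ℤ , 1ℤ)) → _
          by (yes e) = trans (cong (λ { (s , t) → cost s t * δ (N - s * s - t * t) }) e) (sym (guard-yes ((s , t) ≟ₚ (1ℤ , 1ℤ)) e))
          by (no ¬e) = trans (trans (cong (λ n → cost s t * δ n) arg) (trans (cong (_*_ (cost s t)) (lower (proj₁ a) (proj₁ b) nz)) (ℤₚ.*-zeroʳ (cost s t))))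
                             (sym (guard-no ((s , t) ≟ₚ (1ℤ , 1ℤ)) ¬e))
            where
            nz : proj₁ a ℕ.+ proj₁ b ≢ 0
            nz z = ¬e (cong₂ _,_ (proj₂ (proj₂ a) (ℕₚ.m+n≡0⇒m≡0 (proj₁ a) z)) (proj₂ (proj₂ b) (ℕₚ.m+n≡0⇒n≡0 (proj₁ a) z)))
            arg : N - s * s - t * t ≡ + 8 * (+ j - + proj₁ a - + proj₁ b) + + 3
            arg = trans (cong₂ (λ x y → N - x - y) (proj₁ (proj₂ a)) (proj₁ (proj₂ b)))
              (trans (cong (λ n → n - (+ 8 * + proj₁ a + 1ℤ) - (+ 8 * + proj₁ b + 1ℤ)) N-eq) (ring (+ j) (+ proj₁ a) (+ proj₁ b)))
              where
              ring : ∀ j a b → + 8 * j + + 5 - (+ 8 * a + 1ℤ) - (+ 8 * b + 1ℤ) ≡ + 8 * (j - a - b) + + 3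
              ring = solve-∀
        isolated : C * D ≡ 0ℤ
        isolated = begin
          C * D ≡⟨ ∑-point _≟ₚ_ (C * D) (Uniqueₚ.cartesianProduct⁺ (odds-unique B) (odds-unique B)) (∈-cartesianProduct⁺ (one∈O 1≤B) (one∈O 1≤B)) ⟨
          ∑ (cartesianProduct O O) (λ p → guard (p ≟ₚ (1ℤ , 1ℤ)) (C * D)) ≡⟨ ∑-× O O _ ⟩
          ∑ O (λ s → ∑ O λ t → guard ((s , t) ≟ₚ (1ℤ , 1ℤ)) (C * D)) ≡⟨ ∑-cong-∈ O (λ s p → ∑-cong-∈ O λ t q → sym (pointwise s p t q)) ⟩
          ∑ O (λ s → ∑ O λ t → cost s t * δ (N - s * s - t * t)) ≡⟨ ∑-cong O inner ⟩
          ∑ O (λ s → ∑ O (λ t → cost s t * T (N - s * s - t * t)) + - ∑ O (λ t → cost s t * F (N - s * s - t * t))) ≡⟨ trans (∑-+ O _ _) (cong₂ _+_ sum-T (trans (∑-neg O _) (cong -_ sum-F))) ⟩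
          0ℤ ∎
          where
          ring : ∀ c t f → c * (t - f) ≡ c * t + - (c * f)
          ring = solve-∀
          inner : ∀ s → ∑ O (λ t → cost s t * δ (N - s * s - t * t))
                  ≡ ∑ O (λ t → cost s t * T (N - s * s - t * t)) + - ∑ O (λ t → cost s t * F (N - s * s - t * t))
          inner s = trans (∑-cong O λ t → ring (cost s t) (T (N - s * s - t * t)) (F (N - s * s - t * t)))
            (trans (∑-+ O (λ t → cost s t * T (N - s * s - t * t)) (λ t → - (cost s t * F (N - s * s - t * t))))
              (cong (_+_ (∑ O (λ t → cost s t * T (N - s * s - t * t)))) (∑-neg O (λ t → cost s t * F (N - s * s - t * t)))))
          1≤B : 1 ℕ.≤ B
          1≤B = ℕₚ.≤-trans (ℕₚ.m≤n+m 1 (8 ℕ.* j ℕ.+ 4)) (ℕₚ.≤-trans (ℕₚ.≤-reflexive (ℕₚ.+-assoc (8 ℕ.* j) 4 1)) h)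
        nonzero : C ≢ 0ℤ
        nonzero e = absurd (trans (sym (trans (cong (λ n → (n - + 5 * (1ℤ * 1ℤ)) + (n - + 5 * (1ℤ * 1ℤ))) N-eq) (ring (+ j)))) e)
          where
          ring : ∀ j → (+ 8 * j + + 5 - + 5 * (1ℤ * 1ℤ)) + (+ 8 * j + + 5 - + 5 * (1ℤ * 1ℤ)) ≡ + 16 * j
          ring = solve-∀
          absurd : + 16 * +[1+ j₀ ] ≡ 0ℤ → ⊥
          absurd ()
        cancel : C ≢ 0ℤ → C * D ≡ 0ℤ → D ≡ 0ℤ
        cancel n e with ℤₚ.i*j≡0⇒i≡0∨j≡0 C e
        ... | inj₁ z = ⊥-elim (n z)
        ... | inj₂ z = z

  -- AB + BC + CA = 8j + 3 has the solution A = B = 1, C = 4j + 1, so the equinumerous squares cannot be absent.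
  three-odd-squares : ∀ j → Σ ℤ λ x → Σ ℤ λ y → Σ ℤ λ z →
    x * x + y * y + z * z ≡ + 8 * + j + + 3 × par x ≡ true × par y ≡ true × par z ≡ true
  three-odd-squares j = extract (∑-≢0 (cubes B) _ T≢0)
    where
    B = 8 ℕ.* j ℕ.+ 5
    open Eureka B
    n = + 8 * + j + + 3
    c = + 4 * + j + 1ℤ
    witness : (1ℤ , 1ℤ , c) ∈ cubes B
    witness = ∈-cartesianProduct⁺ (one∈O 1≤B) (∈-cartesianProduct⁺ (one∈O 1≤B) (∈-odds⁺ c (cong sg shape) odd-c bound))
      where
      1≤B : 1 ℕ.≤ B
      1≤B = ℕₚ.≤-trans (s≤s z≤n) (ℕₚ.m≤n+m 5 (8 ℕ.* j))
      shape : c ≡ +[1+ 4 ℕ.* j ]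
      shape = trans (cong (_+ 1ℤ) (sym (ℤₚ.pos-* 4 j))) (cong +_ (ℕₚ.+-comm (4 ℕ.* j) 1))
      odd-c : par c ≡ true
      odd-c = trans (par-+ (+ 4 * + j) 1ℤ) (cong (_xor true) (par-* (+ 4) (+ j)))
      bound : ∣ c ∣ ℕ.≤ B
      bound = ℕₚ.≤-trans (ℕₚ.≤-reflexive (cong ∣_∣ shape))
        (ℕₚ.≤-trans (ℕₚ.≤-reflexive (ℕₚ.+-comm 1 (4 ℕ.* j))) (ℕₚ.+-mono-≤ (ℕₚ.*-monoˡ-≤ j (s≤s (s≤s (s≤s (s≤s (z≤n {4})))))) (s≤s (z≤n {4}))))
    guard-nonneg : ∀ {P : Set} (p : Dec P) → 0ℤ ℤ.≤ guard p 1ℤ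
    guard-nonneg (yes _) = ℤ.+≤+ z≤n
    guard-nonneg (no _)  = ℤ.+≤+ z≤n
    F≥1 : 1ℤ ℤ.≤ F n
    F≥1 = ∑-positive (cubes B) _ (λ t → guard-nonneg (products t ℤₚ.≟ n)) witness
      (ℤₚ.≤-reflexive (sym (guard-yes (products (1ℤ , 1ℤ , c) ℤₚ.≟ n) (ring (+ j)))))
      where
      ring : ∀ j → 1ℤ * 1ℤ + 1ℤ * (+ 4 * j + 1ℤ) + (+ 4 * j + 1ℤ) * 1ℤ ≡ + 8 * j + + 3
      ring = solve-∀
    T≡F : T n ≡ F n
    T≡F = trans (ring (T n) (F n)) (trans (cong (_+ F n) (δ-zero j ℕₚ.≤-refl)) (ℤₚ.+-identityˡ (F n)))
      where
      ring : ∀ t f → t ≡ (t - f) + f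
      ring = solve-∀
    T≢0 : T n ≢ 0ℤ
    T≢0 e = bad (subst (1ℤ ℤ.≤_) (trans (sym T≡F) e) F≥1)
      where
      bad : 1ℤ ℤ.≤ 0ℤ → ⊥
      bad (ℤ.+≤+ ())
    extract : (Σ Triple λ t → t ∈ cubes B × guard (squares t ℤₚ.≟ n) 1ℤ ≢ 0ℤ) → _
    extract ((x , y , z) , m , h) = let (p , q , r) = cubes-⁻ m in
      x , y , z , guard-≢0 (squares (x , y , z) ℤₚ.≟ n) h , proj₂ (∈-odds⁻ p) , proj₂ (∈-odds⁻ q) , proj₂ (∈-odds⁻ r)

-- Integers and fractions inside the rationals.

module Rationals where

  open import Data.Rational.Base using (_+_; _*_; -_; _-_; _/_)

  ℚ-ring : ACR.AlmostCommutativeRing 0ℓ 0ℓ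
  ℚ-ring = ACR.fromCommutativeRing ℚₚ.+-*-commutativeRing
    λ x → dec⇒maybe (0ℚ ℚₚ.≟ x)

  toℚᵘ-ℤ→ℚ : ∀ z → toℚᵘ (ℤ→ℚ z) ≃ mkℚᵘ z 0
  toℚᵘ-ℤ→ℚ z = ℚₚ.toℚᵘ-fromℚᵘ (mkℚᵘ z 0)

  ℤ→ℚ-+ : ∀ x y → ℤ→ℚ (x ℤ.+ y) ≡ ℤ→ℚ x + ℤ→ℚ y
  ℤ→ℚ-+ x y = ℚₚ.toℚᵘ-injective (ℚᵘₚ.≃-trans (toℚᵘ-ℤ→ℚ (x ℤ.+ y)) (ℚᵘₚ.≃-trans step
    (ℚᵘₚ.≃-sym (ℚᵘₚ.≃-trans (ℚₚ.toℚᵘ-homo-+ (ℤ→ℚ x) (ℤ→ℚ y)) (ℚᵘₚ.+-cong (toℚᵘ-ℤ→ℚ x) (toℚᵘ-ℤ→ℚ y))))))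
    where
    step : mkℚᵘ (x ℤ.+ y) 0 ≃ mkℚᵘ x 0 ℚᵘ.+ mkℚᵘ y 0
    step = *≡* (cong (ℤ._* + 1) (sym (cong₂ ℤ._+_ (ℤₚ.*-identityʳ x) (ℤₚ.*-identityʳ y))))

  ℤ→ℚ-* : ∀ x y → ℤ→ℚ (x ℤ.* y) ≡ ℤ→ℚ x * ℤ→ℚ y
  ℤ→ℚ-* x y = ℚₚ.toℚᵘ-injective (ℚᵘₚ.≃-trans (toℚᵘ-ℤ→ℚ (x ℤ.* y)) (ℚᵘₚ.≃-trans (*≡* refl)
    (ℚᵘₚ.≃-sym (ℚᵘₚ.≃-trans (ℚₚ.toℚᵘ-homo-* (ℤ→ℚ x) (ℤ→ℚ y)) (ℚᵘₚ.*-cong (toℚᵘ-ℤ→ℚ x) (toℚᵘ-ℤ→ℚ y))))))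

  ℤ→ℚ-injective : ∀ {x y} → ℤ→ℚ x ≡ ℤ→ℚ y → x ≡ y
  ℤ→ℚ-injective {x} {y} e with ℚᵘₚ.≃-trans (ℚᵘₚ.≃-sym (toℚᵘ-ℤ→ℚ x)) (ℚᵘₚ.≃-trans (ℚᵘₚ.≃-reflexive (cong toℚᵘ e)) (toℚᵘ-ℤ→ℚ y))
  ... | *≡* h = trans (sym (ℤₚ.*-identityʳ x)) (trans h (ℤₚ.*-identityʳ y))

  ℤ→ℚ-neg : ∀ x → ℤ→ℚ (ℤ.- x) ≡ - ℤ→ℚ x
  ℤ→ℚ-neg x = trans (ring₁ (ℤ→ℚ (ℤ.- x)) (ℤ→ℚ x)) (trans (cong (_- ℤ→ℚ x) (trans (sym (ℤ→ℚ-+ (ℤ.- x) x)) (cong ℤ→ℚ (ℤₚ.+-inverseˡ x)))) (ring₂ (ℤ→ℚ x)))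
    where
    ring₁ : ∀ a b → a ≡ (a + b) - b
    ring₁ = solve-∀-over ℚ-ring
    ring₂ : ∀ b → 0ℚ - b ≡ - b
    ring₂ = solve-∀-over ℚ-ring

  module _ (k : ℕ) {{_ : ℕ.NonZero k}} where

    /-cancel : ∀ z → ℤ→ℚ (+ k) * (z / k) ≡ ℤ→ℚ z
    /-cancel z = ℚₚ.toℚᵘ-injective (ℚᵘₚ.≃-trans (ℚₚ.toℚᵘ-homo-* (ℤ→ℚ (+ k)) (z / k))
      (ℚᵘₚ.≃-trans (ℚᵘₚ.*-cong (toℚᵘ-ℤ→ℚ (+ k)) (go k)) (ℚᵘₚ.≃-trans (eq k) (ℚᵘₚ.≃-sym (toℚᵘ-ℤ→ℚ z)))))
      where
      go : ∀ k {{_ : ℕ.NonZero k}} → toℚᵘ (z / k) ≃ (z ℚᵘ./ k)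
      go (suc k) = ℚₚ.toℚᵘ-fromℚᵘ (mkℚᵘ z k)
      eq : ∀ k {{_ : ℕ.NonZero k}} → mkℚᵘ (+ k) 0 ℚᵘ.* (z ℚᵘ./ k) ≃ mkℚᵘ z 0
      eq (suc k) = *≡* (trans (ℤₚ.*-identityʳ _) (trans (ℤₚ.*-comm (+ suc k) z) (cong (λ n → z ℤ.* (+ suc n)) (sym (Data.Nat.Properties.+-identityʳ k)))))
        where import Data.Nat.Properties

-- The quadratic field: ring laws, conjugation and norm.

module QuadraticField where

  open import Data.Rational.Base using (_+_; _*_; -_; _-_; _/_)
  open Rationals

  ⌈_⌉ : ℤ → ℚ
  ⌈_⌉ = ℤ→ℚ

  module Algebra (d : ℕ) where
    open Field d

    private
      N = Nm d
      T = Tr d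

    infixl 7 _·_
    _·_ : E → E → E
    _·_ = _*E_

    n : E → ℚ
    n (a , b) = a * a + T * (a * b) + N * (b * b)

    ·-assoc : ∀ x y z → (x · y) · z ≡ x · (y · z)
    ·-assoc (a , b) (c , e) (g , h) = cong₂ _,_ (r₁ N T a b c e g h) (r₂ N T a b c e g h)
      where
      r₁ : ∀ N T a b c e g h → (a * c - N * (b * e)) * g - N * ((a * e + b * c + T * (b * e)) * h)
           ≡ a * (c * g - N * (e * h)) - N * (b * (c * h + e * g + T * (e * h)))
      r₁ = solve-∀-over ℚ-ring
      r₂ : ∀ N T a b c e g h → (a * c - N * (b * e)) * h + (a * e + b * c + T * (b * e)) * g + T * ((a * e + b * c + T * (b * e)) * h)
           ≡ a * (c * h + e * g + T * (e * h)) + b * (c * g - N * (e * h)) + T * (b * (c * h + e * g + T * (e * h)))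
      r₂ = solve-∀-over ℚ-ring

    ·-comm : ∀ x y → x · y ≡ y · x
    ·-comm (a , b) (c , e) = cong₂ _,_ (r₁ N a b c e) (r₂ T a b c e)
      where
      r₁ : ∀ N a b c e → a * c - N * (b * e) ≡ c * a - N * (e * b)
      r₁ = solve-∀-over ℚ-ring
      r₂ : ∀ T a b c e → a * e + b * c + T * (b * e) ≡ c * b + e * a + T * (e * b)
      r₂ = solve-∀-over ℚ-ring

    ·-identityˡ : ∀ x → 1E · x ≡ x
    ·-identityˡ (a , b) = cong₂ _,_ (r₁ N a b) (r₂ T a b)
      where
      r₁ : ∀ N a b → 1ℚ * a - N * (0ℚ * b) ≡ a
      r₁ = solve-∀-over ℚ-ring
      r₂ : ∀ T a b → 1ℚ * b + 0ℚ * a + T * (0ℚ * b) ≡ b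
      r₂ = solve-∀-over ℚ-ring

    ·-distribˡ : ∀ x y z → x · (y +E z) ≡ (x · y) +E (x · z)
    ·-distribˡ (a , b) (c , e) (g , h) = cong₂ _,_ (r₁ N a b c e g h) (r₂ T a b c e g h)
      where
      r₁ : ∀ N a b c e g h → a * (c + g) - N * (b * (e + h)) ≡ (a * c - N * (b * e)) + (a * g - N * (b * h))
      r₁ = solve-∀-over ℚ-ring
      r₂ : ∀ T a b c e g h → a * (e + h) + b * (c + g) + T * (b * (e + h)) ≡ (a * e + b * c + T * (b * e)) + (a * h + b * g + T * (b * h))
      r₂ = solve-∀-over ℚ-ring

    ·-distribʳ : ∀ x y z → (y +E z) · x ≡ (y · x) +E (z · x)
    ·-distribʳ x y z = trans (·-comm (y +E z) x) (trans (·-distribˡ x y z) (cong₂ _+E_ (·-comm x y) (·-comm x z)))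

    ·-zeroʳ : ∀ x → x · 0E ≡ 0E
    ·-zeroʳ (a , b) = cong₂ _,_ (r₁ N a b) (r₂ T a b)
      where
      r₁ : ∀ N a b → a * 0ℚ - N * (b * 0ℚ) ≡ 0ℚ
      r₁ = solve-∀-over ℚ-ring
      r₂ : ∀ T a b → a * 0ℚ + b * 0ℚ + T * (b * 0ℚ) ≡ 0ℚ
      r₂ = solve-∀-over ℚ-ring

    ·-negʳ : ∀ x y → x · (-E y) ≡ -E (x · y)
    ·-negʳ (a , b) (c , e) = cong₂ _,_ (r₁ N a b c e) (r₂ T a b c e)
      where
      r₁ : ∀ N a b c e → a * - c - N * (b * - e) ≡ - (a * c - N * (b * e))
      r₁ = solve-∀-over ℚ-ring
      r₂ : ∀ T a b c e → a * - e + b * - c + T * (b * - e) ≡ - (a * e + b * c + T * (b * e))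
      r₂ = solve-∀-over ℚ-ring

    +E-comm : ∀ x y → x +E y ≡ y +E x
    +E-comm (a , b) (c , e) = cong₂ _,_ (ℚₚ.+-comm a c) (ℚₚ.+-comm b e)

    -E-cancel : ∀ x y → (x -E y) +E y ≡ x
    -E-cancel (a , b) (c , e) = cong₂ _,_ (r a c) (r b e)
      where
      r : ∀ a c → (a + - c) + c ≡ a
      r = solve-∀-over ℚ-ring

    +E-cancel : ∀ x y → (x +E y) -E y ≡ x
    +E-cancel (a , b) (c , e) = cong₂ _,_ (r a c) (r b e)
      where
      r : ∀ a c → (a + c) + - c ≡ a
      r = solve-∀-over ℚ-ring

    -E-self : ∀ x → x -E x ≡ 0E
    -E-self (a , b) = cong₂ _,_ (ℚₚ.+-inverseʳ a) (ℚₚ.+-inverseʳ b)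

    -E-zero : ∀ {x y} → x -E y ≡ 0E → x ≡ y
    -E-zero {x} {y} e = trans (sym (-E-cancel x y)) (trans (cong (_+E y) e) (zeroˡ y))
      where
      zeroˡ : ∀ y → 0E +E y ≡ y
      zeroˡ (a , b) = cong₂ _,_ (ℚₚ.+-identityˡ a) (ℚₚ.+-identityˡ b)

    conj-· : ∀ x y → conj (x · y) ≡ conj x · conj y
    conj-· (a , b) (c , e) = cong₂ _,_ (r₁ N T a b c e) (r₂ N T a b c e)
      where
      r₁ : ∀ N T a b c e → (a * c - N * (b * e)) + T * (a * e + b * c + T * (b * e))
           ≡ (a + T * b) * (c + T * e) - N * (- b * - e)
      r₁ = solve-∀-over ℚ-ring
      r₂ : ∀ N T a b c e → - (a * e + b * c + T * (b * e)) ≡ (a + T * b) * - e + - b * (c + T * e) + T * (- b * - e)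
      r₂ = solve-∀-over ℚ-ring

    x·conj : ∀ x → x · conj x ≡ ι (n x)
    x·conj (a , b) = cong₂ _,_ (r₁ N T a b) (r₂ N T a b)
      where
      r₁ : ∀ N T a b → a * (a + T * b) - N * (b * - b) ≡ a * a + T * (a * b) + N * (b * b)
      r₁ = solve-∀-over ℚ-ring
      r₂ : ∀ N T a b → a * - b + b * (a + T * b) + T * (b * - b) ≡ 0ℚ
      r₂ = solve-∀-over ℚ-ring

    n-· : ∀ x y → n (x · y) ≡ n x * n y
    n-· (a , b) (c , e) = r N T a b c e
      where
      r : ∀ N T a b c e → (a * c - N * (b * e)) * (a * c - N * (b * e)) + T * ((a * c - N * (b * e)) * (a * e + b * c + T * (b * e)))
            + N * ((a * e + b * c + T * (b * e)) * (a * e + b * c + T * (b * e)))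
          ≡ (a * a + T * (a * b) + N * (b * b)) * (c * c + T * (c * e) + N * (e * e))
      r = solve-∀-over ℚ-ring

    n-1 : n 1E ≡ 1ℚ
    n-1 = r N T
      where
      r : ∀ N T → 1ℚ * 1ℚ + T * (1ℚ * 0ℚ) + N * (0ℚ * 0ℚ) ≡ 1ℚ
      r = solve-∀-over ℚ-ring

    ι-· : ∀ p q → ι p · ι q ≡ ι (p * q)
    ι-· p q = cong₂ _,_ (r₁ N p q) (r₂ T p q)
      where
      r₁ : ∀ N p q → p * q - N * (0ℚ * 0ℚ) ≡ p * q
      r₁ = solve-∀-over ℚ-ring
      r₂ : ∀ T p q → p * 0ℚ + 0ℚ * q + T * (0ℚ * 0ℚ) ≡ 0ℚ
      r₂ = solve-∀-over ℚ-ring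

    ι-scale : ∀ p a b → ι p · (a , b) ≡ (p * a , p * b)
    ι-scale p a b = cong₂ _,_ (r₁ N p a b) (r₂ T p a b)
      where
      r₁ : ∀ N p a b → p * a - N * (0ℚ * b) ≡ p * a
      r₁ = solve-∀-over ℚ-ring
      r₂ : ∀ T p a b → p * b + 0ℚ * a + T * (0ℚ * b) ≡ p * b
      r₂ = solve-∀-over ℚ-ring

    interchange : ∀ w x y z → (w · x) · (y · z) ≡ (w · y) · (x · z)
    interchange w x y z = trans (·-assoc w x (y · z)) (trans (cong (w ·_) (trans (sym (·-assoc x y z))
      (trans (cong (_· z) (·-comm x y)) (·-assoc y x z)))) (sym (·-assoc w y (x · z))))

    0·x : ∀ x → 0E · x ≡ 0E
    0·x x = trans (·-comm 0E x) (·-zeroʳ x)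

    -- An element with a chosen inverse, so that ideals can be rescaled without a division on `E`.
    record Unit (α : E) : Set where
      constructor unit
      field
        inv   : E
        right : α · inv ≡ 1E

      left : inv · α ≡ 1E
      left = trans (·-comm inv α) right

      cancel : ∀ x → α · (inv · x) ≡ x
      cancel x = trans (sym (·-assoc α inv x)) (trans (cong (_· x) right) (·-identityˡ x))

      cancel′ : ∀ x → inv · (α · x) ≡ x
      cancel′ x = trans (sym (·-assoc inv α x)) (trans (cong (_· x) left) (·-identityˡ x))

      norms : n α * n inv ≡ 1ℚ
      norms = trans (sym (n-· α inv)) (trans (cong n right) n-1)

    unit-1 : Unit 1E
    unit-1 = unit 1E (·-identityˡ 1E)

    unit-· : ∀ {α β} → Unit α → Unit β → Unit (α · β)
    unit-· {α} {β} (unit α′ p) (unit β′ q) = unit (α′ · β′) (trans (interchange α β α′ β′) (trans (cong₂ _·_ p q) (·-identityˡ 1E)))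

    unit-ι : ∀ p → p ≢ 0ℚ → Unit (ι p)
    unit-ι p nz = unit (ι (ℚ.1/ p)) (trans (ι-· p (ℚ.1/ p)) (cong ι (ℚₚ.*-inverseʳ p)))
      where
      instance
        p≢0 : ℚ.NonZero p
        p≢0 = ℚ.≢-nonZero nz

-- Hermite normal form of finitely generated modules.

module Hermite where

  open import Data.Rational.Base using (_+_; _*_; -_; _-_; _/_)
  open Rationals
  open QuadraticField

  -- The relation is stated for the cofactors `m`, `n` instead of for `p`, `q`. It then survives
  -- `p = q = 0`, where `g = 0` could not be cancelled, and it says that `(m, n)` completes to a
  -- unimodular matrix.
  record Bézout (p q : ℤ) : Set where
    constructor bézout
    field
      g x y m n : ℤ
      p≡  : p ≡ m ℤ.* g
      q≡  : q ≡ n ℤ.* g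
      one : x ℤ.* m ℤ.+ y ℤ.* n ≡ + 1

  bézoutℤ : ∀ p q → Bézout p q
  bézoutℤ p q = go p q (<-wellFounded ℤ.∣ q ∣)
    where
    go : ∀ p q → Acc ℕ._<_ ℤ.∣ q ∣ → Bézout p q
    step : ∀ p q {{_ : ℕ.NonZero ℤ.∣ q ∣}} → ∀ t r → p ≡ r ℤ.+ t ℤ.* q → Bézout q r → Bézout p q
    step p q t r e (bézout g x y m n q≡ r≡ one) = bézout g y (x ℤ.- y ℤ.* t) (n ℤ.+ t ℤ.* m) m
      (trans e (trans (cong₂ (λ r q → r ℤ.+ t ℤ.* q) r≡ q≡) (r₁ n g t m))) q≡ (trans (r₂ x y t m n) one)
      where
      r₁ : ∀ n g t m → n ℤ.* g ℤ.+ t ℤ.* (m ℤ.* g) ≡ (n ℤ.+ t ℤ.* m) ℤ.* g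
      r₁ = solve-∀
      r₂ : ∀ x y t m n → y ℤ.* (n ℤ.+ t ℤ.* m) ℤ.+ (x ℤ.- y ℤ.* t) ℤ.* m ≡ x ℤ.* m ℤ.+ y ℤ.* n
      r₂ = solve-∀
    go p (+ 0) _ = bézout p (+ 1) (+ 0) (+ 1) (+ 0) (sym (ℤₚ.*-identityˡ p)) refl refl
    go p q@(+[1+ _ ]) (acc rec) = step p q (p /ℕ ℤ.∣ q ∣) (+ (p %ℕ ℤ.∣ q ∣)) (ℤD.a≡a%ℕn+[a/ℕn]*n p ℤ.∣ q ∣) (go q (+ (p %ℕ ℤ.∣ q ∣)) (rec (ℤD.n%ℕd<d p ℤ.∣ q ∣)))
    go p q@(-[1+ k ]) (acc rec) = step p q (ℤ.- (p /ℕ ℤ.∣ q ∣)) (+ (p %ℕ ℤ.∣ q ∣))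
      (trans (ℤD.a≡a%ℕn+[a/ℕn]*n p ℤ.∣ q ∣) (cong (ℤ._+_ (+ (p %ℕ suc k))) (r₃ (p /ℕ suc k) +[1+ k ])))
      (go q (+ (p %ℕ ℤ.∣ q ∣)) (rec (ℤD.n%ℕd<d p ℤ.∣ q ∣)))
      where
      r₃ : ∀ a b → a ℤ.* b ≡ (ℤ.- a) ℤ.* (ℤ.- b)
      r₃ = solve-∀

  record Bézoutℚ (p q : ℚ) : Set where
    constructor bézout
    field
      g       : ℚ
      x y m n : ℤ
      p≡  : p ≡ ⌈ m ⌉ * g
      q≡  : q ≡ ⌈ n ⌉ * g
      one : x ℤ.* m ℤ.+ y ℤ.* n ≡ + 1

  clear-denominator : ∀ p → p * ⌈ ℚ.↧ p ⌉ ≡ ⌈ ℚ.↥ p ⌉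
  clear-denominator p@(ℚ.mkℚ a b _) = ℚₚ.toℚᵘ-injective (ℚᵘₚ.≃-trans (ℚₚ.toℚᵘ-homo-* p ⌈ ℚ.↧ p ⌉)
    (ℚᵘₚ.≃-trans (ℚᵘₚ.*-cong (ℚᵘₚ.≃-refl {mkℚᵘ a b}) (toℚᵘ-ℤ→ℚ (+[1+ b ]))) (ℚᵘₚ.≃-trans eq (ℚᵘₚ.≃-sym (toℚᵘ-ℤ→ℚ a)))))
    where
    eq : mkℚᵘ a b ℚᵘ.* mkℚᵘ +[1+ b ] 0 ≃ mkℚᵘ a 0
    eq = *≡* (trans (ℤₚ.*-identityʳ _) (cong (λ n → a ℤ.* + suc n) (sym (ℕₚ.*-identityʳ b))))

  ⌈⌉-nonzero : ∀ {z} → z ≢ + 0 → ⌈ z ⌉ ≢ 0ℚ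
  ⌈⌉-nonzero nz e = nz (ℤ→ℚ-injective e)

  bézoutℚ : ∀ p q → Bézoutℚ p q
  bézoutℚ p q = bézout (⌈ g ⌉ * w) x y m n
    (scale p m P≡ p≡) (scale q n Q≡ q≡) one
    where
    a = ℚ.↧ p
    b = ℚ.↧ q
    open Bézout (bézoutℤ (ℚ.↥ p ℤ.* b) (ℚ.↥ q ℤ.* a))
    D : ℚ
    D = ⌈ a ⌉ * ⌈ b ⌉
    D≢0 : D ≢ 0ℚ
    D≢0 e = nz p q (ℤ→ℚ-injective (trans (ℤ→ℚ-* a b) e))
      where
      nz : ∀ p q → ℚ.↧ p ℤ.* ℚ.↧ q ≢ + 0
      nz (ℚ.mkℚ _ _ _) (ℚ.mkℚ _ _ _) ()
    instance
      nonzero : ℚ.NonZero D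
      nonzero = ℚ.≢-nonZero D≢0
    w : ℚ
    w = ℚ.1/ D
    P≡ : p * D ≡ ⌈ ℚ.↥ p ℤ.* b ⌉
    P≡ = trans (r p ⌈ a ⌉ ⌈ b ⌉) (trans (cong (_* ⌈ b ⌉) (clear-denominator p)) (sym (ℤ→ℚ-* (ℚ.↥ p) b)))
      where
      r : ∀ p a b → p * (a * b) ≡ (p * a) * b
      r = solve-∀-over ℚ-ring
    Q≡ : q * D ≡ ⌈ ℚ.↥ q ℤ.* a ⌉
    Q≡ = trans (r q ⌈ a ⌉ ⌈ b ⌉) (trans (cong (_* ⌈ a ⌉) (clear-denominator q)) (sym (ℤ→ℚ-* (ℚ.↥ q) a)))
      where
      r : ∀ q a b → q * (a * b) ≡ (q * b) * a
      r = solve-∀-over ℚ-ring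
    scale : ∀ p m {z} → p * D ≡ ⌈ z ⌉ → z ≡ m ℤ.* g → p ≡ ⌈ m ⌉ * (⌈ g ⌉ * w)
    scale p m {z} e f = begin
      p                     ≡⟨ ℚₚ.*-identityʳ p ⟨
      p * 1ℚ                ≡⟨ cong (p *_) (ℚₚ.*-inverseʳ D) ⟨
      p * (D * w)           ≡⟨ ℚₚ.*-assoc p D w ⟨
      p * D * w             ≡⟨ cong (_* w) (trans e (trans (cong ⌈_⌉ f) (ℤ→ℚ-* m g))) ⟩
      ⌈ m ⌉ * ⌈ g ⌉ * w     ≡⟨ ℚₚ.*-assoc ⌈ m ⌉ ⌈ g ⌉ w ⟩
      ⌈ m ⌉ * (⌈ g ⌉ * w)   ∎
      where open ≡-Reasoning

  infix 4 _⟺_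
  _⟺_ : Set → Set → Set
  A ⟺ B = (A → B) × (B → A)

  module Lattices (d : ℕ) where
    open Field d
    open Algebra d

    -- The module ℤ(A, 0) + ℤ(B, C). The generators may vanish, so degenerate modules are included
    -- and the zero module can start the induction.
    Span : ℚ → ℚ → ℚ → E → Set
    Span A B C x = Σ ℤ λ p → Σ ℤ λ q → x ≡ (⌈ p ⌉ * A + ⌈ q ⌉ * B , ⌈ q ⌉ * C)

    record Hermite (P : E → Set) : Set where
      constructor hermite
      field
        A B C : ℚ
        to    : ∀ x → P x → Span A B C x
        from  : ∀ x → Span A B C x → P x

    -- Two gcd steps. The first, on the second coordinates `C` and `v`, replaces `(B, C)` and
    -- `(u, v)` by `w₁ = (xB + yu, g)` and `w₂ = (nB - mu, 0)`; the second merges `w₂` with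
    -- `(A, 0)`.
    adjoin : ∀ {P : E → Set} → Hermite P → ∀ v → Hermite (λ x → Σ ℤ λ s → P (x -E (ι ⌈ s ⌉ · v)))
    adjoin-with : ∀ {P : E → Set} A B C (to : ∀ x → P x → Span A B C x) (from : ∀ x → Span A B C x → P x) u v →
      (β : Bézoutℚ C v) → Bézoutℚ A (⌈ Bézoutℚ.n β ⌉ * B - ⌈ Bézoutℚ.m β ⌉ * u) →
      Hermite (λ x → Σ ℤ λ s → P (x -E (ι ⌈ s ⌉ · (u , v))))
    adjoin (hermite A B C to from) (u , v) = adjoin-with A B C to from u v (bézoutℚ C v) (bézoutℚ A _)
    adjoin-with {P} A B C to from u v (bézout g x y m n C≡ v≡ one) (bézout g′ x′ y′ m′ n′ A≡ e≡ one′) = hermite g′ (⌈ x ⌉ * B + ⌈ y ⌉ * u) g to′ from′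
      where
      open ≡-Reasoning
      one₁ : ⌈ x ⌉ * ⌈ m ⌉ + ⌈ y ⌉ * ⌈ n ⌉ ≡ 1ℚ
      one₁ = trans (sym (trans (ℤ→ℚ-+ (x ℤ.* m) (y ℤ.* n)) (cong₂ _+_ (ℤ→ℚ-* x m) (ℤ→ℚ-* y n)))) (cong ⌈_⌉ one)
      one₂ : ⌈ x′ ⌉ * ⌈ m′ ⌉ + ⌈ y′ ⌉ * ⌈ n′ ⌉ ≡ 1ℚ
      one₂ = trans (sym (trans (ℤ→ℚ-+ (x′ ℤ.* m′) (y′ ℤ.* n′)) (cong₂ _+_ (ℤ→ℚ-* x′ m′) (ℤ→ℚ-* y′ n′)))) (cong ⌈_⌉ one′)
      split : ∀ z s → z ≡ (z -E (ι ⌈ s ⌉ · (u , v))) +E (⌈ s ⌉ * u , ⌈ s ⌉ * v)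
      split z s = sym (trans (cong ((z -E (ι ⌈ s ⌉ · (u , v))) +E_) (sym (ι-scale ⌈ s ⌉ u v))) (-E-cancel z (ι ⌈ s ⌉ · (u , v))))
      hom₂ : ∀ a b c d → ⌈ a ℤ.* b ℤ.+ c ℤ.* d ⌉ ≡ ⌈ a ⌉ * ⌈ b ⌉ + ⌈ c ⌉ * ⌈ d ⌉
      hom₂ a b c d = trans (ℤ→ℚ-+ (a ℤ.* b) (c ℤ.* d)) (cong₂ _+_ (ℤ→ℚ-* a b) (ℤ→ℚ-* c d))
      hom₃ : ∀ a b c d → ⌈ a ℤ.* b ℤ.- c ℤ.* d ⌉ ≡ ⌈ a ⌉ * ⌈ b ⌉ - ⌈ c ⌉ * ⌈ d ⌉
      hom₃ a b c d = trans (ℤ→ℚ-+ (a ℤ.* b) (ℤ.- (c ℤ.* d))) (cong₂ _+_ (ℤ→ℚ-* a b) (trans (ℤ→ℚ-neg (c ℤ.* d)) (cong -_ (ℤ→ℚ-* c d))))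
      to′ : ∀ z → (Σ ℤ λ s → P (z -E (ι ⌈ s ⌉ · (u , v)))) → Span g′ (⌈ x ⌉ * B + ⌈ y ⌉ * u) g z
      to′ z (s , p) = go (to _ p)
        where
        go : Span A B C (z -E (ι ⌈ s ⌉ · (u , v))) → Span g′ (⌈ x ⌉ * B + ⌈ y ⌉ * u) g z
        go (p₁ , q₁ , e) = p₁ ℤ.* m′ ℤ.+ (q₁ ℤ.* y ℤ.- s ℤ.* x) ℤ.* n′ , q₁ ℤ.* m ℤ.+ s ℤ.* n ,
          trans (trans (split z s) (cong (_+E (⌈ s ⌉ * u , ⌈ s ⌉ * v)) e)) (cong₂ _,_ first second)
          where
          second : ⌈ q₁ ⌉ * C + ⌈ s ⌉ * v ≡ ⌈ q₁ ℤ.* m ℤ.+ s ℤ.* n ⌉ * g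
          second = trans (cong₂ (λ c v → ⌈ q₁ ⌉ * c + ⌈ s ⌉ * v) C≡ v≡) (trans (r ⌈ q₁ ⌉ ⌈ s ⌉ ⌈ m ⌉ ⌈ n ⌉ g) (cong (_* g) (sym (hom₂ q₁ m s n))))
            where
            r : ∀ q s m n g → q * (m * g) + s * (n * g) ≡ (q * m + s * n) * g
            r = solve-∀-over ℚ-ring
          -- B = m w₁ + y w₂ and u = n w₁ - x w₂ in terms of the new generators.
          first : ⌈ p₁ ⌉ * A + ⌈ q₁ ⌉ * B + ⌈ s ⌉ * u ≡
                  ⌈ p₁ ℤ.* m′ ℤ.+ (q₁ ℤ.* y ℤ.- s ℤ.* x) ℤ.* n′ ⌉ * g′ + ⌈ q₁ ℤ.* m ℤ.+ s ℤ.* n ⌉ * (⌈ x ⌉ * B + ⌈ y ⌉ * u)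
          first = begin
            ⌈ p₁ ⌉ * A + ⌈ q₁ ⌉ * B + ⌈ s ⌉ * u
              ≡⟨ r₁ (⌈ p₁ ⌉ * A) ⌈ q₁ ⌉ ⌈ s ⌉ B u ⟩
            ⌈ p₁ ⌉ * A + 1ℚ * (⌈ q₁ ⌉ * B + ⌈ s ⌉ * u)
              ≡⟨ cong (λ t → ⌈ p₁ ⌉ * A + t * (⌈ q₁ ⌉ * B + ⌈ s ⌉ * u)) (sym one₁) ⟩
            ⌈ p₁ ⌉ * A + (⌈ x ⌉ * ⌈ m ⌉ + ⌈ y ⌉ * ⌈ n ⌉) * (⌈ q₁ ⌉ * B + ⌈ s ⌉ * u)
              ≡⟨ r₂ (⌈ p₁ ⌉ * A) ⌈ q₁ ⌉ ⌈ s ⌉ B u ⌈ x ⌉ ⌈ y ⌉ ⌈ m ⌉ ⌈ n ⌉ ⟩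
            ⌈ p₁ ⌉ * A + (⌈ q₁ ⌉ * ⌈ y ⌉ - ⌈ s ⌉ * ⌈ x ⌉) * (⌈ n ⌉ * B - ⌈ m ⌉ * u) + (⌈ q₁ ⌉ * ⌈ m ⌉ + ⌈ s ⌉ * ⌈ n ⌉) * (⌈ x ⌉ * B + ⌈ y ⌉ * u)
              ≡⟨ cong₂ (λ a e → ⌈ p₁ ⌉ * a + (⌈ q₁ ⌉ * ⌈ y ⌉ - ⌈ s ⌉ * ⌈ x ⌉) * e + (⌈ q₁ ⌉ * ⌈ m ⌉ + ⌈ s ⌉ * ⌈ n ⌉) * (⌈ x ⌉ * B + ⌈ y ⌉ * u)) A≡ e≡ ⟩
            ⌈ p₁ ⌉ * (⌈ m′ ⌉ * g′) + (⌈ q₁ ⌉ * ⌈ y ⌉ - ⌈ s ⌉ * ⌈ x ⌉) * (⌈ n′ ⌉ * g′) + (⌈ q₁ ⌉ * ⌈ m ⌉ + ⌈ s ⌉ * ⌈ n ⌉) * (⌈ x ⌉ * B + ⌈ y ⌉ * u)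
              ≡⟨ cong₂ _+_ (r₃ ⌈ p₁ ⌉ ⌈ m′ ⌉ g′ (⌈ q₁ ⌉ * ⌈ y ⌉ - ⌈ s ⌉ * ⌈ x ⌉) ⌈ n′ ⌉) (cong (_* (⌈ x ⌉ * B + ⌈ y ⌉ * u)) (sym (hom₂ q₁ m s n))) ⟩
            (⌈ p₁ ⌉ * ⌈ m′ ⌉ + (⌈ q₁ ⌉ * ⌈ y ⌉ - ⌈ s ⌉ * ⌈ x ⌉) * ⌈ n′ ⌉) * g′ + ⌈ q₁ ℤ.* m ℤ.+ s ℤ.* n ⌉ * (⌈ x ⌉ * B + ⌈ y ⌉ * u)
              ≡⟨ cong (λ t → t * g′ + ⌈ q₁ ℤ.* m ℤ.+ s ℤ.* n ⌉ * (⌈ x ⌉ * B + ⌈ y ⌉ * u))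
                   (sym (trans (hom₂ p₁ m′ (q₁ ℤ.* y ℤ.- s ℤ.* x) n′) (cong (λ t → ⌈ p₁ ⌉ * ⌈ m′ ⌉ + t * ⌈ n′ ⌉) (hom₃ q₁ y s x)))) ⟩
            ⌈ p₁ ℤ.* m′ ℤ.+ (q₁ ℤ.* y ℤ.- s ℤ.* x) ℤ.* n′ ⌉ * g′ + ⌈ q₁ ℤ.* m ℤ.+ s ℤ.* n ⌉ * (⌈ x ⌉ * B + ⌈ y ⌉ * u) ∎
            where
            r₁ : ∀ a q s B u → a + q * B + s * u ≡ a + 1ℚ * (q * B + s * u)
            r₁ = solve-∀-over ℚ-ring
            r₂ : ∀ a q s B u x y m n → a + (x * m + y * n) * (q * B + s * u)
                 ≡ a + (q * y - s * x) * (n * B - m * u) + (q * m + s * n) * (x * B + y * u)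
            r₂ = solve-∀-over ℚ-ring
            r₃ : ∀ p m g t n → p * (m * g) + t * (n * g) ≡ (p * m + t * n) * g
            r₃ = solve-∀-over ℚ-ring
      from′ : ∀ z → Span g′ (⌈ x ⌉ * B + ⌈ y ⌉ * u) g z → Σ ℤ λ s → P (z -E (ι ⌈ s ⌉ · (u , v)))
      from′ z (p , q , e) = s , from _ (p ℤ.* x′ , p ℤ.* y′ ℤ.* n ℤ.+ q ℤ.* x ,
          trans (cong₂ _-E_ e (ι-scale ⌈ s ⌉ u v)) (cong₂ _,_ first second))
        where
        s = q ℤ.* y ℤ.- p ℤ.* y′ ℤ.* m
        s≡ : ⌈ s ⌉ ≡ ⌈ q ⌉ * ⌈ y ⌉ - ⌈ p ⌉ * ⌈ y′ ⌉ * ⌈ m ⌉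
        s≡ = trans (hom₃ q y (p ℤ.* y′) m) (cong (λ t → ⌈ q ⌉ * ⌈ y ⌉ - t * ⌈ m ⌉) (ℤ→ℚ-* p y′))
        t≡ : ⌈ p ℤ.* y′ ℤ.* n ℤ.+ q ℤ.* x ⌉ ≡ ⌈ p ⌉ * ⌈ y′ ⌉ * ⌈ n ⌉ + ⌈ q ⌉ * ⌈ x ⌉
        t≡ = trans (hom₂ (p ℤ.* y′) n q x) (cong (λ t → t * ⌈ n ⌉ + ⌈ q ⌉ * ⌈ x ⌉) (ℤ→ℚ-* p y′))
        -- g′ = x′ A + y′ (n B - m u), so the new generators are integral combinations of the old ones.
        first : ⌈ p ⌉ * g′ + ⌈ q ⌉ * (⌈ x ⌉ * B + ⌈ y ⌉ * u) + - (⌈ s ⌉ * u) ≡ ⌈ p ℤ.* x′ ⌉ * A + ⌈ p ℤ.* y′ ℤ.* n ℤ.+ q ℤ.* x ⌉ * B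
        first = begin
          ⌈ p ⌉ * g′ + ⌈ q ⌉ * (⌈ x ⌉ * B + ⌈ y ⌉ * u) + - (⌈ s ⌉ * u)
            ≡⟨ cong₂ (λ G S → ⌈ p ⌉ * G + ⌈ q ⌉ * (⌈ x ⌉ * B + ⌈ y ⌉ * u) + - (S * u)) (trans (sym (ℚₚ.*-identityˡ g′)) (cong (_* g′) (sym one₂))) s≡ ⟩
          ⌈ p ⌉ * ((⌈ x′ ⌉ * ⌈ m′ ⌉ + ⌈ y′ ⌉ * ⌈ n′ ⌉) * g′) + ⌈ q ⌉ * (⌈ x ⌉ * B + ⌈ y ⌉ * u) + - ((⌈ q ⌉ * ⌈ y ⌉ - ⌈ p ⌉ * ⌈ y′ ⌉ * ⌈ m ⌉) * u)
            ≡⟨ r₁ ⌈ p ⌉ ⌈ q ⌉ ⌈ x ⌉ ⌈ y ⌉ ⌈ x′ ⌉ ⌈ y′ ⌉ ⌈ m ⌉ ⌈ m′ ⌉ ⌈ n′ ⌉ g′ B u ⟩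
          ⌈ p ⌉ * ⌈ x′ ⌉ * (⌈ m′ ⌉ * g′) + ⌈ p ⌉ * ⌈ y′ ⌉ * (⌈ n′ ⌉ * g′) + ⌈ q ⌉ * ⌈ x ⌉ * B + ⌈ p ⌉ * ⌈ y′ ⌉ * ⌈ m ⌉ * u
            ≡⟨ cong₂ (λ a e → ⌈ p ⌉ * ⌈ x′ ⌉ * a + ⌈ p ⌉ * ⌈ y′ ⌉ * e + ⌈ q ⌉ * ⌈ x ⌉ * B + ⌈ p ⌉ * ⌈ y′ ⌉ * ⌈ m ⌉ * u) (sym A≡) (sym e≡) ⟩
          ⌈ p ⌉ * ⌈ x′ ⌉ * A + ⌈ p ⌉ * ⌈ y′ ⌉ * (⌈ n ⌉ * B - ⌈ m ⌉ * u) + ⌈ q ⌉ * ⌈ x ⌉ * B + ⌈ p ⌉ * ⌈ y′ ⌉ * ⌈ m ⌉ * u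
            ≡⟨ r₂ ⌈ p ⌉ ⌈ q ⌉ ⌈ x ⌉ ⌈ x′ ⌉ ⌈ y′ ⌉ ⌈ m ⌉ ⌈ n ⌉ A B u ⟩
          ⌈ p ⌉ * ⌈ x′ ⌉ * A + (⌈ p ⌉ * ⌈ y′ ⌉ * ⌈ n ⌉ + ⌈ q ⌉ * ⌈ x ⌉) * B
            ≡⟨ cong₂ (λ a b → a * A + b * B) (sym (ℤ→ℚ-* p x′)) (sym t≡) ⟩
          ⌈ p ℤ.* x′ ⌉ * A + ⌈ p ℤ.* y′ ℤ.* n ℤ.+ q ℤ.* x ⌉ * B ∎
          where
          r₁ : ∀ p q x y x′ y′ m m′ n′ g B u → p * ((x′ * m′ + y′ * n′) * g) + q * (x * B + y * u) + - ((q * y - p * y′ * m) * u)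
               ≡ p * x′ * (m′ * g) + p * y′ * (n′ * g) + q * x * B + p * y′ * m * u
          r₁ = solve-∀-over ℚ-ring
          r₂ : ∀ p q x x′ y′ m n A B u → p * x′ * A + p * y′ * (n * B - m * u) + q * x * B + p * y′ * m * u
               ≡ p * x′ * A + (p * y′ * n + q * x) * B
          r₂ = solve-∀-over ℚ-ring
        second : ⌈ q ⌉ * g + - (⌈ s ⌉ * v) ≡ ⌈ p ℤ.* y′ ℤ.* n ℤ.+ q ℤ.* x ⌉ * C
        second = begin
          ⌈ q ⌉ * g + - (⌈ s ⌉ * v)
            ≡⟨ cong₂ (λ G S → ⌈ q ⌉ * G + - S) (trans (sym (ℚₚ.*-identityˡ g)) (cong (_* g) (sym one₁))) (cong₂ _*_ s≡ v≡) ⟩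
          ⌈ q ⌉ * ((⌈ x ⌉ * ⌈ m ⌉ + ⌈ y ⌉ * ⌈ n ⌉) * g) + - ((⌈ q ⌉ * ⌈ y ⌉ - ⌈ p ⌉ * ⌈ y′ ⌉ * ⌈ m ⌉) * (⌈ n ⌉ * g))
            ≡⟨ r ⌈ p ⌉ ⌈ q ⌉ ⌈ x ⌉ ⌈ y ⌉ ⌈ y′ ⌉ ⌈ m ⌉ ⌈ n ⌉ g ⟩
          (⌈ p ⌉ * ⌈ y′ ⌉ * ⌈ n ⌉ + ⌈ q ⌉ * ⌈ x ⌉) * (⌈ m ⌉ * g)
            ≡⟨ cong₂ _*_ (sym t≡) (sym C≡) ⟩
          ⌈ p ℤ.* y′ ℤ.* n ℤ.+ q ℤ.* x ⌉ * C ∎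
          where
          r : ∀ p q x y y′ m n g → q * ((x * m + y * n) * g) + - ((q * y - p * y′ * m) * (n * g)) ≡ (p * y′ * n + q * x) * (m * g)
          r = solve-∀-over ℚ-ring

    -- As an abelian group `𝒪g` is generated by `g` and `ωg`, so each generator of the ideal costs
    -- two adjunctions.
    ideal-hermite : ∀ gs → Hermite (InIdeal gs)
    ideal-hermite [] = hermite 0ℚ 0ℚ 0ℚ
      (λ x e → + 0 , + 0 , trans e (cong₂ _,_ refl refl))
      (λ x (p , q , e) → trans e (cong₂ _,_ (r ⌈ p ⌉ ⌈ q ⌉) (ℚₚ.*-zeroʳ ⌈ q ⌉)))
      where
      r : ∀ p q → p * 0ℚ + q * 0ℚ ≡ 0ℚ
      r = solve-∀-over ℚ-ring
    ideal-hermite (g ∷ gs) = go (adjoin (adjoin (ideal-hermite gs) g) (ω · g))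
      where
      go : Hermite (λ x → Σ ℤ λ s → Σ ℤ λ t → InIdeal gs ((x -E (ι ⌈ s ⌉ · (ω · g))) -E (ι ⌈ t ⌉ · g))) → Hermite (InIdeal (g ∷ gs))
      go (hermite A B C to from) = hermite A B C
        (λ x ((c₁ , c₂) , ((p , p≡) , (q , q≡)) , h) → to x (q , p , subst (InIdeal gs) (trans (cong (λ c → x -E (c · g)) (cong₂ _,_ p≡ q≡)) (rearrange x p q)) h))
        (λ x s → let (q , p , h) = from x s in (⌈ p ⌉ , ⌈ q ⌉) , ((p , refl) , (q , refl)) , subst (InIdeal gs) (sym (rearrange x p q)) h)
        where
        rearrange : ∀ x p q → x -E ((⌈ p ⌉ , ⌈ q ⌉) · g) ≡ (x -E (ι ⌈ q ⌉ · (ω · g))) -E (ι ⌈ p ⌉ · g)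
        rearrange (x₁ , x₂) p q = trans (cong (λ t → (x₁ , x₂) -E t) (trans (cong (_· g) decompose) (trans (·-distribʳ g (ι ⌈ p ⌉) (ι ⌈ q ⌉ · ω)) (cong ((ι ⌈ p ⌉ · g) +E_) (·-assoc (ι ⌈ q ⌉) ω g)))))
            (regroup (x₁ , x₂) (ι ⌈ p ⌉ · g) (ι ⌈ q ⌉ · (ω · g)))
          where
          decompose : (⌈ p ⌉ , ⌈ q ⌉) ≡ ι ⌈ p ⌉ +E (ι ⌈ q ⌉ · ω)
          decompose = trans (cong₂ _,_ (r₁ ⌈ p ⌉ ⌈ q ⌉) (r₂ ⌈ q ⌉)) (cong (ι ⌈ p ⌉ +E_) (sym (ι-scale ⌈ q ⌉ 0ℚ 1ℚ)))
            where
            r₁ : ∀ p q → p ≡ p + q * 0ℚ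
            r₁ = solve-∀-over ℚ-ring
            r₂ : ∀ q → q ≡ 0ℚ + q * 1ℚ
            r₂ = solve-∀-over ℚ-ring
          regroup : ∀ x y z → x -E (y +E z) ≡ (x -E z) -E y
          regroup (a , b) (c , e) (g , h) = cong₂ _,_ (r a c g) (r b e h)
            where
            r : ∀ a c g → a + - (c + g) ≡ (a + - g) + - c
            r = solve-∀-over ℚ-ring

-- Multiples of the ideals ℤa + ℤ(b + ω).

module Multiples where

  open import Data.Rational.Base using (_+_; _*_; -_; _-_; _/_)
  open Rationals
  open QuadraticField
  open Hermite

  module Reduction (d N : ℕ) (Tr≡1 : Tr d ≡ 1ℚ) (Nm≡N : Nm d ≡ ℤ→ℚ (+ N)) (4N : 4 ℕ.* N ≡ suc d) where
    open Field d
    open Algebra d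
    open Lattices d

    ⟪_,_⟫ : ℤ → ℤ → E
    ⟪ p , q ⟫ = ⌈ p ⌉ , ⌈ q ⌉

    𝒪-int : ∀ {x} → Is𝒪 x → Σ ℤ λ p → Σ ℤ λ q → x ≡ ⟪ p , q ⟫
    𝒪-int ((p , e) , (q , f)) = p , q , cong₂ _,_ e f

    int-𝒪 : ∀ {x} p q → x ≡ ⟪ p , q ⟫ → Is𝒪 x
    int-𝒪 p q refl = (p , refl) , (q , refl)

    ⟪⟫-injective : ∀ {p q p′ q′} → ⟪ p , q ⟫ ≡ ⟪ p′ , q′ ⟫ → p ≡ p′ × q ≡ q′
    ⟪⟫-injective e = ℤ→ℚ-injective (cong proj₁ e) , ℤ→ℚ-injective (cong proj₂ e)

    ⌈⌉-poly₁ : ∀ n a b c e → ⌈ a ℤ.* c ℤ.- n ℤ.* (b ℤ.* e) ⌉ ≡ ⌈ a ⌉ * ⌈ c ⌉ - ⌈ n ⌉ * (⌈ b ⌉ * ⌈ e ⌉)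
    ⌈⌉-poly₁ n a b c e = trans (ℤ→ℚ-+ (a ℤ.* c) (ℤ.- (n ℤ.* (b ℤ.* e)))) (cong₂ _+_ (ℤ→ℚ-* a c)
      (trans (ℤ→ℚ-neg (n ℤ.* (b ℤ.* e))) (cong -_ (trans (ℤ→ℚ-* n (b ℤ.* e)) (cong (⌈ n ⌉ *_) (ℤ→ℚ-* b e))))))

    ⌈⌉-poly₂ : ∀ a b c e → ⌈ a ℤ.* e ℤ.+ b ℤ.* c ℤ.+ b ℤ.* e ⌉ ≡ ⌈ a ⌉ * ⌈ e ⌉ + ⌈ b ⌉ * ⌈ c ⌉ + ⌈ b ⌉ * ⌈ e ⌉
    ⌈⌉-poly₂ a b c e = trans (ℤ→ℚ-+ (a ℤ.* e ℤ.+ b ℤ.* c) (b ℤ.* e)) (cong₂ _+_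
      (trans (ℤ→ℚ-+ (a ℤ.* e) (b ℤ.* c)) (cong₂ _+_ (ℤ→ℚ-* a e) (ℤ→ℚ-* b c))) (ℤ→ℚ-* b e))

    ⟪⟫-· : ∀ a b c e → ⟪ a , b ⟫ · ⟪ c , e ⟫ ≡ ⟪ a ℤ.* c ℤ.- + N ℤ.* (b ℤ.* e) , a ℤ.* e ℤ.+ b ℤ.* c ℤ.+ b ℤ.* e ⟫
    ⟪⟫-· a b c e = cong₂ _,_
      (trans (cong (λ t → ⌈ a ⌉ * ⌈ c ⌉ - t * (⌈ b ⌉ * ⌈ e ⌉)) Nm≡N) (sym (⌈⌉-poly₁ (+ N) a b c e)))
      (trans (cong (λ t → ⌈ a ⌉ * ⌈ e ⌉ + ⌈ b ⌉ * ⌈ c ⌉ + t) (trans (cong (_* (⌈ b ⌉ * ⌈ e ⌉)) Tr≡1) (ℚₚ.*-identityˡ _))) (sym (⌈⌉-poly₂ a b c e)))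

    ⟪⟫-+ : ∀ a b c e → ⟪ a , b ⟫ +E ⟪ c , e ⟫ ≡ ⟪ a ℤ.+ c , b ℤ.+ e ⟫
    ⟪⟫-+ a b c e = sym (cong₂ _,_ (ℤ→ℚ-+ a c) (ℤ→ℚ-+ b e))

    ⟪⟫-conj : ∀ a b → conj ⟪ a , b ⟫ ≡ ⟪ a ℤ.+ b , ℤ.- b ⟫
    ⟪⟫-conj a b = cong₂ _,_ (trans (cong (λ t → ⌈ a ⌉ + t * ⌈ b ⌉) Tr≡1) (trans (cong (_+_ ⌈ a ⌉) (ℚₚ.*-identityˡ ⌈ b ⌉)) (sym (ℤ→ℚ-+ a b)))) (sym (ℤ→ℚ-neg b))

    nℤ : ℤ → ℤ → ℤ
    nℤ a b = a ℤ.* a ℤ.+ a ℤ.* b ℤ.+ + N ℤ.* (b ℤ.* b)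

    n-int : ∀ a b → n ⟪ a , b ⟫ ≡ ⌈ nℤ a b ⌉
    n-int a b = trans (cong₂ (λ t m → ⌈ a ⌉ * ⌈ a ⌉ + t * (⌈ a ⌉ * ⌈ b ⌉) + m * (⌈ b ⌉ * ⌈ b ⌉)) Tr≡1 Nm≡N)
      (trans (cong₂ (λ s t → ⌈ a ⌉ * ⌈ a ⌉ + s + t) (trans (ℚₚ.*-identityˡ _) (sym (ℤ→ℚ-* a b))) (trans (cong (_*_ ⌈ + N ⌉) (sym (ℤ→ℚ-* b b))) (sym (ℤ→ℚ-* (+ N) (b ℤ.* b)))))
      (trans (cong (λ s → s + ⌈ a ℤ.* b ⌉ + ⌈ + N ℤ.* (b ℤ.* b) ⌉) (sym (ℤ→ℚ-* a a)))
      (trans (cong (_+ ⌈ + N ℤ.* (b ℤ.* b) ⌉) (sym (ℤ→ℚ-+ (a ℤ.* a) (a ℤ.* b)))) (sym (ℤ→ℚ-+ (a ℤ.* a ℤ.+ a ℤ.* b) (+ N ℤ.* (b ℤ.* b)))))))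

    4n : ∀ a b → + 4 ℤ.* nℤ a b ≡ (+ 2 ℤ.* a ℤ.+ b) ℤ.* (+ 2 ℤ.* a ℤ.+ b) ℤ.+ + d ℤ.* (b ℤ.* b)
    4n a b = trans (r₁ a b (+ N)) (trans (cong (λ t → + 4 ℤ.* (a ℤ.* a ℤ.+ a ℤ.* b) ℤ.+ t ℤ.* (b ℤ.* b)) (trans (sym (ℤₚ.pos-* 4 N)) (cong +_ 4N))) (r₂ a b (+ d)))
      where
      r₁ : ∀ a b N → + 4 ℤ.* (a ℤ.* a ℤ.+ a ℤ.* b ℤ.+ N ℤ.* (b ℤ.* b)) ≡ + 4 ℤ.* (a ℤ.* a ℤ.+ a ℤ.* b) ℤ.+ (+ 4 ℤ.* N) ℤ.* (b ℤ.* b)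
      r₁ = solve-∀
      r₂ : ∀ a b d → + 4 ℤ.* (a ℤ.* a ℤ.+ a ℤ.* b) ℤ.+ (+ 1 ℤ.+ d) ℤ.* (b ℤ.* b) ≡ (+ 2 ℤ.* a ℤ.+ b) ℤ.* (+ 2 ℤ.* a ℤ.+ b) ℤ.+ d ℤ.* (b ℤ.* b)
      r₂ = solve-∀

    -- The ideal ℤa + ℤ(b + ω).
    J : ℤ → ℤ → E → Set
    J a b x = Σ ℤ λ p → Σ ℤ λ q → x ≡ ⟪ p ℤ.* a ℤ.+ q ℤ.* b , q ⟫

    -- `b² + b + N` is the norm of `b + ω`. Its divisibility by `a` makes `J a b` stable under `𝒪`,
    -- and the form `(a, 2b + 1, c)` then has discriminant `-d`.
    Discriminant : ℤ → ℤ → ℤ → Set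
    Discriminant a b c = a ℤ.* c ≡ b ℤ.* b ℤ.+ b ℤ.+ + N

    -- P is the ideal α · J a b.
    record Multiple (P : E → Set) (a b : ℤ) : Set where
      constructor multiple
      field
        {α}  : E
        α⁻¹  : Unit α
        to   : ∀ x → P x → J a b (Unit.inv α⁻¹ · x)
        from : ∀ x → J a b (Unit.inv α⁻¹ · x) → P x

    translate : ∀ {P : E → Set} a b m → Multiple P a b → Multiple P a (b ℤ.+ m ℤ.* a)
    translate a b m (multiple u to from) = multiple u
      (λ x h → let (p , q , e) = to x h in p ℤ.- q ℤ.* m , q , trans e (cong (λ t → ⟪ t , q ⟫) (r₁ p q a b m)))
      (λ x (p , q , e) → from x (p ℤ.+ q ℤ.* m , q , trans e (cong (λ t → ⟪ t , q ⟫) (r₂ p q a b m))))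
      where
      r₁ : ∀ p q a b m → p ℤ.* a ℤ.+ q ℤ.* b ≡ (p ℤ.- q ℤ.* m) ℤ.* a ℤ.+ q ℤ.* (b ℤ.+ m ℤ.* a)
      r₁ = solve-∀
      r₂ : ∀ p q a b m → p ℤ.* a ℤ.+ q ℤ.* (b ℤ.+ m ℤ.* a) ≡ (p ℤ.+ q ℤ.* m) ℤ.* a ℤ.+ q ℤ.* b
      r₂ = solve-∀

    negate : ∀ {P : E → Set} a b → Multiple P a b → Multiple P (ℤ.- a) b
    negate a b (multiple u to from) = multiple u
      (λ x h → let (p , q , e) = to x h in ℤ.- p , q , trans e (cong (λ t → ⟪ t , q ⟫) (r p q a b)))
      (λ x (p , q , e) → from x (ℤ.- p , q , trans e (cong (λ t → ⟪ t , q ⟫) (r′ p q a b))))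
      where
      r : ∀ p q a b → p ℤ.* a ℤ.+ q ℤ.* b ≡ (ℤ.- p) ℤ.* (ℤ.- a) ℤ.+ q ℤ.* b
      r = solve-∀
      r′ : ∀ p q a b → p ℤ.* (ℤ.- a) ℤ.+ q ℤ.* b ≡ (ℤ.- p) ℤ.* a ℤ.+ q ℤ.* b
      r′ = solve-∀

    -- With γ = conj (b + ω) / a one has γ a = conj (b + ω) and γ (b + ω) = c, so γ · J a b = J c (-1 - b).
    invert : ∀ {P : E → Set} a b c → a ≢ + 0 → c ≢ + 0 → Discriminant a b c → Multiple P a b → Multiple P c (ℤ.- (+ 1 ℤ.+ b))
    invert {P} a b c a≢0 c≢0 D (multiple {α} u to from) = multiple (unit-· u δ)
      (λ x h → let (p , q , e) = to x h in q , ℤ.- p , trans (·-assoc′ x) (trans (cong (Unit.inv δ ·_) e) (forward p q)))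
      (λ x (p , q , e) → from x (ℤ.- q , p , trans (sym (Unit.cancel δ (Unit.inv u · x))) (trans (cong ((ι (ℚ.1/ C) · β) ·_) (trans (sym (·-assoc′ x)) e)) (backward p q))))
      where
      A C : ℚ
      A = ⌈ a ⌉
      C = ⌈ c ⌉
      instance
        nzA : ℚ.NonZero A
        nzA = ℚ.≢-nonZero (⌈⌉-nonzero a≢0)
        nzC : ℚ.NonZero C
        nzC = ℚ.≢-nonZero (⌈⌉-nonzero c≢0)
      β β̄ : E
      β = ⟪ b , + 1 ⟫
      β̄ = ⟪ b ℤ.+ + 1 , ℤ.- (+ 1) ⟫
      ββ̄ : β̄ · β ≡ ι (A * C)
      ββ̄ = trans (⟪⟫-· (b ℤ.+ + 1) (ℤ.- (+ 1)) b (+ 1)) (trans (cong₂ ⟪_,_⟫ (trans (r₁ b (+ N)) (sym D)) (r₂ b)) (cong (_, 0ℚ) (ℤ→ℚ-* a c)))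
        where
        r₁ : ∀ b N → (b ℤ.+ + 1) ℤ.* b ℤ.- N ℤ.* ((ℤ.- (+ 1)) ℤ.* + 1) ≡ b ℤ.* b ℤ.+ b ℤ.+ N
        r₁ = solve-∀
        r₂ : ∀ b → (b ℤ.+ + 1) ℤ.* + 1 ℤ.+ (ℤ.- (+ 1)) ℤ.* b ℤ.+ (ℤ.- (+ 1)) ℤ.* + 1 ≡ + 0
        r₂ = solve-∀
      δ : Unit (ι (ℚ.1/ C) · β)
      -- This is `γ⁻¹ = (b + ω) / c`; it is inverse to `γ` because `b + ω` times its conjugate is
      -- `ac`.
      δ = unit (ι (ℚ.1/ A) · β̄) (trans (interchange (ι (ℚ.1/ C)) β (ι (ℚ.1/ A)) β̄) (trans (cong₂ _·_ (ι-· (ℚ.1/ C) (ℚ.1/ A)) (trans (·-comm β β̄) ββ̄))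
        (trans (ι-· (ℚ.1/ C * ℚ.1/ A) (A * C)) (cong ι (trans (r (ℚ.1/ C) (ℚ.1/ A) A C) (trans (cong₂ _*_ (ℚₚ.*-inverseʳ A) (ℚₚ.*-inverseʳ C)) refl))))))
        where
        r : ∀ c′ a′ a c → (c′ * a′) * (a * c) ≡ (a * a′) * (c * c′)
        r = solve-∀-over ℚ-ring
      ·-assoc′ : ∀ x → (Unit.inv u · Unit.inv δ) · x ≡ Unit.inv δ · (Unit.inv u · x)
      ·-assoc′ x = trans (cong (_· x) (·-comm (Unit.inv u) (Unit.inv δ))) (·-assoc (Unit.inv δ) (Unit.inv u) x)
      forward : ∀ p q → (ι (ℚ.1/ A) · β̄) · ⟪ p ℤ.* a ℤ.+ q ℤ.* b , q ⟫ ≡ ⟪ q ℤ.* c ℤ.+ (ℤ.- p) ℤ.* (ℤ.- (+ 1 ℤ.+ b)) , ℤ.- p ⟫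
      forward p q = trans (·-assoc (ι (ℚ.1/ A)) β̄ _) (trans (cong (ι (ℚ.1/ A) ·_) product) (trans (sym (·-assoc (ι (ℚ.1/ A)) (ι A) z)) (trans (cong (_· z) (trans (ι-· (ℚ.1/ A) A) (cong ι (ℚₚ.*-inverseˡ A)))) (·-identityˡ z))))
        where
        z = ⟪ q ℤ.* c ℤ.+ (ℤ.- p) ℤ.* (ℤ.- (+ 1 ℤ.+ b)) , ℤ.- p ⟫
        product : β̄ · ⟪ p ℤ.* a ℤ.+ q ℤ.* b , q ⟫ ≡ ι A · z
        product = trans (⟪⟫-· (b ℤ.+ + 1) (ℤ.- (+ 1)) (p ℤ.* a ℤ.+ q ℤ.* b) q) (trans (cong₂ ⟪_,_⟫
            (trans (r₁ a b (+ N) p q) (trans (cong (λ t → a ℤ.* (p ℤ.* (b ℤ.+ + 1)) ℤ.+ q ℤ.* t) (sym D)) (r₃ a b c p q)))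
            (r₂ a b p q))
          (trans (cong₂ _,_ (ℤ→ℚ-* a _) (ℤ→ℚ-* a (ℤ.- p))) (sym (ι-scale A _ _))))
          where
          r₁ : ∀ a b N p q → (b ℤ.+ + 1) ℤ.* (p ℤ.* a ℤ.+ q ℤ.* b) ℤ.- N ℤ.* ((ℤ.- (+ 1)) ℤ.* q) ≡ a ℤ.* (p ℤ.* (b ℤ.+ + 1)) ℤ.+ q ℤ.* (b ℤ.* b ℤ.+ b ℤ.+ N)
          r₁ = solve-∀
          r₂ : ∀ a b p q → (b ℤ.+ + 1) ℤ.* q ℤ.+ (ℤ.- (+ 1)) ℤ.* (p ℤ.* a ℤ.+ q ℤ.* b) ℤ.+ (ℤ.- (+ 1)) ℤ.* q ≡ a ℤ.* (ℤ.- p)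
          r₂ = solve-∀
          r₃ : ∀ a b c p q → a ℤ.* (p ℤ.* (b ℤ.+ + 1)) ℤ.+ q ℤ.* (a ℤ.* c) ≡ a ℤ.* (q ℤ.* c ℤ.+ (ℤ.- p) ℤ.* (ℤ.- (+ 1 ℤ.+ b)))
          r₃ = solve-∀
      backward : ∀ p q → (ι (ℚ.1/ C) · β) · ⟪ p ℤ.* c ℤ.+ q ℤ.* (ℤ.- (+ 1 ℤ.+ b)) , q ⟫ ≡ ⟪ (ℤ.- q) ℤ.* a ℤ.+ p ℤ.* b , p ⟫
      backward p q = trans (·-assoc (ι (ℚ.1/ C)) β _) (trans (cong (ι (ℚ.1/ C) ·_) product) (trans (sym (·-assoc (ι (ℚ.1/ C)) (ι C) z)) (trans (cong (_· z) (trans (ι-· (ℚ.1/ C) C) (cong ι (ℚₚ.*-inverseˡ C)))) (·-identityˡ z))))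
        where
        z = ⟪ (ℤ.- q) ℤ.* a ℤ.+ p ℤ.* b , p ⟫
        product : β · ⟪ p ℤ.* c ℤ.+ q ℤ.* (ℤ.- (+ 1 ℤ.+ b)) , q ⟫ ≡ ι C · z
        product = trans (⟪⟫-· b (+ 1) (p ℤ.* c ℤ.+ q ℤ.* (ℤ.- (+ 1 ℤ.+ b))) q) (trans (cong₂ ⟪_,_⟫
            (trans (r₁ b c (+ N) p q) (trans (cong (λ t → c ℤ.* (p ℤ.* b) ℤ.- q ℤ.* t) (sym D)) (r₃ a b c p q)))
            (r₂ b c p q))
          (trans (cong₂ _,_ (ℤ→ℚ-* c _) (ℤ→ℚ-* c p)) (sym (ι-scale C _ _))))
          where
          r₁ : ∀ b c N p q → b ℤ.* (p ℤ.* c ℤ.+ q ℤ.* (ℤ.- (+ 1 ℤ.+ b))) ℤ.- N ℤ.* (+ 1 ℤ.* q) ≡ c ℤ.* (p ℤ.* b) ℤ.- q ℤ.* (b ℤ.* b ℤ.+ b ℤ.+ N)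
          r₁ = solve-∀
          r₂ : ∀ b c p q → b ℤ.* q ℤ.+ + 1 ℤ.* (p ℤ.* c ℤ.+ q ℤ.* (ℤ.- (+ 1 ℤ.+ b))) ℤ.+ + 1 ℤ.* q ≡ c ℤ.* p
          r₂ = solve-∀
          r₃ : ∀ a b c p q → c ℤ.* (p ℤ.* b) ℤ.- q ℤ.* (a ℤ.* c) ≡ c ℤ.* ((ℤ.- q) ℤ.* a ℤ.+ p ℤ.* b)
          r₃ = solve-∀

-- From modules stable under ω to multiples of ℤa + ℤ(b + ω).

module Principal where

  open import Data.Rational.Base using (_+_; _*_; -_; _-_; _/_)
  open Rationals
  open QuadraticField
  open Hermite
  open Multiples

  *-cancelℚ : ∀ {p} → p ≢ 0ℚ → ∀ {s t} → p * s ≡ p * t → s ≡ t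
  *-cancelℚ {p} nz {s} {t} e = trans (undo s) (trans (cong (ℚ.1/ p *_) e) (sym (undo t)))
    where
    instance
      p≢0 : ℚ.NonZero p
      p≢0 = ℚ.≢-nonZero nz
    undo : ∀ s → s ≡ ℚ.1/ p * (p * s)
    undo s = trans (sym (ℚₚ.*-identityˡ s)) (trans (cong (_* s) (sym (ℚₚ.*-inverseˡ p))) (ℚₚ.*-assoc (ℚ.1/ p) p s))

  *-zero-cancel : ∀ {p} → p ≢ 0ℚ → ∀ {t} → p * t ≡ 0ℚ → t ≡ 0ℚ
  *-zero-cancel {p} nz e = *-cancelℚ nz (trans e (sym (ℚₚ.*-zeroʳ p)))

  module Reduce (d N : ℕ) (Tr≡1 : Tr d ≡ 1ℚ) (Nm≡N : Nm d ≡ ℤ→ℚ (+ N)) (4N : 4 ℕ.* N ≡ suc d) where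
    open Field d
    open Algebra d
    open Lattices d
    open Reduction d N Tr≡1 Nm≡N 4N

    d≥1 : 1 ℕ.≤ d
    d≥1 = go N d 4N
      where
      go : ∀ N d → 4 ℕ.* N ≡ suc d → 1 ℕ.≤ d
      go (suc N) (suc d) _ = ℕ.s≤s ℕ.z≤n
      go (suc N) zero e = ⊥-elim (small (subst (4 ℕ.≤_) e (ℕₚ.*-monoʳ-≤ 4 (ℕ.s≤s (ℕ.z≤n {N})))))
        where
        small : 4 ℕ.≤ 1 → ⊥
        small (ℕ.s≤s ())
      go zero d ()

    square-nonneg : ∀ x → Σ ℕ λ m → x ℤ.* x ≡ + m
    square-nonneg (+ 0)    = 0 , refl
    square-nonneg +[1+ m ] = _ , refl
    square-nonneg -[1+ m ] = _ , refl

    square-zero : ∀ x → x ℤ.* x ≡ + 0 → x ≡ + 0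
    square-zero x e with ℤₚ.i*j≡0⇒i≡0∨j≡0 x e
    ... | inj₁ z = z
    ... | inj₂ z = z

    -- 4 n(p + qω) = (2p + q)² + d q² vanishes only at the origin.
    nℤ-zero : ∀ p q → nℤ p q ≡ + 0 → p ≡ + 0 × q ≡ + 0
    nℤ-zero p q e = p≡0 , q≡0
      where
      t = + 2 ℤ.* p ℤ.+ q
      sum : t ℤ.* t ℤ.+ + d ℤ.* (q ℤ.* q) ≡ + 0
      sum = trans (sym (4n p q)) (cong (+ 4 ℤ.*_) e)
      parts : proj₁ (square-nonneg t) ℕ.+ d ℕ.* proj₁ (square-nonneg q) ≡ 0
      parts = ℤₚ.+-injective (trans (cong₂ ℤ._+_ (sym (proj₂ (square-nonneg t))) (trans (ℤₚ.pos-* d _) (cong (+ d ℤ.*_) (sym (proj₂ (square-nonneg q)))))) sum)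
      q≡0 : q ≡ + 0
      q≡0 = square-zero q (trans (proj₂ (square-nonneg q)) (cong +_ (zero-product (ℕₚ.m*n≡0⇒m≡0∨n≡0 d (ℕₚ.m+n≡0⇒n≡0 (proj₁ (square-nonneg t)) parts)))))
        where
        zero-product : d ≡ 0 ⊎ proj₁ (square-nonneg q) ≡ 0 → proj₁ (square-nonneg q) ≡ 0
        zero-product (inj₁ z) = ⊥-elim (ℕₚ.<⇒≢ d≥1 (sym z))
        zero-product (inj₂ z) = z
      t≡0 : t ≡ + 0
      t≡0 = square-zero t (trans (proj₂ (square-nonneg t)) (cong +_ (ℕₚ.m+n≡0⇒m≡0 (proj₁ (square-nonneg t)) parts)))
      p≡0 : p ≡ + 0
      p≡0 = ℤₚ.*-cancelˡ-≡ (+ 2) p (+ 0) (trans (r p q) (cong₂ ℤ._-_ t≡0 q≡0))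
        where
        r : ∀ p q → + 2 ℤ.* p ≡ (+ 2 ℤ.* p ℤ.+ q) ℤ.- q
        r = solve-∀

    -- Clearing denominators reduces the anisotropy of the norm to integral coordinates.
    n-zero : ∀ z → n z ≡ 0ℚ → z ≡ 0E
    n-zero (x , y) e = cong₂ _,_ (vanish (proj₁ pq) X) (vanish (proj₂ pq) Y)
      where
      a = ℚ.↧ x
      b = ℚ.↧ y
      D≢0 : ⌈ a ℤ.* b ⌉ ≢ 0ℚ
      D≢0 = ⌈⌉-nonzero (nz x y)
        where
        nz : ∀ p q → ℚ.↧ p ℤ.* ℚ.↧ q ≢ + 0
        nz (ℚ.mkℚ _ _ _) (ℚ.mkℚ _ _ _) ()
      P = ℚ.↥ x ℤ.* b
      Q = ℚ.↥ y ℤ.* a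
      X : ⌈ a ℤ.* b ⌉ * x ≡ ⌈ P ⌉
      X = trans (cong (_* x) (ℤ→ℚ-* a b)) (trans (r x ⌈ a ⌉ ⌈ b ⌉) (trans (cong (_* ⌈ b ⌉) (clear-denominator x)) (sym (ℤ→ℚ-* (ℚ.↥ x) b))))
        where
        r : ∀ x a b → (a * b) * x ≡ (x * a) * b
        r = solve-∀-over ℚ-ring
      Y : ⌈ a ℤ.* b ⌉ * y ≡ ⌈ Q ⌉
      Y = trans (cong (_* y) (ℤ→ℚ-* a b)) (trans (r y ⌈ a ⌉ ⌈ b ⌉) (trans (cong (_* ⌈ a ⌉) (clear-denominator y)) (sym (ℤ→ℚ-* (ℚ.↥ y) a))))
        where
        r : ∀ x a b → (a * b) * x ≡ (x * b) * a
        r = solve-∀-over ℚ-ring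
      pq = nℤ-zero P Q (ℤ→ℚ-injective (trans (sym (n-int P Q)) (trans (cong n (sym (trans (ι-scale ⌈ a ℤ.* b ⌉ x y) (cong₂ _,_ X Y))))
        (trans (n-· (ι ⌈ a ℤ.* b ⌉) (x , y)) (trans (cong (n (ι ⌈ a ℤ.* b ⌉) *_) e) (ℚₚ.*-zeroʳ (n (ι ⌈ a ℤ.* b ⌉))))))))
      vanish : ∀ {z t} → z ≡ + 0 → ⌈ a ℤ.* b ⌉ * t ≡ ⌈ z ⌉ → t ≡ 0ℚ
      vanish refl = *-zero-cancel D≢0

    ω-· : ∀ a b → ω · (a , b) ≡ (- (⌈ + N ⌉ * b) , a + b)
    ω-· a b = trans (cong₂ _,_ (r₁ (Nm d) a b) (r₂ (Tr d) a b)) (trans (cong₂ (λ N T → - (N * b) , a + T * b) Nm≡N Tr≡1) (cong (λ t → - (⌈ + N ⌉ * b) , a + t) (ℚₚ.*-identityˡ b)))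
      where
      r₁ : ∀ N a b → 0ℚ * a - N * (1ℚ * b) ≡ - (N * b)
      r₁ = solve-∀-over ℚ-ring
      r₂ : ∀ T a b → 0ℚ * b + 1ℚ * a + T * (1ℚ * b) ≡ a + T * b
      r₂ = solve-∀-over ℚ-ring

    record Principalised (P : E → Set) : Set where
      constructor principalised
      field
        a b c  : ℤ
        a≢0    : a ≢ + 0
        disc   : Discriminant a b c
        mult   : Multiple P a b

    -- Stability is applied to the two generators. `ω(A, 0) = (0, A)` gives `A = qC` and
    -- `pA + qB = 0`, hence `B = -pC`; `ω(B, C) = (-NC, B + C)` gives `q′ = 1 - p` and the
    -- discriminant relation. So the module is `C` times `J q (-p)`.
    from-hermite : ∀ {P : E → Set} → Hermite P → (∀ x → P x → P (ω · x)) → ∀ z → z ≢ 0E → P z → Principalised P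
    from-hermite {P} (hermite A B C to from) stable z z≢0 Pz = main
      where
      open ≡-Reasoning
      r10 : ∀ A B → 1ℚ * A + 0ℚ * B ≡ A
      r10 = solve-∀-over ℚ-ring
      r01 : ∀ A B → 0ℚ * A + 1ℚ * B ≡ B
      r01 = solve-∀-over ℚ-ring
      first : Span A B C (ω · (A , 0ℚ))
      first = to _ (stable _ (from _ (+ 1 , + 0 , cong₂ _,_ (sym (r10 A B)) (sym (ℚₚ.*-zeroˡ C)))))
      second : Span A B C (ω · (B , C))
      second = to _ (stable _ (from _ (+ 0 , + 1 , cong₂ _,_ (sym (r01 A B)) (sym (ℚₚ.*-identityˡ C)))))
      p q p′ q′ : ℤ
      p = proj₁ first
      q = proj₁ (proj₂ first)
      p′ = proj₁ second
      q′ = proj₁ (proj₂ second)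
      e₁ = trans (sym (ω-· A 0ℚ)) (proj₂ (proj₂ first))
      e₂ = trans (sym (ω-· B C)) (proj₂ (proj₂ second))
      A≡ : A ≡ ⌈ q ⌉ * C
      A≡ = trans (sym (ℚₚ.+-identityʳ A)) (cong proj₂ e₁)
      zero₁ : ⌈ p ⌉ * A + ⌈ q ⌉ * B ≡ 0ℚ
      zero₁ = trans (sym (cong proj₁ e₁)) (trans (cong -_ (ℚₚ.*-zeroʳ ⌈ + N ⌉)) refl)
      B+C : B + C ≡ ⌈ q′ ⌉ * C
      B+C = cong proj₂ e₂
      -NC : - (⌈ + N ⌉ * C) ≡ ⌈ p′ ⌉ * A + ⌈ q′ ⌉ * B
      -NC = cong proj₁ e₂
      C≢0 : C ≢ 0ℚ
      C≢0 C≡0 = z≢0 (trans (proj₂ (proj₂ s)) (cong₂ _,_ (trans (cong₂ (λ a b → ⌈ proj₁ s ⌉ * a + ⌈ proj₁ (proj₂ s) ⌉ * b) A≡0 B≡0) (r ⌈ proj₁ s ⌉ ⌈ proj₁ (proj₂ s) ⌉))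
                                                (trans (cong (⌈ proj₁ (proj₂ s) ⌉ *_) C≡0) (ℚₚ.*-zeroʳ ⌈ proj₁ (proj₂ s) ⌉))))
        where
        s = to z Pz
        A≡0 : A ≡ 0ℚ
        A≡0 = trans A≡ (trans (cong (⌈ q ⌉ *_) C≡0) (ℚₚ.*-zeroʳ ⌈ q ⌉))
        B≡0 : B ≡ 0ℚ
        B≡0 = trans (sym (ℚₚ.+-identityʳ B)) (trans (cong (_+_ B) (sym C≡0)) (trans B+C (trans (cong (⌈ q′ ⌉ *_) C≡0) (ℚₚ.*-zeroʳ ⌈ q′ ⌉))))
        r : ∀ p q → p * 0ℚ + q * 0ℚ ≡ 0ℚ
        r = solve-∀-over ℚ-ring
      cancel-C : ∀ {s t : ℤ} → ⌈ s ⌉ * C ≡ ⌈ t ⌉ * C → s ≡ t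
      cancel-C {s} {t} e = ℤ→ℚ-injective (*-cancelℚ C≢0 (trans (ℚₚ.*-comm C ⌈ s ⌉) (trans e (ℚₚ.*-comm ⌈ t ⌉ C))))
      q≢0 : q ≢ + 0
      -- For `q = 0` one gets `A = 0` and `B = (q′ - 1) C`, and then the norm of `ω - q′` would
      -- vanish.
      q≢0 q≡0 = absurd (proj₂ (nℤ-zero (ℤ.- q′) (+ 1) (cancel-C equation)))
        where
        absurd : + 1 ≢ + 0
        absurd ()
        A≡0 : A ≡ 0ℚ
        A≡0 = trans A≡ (trans (cong (λ t → ⌈ t ⌉ * C) q≡0) (ℚₚ.*-zeroˡ C))
        B≡ : B ≡ ⌈ q′ ⌉ * C - C
        B≡ = trans (r B C) (cong (_- C) B+C)
          where
          r : ∀ b c → b ≡ (b + c) - c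
          r = solve-∀-over ℚ-ring
        value : ⌈ nℤ (ℤ.- q′) (+ 1) ⌉ ≡ ⌈ q′ ⌉ * ⌈ q′ ⌉ - ⌈ q′ ⌉ + ⌈ + N ⌉
        value = trans (cong ⌈_⌉ (r q′ (+ N))) (trans (ℤ→ℚ-+ (q′ ℤ.* q′ ℤ.- q′) (+ N)) (cong (_+ ⌈ + N ⌉) (trans (ℤ→ℚ-+ (q′ ℤ.* q′) (ℤ.- q′)) (cong₂ _+_ (ℤ→ℚ-* q′ q′) (ℤ→ℚ-neg q′)))))
          where
          r : ∀ q N → (ℤ.- q) ℤ.* (ℤ.- q) ℤ.+ (ℤ.- q) ℤ.* + 1 ℤ.+ N ℤ.* (+ 1 ℤ.* + 1) ≡ q ℤ.* q ℤ.- q ℤ.+ N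
          r = solve-∀
        equation : ⌈ nℤ (ℤ.- q′) (+ 1) ⌉ * C ≡ ⌈ + 0 ⌉ * C
        equation = begin
          ⌈ nℤ (ℤ.- q′) (+ 1) ⌉ * C ≡⟨ cong (_* C) value ⟩
          (⌈ q′ ⌉ * ⌈ q′ ⌉ - ⌈ q′ ⌉ + ⌈ + N ⌉) * C ≡⟨ r₁ ⌈ q′ ⌉ ⌈ + N ⌉ C ⌈ p′ ⌉ ⟩
          ⌈ p′ ⌉ * 0ℚ + ⌈ q′ ⌉ * (⌈ q′ ⌉ * C - C) - - (⌈ + N ⌉ * C) ≡⟨ cong₂ (λ a b → ⌈ p′ ⌉ * a + ⌈ q′ ⌉ * b - - (⌈ + N ⌉ * C)) (sym A≡0) (sym B≡) ⟩
          ⌈ p′ ⌉ * A + ⌈ q′ ⌉ * B - - (⌈ + N ⌉ * C) ≡⟨ cong (_- - (⌈ + N ⌉ * C)) (sym -NC) ⟩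
          - (⌈ + N ⌉ * C) - - (⌈ + N ⌉ * C) ≡⟨ r₂ (⌈ + N ⌉ * C) C ⟩
          0ℚ * C ∎
          where
          r₁ : ∀ q N C p → (q * q - q + N) * C ≡ p * 0ℚ + q * (q * C - C) - - (N * C)
          r₁ = solve-∀-over ℚ-ring
          r₂ : ∀ x C → - x - - x ≡ 0ℚ * C
          r₂ = solve-∀-over ℚ-ring
      B≡ : B ≡ ⌈ ℤ.- p ⌉ * C
      B≡ = *-cancelℚ (⌈⌉-nonzero q≢0) (begin
        ⌈ q ⌉ * B ≡⟨ r₁ (⌈ p ⌉ * A) (⌈ q ⌉ * B) ⟩
        (⌈ p ⌉ * A + ⌈ q ⌉ * B) - ⌈ p ⌉ * A ≡⟨ cong₂ (λ s a → s - ⌈ p ⌉ * a) zero₁ A≡ ⟩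
        0ℚ - ⌈ p ⌉ * (⌈ q ⌉ * C) ≡⟨ r₂ ⌈ p ⌉ ⌈ q ⌉ C ⟩
        ⌈ q ⌉ * (- ⌈ p ⌉ * C) ≡⟨ cong (λ t → ⌈ q ⌉ * (t * C)) (ℤ→ℚ-neg p) ⟨
        ⌈ q ⌉ * (⌈ ℤ.- p ⌉ * C) ∎)
        where
        r₁ : ∀ x y → y ≡ (x + y) - x
        r₁ = solve-∀-over ℚ-ring
        r₂ : ∀ p q C → 0ℚ - p * (q * C) ≡ q * (- p * C)
        r₂ = solve-∀-over ℚ-ring
      q′≡ : q′ ≡ + 1 ℤ.- p
      q′≡ = cancel-C (trans (sym B+C) (trans (cong (_+ C) B≡) (trans (r ⌈ ℤ.- p ⌉ C) (cong (_* C) (sym (ℤ→ℚ-+ (+ 1) (ℤ.- p)))))))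
        where
        r : ∀ b C → b * C + C ≡ (1ℚ + b) * C
        r = solve-∀-over ℚ-ring
      disc : Discriminant q (ℤ.- p) (ℤ.- p′)
      disc = trans (r₁ q p′) (trans (cong ℤ.-_ (trans (r₂ (p′ ℤ.* q) q′ p) (trans (cong₂ (λ x y → x ℤ.- y ℤ.* (ℤ.- p)) (sym minus-N) q′≡) refl))) (r₃ p (+ N)))
        where
        r₁ : ∀ q p′ → q ℤ.* (ℤ.- p′) ≡ ℤ.- (p′ ℤ.* q)
        r₁ = solve-∀
        r₂ : ∀ x q′ p → x ≡ (x ℤ.+ q′ ℤ.* (ℤ.- p)) ℤ.- q′ ℤ.* (ℤ.- p)
        r₂ = solve-∀
        r₃ : ∀ p N → ℤ.- (ℤ.- N ℤ.- (+ 1 ℤ.- p) ℤ.* (ℤ.- p)) ≡ (ℤ.- p) ℤ.* (ℤ.- p) ℤ.+ (ℤ.- p) ℤ.+ N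
        r₃ = solve-∀
        minus-N : ℤ.- + N ≡ p′ ℤ.* q ℤ.+ q′ ℤ.* (ℤ.- p)
        minus-N = cancel-C (begin
          ⌈ ℤ.- + N ⌉ * C ≡⟨ trans (cong (_* C) (ℤ→ℚ-neg (+ N))) (sym (ℚₚ.neg-distribˡ-* ⌈ + N ⌉ C)) ⟩
          - (⌈ + N ⌉ * C) ≡⟨ -NC ⟩
          ⌈ p′ ⌉ * A + ⌈ q′ ⌉ * B ≡⟨ cong₂ (λ a b → ⌈ p′ ⌉ * a + ⌈ q′ ⌉ * b) A≡ B≡ ⟩
          ⌈ p′ ⌉ * (⌈ q ⌉ * C) + ⌈ q′ ⌉ * (⌈ ℤ.- p ⌉ * C) ≡⟨ r ⌈ p′ ⌉ ⌈ q ⌉ ⌈ q′ ⌉ ⌈ ℤ.- p ⌉ C ⟩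
          (⌈ p′ ⌉ * ⌈ q ⌉ + ⌈ q′ ⌉ * ⌈ ℤ.- p ⌉) * C ≡⟨ cong (_* C) (trans (ℤ→ℚ-+ (p′ ℤ.* q) (q′ ℤ.* (ℤ.- p))) (cong₂ _+_ (ℤ→ℚ-* p′ q) (ℤ→ℚ-* q′ (ℤ.- p)))) ⟨
          ⌈ p′ ℤ.* q ℤ.+ q′ ℤ.* (ℤ.- p) ⌉ * C ∎)
          where
          r : ∀ a b c e C → a * (b * C) + c * (e * C) ≡ (a * b + c * e) * C
          r = solve-∀-over ℚ-ring
      instance
        nzC : ℚ.NonZero C
        nzC = ℚ.≢-nonZero C≢0
      combine : ∀ s t → ⌈ s ⌉ * A + ⌈ t ⌉ * B ≡ ⌈ s ℤ.* q ℤ.+ t ℤ.* (ℤ.- p) ⌉ * C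
      combine s t = trans (cong₂ (λ a b → ⌈ s ⌉ * a + ⌈ t ⌉ * b) A≡ B≡) (trans (r ⌈ s ⌉ ⌈ q ⌉ ⌈ t ⌉ ⌈ ℤ.- p ⌉ C)
        (cong (_* C) (sym (trans (ℤ→ℚ-+ (s ℤ.* q) (t ℤ.* (ℤ.- p))) (cong₂ _+_ (ℤ→ℚ-* s q) (ℤ→ℚ-* t (ℤ.- p)))))))
        where
        r : ∀ a b c e C → a * (b * C) + c * (e * C) ≡ (a * b + c * e) * C
        r = solve-∀-over ℚ-ring
      scaled : ∀ s t → (⌈ s ⌉ * C , ⌈ t ⌉ * C) ≡ ι C · ⟪ s , t ⟫
      scaled s t = trans (cong₂ _,_ (ℚₚ.*-comm ⌈ s ⌉ C) (ℚₚ.*-comm ⌈ t ⌉ C)) (sym (ι-scale C ⌈ s ⌉ ⌈ t ⌉))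
      main : Principalised P
      main = principalised q (ℤ.- p) (ℤ.- p′) q≢0 disc (multiple u
        (λ x Px → let (s , t , e) = to x Px in s , t ,
           trans (cong (Unit.inv u ·_) (trans e (trans (cong (_, ⌈ t ⌉ * C) (combine s t)) (scaled (s ℤ.* q ℤ.+ t ℤ.* (ℤ.- p)) t)))) (Unit.cancel′ u _))
        (λ x (s , t , e) → from x (s , t , trans (sym (Unit.cancel u x)) (trans (cong (ι C ·_) e)
           (trans (sym (scaled (s ℤ.* q ℤ.+ t ℤ.* (ℤ.- p)) t)) (cong (_, ⌈ t ⌉ * C) (sym (combine s t))))))))
        where
        u : Unit (ι C)
        u = unit-ι C C≢0

-- Gauss reduction of ideals.

module GaussReduction where

  open import Data.Rational.Base using (_+_; _*_; -_; _-_; _/_)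
  open QuadraticField
  open Hermite
  open Multiples
  open Principal

  module Present (d N : ℕ) (Tr≡1 : Tr d ≡ 1ℚ) (Nm≡N : Nm d ≡ ℤ→ℚ (+ N)) (4N : 4 ℕ.* N ≡ suc d) where
    open Field d
    open Algebra d
    open Lattices d
    open Reduction d N Tr≡1 Nm≡N 4N
    open Reduce d N Tr≡1 Nm≡N 4N

    𝒪-· : ∀ {x y} → Is𝒪 x → Is𝒪 y → Is𝒪 (x · y)
    𝒪-· {x} {y} p q =
      let (a , b , e) = 𝒪-int p ; (c , f , g) = 𝒪-int q
      in int-𝒪 (a ℤ.* c ℤ.- + N ℤ.* (b ℤ.* f)) (a ℤ.* f ℤ.+ b ℤ.* c ℤ.+ b ℤ.* f) (trans (cong₂ _·_ e g) (⟪⟫-· a b c f))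

    𝒪-0 : Is𝒪 0E
    𝒪-0 = (+ 0 , refl) , (+ 0 , refl)

    𝒪-1 : Is𝒪 1E
    𝒪-1 = (+ 1 , refl) , (+ 0 , refl)

    𝒪-ω : Is𝒪 ω
    𝒪-ω = (+ 0 , refl) , (+ 1 , refl)

    ideal-· : ∀ gs c x → Is𝒪 c → InIdeal gs x → InIdeal gs (c · x)
    ideal-· [] c x _ refl = ·-zeroʳ c
    ideal-· (g ∷ gs) c x oc (c′ , oc′ , h) = c · c′ , 𝒪-· oc oc′ ,
      subst (InIdeal gs) (trans (·-distribˡ c x (-E (c′ · g))) (cong ((c · x) +E_) (trans (·-negʳ c (c′ · g)) (cong -E_ (sym (·-assoc c c′ g)))))) (ideal-· gs c (x -E (c′ · g)) oc h)

    ideal-0 : ∀ gs → InIdeal gs 0E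
    ideal-0 [] = refl
    ideal-0 (g ∷ gs) = 0E , 𝒪-0 , subst (InIdeal gs) (sym (trans (cong (λ t → 0E -E t) (0·x g)) (-E-self 0E))) (ideal-0 gs)

    ideal-nonzero : ∀ gs → Any (λ g → g ≢ 0E) gs → Σ E λ z → z ≢ 0E × InIdeal gs z
    ideal-nonzero (g ∷ gs) (here nz) = g , nz , 1E , 𝒪-1 , subst (InIdeal gs) (sym (trans (cong (λ t → g -E t) (·-identityˡ g)) (-E-self g))) (ideal-0 gs)
    ideal-nonzero (g ∷ gs) (there p) = let (z , nz , h) = ideal-nonzero gs p in
      z , nz , 0E , 𝒪-0 , subst (InIdeal gs) (sym (minus-zero z)) h
      where
      minus-zero : ∀ z → z -E (0E · g) ≡ z
      minus-zero z = trans (cong (λ t → z -E t) (0·x g)) (r z)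
        where
        r : ∀ z → z -E 0E ≡ z
        r (a , b) = cong₂ _,_ (ℚₚ.+-identityʳ a) (ℚₚ.+-identityʳ b)

    principalise : ∀ I → Principalised (_∈ᴵ I)
    principalise I = let (z , nz , h) = ideal-nonzero gs (FracIdeal.nonzero I) in
      from-hermite (ideal-hermite gs) (λ x → ideal-· gs ω x 𝒪-ω) z nz h
      where
      gs : List E
      gs = FracIdeal.gens I

    record Reduced (P : E → Set) : Set where
      constructor reduced
      field
        a      : ℕ
        b c    : ℤ
        a≥1    : 1 ℕ.≤ a
        disc   : Discriminant (+ a) b c
        centre : ℤ.∣ + 2 ℤ.* b ℤ.+ + 1 ∣ ℕ.≤ a
        a≤c    : a ℕ.≤ ℤ.∣ c ∣
        small  : 3 ℕ.* (a ℕ.* a) ℕ.≤ d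
        mult   : Multiple P (+ a) b

    shift-disc : ∀ a b c m → Discriminant a b c → Discriminant a (b ℤ.+ m ℤ.* a) (c ℤ.+ + 2 ℤ.* b ℤ.* m ℤ.+ m ℤ.* m ℤ.* a ℤ.+ m)
    shift-disc a b c m D = trans (r₁ a b c m) (trans (cong (λ t → t ℤ.+ (+ 2 ℤ.* b ℤ.* m ℤ.* a ℤ.+ m ℤ.* m ℤ.* a ℤ.* a ℤ.+ m ℤ.* a)) D) (r₂ a b m (+ N)))
      where
      r₁ : ∀ a b c m → a ℤ.* (c ℤ.+ + 2 ℤ.* b ℤ.* m ℤ.+ m ℤ.* m ℤ.* a ℤ.+ m) ≡ a ℤ.* c ℤ.+ (+ 2 ℤ.* b ℤ.* m ℤ.* a ℤ.+ m ℤ.* m ℤ.* a ℤ.* a ℤ.+ m ℤ.* a)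
      r₁ = solve-∀
      r₂ : ∀ a b m N → b ℤ.* b ℤ.+ b ℤ.+ N ℤ.+ (+ 2 ℤ.* b ℤ.* m ℤ.* a ℤ.+ m ℤ.* m ℤ.* a ℤ.* a ℤ.+ m ℤ.* a) ≡ (b ℤ.+ m ℤ.* a) ℤ.* (b ℤ.+ m ℤ.* a) ℤ.+ (b ℤ.+ m ℤ.* a) ℤ.+ N
      r₂ = solve-∀

    4ac : ∀ a b c → Discriminant a b c → + 4 ℤ.* (a ℤ.* c) ≡ (+ 2 ℤ.* b ℤ.+ + 1) ℤ.* (+ 2 ℤ.* b ℤ.+ + 1) ℤ.+ + d
    4ac a b c D = trans (cong (+ 4 ℤ.*_) D) (trans (r₁ b (+ N)) (trans (4n b (+ 1)) (r₂ b (+ d))))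
      where
      r₁ : ∀ b N → + 4 ℤ.* (b ℤ.* b ℤ.+ b ℤ.+ N) ≡ + 4 ℤ.* (b ℤ.* b ℤ.+ b ℤ.* + 1 ℤ.+ N ℤ.* (+ 1 ℤ.* + 1))
      r₁ = solve-∀
      r₂ : ∀ b d → (+ 2 ℤ.* b ℤ.+ + 1) ℤ.* (+ 2 ℤ.* b ℤ.+ + 1) ℤ.+ d ℤ.* (+ 1 ℤ.* + 1) ≡ (+ 2 ℤ.* b ℤ.+ + 1) ℤ.* (+ 2 ℤ.* b ℤ.+ + 1) ℤ.+ d
      r₂ = solve-∀

    square-abs : ∀ x → x ℤ.* x ≡ + (ℤ.∣ x ∣ ℕ.* ℤ.∣ x ∣)
    square-abs (+ 0)    = refl
    square-abs +[1+ _ ] = refl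
    square-abs -[1+ _ ] = refl

    4acℕ : ∀ a b c → Discriminant (+ a) b (+ c) → 4 ℕ.* (a ℕ.* c) ≡ ℤ.∣ + 2 ℤ.* b ℤ.+ + 1 ∣ ℕ.* ℤ.∣ + 2 ℤ.* b ℤ.+ + 1 ∣ ℕ.+ d
    4acℕ a b c D = ℤₚ.+-injective (trans (trans (ℤₚ.pos-* 4 (a ℕ.* c)) (cong (+ 4 ℤ.*_) (ℤₚ.pos-* a c))) (trans (4ac (+ a) b (+ c) D) (cong (ℤ._+ + d) (square-abs (+ 2 ℤ.* b ℤ.+ + 1)))))

    -- `4ac = (2b + 1)² + d` is positive, so `c` has the sign of `a`.
    positive-factor : ∀ a b c → Discriminant +[1+ a ] b c → Σ ℕ λ c′ → c ≡ +[1+ c′ ]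
    positive-factor a b +[1+ c ] D = c , refl
    positive-factor a b (+ 0) D = ⊥-elim (absurd (trans (cong (+ 4 ℤ.*_) (sym (ℤₚ.*-zeroʳ +[1+ a ]))) (trans (4ac +[1+ a ] b (+ 0) D) (cong (ℤ._+ + d) (square-abs (+ 2 ℤ.* b ℤ.+ + 1))))))
      where
      absurd : + 0 ≡ + (ℤ.∣ + 2 ℤ.* b ℤ.+ + 1 ∣ ℕ.* ℤ.∣ + 2 ℤ.* b ℤ.+ + 1 ∣) ℤ.+ + d → ⊥
      absurd e = ℕₚ.<⇒≢ d≥1 (sym (ℕₚ.m+n≡0⇒n≡0 (ℤ.∣ + 2 ℤ.* b ℤ.+ + 1 ∣ ℕ.* ℤ.∣ + 2 ℤ.* b ℤ.+ + 1 ∣) (ℤₚ.+-injective (sym e))))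
    positive-factor a b -[1+ c ] D = ⊥-elim (absurd {ℤ.∣ + 2 ℤ.* b ℤ.+ + 1 ∣} (trans (4ac +[1+ a ] b -[1+ c ] D) (cong (ℤ._+ + d) (square-abs (+ 2 ℤ.* b ℤ.+ + 1)))))
      where
      absurd : ∀ {m} → + 4 ℤ.* (+[1+ a ] ℤ.* -[1+ c ]) ≡ + (m ℕ.* m) ℤ.+ + d → ⊥
      absurd ()

    -- With `r = b mod a`, one of `2r + 1` and `2r + 1 - 2a` has absolute value at most `a`.
    centred : ∀ a b → 1 ℕ.≤ a → Σ ℤ λ m → ℤ.∣ + 2 ℤ.* (b ℤ.+ m ℤ.* + a) ℤ.+ + 1 ∣ ℕ.≤ a
    centred a@(suc a₀) b _ = by (2 ℕ.* r ℕ.+ 1 ℕₚ.≤? a)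
      where
      r = b %ℕ a
      t = b /ℕ a
      b≡ : b ≡ + r ℤ.+ t ℤ.* + a
      b≡ = ℤD.a≡a%ℕn+[a/ℕn]*n b a
      low : ∀ r t a → r ℤ.+ t ℤ.* a ℤ.+ (ℤ.- t) ℤ.* a ≡ r
      low = solve-∀
      high : ∀ r t a → + 2 ℤ.* (r ℤ.+ t ℤ.* a ℤ.+ (ℤ.- (t ℤ.+ + 1)) ℤ.* a) ℤ.+ + 1 ≡ ℤ.- (+ 2 ℤ.* a ℤ.- (+ 2 ℤ.* r ℤ.+ + 1))
      high = solve-∀
      shape₁ : + 2 ℤ.* (b ℤ.+ (ℤ.- t) ℤ.* + a) ℤ.+ + 1 ≡ + (2 ℕ.* r ℕ.+ 1)
      shape₁ = trans (cong (λ s → + 2 ℤ.* s ℤ.+ + 1) (trans (cong (ℤ._+ (ℤ.- t) ℤ.* + a) b≡) (low (+ r) t (+ a)))) (cong (ℤ._+ + 1) (sym (ℤₚ.pos-* 2 r)))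
      shape₂ : + 2 ℤ.* (b ℤ.+ (ℤ.- (t ℤ.+ + 1)) ℤ.* + a) ℤ.+ + 1 ≡ ℤ.- (+ (2 ℕ.* a) ℤ.- + (2 ℕ.* r ℕ.+ 1))
      shape₂ = trans (cong (λ s → + 2 ℤ.* (s ℤ.+ (ℤ.- (t ℤ.+ + 1)) ℤ.* + a) ℤ.+ + 1) b≡) (trans (high (+ r) t (+ a))
        (cong₂ (λ x y → ℤ.- (x ℤ.- (y ℤ.+ + 1))) (sym (ℤₚ.pos-* 2 a)) (sym (ℤₚ.pos-* 2 r))))
      less : 2 ℕ.* r ℕ.+ 1 ℕ.≤ 2 ℕ.* a
      less = ℕₚ.≤-trans (ℕₚ.+-monoʳ-≤ (2 ℕ.* r) (ℕ.s≤s (ℕ.z≤n {1}))) (ℕₚ.≤-trans (ℕₚ.≤-reflexive (trans (ℕₚ.+-comm (2 ℕ.* r) 2) (sym (ℕₚ.*-suc 2 r)))) (ℕₚ.*-monoʳ-≤ 2 (ℤD.n%ℕd<d b a)))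
      abs-difference : ∀ x y → y ℕ.≤ x → ℤ.∣ ℤ.- (+ x ℤ.- + y) ∣ ≡ x ℕ.∸ y
      abs-difference x y h = trans (ℤₚ.∣-i∣≡∣i∣ (+ x ℤ.- + y)) (cong ℤ.∣_∣ (trans (ℤₚ.m-n≡m⊖n x y) (ℤₚ.⊖-≥ h)))
      by : Dec (2 ℕ.* r ℕ.+ 1 ℕ.≤ a) → Σ ℤ λ m → ℤ.∣ + 2 ℤ.* (b ℤ.+ m ℤ.* + a) ℤ.+ + 1 ∣ ℕ.≤ a
      by (yes h) = ℤ.- t , ℕₚ.≤-trans (ℕₚ.≤-reflexive (cong ℤ.∣_∣ shape₁)) h
      by (no ¬h) = ℤ.- (t ℤ.+ + 1) , ℕₚ.≤-trans (ℕₚ.≤-reflexive (trans (cong ℤ.∣_∣ shape₂) (abs-difference (2 ℕ.* a) (2 ℕ.* r ℕ.+ 1) less))) bound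
        where
        bound : 2 ℕ.* a ℕ.∸ (2 ℕ.* r ℕ.+ 1) ℕ.≤ a
        bound = ℕₚ.≤-trans (ℕₚ.∸-monoʳ-≤ (2 ℕ.* a) (ℕₚ.<⇒≤ (ℕₚ.≰⇒> ¬h))) (ℕₚ.≤-reflexive (trans (cong (ℕ._∸ a) (cong (a ℕ.+_) (ℕₚ.+-identityʳ a))) (ℕₚ.m+n∸n≡m a a)))

    -- If a ≤ c then 4a² ≤ 4ac = (2b + 1)² + d ≤ a² + d.
    reduced-small : ∀ a b c → a ℕ.≤ c → ℤ.∣ + 2 ℤ.* b ℤ.+ + 1 ∣ ℕ.≤ a → Discriminant (+ a) b (+ c) → 3 ℕ.* (a ℕ.* a) ℕ.≤ d
    reduced-small a b c a≤c h D = ℕₚ.+-cancelˡ-≤ (a ℕ.* a) _ _ (ℕₚ.≤-trans (ℕₚ.*-monoʳ-≤ 4 (ℕₚ.*-monoʳ-≤ a a≤c)) (ℕₚ.≤-trans (ℕₚ.≤-reflexive (4acℕ a b c D)) (ℕₚ.+-monoˡ-≤ d (ℕₚ.*-mono-≤ h h))))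

    -- After centring, either `a ≤ c`, or inversion makes the smaller `c` the new leading
    -- coefficient; so `a` is the decreasing measure.
    reduce : ∀ {P : E → Set} a b c → Acc ℕ._<_ a → 1 ℕ.≤ a → Discriminant (+ a) b c → Multiple P (+ a) b → Reduced P
    reduce {P} a@(suc a₀) b c (acc rec) a≥1 D M = by (a ℕₚ.≤? suc c₀)
      where
      m  = proj₁ (centred a b a≥1)
      b′ = b ℤ.+ m ℤ.* + a
      c′ = c ℤ.+ + 2 ℤ.* b ℤ.* m ℤ.+ m ℤ.* m ℤ.* + a ℤ.+ m
      D′ : Discriminant (+ a) b′ c′
      D′ = shift-disc (+ a) b c m D
      M′ : Multiple P (+ a) b′
      M′ = translate (+ a) b m M
      c₀ = proj₁ (positive-factor a₀ b′ c′ D′)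
      c≡ : c′ ≡ +[1+ c₀ ]
      c≡ = proj₂ (positive-factor a₀ b′ c′ D′)
      D″ : Discriminant (+ a) b′ +[1+ c₀ ]
      D″ = subst (Discriminant (+ a) b′) c≡ D′
      by : Dec (a ℕ.≤ suc c₀) → Reduced P
      by (yes h) = reduced a b′ +[1+ c₀ ] a≥1 D″ (proj₂ (centred a b a≥1)) h (reduced-small a b′ (suc c₀) h (proj₂ (centred a b a≥1)) D″) M′
      by (no ¬h) = reduce (suc c₀) (ℤ.- (+ 1 ℤ.+ b′)) (+ a) (rec (ℕₚ.≰⇒> ¬h)) (ℕ.s≤s ℕ.z≤n)
        (trans (ℤₚ.*-comm +[1+ c₀ ] (+ a)) (trans D″ (r b′ (+ N)))) (invert (+ a) b′ +[1+ c₀ ] (λ ()) (λ ()) D″ M′)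
        where
        r : ∀ b N → b ℤ.* b ℤ.+ b ℤ.+ N ≡ (ℤ.- (+ 1 ℤ.+ b)) ℤ.* (ℤ.- (+ 1 ℤ.+ b)) ℤ.+ (ℤ.- (+ 1 ℤ.+ b)) ℤ.+ N
        r = solve-∀

    reduce-ideal : ∀ I → Reduced (_∈ᴵ I)
    reduce-ideal I = go (principalise I)
      where
      r : ∀ a c → (ℤ.- a) ℤ.* (ℤ.- c) ≡ a ℤ.* c
      r = solve-∀
      go : Principalised (_∈ᴵ I) → Reduced (_∈ᴵ I)
      go (principalised (+ 0) b c nz D M) = ⊥-elim (nz refl)
      go (principalised +[1+ a ] b c nz D M) = reduce (suc a) b c (<-wellFounded _) (ℕ.s≤s ℕ.z≤n) D M
      go (principalised -[1+ a ] b c nz D M) = reduce (suc a) b (ℤ.- c) (<-wellFounded _) (ℕ.s≤s ℕ.z≤n) (trans (r -[1+ a ] c) D) (negate -[1+ a ] b M)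

-- Unary lattices and sums of values of binary forms.

module Presentations where

  open import Data.Rational.Base using (_+_; _*_; -_; _-_; _/_)
  open Rationals
  open QuadraticField
  open Hermite
  open Multiples
  open Principal
  open GaussReduction

  sumZ : (m : ℕ) → (Fin m → ℤ) → ℤ
  sumZ zero    f = + 0
  sumZ (suc m) f = f Fin.zero ℤ.+ sumZ m (λ i → f (Fin.suc i))

  sumZ-cong : ∀ m {f g : Fin m → ℤ} → (∀ i → f i ≡ g i) → sumZ m f ≡ sumZ m g
  sumZ-cong zero    h = refl
  sumZ-cong (suc m) h = cong₂ ℤ._+_ (h Fin.zero) (sumZ-cong m (λ i → h (Fin.suc i)))

  sumZ-* : ∀ m c (f : Fin m → ℤ) → sumZ m (λ i → c ℤ.* f i) ≡ c ℤ.* sumZ m f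
  sumZ-* zero    c f = sym (ℤₚ.*-zeroʳ c)
  sumZ-* (suc m) c f = trans (cong (ℤ._+_ (c ℤ.* f Fin.zero)) (sumZ-* m c (λ i → f (Fin.suc i)))) (sym (ℤₚ.*-distribˡ-+ c (f Fin.zero) _))

  QF : ℤ → ℤ → ℤ → ℤ × ℤ → ℤ
  QF a b c (X , Y) = a ℤ.* (X ℤ.* X) ℤ.+ (+ 2 ℤ.* b ℤ.+ + 1) ℤ.* (X ℤ.* Y) ℤ.+ c ℤ.* (Y ℤ.* Y)

  SumOf : ℤ → ℤ → ℤ → ℕ → ℕ → Set
  SumOf a b c m r = Σ (Fin m → ℤ × ℤ) λ v → sumZ m (λ i → QF a b c (v i)) ≡ + r

  module Representations (d N : ℕ) (Tr≡1 : Tr d ≡ 1ℚ) (Nm≡N : Nm d ≡ ℤ→ℚ (+ N)) (4N : 4 ℕ.* N ≡ suc d) where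
    open Field d
    open Algebra d
    open Lattices d
    open Reduction d N Tr≡1 Nm≡N 4N
    open Reduce d N Tr≡1 Nm≡N 4N
    open Present d N Tr≡1 Nm≡N 4N

    -- On `α (pa + q(b + ω))` the Hermitian form takes the value `r (a p² + (2b + 1) p q + c q²)`.
    -- Thus `r` is the scale of `h` against the binary form, and form and scale together determine
    -- the lattice up to isometry.
    record Presentation (L : Unary) (a : ℕ) (b c : ℤ) (r : ℕ) : Set where
      constructor presentation
      field
        a≥1   : 1 ℕ.≤ a
        r≥1   : 1 ℕ.≤ r
        disc  : Discriminant (+ a) b c
        mult  : Multiple (_∈ᴵ ideal L) (+ a) b
        value : (n (Multiple.α mult) * hv L) * ⌈ + a ⌉ ≡ ⌈ + r ⌉

    hU-norm : ∀ L α x y → hU L (α · x) (α · y) ≡ (x · conj y) · ι (n α * hv L)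
    hU-norm L α x y = begin
      ((α · x) · conj (α · y)) · ι (hv L)       ≡⟨ cong (λ t → ((α · x) · t) · ι (hv L)) (conj-· α y) ⟩
      ((α · x) · (conj α · conj y)) · ι (hv L)  ≡⟨ cong (_· ι (hv L)) (interchange α x (conj α) (conj y)) ⟩
      ((α · conj α) · (x · conj y)) · ι (hv L)  ≡⟨ cong (λ t → (t · (x · conj y)) · ι (hv L)) (x·conj α) ⟩
      (ι (n α) · (x · conj y)) · ι (hv L)       ≡⟨ trans (cong (_· ι (hv L)) (·-comm (ι (n α)) (x · conj y))) (·-assoc (x · conj y) (ι (n α)) (ι (hv L))) ⟩
      (x · conj y) · (ι (n α) · ι (hv L))       ≡⟨ cong ((x · conj y) ·_) (ι-· (n α) (hv L)) ⟩
      (x · conj y) · ι (n α * hv L)             ∎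
      where open ≡-Reasoning

    scale-⟪⟫ : ∀ p q H → ⟪ p , q ⟫ · ι H ≡ (H * ⌈ p ⌉ , H * ⌈ q ⌉)
    scale-⟪⟫ p q H = trans (·-comm ⟪ p , q ⟫ (ι H)) (ι-scale H ⌈ p ⌉ ⌈ q ⌉)

    a·a : ∀ a → ⟪ a , + 0 ⟫ · conj ⟪ a , + 0 ⟫ ≡ ⟪ a ℤ.* a , + 0 ⟫
    a·a a = trans (x·conj ⟪ a , + 0 ⟫) (trans (cong ι (n-int a (+ 0))) (cong (λ t → ⟪ t , + 0 ⟫) (r a (+ N))))
      where
      r : ∀ a N → a ℤ.* a ℤ.+ a ℤ.* + 0 ℤ.+ N ℤ.* (+ 0 ℤ.* + 0) ≡ a ℤ.* a
      r = solve-∀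

    a·b : ∀ a b → ⟪ a , + 0 ⟫ · conj ⟪ b , + 1 ⟫ ≡ ⟪ a ℤ.* (b ℤ.+ + 1) , ℤ.- a ⟫
    a·b a b = trans (cong (⟪ a , + 0 ⟫ ·_) (⟪⟫-conj b (+ 1))) (trans (⟪⟫-· a (+ 0) (b ℤ.+ + 1) (ℤ.- (+ 1))) (cong₂ ⟪_,_⟫ (r₁ a b (+ N)) (r₂ a b)))
      where
      r₁ : ∀ a b N → a ℤ.* (b ℤ.+ + 1) ℤ.- N ℤ.* (+ 0 ℤ.* (ℤ.- (+ 1))) ≡ a ℤ.* (b ℤ.+ + 1)
      r₁ = solve-∀
      r₂ : ∀ a b → a ℤ.* (ℤ.- (+ 1)) ℤ.+ + 0 ℤ.* (b ℤ.+ + 1) ℤ.+ + 0 ℤ.* (ℤ.- (+ 1)) ≡ ℤ.- a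
      r₂ = solve-∀

    module _ {P : E → Set} {a b : ℤ} (M : Multiple P a b) where
      open Multiple M

      first-generator : P (α · ⟪ a , + 0 ⟫)
      first-generator = from _ (+ 1 , + 0 , trans (Unit.cancel′ α⁻¹ ⟪ a , + 0 ⟫) (cong (λ t → ⟪ t , + 0 ⟫) (r a b)))
        where
        r : ∀ a b → a ≡ + 1 ℤ.* a ℤ.+ + 0 ℤ.* b
        r = solve-∀

      second-generator : P (α · ⟪ b , + 1 ⟫)
      second-generator = from _ (+ 0 , + 1 , trans (Unit.cancel′ α⁻¹ ⟪ b , + 1 ⟫) (cong (λ t → ⟪ t , + 1 ⟫) (r a b)))
        where
        r : ∀ a b → b ≡ + 0 ℤ.* a ℤ.+ + 1 ℤ.* b
        r = solve-∀

    -- h(αa, αa) = a²H and h(αa, α(b + ω)) = a(b + 1)H - aH ω with H = n(α) hv, so aH is a positive integer.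
    present : ∀ L a b c → 1 ℕ.≤ a → Discriminant (+ a) b c → Multiple (_∈ᴵ ideal L) (+ a) b → PosDefIntegral L →
              Σ ℕ λ r → Presentation L a b c r
    present L a@(suc a₀) b c a≥1 D M (positive , integral) = go (proj₁ (proj₂ O)) R≡
      where
      open ≡-Reasoning
      open Multiple M
      H R : ℚ
      H = n α * hv L
      R = H * ⌈ + a ⌉
      x y : E
      x = α · ⟪ + a , + 0 ⟫
      y = α · ⟪ b , + 1 ⟫
      x≢0 : x ≢ 0E
      x≢0 e = absurd (proj₁ (⟪⟫-injective {q = + 0} {q′ = + 0} (trans (sym (Unit.cancel′ α⁻¹ ⟪ + a , + 0 ⟫)) (trans (cong (Unit.inv α⁻¹ ·_) e) (·-zeroʳ (Unit.inv α⁻¹))))))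
        where
        absurd : + a ≢ + 0
        absurd ()
      P = positive x (first-generator M) x≢0
      k : ℕ
      k = proj₁ P
      hxx : ι ⌈ + k ⌉ ≡ (H * ⌈ + a ℤ.* + a ⌉ , H * ⌈ + 0 ⌉)
      hxx = trans (sym (proj₂ (proj₂ P))) (trans (hU-norm L α ⟪ + a , + 0 ⟫ ⟪ + a , + 0 ⟫) (trans (cong (_· ι H) (a·a (+ a))) (scale-⟪⟫ (+ a ℤ.* + a) (+ 0) H)))
      hxy : hU L x y ≡ (H * ⌈ + a ℤ.* (b ℤ.+ + 1) ⌉ , H * ⌈ ℤ.- + a ⌉)
      hxy = trans (hU-norm L α ⟪ + a , + 0 ⟫ ⟪ b , + 1 ⟫) (trans (cong (_· ι H) (a·b (+ a) b)) (scale-⟪⟫ (+ a ℤ.* (b ℤ.+ + 1)) (ℤ.- + a) H))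
      O = 𝒪-int (integral x y (first-generator M) (second-generator M))
      z : ℤ
      z = proj₁ (proj₂ O)
      R≡ : R ≡ ⌈ ℤ.- z ⌉
      R≡ = begin
        H * ⌈ + a ⌉          ≡⟨ r H ⌈ + a ⌉ ⟩
        - (H * - ⌈ + a ⌉)    ≡⟨ cong (λ t → - (H * t)) (ℤ→ℚ-neg (+ a)) ⟨
        - (H * ⌈ ℤ.- + a ⌉)  ≡⟨ cong -_ (trans (sym (cong proj₂ hxy)) (cong proj₂ (proj₂ (proj₂ O)))) ⟩
        - ⌈ z ⌉              ≡⟨ ℤ→ℚ-neg z ⟨
        ⌈ ℤ.- z ⌉            ∎
        where
        r : ∀ H a → H * a ≡ - (H * - a)
        r = solve-∀-over ℚ-ring
      Ra : (ℤ.- z) ℤ.* + a ≡ + k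
      Ra = ℤ→ℚ-injective (begin
        ⌈ (ℤ.- z) ℤ.* + a ⌉        ≡⟨ ℤ→ℚ-* (ℤ.- z) (+ a) ⟩
        ⌈ ℤ.- z ⌉ * ⌈ + a ⌉        ≡⟨ cong (_* ⌈ + a ⌉) R≡ ⟨
        H * ⌈ + a ⌉ * ⌈ + a ⌉      ≡⟨ ℚₚ.*-assoc H ⌈ + a ⌉ ⌈ + a ⌉ ⟩
        H * (⌈ + a ⌉ * ⌈ + a ⌉)    ≡⟨ cong (H *_) (ℤ→ℚ-* (+ a) (+ a)) ⟨
        H * ⌈ + a ℤ.* + a ⌉        ≡⟨ cong proj₁ hxx ⟨
        ⌈ + k ⌉                    ∎)
      go : ℤ → R ≡ ⌈ ℤ.- z ⌉ → Σ ℕ λ r → Presentation L a b c r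
      go _ _ = find (ℤ.- z) R≡ Ra
        where
        find : ∀ t → R ≡ ⌈ t ⌉ → t ℤ.* + a ≡ + k → Σ ℕ λ r → Presentation L a b c r
        find +[1+ r ] e _ = suc r , presentation a≥1 (ℕ.s≤s ℕ.z≤n) D M e
        find (+ 0) e f = ⊥-elim (ℕₚ.<⇒≢ (proj₁ (proj₂ P)) (ℤₚ.+-injective f))
        find -[1+ r ] e ()

    -- Norms of 𝒪-multiples: if a divides (b + ω)(p + qω), then p + qω has norm a · QF.
    norm-form : ∀ a b c X Y → Discriminant a b c → nℤ (a ℤ.* X ℤ.+ (b ℤ.+ + 1) ℤ.* Y) (ℤ.- Y) ≡ a ℤ.* QF a b c (X , Y)
    norm-form a b c X Y D = trans (r₁ a b X Y (+ N)) (trans (cong (λ t → a ℤ.* (a ℤ.* (X ℤ.* X) ℤ.+ (+ 2 ℤ.* b ℤ.+ + 1) ℤ.* (X ℤ.* Y)) ℤ.+ t ℤ.* (Y ℤ.* Y)) (sym D)) (r₂ a b c X Y))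
      where
      r₁ : ∀ a b X Y N → (a ℤ.* X ℤ.+ (b ℤ.+ + 1) ℤ.* Y) ℤ.* (a ℤ.* X ℤ.+ (b ℤ.+ + 1) ℤ.* Y) ℤ.+ (a ℤ.* X ℤ.+ (b ℤ.+ + 1) ℤ.* Y) ℤ.* (ℤ.- Y) ℤ.+ N ℤ.* ((ℤ.- Y) ℤ.* (ℤ.- Y))
           ≡ a ℤ.* (a ℤ.* (X ℤ.* X) ℤ.+ (+ 2 ℤ.* b ℤ.+ + 1) ℤ.* (X ℤ.* Y)) ℤ.+ (b ℤ.* b ℤ.+ b ℤ.+ N) ℤ.* (Y ℤ.* Y)
      r₁ = solve-∀
      r₂ : ∀ a b c X Y → a ℤ.* (a ℤ.* (X ℤ.* X) ℤ.+ (+ 2 ℤ.* b ℤ.+ + 1) ℤ.* (X ℤ.* Y)) ℤ.+ (a ℤ.* c) ℤ.* (Y ℤ.* Y)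
           ≡ a ℤ.* (a ℤ.* (X ℤ.* X) ℤ.+ (+ 2 ℤ.* b ℤ.+ + 1) ℤ.* (X ℤ.* Y) ℤ.+ c ℤ.* (Y ℤ.* Y))
      r₂ = solve-∀

    sumE-cong : ∀ m {f g : Fin m → E} → (∀ i → f i ≡ g i) → sumE m f ≡ sumE m g
    sumE-cong zero    h = refl
    sumE-cong (suc m) h = cong₂ _+E_ (h Fin.zero) (sumE-cong m (λ i → h (Fin.suc i)))

    sumE-ι : ∀ m (f : Fin m → ℤ) → sumE m (λ i → ι ⌈ f i ⌉) ≡ ι ⌈ sumZ m f ⌉
    sumE-ι zero    f = refl
    sumE-ι (suc m) f = trans (cong (ι ⌈ f Fin.zero ⌉ +E_) (sumE-ι m (λ i → f (Fin.suc i)))) (cong (_, 0ℚ) (sym (ℤ→ℚ-+ (f Fin.zero) _)))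

    sumE-· : ∀ m c (f : Fin m → E) → sumE m (λ i → c · f i) ≡ c · sumE m f
    sumE-· zero    c f = sym (·-zeroʳ c)
    sumE-· (suc m) c f = trans (cong ((c · f Fin.zero) +E_) (sumE-· m c (λ i → f (Fin.suc i)))) (sym (·-distribˡ c (f Fin.zero) _))

    -- Let `u`, `w` be the images of `αa` and `α(b + ω)`. Linearity gives `(b + ω) u = a w` in each
    -- coordinate, which forces `u = aX + Y conj(b + ω)` with integers `X`, `Y`. Such a number has
    -- norm `a QF(X, Y)`, and the norms add up to `h(αa) = ar`.
    represented-sum : ∀ {L a b c r m} → Presentation L a b c r → RepresentedBy L m → SumOf (+ a) b c m r
    represented-sum {L} {a@(suc _)} {b} {c} {r} {m} (presentation _ _ D M value) (f , f𝒪 , f+ , f· , _ , fh) = v , ℤₚ.*-cancelˡ-≡ (+ a) (sumZ m (λ i → QF (+ a) b c (v i))) (+ r) total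
      where
      open ≡-Reasoning
      open Multiple M
      H : ℚ
      H = n α * hv L
      x y : E
      x = α · ⟪ + a , + 0 ⟫
      y = α · ⟪ b , + 1 ⟫
      u w : Fin m → Σ ℤ λ p → ℤ
      u i = proj₁ (𝒪-int (f𝒪 x (first-generator M) i)) , proj₁ (proj₂ (𝒪-int (f𝒪 x (first-generator M) i)))
      w i = proj₁ (𝒪-int (f𝒪 y (second-generator M) i)) , proj₁ (proj₂ (𝒪-int (f𝒪 y (second-generator M) i)))
      fx : ∀ i → f x i ≡ ⟪ proj₁ (u i) , proj₂ (u i) ⟫
      fx i = proj₂ (proj₂ (𝒪-int (f𝒪 x (first-generator M) i)))
      fy : ∀ i → f y i ≡ ⟪ proj₁ (w i) , proj₂ (w i) ⟫
      fy i = proj₂ (proj₂ (𝒪-int (f𝒪 y (second-generator M) i)))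
      v : Fin m → ℤ × ℤ
      -- `X` and `Y` as read off from the ω-coordinates of `(b + ω) u = a w`.
      v i = proj₂ (w i) , ℤ.- proj₂ (u i)
      swap : ⟪ b , + 1 ⟫ · x ≡ ⟪ + a , + 0 ⟫ · y
      swap = trans (rot ⟪ b , + 1 ⟫ α ⟪ + a , + 0 ⟫) (trans (cong (α ·_) (·-comm ⟪ b , + 1 ⟫ ⟪ + a , + 0 ⟫)) (sym (rot ⟪ + a , + 0 ⟫ α ⟪ b , + 1 ⟫)))
        where
        rot : ∀ s t q → s · (t · q) ≡ t · (s · q)
        rot s t q = trans (sym (·-assoc s t q)) (trans (cong (_· q) (·-comm s t)) (·-assoc t s q))
      relation : ∀ i → ⟪ b , + 1 ⟫ · ⟪ proj₁ (u i) , proj₂ (u i) ⟫ ≡ ⟪ + a , + 0 ⟫ · ⟪ proj₁ (w i) , proj₂ (w i) ⟫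
      relation i = begin
        ⟪ b , + 1 ⟫ · ⟪ proj₁ (u i) , proj₂ (u i) ⟫    ≡⟨ cong (⟪ b , + 1 ⟫ ·_) (fx i) ⟨
        ⟪ b , + 1 ⟫ · f x i                            ≡⟨ f· ⟪ b , + 1 ⟫ x ((b , refl) , (+ 1 , refl)) (first-generator M) i ⟨
        f (⟪ b , + 1 ⟫ · x) i                          ≡⟨ cong (λ t → f t i) swap ⟩
        f (⟪ + a , + 0 ⟫ · y) i                        ≡⟨ f· ⟪ + a , + 0 ⟫ y ((+ a , refl) , (+ 0 , refl)) (second-generator M) i ⟩
        ⟪ + a , + 0 ⟫ · f y i                          ≡⟨ cong (⟪ + a , + 0 ⟫ ·_) (fy i) ⟩
        ⟪ + a , + 0 ⟫ · ⟪ proj₁ (w i) , proj₂ (w i) ⟫  ∎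
      u≡ : ∀ i → proj₁ (u i) ≡ + a ℤ.* proj₁ (v i) ℤ.+ (b ℤ.+ + 1) ℤ.* proj₂ (v i)
      u≡ i = solve-p (+ a) b (proj₁ (u i)) (proj₂ (u i)) (proj₁ (w i)) (proj₂ (w i))
        (ℤ→ℚ-injective {b ℤ.* proj₂ (u i) ℤ.+ + 1 ℤ.* proj₁ (u i) ℤ.+ + 1 ℤ.* proj₂ (u i)} {+ a ℤ.* proj₂ (w i) ℤ.+ + 0 ℤ.* proj₁ (w i) ℤ.+ + 0 ℤ.* proj₂ (w i)}
          (cong proj₂ (trans (sym (⟪⟫-· b (+ 1) (proj₁ (u i)) (proj₂ (u i)))) (trans (relation i) (⟪⟫-· (+ a) (+ 0) (proj₁ (w i)) (proj₂ (w i)))))))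
        where
        solve-p : ∀ a b p q w₁ w₂ → b ℤ.* q ℤ.+ + 1 ℤ.* p ℤ.+ + 1 ℤ.* q ≡ a ℤ.* w₂ ℤ.+ + 0 ℤ.* w₁ ℤ.+ + 0 ℤ.* w₂ → p ≡ a ℤ.* w₂ ℤ.+ (b ℤ.+ + 1) ℤ.* (ℤ.- q)
        solve-p a b p q w₁ w₂ e = trans (r₁ b p q) (trans (cong (ℤ._+ (b ℤ.+ + 1) ℤ.* (ℤ.- q)) e) (r₂ a b w₁ w₂ q))
          where
          r₁ : ∀ b p q → p ≡ (b ℤ.* q ℤ.+ + 1 ℤ.* p ℤ.+ + 1 ℤ.* q) ℤ.+ (b ℤ.+ + 1) ℤ.* (ℤ.- q)
          r₁ = solve-∀
          r₂ : ∀ a b w₁ w₂ q → (a ℤ.* w₂ ℤ.+ + 0 ℤ.* w₁ ℤ.+ + 0 ℤ.* w₂) ℤ.+ (b ℤ.+ + 1) ℤ.* (ℤ.- q) ≡ a ℤ.* w₂ ℤ.+ (b ℤ.+ + 1) ℤ.* (ℤ.- q)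
          r₂ = solve-∀
      norms : ∀ i → nℤ (proj₁ (u i)) (proj₂ (u i)) ≡ + a ℤ.* QF (+ a) b c (v i)
      norms i = trans (cong₂ nℤ (u≡ i) (sym (ℤₚ.neg-involutive (proj₂ (u i))))) (norm-form (+ a) b c (proj₁ (v i)) (proj₂ (v i)) D)
      total : + a ℤ.* sumZ m (λ i → QF (+ a) b c (v i)) ≡ + a ℤ.* + r
      total = ℤ→ℚ-injective (begin
        ⌈ + a ℤ.* sumZ m (λ i → QF (+ a) b c (v i)) ⌉   ≡⟨ cong ⌈_⌉ (trans (sym (sumZ-* m (+ a) _)) (sumZ-cong m λ i → sym (norms i))) ⟩
        ⌈ sumZ m (λ i → nℤ (proj₁ (u i)) (proj₂ (u i))) ⌉ ≡⟨ cong proj₁ (trans (sym (sumE-ι m _)) (sumE-cong m λ i → trans (cong ι (sym (n-int (proj₁ (u i)) (proj₂ (u i)))))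
              (trans (sym (x·conj ⟪ proj₁ (u i) , proj₂ (u i) ⟫)) (cong (λ t → t · conj t) (sym (fx i)))))) ⟩
        proj₁ (hI m (f x) (f x))                         ≡⟨ cong proj₁ (trans (fh x x (first-generator M) (first-generator M)) (trans (hU-norm L α ⟪ + a , + 0 ⟫ ⟪ + a , + 0 ⟫) (trans (cong (_· ι H) (a·a (+ a))) (scale-⟪⟫ (+ a ℤ.* + a) (+ 0) H)))) ⟩
        H * ⌈ + a ℤ.* + a ⌉                              ≡⟨ trans (cong (H *_) (ℤ→ℚ-* (+ a) (+ a))) (sym (ℚₚ.*-assoc H ⌈ + a ⌉ ⌈ + a ⌉)) ⟩
        H * ⌈ + a ⌉ * ⌈ + a ⌉                            ≡⟨ trans (cong (_* ⌈ + a ⌉) value) (ℚₚ.*-comm ⌈ + r ⌉ ⌈ + a ⌉) ⟩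
        ⌈ + a ⌉ * ⌈ + r ⌉                                ≡⟨ ℤ→ℚ-* (+ a) (+ r) ⟨
        ⌈ + a ℤ.* + r ⌉                                  ∎)

    -- The map multiplies by the vector `α⁻¹ a⁻¹ u` with `u = aX + Y conj(b + ω)` in each
    -- coordinate. It is integral because `J a b` times each coordinate of `u` lies in `a𝒪`, and it
    -- preserves `h` because the norms of these coordinates add up to `ar`. Injectivity follows from
    -- the anisotropy of `h`.
    sum-represented : ∀ {L a b c r m} → Presentation L a b c r → SumOf (+ a) b c m r → RepresentedBy L m
    sum-represented {L} {a@(suc _)} {b} {c} {r} {m} (presentation _ r≥1 D M value) (v , total) = f ,
      (λ x h i → integral x (to x h) i) , (λ x y _ _ i → ·-distribʳ (w i) x y) , (λ k x _ _ i → ·-assoc k x (w i)) ,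
      (λ x y _ _ e → injective x y e) , (λ x y _ _ → isometric x y)
      where
      open ≡-Reasoning
      open Multiple M
      α′ : E
      α′ = Unit.inv α⁻¹
      A : ℚ
      A = ⌈ + a ⌉
      A≢0 : A ≢ 0ℚ
      A≢0 = ⌈⌉-nonzero {+ a} λ ()
      instance
        nzA : ℚ.NonZero A
        nzA = ℚ.≢-nonZero A≢0
      A⁻¹ : ℚ
      A⁻¹ = ℚ.1/ A
      u : Fin m → E
      u i = ⟪ + a ℤ.* proj₁ (v i) ℤ.+ (b ℤ.+ + 1) ℤ.* proj₂ (v i) , ℤ.- proj₂ (v i) ⟫
      w : Fin m → E
      w i = (α′ · ι A⁻¹) · u i
      f : E → Fin m → E
      f x i = x · w i
      product : ∀ p q X Y → ⟪ p ℤ.* + a ℤ.+ q ℤ.* b , q ⟫ · ⟪ + a ℤ.* X ℤ.+ (b ℤ.+ + 1) ℤ.* Y , ℤ.- Y ⟫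
                ≡ ι A · ⟪ p ℤ.* (+ a ℤ.* X ℤ.+ (b ℤ.+ + 1) ℤ.* Y) ℤ.+ q ℤ.* (b ℤ.* X ℤ.+ c ℤ.* Y) , q ℤ.* X ℤ.- p ℤ.* Y ⟫
      product p q X Y = trans (⟪⟫-· (p ℤ.* + a ℤ.+ q ℤ.* b) q (+ a ℤ.* X ℤ.+ (b ℤ.+ + 1) ℤ.* Y) (ℤ.- Y)) (trans (cong₂ ⟪_,_⟫
          (trans (r₁ (+ a) b (+ N) p q X Y) (trans (cong (λ t → + a ℤ.* (p ℤ.* (+ a ℤ.* X ℤ.+ (b ℤ.+ + 1) ℤ.* Y) ℤ.+ q ℤ.* (b ℤ.* X)) ℤ.+ q ℤ.* t ℤ.* Y) (sym D)) (r₂ (+ a) b c p q X Y)))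
          (r₃ (+ a) b p q X Y))
        (trans (cong₂ _,_ (ℤ→ℚ-* (+ a) s) (ℤ→ℚ-* (+ a) t)) (sym (ι-scale A ⌈ s ⌉ ⌈ t ⌉))))
        where
        s t : ℤ
        s = p ℤ.* (+ a ℤ.* X ℤ.+ (b ℤ.+ + 1) ℤ.* Y) ℤ.+ q ℤ.* (b ℤ.* X ℤ.+ c ℤ.* Y)
        t = q ℤ.* X ℤ.- p ℤ.* Y
        r₁ : ∀ a b N p q X Y → (p ℤ.* a ℤ.+ q ℤ.* b) ℤ.* (a ℤ.* X ℤ.+ (b ℤ.+ + 1) ℤ.* Y) ℤ.- N ℤ.* (q ℤ.* (ℤ.- Y))
             ≡ a ℤ.* (p ℤ.* (a ℤ.* X ℤ.+ (b ℤ.+ + 1) ℤ.* Y) ℤ.+ q ℤ.* (b ℤ.* X)) ℤ.+ q ℤ.* (b ℤ.* b ℤ.+ b ℤ.+ N) ℤ.* Y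
        r₁ = solve-∀
        r₂ : ∀ a b c p q X Y → a ℤ.* (p ℤ.* (a ℤ.* X ℤ.+ (b ℤ.+ + 1) ℤ.* Y) ℤ.+ q ℤ.* (b ℤ.* X)) ℤ.+ q ℤ.* (a ℤ.* c) ℤ.* Y
             ≡ a ℤ.* (p ℤ.* (a ℤ.* X ℤ.+ (b ℤ.+ + 1) ℤ.* Y) ℤ.+ q ℤ.* (b ℤ.* X ℤ.+ c ℤ.* Y))
        r₂ = solve-∀
        r₃ : ∀ a b p q X Y → (p ℤ.* a ℤ.+ q ℤ.* b) ℤ.* (ℤ.- Y) ℤ.+ q ℤ.* (a ℤ.* X ℤ.+ (b ℤ.+ + 1) ℤ.* Y) ℤ.+ q ℤ.* (ℤ.- Y) ≡ a ℤ.* (q ℤ.* X ℤ.- p ℤ.* Y)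
        r₃ = solve-∀
      integral : ∀ x → J (+ a) b (α′ · x) → ∀ i → Is𝒪 (f x i)
      integral x (p , q , e) i = int-𝒪 (p ℤ.* (+ a ℤ.* X ℤ.+ (b ℤ.+ + 1) ℤ.* Y) ℤ.+ q ℤ.* (b ℤ.* X ℤ.+ c ℤ.* Y)) (q ℤ.* X ℤ.- p ℤ.* Y) (begin
          x · ((α′ · ι A⁻¹) · u i)    ≡⟨ ·-assoc x (α′ · ι A⁻¹) (u i) ⟨
          (x · (α′ · ι A⁻¹)) · u i    ≡⟨ cong (_· u i) (trans (sym (·-assoc x α′ (ι A⁻¹))) (trans (cong (_· ι A⁻¹) (·-comm x α′)) (·-comm (α′ · x) (ι A⁻¹)))) ⟩
          (ι A⁻¹ · (α′ · x)) · u i    ≡⟨ ·-assoc (ι A⁻¹) (α′ · x) (u i) ⟩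
          ι A⁻¹ · ((α′ · x) · u i)    ≡⟨ cong (ι A⁻¹ ·_) (trans (cong (_· u i) e) (product p q X Y)) ⟩
          ι A⁻¹ · (ι A · z)           ≡⟨ ·-assoc (ι A⁻¹) (ι A) z ⟨
          (ι A⁻¹ · ι A) · z           ≡⟨ cong (_· z) (trans (ι-· A⁻¹ A) (cong ι (ℚₚ.*-inverseˡ A))) ⟩
          1E · z                      ≡⟨ ·-identityˡ z ⟩
          z                           ∎)
        where
        X = proj₁ (v i)
        Y = proj₂ (v i)
        z = ⟪ p ℤ.* (+ a ℤ.* X ℤ.+ (b ℤ.+ + 1) ℤ.* Y) ℤ.+ q ℤ.* (b ℤ.* X ℤ.+ c ℤ.* Y) , q ℤ.* X ℤ.- p ℤ.* Y ⟫
      sum-u : sumE m (λ i → u i · conj (u i)) ≡ ι (A * ⌈ + r ⌉)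
      sum-u = begin
        sumE m (λ i → u i · conj (u i))                        ≡⟨ sumE-cong m (λ i → trans (x·conj (u i)) (cong ι (trans (n-int (+ a ℤ.* proj₁ (v i) ℤ.+ (b ℤ.+ + 1) ℤ.* proj₂ (v i)) (ℤ.- proj₂ (v i))) (cong ⌈_⌉ (norm-form (+ a) b c (proj₁ (v i)) (proj₂ (v i)) D))))) ⟩
        sumE m (λ i → ι ⌈ + a ℤ.* QF (+ a) b c (v i) ⌉)        ≡⟨ sumE-ι m _ ⟩
        ι ⌈ sumZ m (λ i → + a ℤ.* QF (+ a) b c (v i)) ⌉        ≡⟨ cong (λ t → ι ⌈ t ⌉) (trans (sumZ-* m (+ a) _) (cong (+ a ℤ.*_) total)) ⟩
        ι ⌈ + a ℤ.* + r ⌉                                      ≡⟨ cong ι (ℤ→ℚ-* (+ a) (+ r)) ⟩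
        ι (A * ⌈ + r ⌉)                                        ∎
      κ : E
      κ = α′ · ι A⁻¹
      nκ : n κ * (A * ⌈ + r ⌉) ≡ hv L
      -- By the definition of the scale, `ar = a² n(α) hv`, and the norm of `κ` is the inverse of
      -- `a² n(α)`.
      nκ = begin
        n κ * (A * ⌈ + r ⌉)                              ≡⟨ cong₂ _*_ (n-· α′ (ι A⁻¹)) (cong (A *_) (sym value)) ⟩
        n α′ * n (ι A⁻¹) * (A * (n α * hv L * A))        ≡⟨ cong (λ t → n α′ * t * (A * (n α * hv L * A))) (n-ι A⁻¹) ⟩
        n α′ * (A⁻¹ * A⁻¹) * (A * (n α * hv L * A))      ≡⟨ r₁ (n α′) (n α) A⁻¹ A (hv L) ⟩
        (n α * n α′) * ((A⁻¹ * A) * (A⁻¹ * A)) * hv L    ≡⟨ cong₂ (λ s t → s * (t * t) * hv L) (Unit.norms α⁻¹) (ℚₚ.*-inverseˡ A) ⟩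
        1ℚ * (1ℚ * 1ℚ) * hv L                            ≡⟨ r₂ (hv L) ⟩
        hv L ∎
        where
        r₁ : ∀ s t i A h → s * (i * i) * (A * (t * h * A)) ≡ (t * s) * ((i * A) * (i * A)) * h
        r₁ = solve-∀-over ℚ-ring
        r₂ : ∀ h → 1ℚ * (1ℚ * 1ℚ) * h ≡ h
        r₂ = solve-∀-over ℚ-ring
        n-ι : ∀ p → n (ι p) ≡ p * p
        n-ι p = r₃ (Tr d) (Nm d) p
          where
          r₃ : ∀ T N p → p * p + T * (p * 0ℚ) + N * (0ℚ * 0ℚ) ≡ p * p
          r₃ = solve-∀-over ℚ-ring
      isometric : ∀ x y → hI m (f x) (f y) ≡ hU L x y
      isometric x y = begin
        sumE m (λ i → (x · w i) · conj (y · w i))                      ≡⟨ sumE-cong m (λ i → trans (cong ((x · w i) ·_) (conj-· y (w i))) (interchange x (w i) (conj y) (conj (w i)))) ⟩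
        sumE m (λ i → (x · conj y) · (w i · conj (w i)))               ≡⟨ sumE-· m (x · conj y) _ ⟩
        (x · conj y) · sumE m (λ i → w i · conj (w i))                 ≡⟨ cong ((x · conj y) ·_) (begin
          sumE m (λ i → (κ · u i) · conj (κ · u i))                    ≡⟨ sumE-cong m (λ i → trans (cong ((κ · u i) ·_) (conj-· κ (u i))) (trans (interchange κ (u i) (conj κ) (conj (u i))) (cong (_· (u i · conj (u i))) (x·conj κ)))) ⟩
          sumE m (λ i → ι (n κ) · (u i · conj (u i)))                  ≡⟨ trans (sumE-· m (ι (n κ)) _) (cong (ι (n κ) ·_) sum-u) ⟩
          ι (n κ) · ι (A * ⌈ + r ⌉)                                    ≡⟨ trans (ι-· (n κ) (A * ⌈ + r ⌉)) (cong ι nκ) ⟩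
          ι (hv L)                                                     ∎) ⟩
        (x · conj y) · ι (hv L)                                        ∎
      hv≢0 : hv L ≢ 0ℚ
      hv≢0 e = ℕₚ.<⇒≢ r≥1 (sym (ℤₚ.+-injective (ℤ→ℚ-injective (trans (sym value) (trans (cong (λ t → n α * t * A) e) (r₀ (n α) A))))))
        where
        r₀ : ∀ s A → s * 0ℚ * A ≡ 0ℚ
        r₀ = solve-∀-over ℚ-ring
      injective : ∀ x y → (∀ i → f x i ≡ f y i) → x ≡ y
      injective x y e = -E-zero (n-zero z (*-zero-cancel hv≢0 (trans (ℚₚ.*-comm (hv L) (n z)) (cong proj₁ (begin
        ι (n z * hv L)                    ≡⟨ trans (sym (ι-· (n z) (hv L))) (cong (_· ι (hv L)) (sym (x·conj z))) ⟩
        hU L z z                          ≡⟨ isometric z z ⟨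
        hI m (f z) (f z)                  ≡⟨ sumE-cong m (λ i → trans (cong (_· conj (f z i)) (vanish i)) (0·x (conj (f z i)))) ⟩
        sumE m (λ _ → 0E)                 ≡⟨ sumE-zero m ⟩
        0E                                ∎)))))
        where
        z : E
        z = x -E y
        vanish : ∀ i → f z i ≡ 0E
        vanish i = trans (·-distribʳ (w i) x (-E y)) (trans (cong₂ _+E_ (e i) (trans (·-comm (-E y) (w i)) (trans (·-negʳ (w i) y) (cong -E_ (·-comm (w i) y))))) (-E-self (y · w i)))
        sumE-zero : ∀ m → sumE m (λ _ → 0E) ≡ 0E
        sumE-zero zero    = refl
        sumE-zero (suc m) = cong (0E +E_) (sumE-zero m)

-- Boolean searches for sums of values.

module Searches where

  open import Data.Nat.DivMod using (_%_; _/_)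
  open Parity using (par)
  open ThreeSquares using (three-odd-squares)
  open Presentations using (sumZ; sumZ-cong; QF; SumOf)
  open import Data.Bool.Base using (T)

  -- Unlike the library's any and all, these evaluate quickly during type checking.
  some every : ∀ {A : Set} → (A → Bool) → List A → Bool
  some p []       = false
  some p (x ∷ xs) = if p x then true else some p xs
  every p []       = true
  every p (x ∷ xs) = if p x then every p xs else false

  some< every< : (ℕ → Bool) → ℕ → Bool
  some< p zero    = false
  some< p (suc n) = if p n then true else some< p n
  every< p zero    = true
  every< p (suc n) = if p n then every< p n else false

  some-sound : ∀ {A : Set} (p : A → Bool) xs → T (some p xs) → Σ A λ x → x ∈ xs × T (p x)
  some-sound {A} p (x ∷ xs) h = go (p x) refl h
    where
    go : ∀ b → p x ≡ b → T (if b then true else some p xs) → Σ A λ y → y ∈ x ∷ xs × T (p y)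
    go true  e _ = x , here refl , subst T (sym e) _
    go false _ h = let (y , m , q) = some-sound p xs h in y , there m , q

  some-complete : ∀ {A : Set} (p : A → Bool) {xs x} → x ∈ xs → T (p x) → T (some p xs)
  some-complete {A} p {x ∷ xs} m h = go (p x) refl m
    where
    go : ∀ b → p x ≡ b → _ ∈ x ∷ xs → T (if b then true else some p xs)
    go true  _ _           = _
    go false e (here refl) = ⊥-elim (subst T e h)
    go false _ (there m)   = some-complete p m h

  every-sound : ∀ {A : Set} (p : A → Bool) xs → T (every p xs) → ∀ {x} → x ∈ xs → T (p x)
  every-sound p (x ∷ xs) h = go (p x) refl h
    where
    go : ∀ b → p x ≡ b → T (if b then every p xs else false) → ∀ {y} → y ∈ x ∷ xs → T (p y)
    go true e h (here refl) = subst T (sym e) _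
    go true e h (there m)   = every-sound p xs h m

  some<-sound : ∀ p n → T (some< p n) → Σ ℕ λ x → T (p x)
  some<-sound p (suc n) h = go (p n) refl h
    where
    go : ∀ b → p n ≡ b → T (if b then true else some< p n) → Σ ℕ λ y → T (p y)
    go true  e _ = n , subst T (sym e) _
    go false _ h = some<-sound p n h

  every<-sound : ∀ p n → T (every< p n) → ∀ {x} → x ℕ.< n → T (p x)
  every<-sound p (suc n) h {x} x<n = go (p n) refl h (ℕₚ.m≤n⇒m<n∨m≡n (ℕₚ.≤-pred x<n))
    where
    go : ∀ b → p n ≡ b → T (if b then every< p n else false) → x ℕ.< n ⊎ x ≡ n → T (p x)
    go true e _ (inj₂ refl) = subst T (sym e) _
    go true e h (inj₁ x<n)  = every<-sound p n h x<n

  ∧-T : ∀ {p q} → T (p ∧ q) → T p × T q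
  ∧-T = Equivalence.to T-∧

  ∨-T : ∀ {p q} → T (p ∨ q) → T p ⊎ T q
  ∨-T = Equivalence.to T-∨

  module _ (a b c : ℤ) where

    cons : ∀ {m r s} v → QF a b c v ≡ + s → SumOf a b c m r → SumOf a b c (suc m) (s ℕ.+ r)
    cons {m} {r} {s} v e (f , h) = g , cong₂ ℤ._+_ e h
      where
      g : Fin (suc m) → ℤ × ℤ
      g Fin.zero    = v
      g (Fin.suc i) = f i

    nil : SumOf a b c 0 0
    nil = (λ ()) , refl

    QF-axis : ∀ x → QF a b c (x , + 0) ≡ a ℤ.* (x ℤ.* x)
    QF-axis x = r a b c x
      where
      r : ∀ a b c x → a ℤ.* (x ℤ.* x) ℤ.+ (+ 2 ℤ.* b ℤ.+ + 1) ℤ.* (x ℤ.* + 0) ℤ.+ c ℤ.* (+ 0 ℤ.* + 0) ≡ a ℤ.* (x ℤ.* x)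
      r = solve-∀

    pad₁ : ∀ {m r} → SumOf a b c m r → SumOf a b c (suc m) r
    pad₁ = cons (+ 0 , + 0) (trans (QF-axis (+ 0)) (ℤₚ.*-zeroʳ a))

    pad : ∀ {m r} n → SumOf a b c m r → SumOf a b c (n ℕ.+ m) r
    pad zero    s = s
    pad (suc n) s = pad₁ (pad n s)

  -- The substitution `X ↦ -X` exchanges the forms of an ideal and of its conjugate, so `𝔘₂` and
  -- `𝔘₃` can share one search.
  reflect : ∀ a b c {m r} → SumOf a b c m r → SumOf a (ℤ.- (+ 1 ℤ.+ b)) c m r
  reflect a b c {m} (f , h) = (λ i → ℤ.- proj₁ (f i) , proj₂ (f i)) , trans (sumZ-cong m (λ i → r a b c (proj₁ (f i)) (proj₂ (f i)))) h
    where
    r : ∀ a b c X Y → a ℤ.* (ℤ.- X ℤ.* ℤ.- X) ℤ.+ (+ 2 ℤ.* (ℤ.- (+ 1 ℤ.+ b)) ℤ.+ + 1) ℤ.* (ℤ.- X ℤ.* Y) ℤ.+ c ℤ.* (Y ℤ.* Y)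
        ≡ a ℤ.* (X ℤ.* X) ℤ.+ (+ 2 ℤ.* b ℤ.+ + 1) ℤ.* (X ℤ.* Y) ℤ.+ c ℤ.* (Y ℤ.* Y)
    r = solve-∀

  square-abs : ∀ x → x ℤ.* x ≡ + (ℤ.∣ x ∣ ℕ.* ℤ.∣ x ∣)
  square-abs (+ 0)    = refl
  square-abs +[1+ _ ] = refl
  square-abs -[1+ _ ] = refl

  Squares₂ Squares₃ : ℕ → Set
  Squares₂ n = Σ ℕ λ x → Σ ℕ λ y → x ℕ.* x ℕ.+ y ℕ.* y ≡ n
  Squares₃ n = Σ ℕ λ x → Σ ℕ λ y → Σ ℕ λ z → x ℕ.* x ℕ.+ (y ℕ.* y ℕ.+ z ℕ.* z) ≡ n

  three-squares : ∀ j → Squares₃ (8 ℕ.* j ℕ.+ 3)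
  three-squares j = go (three-odd-squares j)
    where
    go : (Σ ℤ λ x → Σ ℤ λ y → Σ ℤ λ z → x ℤ.* x ℤ.+ y ℤ.* y ℤ.+ z ℤ.* z ≡ + 8 ℤ.* + j ℤ.+ + 3 × par x ≡ true × par y ≡ true × par z ≡ true) → Squares₃ (8 ℕ.* j ℕ.+ 3)
    go (x , y , z , e , _) = ℤ.∣ x ∣ , ℤ.∣ y ∣ , ℤ.∣ z ∣ , ℤₚ.+-injective (trans (cong₂ ℤ._+_ (sym (square-abs x)) (cong₂ ℤ._+_ (sym (square-abs y)) (sym (square-abs z))))
      (trans (sym (ℤₚ.+-assoc (x ℤ.* x) (y ℤ.* y) (z ℤ.* z))) (trans e (cong (ℤ._+ + 3) (sym (ℤₚ.pos-* 8 j))))))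

  twice-squares : ∀ {n} → Squares₃ n → Squares₃ (4 ℕ.* n)
  twice-squares (x , y , z , refl) = 2 ℕ.* x , 2 ℕ.* y , 2 ℕ.* z , r x y z
    where
    r : ∀ x y z → 2 ℕ.* x ℕ.* (2 ℕ.* x) ℕ.+ (2 ℕ.* y ℕ.* (2 ℕ.* y) ℕ.+ 2 ℕ.* z ℕ.* (2 ℕ.* z)) ≡ 4 ℕ.* (x ℕ.* x ℕ.+ (y ℕ.* y ℕ.+ z ℕ.* z))
    r = solveℕ

  residue : ∀ n m s → .{{_ : ℕ.NonZero m}} → T (n % m ≡ᵇ s) → n ≡ m ℕ.* (n / m) ℕ.+ s
  residue n m s h = trans (ℕD.m≡m%n+[m/n]*n n m) (trans (ℕₚ.+-comm (n % m) _) (cong₂ ℕ._+_ (ℕₚ.*-comm (n / m) m) (ℕₚ.≡ᵇ⇒≡ (n % m) s h)))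

  twelve-mod-32 : ∀ j → Squares₃ (32 ℕ.* j ℕ.+ 12)
  twelve-mod-32 j = subst Squares₃ (r j) (twice-squares (three-squares j))
    where
    r : ∀ j → 4 ℕ.* (8 ℕ.* j ℕ.+ 3) ≡ 32 ℕ.* j ℕ.+ 12
    r = solveℕ

  -- Searches x ≤ a and y ≥ b with x² + y² = n, moving x down or y up.
  two? two-down : ℕ → ℕ → ℕ → ℕ → Bool
  two? zero       x y n = false
  two? (suc fuel) x y n = if s ≡ᵇ n then true else if s <ᵇ n then two? fuel x (suc y) n else two-down fuel x y n
    where
    s = x ℕ.* x ℕ.+ y ℕ.* y
  two-down fuel zero    y n = false
  two-down fuel (suc x) y n = two? fuel x y n

  two-sound : ∀ fuel x y n → T (two? fuel x y n) → Squares₂ n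
  two-sound (suc fuel) x y n h = found (x ℕ.* x ℕ.+ y ℕ.* y ≡ᵇ n) refl (x ℕ.* x ℕ.+ y ℕ.* y <ᵇ n) x h
    where
    found : ∀ p → (x ℕ.* x ℕ.+ y ℕ.* y ≡ᵇ n) ≡ p → ∀ q x′ → T (if p then true else if q then two? fuel x (suc y) n else two-down fuel x′ y n) → Squares₂ n
    found true  e _    _       h = x , y , ℕₚ.≡ᵇ⇒≡ _ n (subst T (sym e) _)
    found false e true _       h = two-sound fuel x (suc y) n h
    found false e false (suc x′) h = two-sound fuel x′ y n h

  -- Only soundness is claimed, so starting points and fuel just have to be large enough for the
  -- numbers that occur; 10 suffices below 120 because `11² > 120`. The class `3 (mod 4)` contains
  -- no sums of two squares and is discarded at once.
  squares₂? : ℕ → Bool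
  squares₂? n = not (n % 4 ≡ᵇ 3) ∧ (if n <ᵇ 120 then two? 22 10 0 n else two? 90 42 0 n)

  squares₂-sound : ∀ n → T (squares₂? n) → Squares₂ n
  squares₂-sound n h = go (n <ᵇ 120) (proj₂ (∧-T {not (n % 4 ≡ᵇ 3)} h))
    where
    go : ∀ p → T (if p then two? 22 10 0 n else two? 90 42 0 n) → Squares₂ n
    go true  = two-sound 22 10 0 n
    go false = two-sound 90 42 0 n

  -- The first two alternatives rest on the three squares theorem and cover whole residue classes.
  -- Other numbers are searched with one root below 21, after discarding `7 (mod 8)` and
  -- `28 (mod 32)`, which are never sums of three squares.
  squares₃? : ℕ → Bool
  squares₃? n = (n % 8 ≡ᵇ 3) ∨ (n % 32 ≡ᵇ 12) ∨ (not (n % 8 ≡ᵇ 7) ∧ not (n % 32 ≡ᵇ 28)) ∧ some< (λ z → (z ℕ.* z ≤ᵇ n) ∧ squares₂? (n ℕ.∸ z ℕ.* z)) 21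

  squares₃-sound : ∀ n → T (squares₃? n) → Squares₃ n
  squares₃-sound n h = first (∨-T {n % 8 ≡ᵇ 3} h)
    where
    small? : ℕ → Bool
    small? z = (z ℕ.* z ≤ᵇ n) ∧ squares₂? (n ℕ.∸ z ℕ.* z)
    third : (Σ ℕ λ z → T (small? z)) → Squares₃ n
    third (z , t) = z , proj₁ s , proj₁ (proj₂ s) , trans (cong (z ℕ.* z ℕ.+_) (proj₂ (proj₂ s))) (ℕₚ.m+[n∸m]≡n (ℕₚ.≤ᵇ⇒≤ (z ℕ.* z) n (proj₁ (∧-T {z ℕ.* z ≤ᵇ n} t))))
      where
      s : Squares₂ (n ℕ.∸ z ℕ.* z)
      s = squares₂-sound (n ℕ.∸ z ℕ.* z) (proj₂ (∧-T {z ℕ.* z ≤ᵇ n} t))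
    second : T (n % 32 ≡ᵇ 12) ⊎ T ((not (n % 8 ≡ᵇ 7) ∧ not (n % 32 ≡ᵇ 28)) ∧ some< small? 21) → Squares₃ n
    second (inj₁ p) = subst Squares₃ (sym (residue n 32 12 p)) (twelve-mod-32 (n / 32))
    second (inj₂ p) = third (some<-sound small? 21 (proj₂ (∧-T {not (n % 8 ≡ᵇ 7) ∧ not (n % 32 ≡ᵇ 28)} p)))
    first : T (n % 8 ≡ᵇ 3) ⊎ T ((n % 32 ≡ᵇ 12) ∨ (not (n % 8 ≡ᵇ 7) ∧ not (n % 32 ≡ᵇ 28)) ∧ some< small? 21) → Squares₃ n
    first (inj₁ p) = subst Squares₃ (sym (residue n 8 3 p)) (three-squares (n / 8))
    first (inj₂ q) = second (∨-T {n % 32 ≡ᵇ 12} q)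

  ints : ℕ → List ℤ
  ints B = map (λ i → + i ℤ.- + B) (upTo (suc (B ℕ.+ B)))

  ∈-ints : ∀ {B} x → ℤ.∣ x ∣ ℕ.≤ B → x ∈ ints B
  ∈-ints {B} x h = subst (_∈ ints B) (trans (cong (ℤ._- + B) (proj₁ (shifted x h))) (r x (+ B))) (∈-map⁺ _ (∈-upTo⁺ (s≤s (proj₂ (shifted x h)))))
    where
    r : ∀ x b → (x ℤ.+ b) ℤ.- b ≡ x
    r = solve-∀
    shifted : ∀ x → ℤ.∣ x ∣ ℕ.≤ B → + ℤ.∣ x ℤ.+ + B ∣ ≡ x ℤ.+ + B × ℤ.∣ x ℤ.+ + B ∣ ℕ.≤ B ℕ.+ B
    shifted (+ n) h = refl , ℕₚ.+-monoˡ-≤ B h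
    shifted -[1+ n ] h rewrite ℤₚ.⊖-≥ h = refl , ℕₚ.≤-trans (ℕₚ.m∸n≤m B (suc n)) (ℕₚ.m≤m+n B B)

  -- A positive definite form k X² + (2b + 1) X Y + c Y² of discriminant -d.
  module Form (d k c : ℕ) (b : ℤ) (k≥1 : 1 ℕ.≤ k) (c≥1 : 1 ℕ.≤ c)
              (disc : + 4 ℤ.* (+ k ℤ.* + c) ≡ (+ 2 ℤ.* b ℤ.+ + 1) ℤ.* (+ 2 ℤ.* b ℤ.+ + 1) ℤ.+ + d) where

    Q : ℤ × ℤ → ℤ
    Q = QF (+ k) b (+ c)

    -- Completing the square gives the positivity of `Q` and, together with the mirror image `4cQ`,
    -- bounds for `Y` and `X` in terms of the value.
    4kQ : ∀ X Y → + 4 ℤ.* (+ k ℤ.* Q (X , Y)) ≡ (+ 2 ℤ.* + k ℤ.* X ℤ.+ (+ 2 ℤ.* b ℤ.+ + 1) ℤ.* Y) ℤ.* (+ 2 ℤ.* + k ℤ.* X ℤ.+ (+ 2 ℤ.* b ℤ.+ + 1) ℤ.* Y) ℤ.+ + d ℤ.* (Y ℤ.* Y)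
    4kQ X Y = trans (r₁ (+ k) b (+ c) X Y) (trans (cong (λ t → + 4 ℤ.* (+ k ℤ.* (+ k ℤ.* (X ℤ.* X) ℤ.+ (+ 2 ℤ.* b ℤ.+ + 1) ℤ.* (X ℤ.* Y))) ℤ.+ t ℤ.* (Y ℤ.* Y)) disc) (r₂ (+ k) b (+ d) X Y))
      where
      r₁ : ∀ k b c X Y → + 4 ℤ.* (k ℤ.* (k ℤ.* (X ℤ.* X) ℤ.+ (+ 2 ℤ.* b ℤ.+ + 1) ℤ.* (X ℤ.* Y) ℤ.+ c ℤ.* (Y ℤ.* Y)))
           ≡ + 4 ℤ.* (k ℤ.* (k ℤ.* (X ℤ.* X) ℤ.+ (+ 2 ℤ.* b ℤ.+ + 1) ℤ.* (X ℤ.* Y))) ℤ.+ + 4 ℤ.* (k ℤ.* c) ℤ.* (Y ℤ.* Y)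
      r₁ = solve-∀
      r₂ : ∀ k b d X Y → + 4 ℤ.* (k ℤ.* (k ℤ.* (X ℤ.* X) ℤ.+ (+ 2 ℤ.* b ℤ.+ + 1) ℤ.* (X ℤ.* Y))) ℤ.+ ((+ 2 ℤ.* b ℤ.+ + 1) ℤ.* (+ 2 ℤ.* b ℤ.+ + 1) ℤ.+ d) ℤ.* (Y ℤ.* Y)
           ≡ (+ 2 ℤ.* k ℤ.* X ℤ.+ (+ 2 ℤ.* b ℤ.+ + 1) ℤ.* Y) ℤ.* (+ 2 ℤ.* k ℤ.* X ℤ.+ (+ 2 ℤ.* b ℤ.+ + 1) ℤ.* Y) ℤ.+ d ℤ.* (Y ℤ.* Y)
      r₂ = solve-∀

    4cQ : ∀ X Y → + 4 ℤ.* (+ c ℤ.* Q (X , Y)) ≡ (+ 2 ℤ.* + c ℤ.* Y ℤ.+ (+ 2 ℤ.* b ℤ.+ + 1) ℤ.* X) ℤ.* (+ 2 ℤ.* + c ℤ.* Y ℤ.+ (+ 2 ℤ.* b ℤ.+ + 1) ℤ.* X) ℤ.+ + d ℤ.* (X ℤ.* X)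
    4cQ X Y = trans (r₁ (+ k) b (+ c) X Y) (trans (cong (λ t → + 4 ℤ.* (+ c ℤ.* (+ c ℤ.* (Y ℤ.* Y) ℤ.+ (+ 2 ℤ.* b ℤ.+ + 1) ℤ.* (X ℤ.* Y))) ℤ.+ t ℤ.* (X ℤ.* X)) disc) (r₂ (+ c) b (+ d) X Y))
      where
      r₁ : ∀ k b c X Y → + 4 ℤ.* (c ℤ.* (k ℤ.* (X ℤ.* X) ℤ.+ (+ 2 ℤ.* b ℤ.+ + 1) ℤ.* (X ℤ.* Y) ℤ.+ c ℤ.* (Y ℤ.* Y)))
           ≡ + 4 ℤ.* (c ℤ.* (c ℤ.* (Y ℤ.* Y) ℤ.+ (+ 2 ℤ.* b ℤ.+ + 1) ℤ.* (X ℤ.* Y))) ℤ.+ + 4 ℤ.* (k ℤ.* c) ℤ.* (X ℤ.* X)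
      r₁ = solve-∀
      r₂ : ∀ c b d X Y → + 4 ℤ.* (c ℤ.* (c ℤ.* (Y ℤ.* Y) ℤ.+ (+ 2 ℤ.* b ℤ.+ + 1) ℤ.* (X ℤ.* Y))) ℤ.+ ((+ 2 ℤ.* b ℤ.+ + 1) ℤ.* (+ 2 ℤ.* b ℤ.+ + 1) ℤ.+ d) ℤ.* (X ℤ.* X)
           ≡ (+ 2 ℤ.* c ℤ.* Y ℤ.+ (+ 2 ℤ.* b ℤ.+ + 1) ℤ.* X) ℤ.* (+ 2 ℤ.* c ℤ.* Y ℤ.+ (+ 2 ℤ.* b ℤ.+ + 1) ℤ.* X) ℤ.+ d ℤ.* (X ℤ.* X)
      r₂ = solve-∀

    nonneg : ∀ v → + ℤ.∣ Q v ∣ ≡ Q v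
    nonneg v@(X , Y) = go (Q v) (4kQ X Y)
      where
      W = + 2 ℤ.* + k ℤ.* X ℤ.+ (+ 2 ℤ.* b ℤ.+ + 1) ℤ.* Y
      rhs : W ℤ.* W ℤ.+ + d ℤ.* (Y ℤ.* Y) ≡ + (ℤ.∣ W ∣ ℕ.* ℤ.∣ W ∣ ℕ.+ d ℕ.* (ℤ.∣ Y ∣ ℕ.* ℤ.∣ Y ∣))
      rhs = cong₂ ℤ._+_ (square-abs W) (trans (cong (+ d ℤ.*_) (square-abs Y)) (sym (ℤₚ.pos-* d _)))
      go : ∀ q → + 4 ℤ.* (+ k ℤ.* q) ≡ W ℤ.* W ℤ.+ + d ℤ.* (Y ℤ.* Y) → + ℤ.∣ q ∣ ≡ q
      go (+ _) _ = refl
      go -[1+ q ] e = ⊥-elim (negative k k≥1 (trans e rhs))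
        where
        negative : ∀ k → 1 ℕ.≤ k → ∀ {m} → + 4 ℤ.* (+ k ℤ.* -[1+ q ]) ≡ + m → ⊥
        negative (suc _) _ ()

    value : ℤ × ℤ → ℕ
    value v = ℤ.∣ Q v ∣

    bound : ∀ t W e q → + 4 ℤ.* (+ t ℤ.* + q) ≡ W ℤ.* W ℤ.+ + d ℤ.* (e ℤ.* e) → d ℕ.* (ℤ.∣ e ∣ ℕ.* ℤ.∣ e ∣) ℕ.≤ 4 ℕ.* (t ℕ.* q)
    bound t W e q h = subst (d ℕ.* (ℤ.∣ e ∣ ℕ.* ℤ.∣ e ∣) ℕ.≤_) total (ℕₚ.m≤n+m _ (ℤ.∣ W ∣ ℕ.* ℤ.∣ W ∣))
      where
      total : ℤ.∣ W ∣ ℕ.* ℤ.∣ W ∣ ℕ.+ d ℕ.* (ℤ.∣ e ∣ ℕ.* ℤ.∣ e ∣) ≡ 4 ℕ.* (t ℕ.* q)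
      total = ℤₚ.+-injective (trans (cong₂ ℤ._+_ (sym (square-abs W)) (trans (ℤₚ.pos-* d _) (cong (+ d ℤ.*_) (sym (square-abs e)))))
        (trans (sym h) (sym (trans (ℤₚ.pos-* 4 (t ℕ.* q)) (cong (+ 4 ℤ.*_) (ℤₚ.pos-* t q))))))

    bound-Y : ∀ X Y → d ℕ.* (ℤ.∣ Y ∣ ℕ.* ℤ.∣ Y ∣) ℕ.≤ 4 ℕ.* (k ℕ.* value (X , Y))
    bound-Y X Y = bound k (+ 2 ℤ.* + k ℤ.* X ℤ.+ (+ 2 ℤ.* b ℤ.+ + 1) ℤ.* Y) Y (value (X , Y)) (trans (cong (λ q → + 4 ℤ.* (+ k ℤ.* q)) (nonneg (X , Y))) (4kQ X Y))

    bound-X : ∀ X Y → d ℕ.* (ℤ.∣ X ∣ ℕ.* ℤ.∣ X ∣) ℕ.≤ 4 ℕ.* (c ℕ.* value (X , Y))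
    bound-X X Y = bound c (+ 2 ℤ.* + c ℤ.* Y ℤ.+ (+ 2 ℤ.* b ℤ.+ + 1) ℤ.* X) X (value (X , Y)) (trans (cong (λ q → + 4 ℤ.* (+ c ℤ.* q)) (nonneg (X , Y))) (4cQ X Y))

    -- n ≤ B as soon as d (B + 1)² exceeds the bound on d n².
    within : ∀ n t v M B → d ℕ.* (n ℕ.* n) ℕ.≤ 4 ℕ.* (t ℕ.* v) → v ℕ.≤ M → T (4 ℕ.* (t ℕ.* M) <ᵇ d ℕ.* (suc B ℕ.* suc B)) → n ℕ.≤ B
    within n t v M B h v≤M s = ℕₚ.≮⇒≥ λ B<n → ℕₚ.<-irrefl refl (ℕₚ.<-≤-trans (ℕₚ.<ᵇ⇒< _ _ s)
      (ℕₚ.≤-trans (ℕₚ.*-monoʳ-≤ d (ℕₚ.*-mono-≤ B<n B<n)) (ℕₚ.≤-trans h (ℕₚ.*-monoʳ-≤ 4 (ℕₚ.*-monoʳ-≤ t v≤M)))))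

    values : ℕ → ℕ → List ℕ
    values x y = map value (cartesianProduct (ints x) (ints y))

    ∈-values : ∀ M x y v → value v ℕ.≤ M → T (4 ℕ.* (c ℕ.* M) <ᵇ d ℕ.* (suc x ℕ.* suc x)) → T (4 ℕ.* (k ℕ.* M) <ᵇ d ℕ.* (suc y ℕ.* suc y)) → value v ∈ values x y
    ∈-values M x y (X , Y) h p q = ∈-map⁺ value (∈-cartesianProduct⁺ (∈-ints X (within _ c _ M x (bound-X X Y) h p)) (∈-ints Y (within _ k _ M y (bound-Y X Y) h q)))

    uncons : ∀ {m r} → SumOf (+ k) b (+ c) (suc m) r → Σ (ℤ × ℤ) λ v → Σ ℕ λ s → value v ℕ.+ s ≡ r × SumOf (+ k) b (+ c) m s
    uncons {m} {r} (f , h) = f Fin.zero , rest , ℤₚ.+-injective (trans (cong₂ ℤ._+_ (nonneg (f Fin.zero)) (proj₂ (tail m f′))) h) , f′ , sym (proj₂ (tail m f′))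
      where
      f′ : Fin m → ℤ × ℤ
      f′ i = f (Fin.suc i)
      tail : ∀ m (f : Fin m → ℤ × ℤ) → Σ ℕ λ s → + s ≡ sumZ m (λ i → Q (f i))
      tail zero    f = 0 , refl
      tail (suc m) f = let (s , e) = tail m (λ i → f (Fin.suc i)) in value (f Fin.zero) ℕ.+ s , cong₂ ℤ._+_ (nonneg (f Fin.zero)) e
      rest = proj₁ (tail m f′)

    decompose? : List ℕ → ℕ → ℕ → Bool
    decompose? vs zero    r = r ≡ᵇ 0
    decompose? vs (suc m) r = some (λ v → (v ≤ᵇ r) ∧ decompose? vs m (r ℕ.∸ v)) vs

    -- Values are nonnegative, so every summand is at most `r ≤ M` and its argument lies in the
    -- searched box. A failed search therefore refutes `SumOf`.
    decompose-complete : ∀ M x y → T (4 ℕ.* (c ℕ.* M) <ᵇ d ℕ.* (suc x ℕ.* suc x)) → T (4 ℕ.* (k ℕ.* M) <ᵇ d ℕ.* (suc y ℕ.* suc y)) →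
      ∀ m r → r ℕ.≤ M → SumOf (+ k) b (+ c) m r → T (decompose? (values x y) m r)
    decompose-complete M x y p q zero r _ (f , h) = ℕₚ.≡⇒≡ᵇ r 0 (sym (ℤₚ.+-injective h))
    decompose-complete M x y p q (suc m) r r≤M S =
      let (v , s , e , S′) = uncons S
          v≤r = subst (value v ℕ.≤_) e (ℕₚ.m≤m+n (value v) s)
          s≡  = trans (sym (ℕₚ.m+n∸m≡n (value v) s)) (cong (ℕ._∸ value v) e)
      in some-complete _ (∈-values M x y v (ℕₚ.≤-trans v≤r r≤M) p q) (Equivalence.from T-∧ (ℕₚ.≤⇒≤ᵇ v≤r ,
           subst (λ t → T (decompose? (values x y) m t)) s≡ (decompose-complete M x y p q m s (ℕₚ.≤-trans (subst (s ℕ.≤_) e (ℕₚ.m≤n+m s (value v))) r≤M) S′)))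

    Candidates : Set
    Candidates = List (Σ (ℤ × ℤ) λ v → Σ ℕ λ n → n ≡ value v)

    cons′ : ∀ {m r} v → SumOf (+ k) b (+ c) m r → SumOf (+ k) b (+ c) (suc m) (value v ℕ.+ r)
    cons′ v = cons (+ k) b (+ c) v (sym (nonneg v))

    axis : ∀ x {m r} → SumOf (+ k) b (+ c) m r → SumOf (+ k) b (+ c) (suc m) (k ℕ.* (x ℕ.* x) ℕ.+ r)
    axis x = cons (+ k) b (+ c) (+ x , + 0) (trans (QF-axis (+ k) b (+ c) (+ x)) (trans (cong (+ k ℤ.*_) (sym (ℤₚ.pos-* x x))) (sym (ℤₚ.pos-* k _))))

    two-sum : ∀ {n} → Squares₂ n → SumOf (+ k) b (+ c) 2 (k ℕ.* n)
    two-sum (x , y , refl) = subst (SumOf (+ k) b (+ c) 2) (trans (cong (k ℕ.* (x ℕ.* x) ℕ.+_) (ℕₚ.+-identityʳ _)) (sym (ℕₚ.*-distribˡ-+ k _ _))) (axis x (axis y (nil (+ k) b (+ c))))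

    three-sum : ∀ {n} → Squares₃ n → SumOf (+ k) b (+ c) 3 (k ℕ.* n)
    three-sum (x , y , z , refl) = subst (SumOf (+ k) b (+ c) 3) (sym (ℕₚ.*-distribˡ-+ k _ _)) (axis x (two-sum (y , z , refl)))

    instance
      k-nonzero : ℕ.NonZero k
      k-nonzero = ℕ.>-nonZero k≥1

    leaf? : ℕ → ℕ → Bool
    leaf? zero                n = n ≡ᵇ 0
    leaf? (suc zero)          n = some< (λ x → x ℕ.* x ≡ᵇ n) 21
    leaf? (suc (suc zero))    n = squares₂? n
    leaf? (suc (suc (suc m))) n = squares₃? n

    -- r = v₁ + … + v_j + k (sum of m - j squares).
    search? : Candidates → ℕ → ℕ → ℕ → Bool
    search? cs zero    m       r = (r % k ≡ᵇ 0) ∧ leaf? m (r / k)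
    search? cs (suc j) zero    r = false
    search? cs (suc j) (suc m) r = some (λ (_ , v , _) → (v ≤ᵇ r) ∧ search? cs j m (r ℕ.∸ v)) cs

    one-sum : ∀ x n → T (x ℕ.* x ≡ᵇ n) → SumOf (+ k) b (+ c) 1 (k ℕ.* n)
    one-sum x n h = subst (SumOf (+ k) b (+ c) 1) (trans (ℕₚ.+-identityʳ _) (cong (k ℕ.*_) (ℕₚ.≡ᵇ⇒≡ (x ℕ.* x) n h))) (axis x (nil (+ k) b (+ c)))

    leaf-sound : ∀ m n → T (leaf? m n) → SumOf (+ k) b (+ c) m (k ℕ.* n)
    leaf-sound zero                n h = subst (SumOf (+ k) b (+ c) 0) (trans (sym (ℕₚ.*-zeroʳ k)) (cong (k ℕ.*_) (sym (ℕₚ.≡ᵇ⇒≡ n 0 h)))) (nil (+ k) b (+ c))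
    leaf-sound (suc zero)          n h = let (x , t) = some<-sound (λ x → x ℕ.* x ≡ᵇ n) 21 h in one-sum x n t
    leaf-sound (suc (suc zero))    n h = two-sum (squares₂-sound n h)
    leaf-sound (suc (suc (suc m))) n h = subst (λ l → SumOf (+ k) b (+ c) l (k ℕ.* n)) (ℕₚ.+-comm m 3) (pad (+ k) b (+ c) m (three-sum (squares₃-sound n h)))

    subtract : ∀ {m} v n r → n ≡ value v → n ℕ.≤ r → SumOf (+ k) b (+ c) m (r ℕ.∸ n) → SumOf (+ k) b (+ c) (suc m) r
    subtract {m} v n r e n≤r S = subst (SumOf (+ k) b (+ c) (suc m)) (trans (cong (ℕ._+ (r ℕ.∸ n)) (sym e)) (ℕₚ.m+[n∸m]≡n n≤r)) (cons′ v S)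

    search-sound : ∀ cs j m r → T (search? cs j m r) → SumOf (+ k) b (+ c) m r
    search-sound cs zero m r h = subst (SumOf (+ k) b (+ c) m) (sym (trans (residue r k 0 (proj₁ pq)) (ℕₚ.+-identityʳ _))) (leaf-sound m (r / k) (proj₂ pq))
      where
      pq : T (r % k ≡ᵇ 0) × T (leaf? m (r / k))
      pq = ∧-T {r % k ≡ᵇ 0} h
    search-sound cs (suc j) (suc m) r h = go (some-sound p cs h)
      where
      p : Σ (ℤ × ℤ) (λ v → Σ ℕ λ n → n ≡ value v) → Bool
      p (_ , v , _) = (v ≤ᵇ r) ∧ search? cs j m (r ℕ.∸ v)
      go : (Σ _ λ x → x ∈ cs × T (p x)) → SumOf (+ k) b (+ c) (suc m) r
      go ((v , n , e) , _ , t) = subtract v n r e (ℕₚ.≤ᵇ⇒≤ n r (proj₁ (∧-T {n ≤ᵇ r} t))) (search-sound cs j m (r ℕ.∸ n) (proj₂ (∧-T {n ≤ᵇ r} t)))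

    -- Restricting to `Y ≥ 0` loses no values of bounded arguments except possibly the sign of the
    -- argument, as `Q v = Q (-v)`.
    candidates : ℕ → ℕ → Candidates
    candidates x y = map (λ v → v , value v , refl) (cartesianProduct (ints x) (map +_ (upTo y)))

    below : ℕ → Candidates → Candidates
    below B = filterᵇ (λ (_ , n , _) → n <ᵇ B)

    -- A coarse sort by the thresholds, smaller values first; values not below the last threshold
    -- are dropped. The first candidate that fits then tends to have a small `start`, which leaves
    -- few numbers to the search.
    increasing : Candidates → List ℕ → Candidates
    increasing cs []       = []
    increasing cs (B ∷ Bs) = below B cs ++ increasing (filterᵇ (λ (_ , n , _) → B ≤ᵇ n) cs) Bs

    -- `e` is the number of summands allowed beyond four. Large `r` are always written with four;
    -- the additional ones only help small `r`.
    module Cover (e : ℕ) (wanted? : ℕ → Bool) where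

      -- One value from the long list `cs`, or two or three values from the short list `ds`, the
      -- remaining summands being multiples of `k` by squares. The short list keeps the nested loops
      -- affordable.
      found? : Candidates → Candidates → ℕ → Bool
      found? cs ds r = not (wanted? r) ∨ search? cs 1 (e ℕ.+ 4) r ∨ search? ds 2 (e ℕ.+ 4) r ∨ search? ds 3 (e ℕ.+ 4) r

      found-sound : ∀ cs ds r → T (wanted? r) → T (found? cs ds r) → SumOf (+ k) b (+ c) (e ℕ.+ 4) r
      found-sound cs ds r w h = first (∨-T {not (wanted? r)} h)
        where
        absurd : ∀ p → T p → T (not p) → ⊥
        absurd true _ ()
        third : T (search? ds 2 (e ℕ.+ 4) r) ⊎ T (search? ds 3 (e ℕ.+ 4) r) → SumOf (+ k) b (+ c) (e ℕ.+ 4) r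
        third (inj₁ t) = search-sound ds 2 (e ℕ.+ 4) r t
        third (inj₂ t) = search-sound ds 3 (e ℕ.+ 4) r t
        second : T (search? cs 1 (e ℕ.+ 4) r) ⊎ T (search? ds 2 (e ℕ.+ 4) r ∨ search? ds 3 (e ℕ.+ 4) r) → SumOf (+ k) b (+ c) (e ℕ.+ 4) r
        second (inj₁ t) = search-sound cs 1 (e ℕ.+ 4) r t
        second (inj₂ t) = third (∨-T {search? ds 2 (e ℕ.+ 4) r} t)
        first : T (not (wanted? r)) ⊎ T (search? cs 1 (e ℕ.+ 4) r ∨ search? ds 2 (e ℕ.+ 4) r ∨ search? ds 3 (e ℕ.+ 4) r) → SumOf (+ k) b (+ c) (e ℕ.+ 4) r
        first (inj₁ t) = ⊥-elim (absurd (wanted? r) w t)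
        first (inj₂ t) = second (∨-T {search? cs 1 (e ℕ.+ 4) r} t)

      -- Adding `32k` to `r` adds 32 to the quotient by `k`, which preserves both `3 (mod 8)` and
      -- `12 (mod 32)`.
      P : ℕ
      P = 32 ℕ.* k

      instance
        P-nonzero : ℕ.NonZero P
        P-nonzero = ℕₚ.m*n≢0 32 k

      -- The least `i` with `v ≤ s + P i`: a division rounded up.
      start : ℕ → ℕ → ℕ
      start s v = ((v ℕ.∸ s) ℕ.+ (P ℕ.∸ 1)) / P

      -- Subtracting v from r ≡ s (mod 32 k) leaves k n with n ≡ 3 (mod 8) or n ≡ 12 (mod 32), once r is at least s + 32 k i.
      uniform? : ℕ → ℕ → ℕ → Bool
      uniform? s v i = (v ≤ᵇ s ℕ.+ P ℕ.* i) ∧ ((s ℕ.+ P ℕ.* i ℕ.∸ v) % k ≡ᵇ 0) ∧ ((((s ℕ.+ P ℕ.* i ℕ.∸ v) / k) % 8 ≡ᵇ 3) ∨ (((s ℕ.+ P ℕ.* i ℕ.∸ v) / k) % 32 ≡ᵇ 12))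

      uniform-sound : ∀ s v n i → n ≡ value v → T (uniform? s n i) → ∀ j → SumOf (+ k) b (+ c) 4 (s ℕ.+ P ℕ.* (i ℕ.+ j))
      uniform-sound s v n i e h j = subst (SumOf (+ k) b (+ c) 4) (sym total) (subst (λ t → SumOf (+ k) b (+ c) 4 (t ℕ.+ k ℕ.* (q ℕ.+ 32 ℕ.* j))) (sym e) (cons′ v (three-sum (lift (∨-T {q % 8 ≡ᵇ 3} (proj₂ h₂))))))
        where
        q : ℕ
        q = (s ℕ.+ P ℕ.* i ℕ.∸ n) / k
        h₁ : T (n ≤ᵇ s ℕ.+ P ℕ.* i) × T (((s ℕ.+ P ℕ.* i ℕ.∸ n) % k ≡ᵇ 0) ∧ ((q % 8 ≡ᵇ 3) ∨ (q % 32 ≡ᵇ 12)))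
        h₁ = ∧-T {n ≤ᵇ s ℕ.+ P ℕ.* i} h
        h₂ : T ((s ℕ.+ P ℕ.* i ℕ.∸ n) % k ≡ᵇ 0) × T ((q % 8 ≡ᵇ 3) ∨ (q % 32 ≡ᵇ 12))
        h₂ = ∧-T {(s ℕ.+ P ℕ.* i ℕ.∸ n) % k ≡ᵇ 0} (proj₂ h₁)
        at-i : s ℕ.+ P ℕ.* i ≡ n ℕ.+ k ℕ.* q
        at-i = trans (sym (ℕₚ.m+[n∸m]≡n (ℕₚ.≤ᵇ⇒≤ n _ (proj₁ h₁)))) (cong (n ℕ.+_) (trans (residue _ k 0 (proj₁ h₂)) (ℕₚ.+-identityʳ _)))
        total : s ℕ.+ P ℕ.* (i ℕ.+ j) ≡ n ℕ.+ k ℕ.* (q ℕ.+ 32 ℕ.* j)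
        total = trans (trans (cong (s ℕ.+_) (ℕₚ.*-distribˡ-+ P i j)) (sym (ℕₚ.+-assoc s _ _))) (trans (cong (ℕ._+ P ℕ.* j) at-i) (r n k q j))
          where
          r : ∀ n k q j → n ℕ.+ k ℕ.* q ℕ.+ 32 ℕ.* k ℕ.* j ≡ n ℕ.+ k ℕ.* (q ℕ.+ 32 ℕ.* j)
          r = solveℕ
        lift : T (q % 8 ≡ᵇ 3) ⊎ T (q % 32 ≡ᵇ 12) → Squares₃ (q ℕ.+ 32 ℕ.* j)
        lift (inj₁ t) = subst Squares₃ (trans (r (q / 8) j) (cong (ℕ._+ 32 ℕ.* j) (sym (residue q 8 3 t)))) (three-squares (q / 8 ℕ.+ 4 ℕ.* j))
          where
          r : ∀ a j → 8 ℕ.* (a ℕ.+ 4 ℕ.* j) ℕ.+ 3 ≡ 8 ℕ.* a ℕ.+ 3 ℕ.+ 32 ℕ.* j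
          r = solveℕ
        lift (inj₂ t) = subst Squares₃ (trans (r (q / 32) j) (cong (ℕ._+ 32 ℕ.* j) (sym (residue q 32 12 t)))) (twelve-mod-32 (q / 32 ℕ.+ j))
          where
          r : ∀ a j → 32 ℕ.* (a ℕ.+ j) ℕ.+ 12 ≡ 32 ℕ.* a ℕ.+ 12 ℕ.+ 32 ℕ.* j
          r = solveℕ

      -- The congruence test modulo k only discards most candidates early.
      fits? : Candidates → Candidates → ℕ → ℕ → Σ (ℤ × ℤ) (λ v → Σ ℕ λ n → n ≡ value v) → Bool
      fits? cs ds s t (_ , v , _) = (v % k ≡ᵇ t) ∧ (uniform? s v (start s v) ∧ every< (λ i → found? cs ds (s ℕ.+ P ℕ.* i)) (start s v))

      covered? : Candidates → Candidates → ℕ → Bool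
      covered? cs ds s = (λ t → some (fits? cs ds s t) cs) (s % k)

      covered-sound : ∀ cs ds s → T (covered? cs ds s) → ∀ i → T (wanted? (s ℕ.+ P ℕ.* i)) → SumOf (+ k) b (+ c) (e ℕ.+ 4) (s ℕ.+ P ℕ.* i)
      covered-sound cs ds s h i w = go (some-sound p cs h)
        where
        p : Σ (ℤ × ℤ) (λ v → Σ ℕ λ n → n ≡ value v) → Bool
        p = fits? cs ds s (s % k)
        go : (Σ _ λ x → x ∈ cs × T (p x)) → SumOf (+ k) b (+ c) (e ℕ.+ 4) (s ℕ.+ P ℕ.* i)
        go ((v , n , eq) , _ , t) = split (ℕₚ.<-≤-connex i (start s n))
          where
          both : T (uniform? s n (start s n)) × T (every< (λ i → found? cs ds (s ℕ.+ P ℕ.* i)) (start s n))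
          both = ∧-T {uniform? s n (start s n)} (proj₂ (∧-T {n % k ≡ᵇ s % k} t))
          split : i ℕ.< start s n ⊎ start s n ℕ.≤ i → SumOf (+ k) b (+ c) (e ℕ.+ 4) (s ℕ.+ P ℕ.* i)
          split (inj₁ i<) = found-sound cs ds (s ℕ.+ P ℕ.* i) w (every<-sound (λ i → found? cs ds (s ℕ.+ P ℕ.* i)) (start s n) (proj₂ both) i<)
          split (inj₂ ≤i) = pad (+ k) b (+ c) e (subst (λ t → SumOf (+ k) b (+ c) 4 (s ℕ.+ P ℕ.* t)) (ℕₚ.m+[n∸m]≡n ≤i) (uniform-sound s v n (start s n) eq (proj₁ both) (i ℕ.∸ start s n)))

      cover? : Candidates → Candidates → Bool
      cover? cs ds = every< (covered? cs ds) P

      cover-sound : ∀ cs ds → T (cover? cs ds) → ∀ r → T (wanted? r) → SumOf (+ k) b (+ c) (e ℕ.+ 4) r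
      cover-sound cs ds h r w = subst (SumOf (+ k) b (+ c) (e ℕ.+ 4)) (sym r≡) (covered-sound cs ds (r % P) (every<-sound (covered? cs ds) P h (ℕD.m%n<n r P)) (r / P) (subst (λ t → T (wanted? t)) r≡ w))
        where
        r≡ : r ≡ r % P ℕ.+ P ℕ.* (r / P)
        r≡ = trans (ℕD.m≡m%n+[m/n]*n r P) (cong (r % P ℕ.+_) (ℕₚ.*-comm (r / P) P))

      -- The λ-bindings let one evaluation of the candidate lists serve all residues.
      cover : ℕ → ℕ → ℕ → List ℕ → Bool
      cover x y B Bs = (λ cs → (λ ds → cover? cs ds) (below B cs)) (increasing (candidates x y) Bs)

      covers : ∀ x y B Bs → T (cover x y B Bs) → ∀ r → T (wanted? r) → SumOf (+ k) b (+ c) (e ℕ.+ 4) r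
      covers x y B Bs = cover-sound (increasing (candidates x y) Bs) (below B (increasing (candidates x y) Bs))

-- Certificates for the rows of the table.

module Certificates where

  open import Data.Nat.DivMod using (_%_; _/_)
  open Presentations using (SumOf; QF)
  open Searches
  open import Data.Bool.Base using (T)

  ⇒-T : ∀ {p q} → T p → T (not p ∨ q) → T q
  ⇒-T {true} _ h = h

  T-dec : ∀ {P : Set} (p : Dec P) → T (does p) → P
  T-dec (yes p) _ = p

  inR? : ℕ → List ℕ → ℕ → Bool
  inR? k excl r = (k ≤ᵇ r) ∧ every (λ e → not (e ≡ᵇ r)) excl

  not-T : ∀ {p} → T p → T (not p) → ⊥
  not-T {true} _ ()

  every-complete : ∀ {A : Set} (p : A → Bool) xs → (∀ {x} → x ∈ xs → T (p x)) → T (every p xs)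
  every-complete p []       h = _
  every-complete p (x ∷ xs) h = go (p x) (h (here refl))
    where
    go : ∀ b → T b → T (if b then every p xs else false)
    go true _ = every-complete p xs (λ m → h (there m))

  T-not : ∀ {p} → (T p → ⊥) → T (not p)
  T-not {true}  h = h _
  T-not {false} h = _

  inR-sound : ∀ k excl r → T (inR? k excl r) → k ℕ.≤ r × r ∉ excl
  inR-sound k excl r h = ℕₚ.≤ᵇ⇒≤ k r (proj₁ pq) , λ m → not-T (ℕₚ.≡⇒≡ᵇ r r refl) (every-sound (λ e → not (e ≡ᵇ r)) excl (proj₂ pq) m)
    where
    pq : T (k ≤ᵇ r) × T (every (λ e → not (e ≡ᵇ r)) excl)
    pq = ∧-T {k ≤ᵇ r} h

  inR-complete : ∀ k excl r → k ℕ.≤ r × r ∉ excl → T (inR? k excl r)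
  inR-complete k excl r (l , m) = Equivalence.from T-∧ (ℕₚ.≤⇒≤ᵇ l , every-complete _ excl λ {e} i → T-not λ t → m (subst (_∈ excl) (ℕₚ.≡ᵇ⇒≡ e r t) i))

  module Exact (d k c : ℕ) (b : ℤ) (k≥1 : 1 ℕ.≤ k) (c≥1 : 1 ℕ.≤ c)
               (disc : + 4 ℤ.* (+ k ℤ.* + c) ≡ (+ 2 ℤ.* b ℤ.+ + 1) ℤ.* (+ 2 ℤ.* b ℤ.+ + 1) ℤ.+ + d) where
    open Form d k c b k≥1 c≥1 disc

    box? : ℕ → ℕ → ℕ → Bool
    box? M x y = (4 ℕ.* (c ℕ.* M) <ᵇ d ℕ.* (suc x ℕ.* suc x)) ∧ (4 ℕ.* (k ℕ.* M) <ᵇ d ℕ.* (suc y ℕ.* suc y))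

    shortest? : ℕ → ℕ → ℕ → ℕ → Bool
    shortest? m r x y = box? r x y ∧ not (decompose? (values x y) m r)

    -- Refuting exactly `m` summands refutes fewer as well: zero is a value of the form, so a
    -- shorter sum can be padded.
    shortest-sound : ∀ m r x y → T (shortest? m r x y) → ∀ m′ → SumOf (+ k) b (+ c) m′ r → suc m ℕ.≤ m′
    shortest-sound m r x y h m′ S = ℕₚ.≰⇒> λ m′≤m → not-T
        (decompose-complete r x y (proj₁ box) (proj₂ box) m r ℕₚ.≤-refl (subst (λ t → SumOf (+ k) b (+ c) t r) (ℕₚ.m∸n+n≡m m′≤m) (pad (+ k) b (+ c) (m ℕ.∸ m′) S)))
        (proj₂ pq)
      where
      pq : T (box? r x y) × T (not (decompose? (values x y) m r))
      pq = ∧-T {box? r x y} h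
      box : T (4 ℕ.* (c ℕ.* r) <ᵇ d ℕ.* (suc x ℕ.* suc x)) × T (4 ℕ.* (k ℕ.* r) <ᵇ d ℕ.* (suc y ℕ.* suc y))
      box = ∧-T {4 ℕ.* (c ℕ.* r) <ᵇ d ℕ.* (suc x ℕ.* suc x)} (proj₁ pq)

    module _ (wanted? : ℕ → Bool) where

      ok? : ℕ → Bool
      ok? r = (r ≡ᵇ 0) ∨ wanted? r

      additive? : ℕ → Bool
      additive? M = every< (λ s → not (ok? s) ∨ every< (λ t → not (ok? t) ∨ ok? (s ℕ.+ t)) (suc M)) (suc M)

      closed? : ℕ → ℕ → ℕ → Bool
      closed? M x y = box? M x y ∧ (every (λ v → (M <ᵇ v) ∨ ok? v) (values x y) ∧ additive? M)

      -- Values and pairwise sums need testing up to `M` only, since beyond it every number is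
      -- wanted; the rest is induction on the number of summands.
      closed-sound : ∀ M x y → T (closed? M x y) → (∀ r → M ℕ.< r → T (wanted? r)) → ∀ m r → SumOf (+ k) b (+ c) m r → T (ok? r)
      closed-sound M x y h above = go
        where
        h₁ : T (box? M x y) × T (every (λ v → (M <ᵇ v) ∨ ok? v) (values x y) ∧ additive? M)
        h₁ = ∧-T {box? M x y} h
        h₂ : T (every (λ v → (M <ᵇ v) ∨ ok? v) (values x y)) × T (additive? M)
        h₂ = ∧-T {every (λ v → (M <ᵇ v) ∨ ok? v) (values x y)} (proj₂ h₁)
        box : T (4 ℕ.* (c ℕ.* M) <ᵇ d ℕ.* (suc x ℕ.* suc x)) × T (4 ℕ.* (k ℕ.* M) <ᵇ d ℕ.* (suc y ℕ.* suc y))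
        box = ∧-T {4 ℕ.* (c ℕ.* M) <ᵇ d ℕ.* (suc x ℕ.* suc x)} (proj₁ h₁)
        large : ∀ r → M ℕ.< r → T (ok? r)
        large r M<r = Equivalence.from (T-∨ {r ≡ᵇ 0}) (inj₂ (above r M<r))
        value-ok : ∀ v → T (ok? (value v))
        value-ok v = case (ℕₚ.<-≤-connex M (value v))
          where
          finish : T (M <ᵇ value v) ⊎ T (ok? (value v)) → T (ok? (value v))
          finish (inj₁ l) = large (value v) (ℕₚ.<ᵇ⇒< M (value v) l)
          finish (inj₂ t) = t
          case : M ℕ.< value v ⊎ value v ℕ.≤ M → T (ok? (value v))
          case (inj₁ l) = large (value v) l
          case (inj₂ l) = finish (∨-T {M <ᵇ value v} (every-sound (λ v → (M <ᵇ v) ∨ ok? v) (values x y) (proj₁ h₂) (∈-values M x y v l (proj₁ box) (proj₂ box))))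
        sum-ok : ∀ s t → T (ok? s) → T (ok? t) → T (ok? (s ℕ.+ t))
        sum-ok s t p q = case (ℕₚ.<-≤-connex M s) (ℕₚ.<-≤-connex M t)
          where
          case : M ℕ.< s ⊎ s ℕ.≤ M → M ℕ.< t ⊎ t ℕ.≤ M → T (ok? (s ℕ.+ t))
          case (inj₁ l) _ = large (s ℕ.+ t) (ℕₚ.<-≤-trans l (ℕₚ.m≤m+n s t))
          case (inj₂ _) (inj₁ l) = large (s ℕ.+ t) (ℕₚ.<-≤-trans l (ℕₚ.m≤n+m t s))
          case (inj₂ s≤M) (inj₂ t≤M) = ⇒-T {ok? t} q (every<-sound (λ t → not (ok? t) ∨ ok? (s ℕ.+ t)) (suc M)
            (⇒-T {ok? s} p (every<-sound (λ s → not (ok? s) ∨ every< (λ t → not (ok? t) ∨ ok? (s ℕ.+ t)) (suc M)) (suc M) (proj₂ h₂) (s≤s s≤M))) (s≤s t≤M))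
        go : ∀ m r → SumOf (+ k) b (+ c) m r → T (ok? r)
        go zero r (f , e) = Equivalence.from (T-∨ {r ≡ᵇ 0}) (inj₁ (ℕₚ.≡⇒≡ᵇ r 0 (sym (ℤₚ.+-injective e))))
        go (suc m) r S = step (uncons S)
          where
          step : (Σ (ℤ × ℤ) λ v → Σ ℕ λ s → value v ℕ.+ s ≡ r × SumOf (+ k) b (+ c) m s) → T (ok? r)
          step (v , s , e , S′) = subst (λ t → T (ok? t)) e (sum-ok (value v) s (value-ok v) (go m s S′))

  -- The reduced forms of discriminant -d: here 3 a² ≤ d < 3 · 18².
  module _ (d N k : ℕ) (c₂ c₃ : ℤ) where

    -- The negated disjuncts encode premises. The leading coefficient is `suc a`; the last
    -- coefficient is eliminated through `ac = b² + b + N`, so that `a ≤ c` is tested as `a² ≤ ac`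
    -- and integrality as divisibility.
    reduced-form? : ℕ → ℤ → Bool
    reduced-form? a b = not (ℤ.∣ + 2 ℤ.* b ℤ.+ + 1 ∣ ≤ᵇ suc a) ∨ (not (suc a ℕ.* suc a ≤ᵇ ℤ.∣ b ℤ.* b ℤ.+ b ℤ.+ + N ∣) ∨ (not (3 ℕ.* (suc a ℕ.* suc a) ≤ᵇ d) ∨ (not (ℤ.∣ b ℤ.* b ℤ.+ b ℤ.+ + N ∣ % suc a ≡ᵇ 0)
      ∨ ((a ≡ᵇ 0) ∨ ((suc a ≡ᵇ k) ∧ (does (b ℤₚ.≟ c₂) ∨ does (b ℤₚ.≟ c₃)))))))

    reduced-forms? : Bool
    reduced-forms? = (d <ᵇ 972) ∧ every< (λ a → every (reduced-form? a) (ints 17)) 17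

    reduced-forms : T reduced-forms? → ∀ a b c → + suc a ℤ.* c ≡ b ℤ.* b ℤ.+ b ℤ.+ + N → ℤ.∣ + 2 ℤ.* b ℤ.+ + 1 ∣ ℕ.≤ suc a → suc a ℕ.≤ ℤ.∣ c ∣ → 3 ℕ.* (suc a ℕ.* suc a) ℕ.≤ d →
      a ≡ 0 ⊎ (suc a ≡ k × (b ≡ c₂ ⊎ b ≡ c₃))
    reduced-forms h a b c D centre a≤c small = finish (∨-T {a ≡ᵇ 0} (⇒-T {ℤ.∣ b ℤ.* b ℤ.+ b ℤ.+ + N ∣ % suc a ≡ᵇ 0} divisible (⇒-T {3 ℕ.* (suc a ℕ.* suc a) ≤ᵇ d} (ℕₚ.≤⇒≤ᵇ small) (⇒-T {suc a ℕ.* suc a ≤ᵇ ℤ.∣ b ℤ.* b ℤ.+ b ℤ.+ + N ∣} (ℕₚ.≤⇒≤ᵇ a²≤) (⇒-T {ℤ.∣ + 2 ℤ.* b ℤ.+ + 1 ∣ ≤ᵇ suc a} (ℕₚ.≤⇒≤ᵇ centre) at)))))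
      where
      hs : T (d <ᵇ 972) × T (every< (λ a → every (reduced-form? a) (ints 17)) 17)
      hs = ∧-T {d <ᵇ 972} h
      a<17 : a ℕ.< 17
      a<17 = ℕₚ.≰⇒> λ 17≤a → ℕₚ.<-irrefl refl (ℕₚ.<-≤-trans (ℕₚ.<ᵇ⇒< d 972 (proj₁ hs)) (ℕₚ.≤-trans (ℕₚ.*-monoʳ-≤ 3 (ℕₚ.*-mono-≤ (s≤s 17≤a) (s≤s 17≤a))) small))
      ∣b∣≤ : ∀ b → ℤ.∣ b ∣ ℕ.≤ ℤ.∣ + 2 ℤ.* b ℤ.+ + 1 ∣
      ∣b∣≤ (+ n) = subst (n ℕ.≤_) (cong (λ t → ℤ.∣ t ℤ.+ + 1 ∣) (ℤₚ.pos-* 2 n)) (ℕₚ.≤-trans (ℕₚ.m≤m+n n (n ℕ.+ 0)) (ℕₚ.m≤m+n _ 1))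
      ∣b∣≤ -[1+ n ] = negative (n ℕ.+ 1 ℕ.* suc n) (trans (cong (n ℕ.+_) (ℕₚ.*-identityˡ (suc n))) (ℕₚ.+-suc n n))
        where
        negative : ∀ m → m ≡ suc (n ℕ.+ n) → suc n ℕ.≤ ℤ.∣ 1 ℤ.⊖ suc m ∣
        negative _ refl = s≤s (ℕₚ.m≤m+n n n)
      at : T (reduced-form? a b)
      at = every-sound (reduced-form? a) (ints 17) (every<-sound (λ a → every (reduced-form? a) (ints 17)) 17 (proj₂ hs) a<17)
             (∈-ints b (ℕₚ.≤-trans (∣b∣≤ b) (ℕₚ.≤-trans centre a<17)))
      a²≤ : suc a ℕ.* suc a ℕ.≤ ℤ.∣ b ℤ.* b ℤ.+ b ℤ.+ + N ∣
      a²≤ = ℕₚ.≤-trans (ℕₚ.*-monoʳ-≤ (suc a) a≤c) (ℕₚ.≤-reflexive (trans (sym (ℤₚ.abs-* (+ suc a) c)) (cong ℤ.∣_∣ D)))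
      divisible : T (ℤ.∣ b ℤ.* b ℤ.+ b ℤ.+ + N ∣ % suc a ≡ᵇ 0)
      divisible = ℕₚ.≡⇒≡ᵇ _ 0 (trans (cong (_% suc a) (trans (cong ℤ.∣_∣ (sym D)) (trans (ℤₚ.abs-* (+ suc a) c) (ℕₚ.*-comm (suc a) ℤ.∣ c ∣)))) (ℕD.m*n%n≡0 ℤ.∣ c ∣ (suc a)))
      last : T (does (b ℤₚ.≟ c₂)) ⊎ T (does (b ℤₚ.≟ c₃)) → b ≡ c₂ ⊎ b ≡ c₃
      last (inj₁ t) = inj₁ (T-dec (b ℤₚ.≟ c₂) t)
      last (inj₂ t) = inj₂ (T-dec (b ℤₚ.≟ c₃) t)
      finish : T (a ≡ᵇ 0) ⊎ T ((suc a ≡ᵇ k) ∧ (does (b ℤₚ.≟ c₂) ∨ does (b ℤₚ.≟ c₃))) → a ≡ 0 ⊎ (suc a ≡ k × (b ≡ c₂ ⊎ b ≡ c₃))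
      finish (inj₁ t) = inj₁ (ℕₚ.≡ᵇ⇒≡ a 0 t)
      finish (inj₂ t) = inj₂ (ℕₚ.≡ᵇ⇒≡ (suc a) k (proj₁ (∧-T {suc a ≡ᵇ k} t)) , last (∨-T {does (b ℤₚ.≟ c₂)} (proj₂ (∧-T {suc a ≡ᵇ k} t))))

  -- The arithmetic that depends on the row, stated for the norm form `(1, 1, N)` and for the form
  -- `(k, 2c₂ + 1, C)` of `𝔘₂`; `opposite` transfers it to the conjugate ideal `𝔘₃`. `minimal` names
  -- a scale whose lattice requires `g` summands.
  record Certificate (ρ : Row) : Set where
    open Row ρ
    field
      N C      : ℕ
      4N       : 4 ℕ.* N ≡ suc d
      Tr≡1     : Tr d ≡ 1ℚ
      Nm≡N     : Nm d ≡ ℤ→ℚ (+ N)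
      k≥1      : 1 ℕ.≤ k
      g≥1      : 1 ℕ.≤ g
      disc     : + k ℤ.* + C ≡ c₂ ℤ.* c₂ ℤ.+ c₂ ℤ.+ + N
      opposite : c₃ ≡ ℤ.- (+ 1 ℤ.+ c₂)
      unary    : ∀ r → 1 ℕ.≤ r → SumOf (+ 1) (+ 0) (+ N) g r
      ideal    : ∀ r → InR ρ r → SumOf (+ k) c₂ (+ C) g r
      closed   : ∀ m r → 1 ℕ.≤ r → SumOf (+ k) c₂ (+ C) m r → InR ρ r
      minimal  : (Σ ℕ λ r → 1 ℕ.≤ r × (∀ m → SumOf (+ 1) (+ 0) (+ N) m r → g ℕ.≤ m))
               ⊎ (Σ ℕ λ r → InR ρ r × (∀ m → SumOf (+ k) c₂ (+ C) m r → g ℕ.≤ m))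
      reduced  : ∀ a b c → + suc a ℤ.* c ≡ b ℤ.* b ℤ.+ b ℤ.+ + N → ℤ.∣ + 2 ℤ.* b ℤ.+ + 1 ∣ ℕ.≤ suc a → suc a ℕ.≤ ℤ.∣ c ∣ → 3 ℕ.* (suc a ℕ.* suc a) ℕ.≤ d →
                 a ≡ 0 ⊎ (suc a ≡ k × (b ≡ c₂ ⊎ b ≡ c₃))

  module _ (d k : ℕ) {{k≢0 : ℕ.NonZero k}} (c₂ : ℤ) (excl : List ℕ) (C M : ℕ)
           (k≥1 : 1 ℕ.≤ k) (C≥1 : 1 ℕ.≤ C)
           (disc : + 4 ℤ.* (+ k ℤ.* + C) ≡ (+ 2 ℤ.* c₂ ℤ.+ + 1) ℤ.* (+ 2 ℤ.* c₂ ℤ.+ + 1) ℤ.+ + d) where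

    private module X = Exact d k C c₂ k≥1 C≥1 disc

    exact? : Bool
    exact? = X.closed? (inR? k excl) M 3 3 ∧ ((k ≤ᵇ M) ∧ every (λ e → e ≤ᵇ M) excl)

    exact-sound : T exact? → ∀ m r → 1 ℕ.≤ r → SumOf (+ k) c₂ (+ C) m r → k ℕ.≤ r × r ∉ excl
    exact-sound h m r r≥1 S = finish r r≥1 (∨-T {r ≡ᵇ 0} (X.closed-sound (inR? k excl) M 3 3 (proj₁ pq) above m r S))
      where
      pq : T (X.closed? (inR? k excl) M 3 3) × T ((k ≤ᵇ M) ∧ every (λ e → e ≤ᵇ M) excl)
      pq = ∧-T {X.closed? (inR? k excl) M 3 3} h
      pq′ : T (k ≤ᵇ M) × T (every (λ e → e ≤ᵇ M) excl)
      pq′ = ∧-T {k ≤ᵇ M} (proj₂ pq)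
      above : ∀ r → M ℕ.< r → T (inR? k excl r)
      above r M<r = inR-complete k excl r (ℕₚ.≤-trans (ℕₚ.≤ᵇ⇒≤ k M (proj₁ pq′)) (ℕₚ.<⇒≤ M<r) ,
        λ m → ℕₚ.<-irrefl refl (ℕₚ.<-≤-trans M<r (ℕₚ.≤ᵇ⇒≤ r M (every-sound (λ e → e ≤ᵇ M) excl (proj₂ pq′) m))))
      finish : ∀ r → 1 ℕ.≤ r → T (r ≡ᵇ 0) ⊎ T (inR? k excl r) → k ℕ.≤ r × r ∉ excl
      finish (suc r) _ (inj₂ t) = inR-sound k excl (suc r) t

  module _ (d k : ℕ) {{k≢0 : ℕ.NonZero k}} (c₂ : ℤ) (excl : List ℕ) (e N C M : ℕ) where

    Minimal : ℕ → Set
    Minimal g = (Σ ℕ λ r → 1 ℕ.≤ r × (∀ m → SumOf (+ 1) (+ 0) (+ N) m r → g ℕ.≤ m))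
              ⊎ (Σ ℕ λ r → (k ℕ.≤ r × r ∉ excl) × (∀ m → SumOf (+ k) c₂ (+ C) m r → g ℕ.≤ m))

    module _ (k≥1 : 1 ℕ.≤ k) (C≥1 : 1 ℕ.≤ C) (N≥1 : 1 ℕ.≤ N)
             (discᵤ : + 4 ℤ.* (+ 1 ℤ.* + N) ≡ (+ 2 ℤ.* + 0 ℤ.+ + 1) ℤ.* (+ 2 ℤ.* + 0 ℤ.+ + 1) ℤ.+ + d)
             (disc : + 4 ℤ.* (+ k ℤ.* + C) ≡ (+ 2 ℤ.* c₂ ℤ.+ + 1) ℤ.* (+ 2 ℤ.* c₂ ℤ.+ + 1) ℤ.+ + d) where

      module U = Form d 1 N (+ 0) (s≤s z≤n) N≥1 discᵤ
      module V = Form d k C c₂ k≥1 C≥1 disc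

      -- One choice of bounds serves every row with four or five summands: `|X| ≤ 20`, `Y ≤ 1` and
      -- values below 2000 for norms, `|X| ≤ 42`, `Y ≤ 36` and values below 20000 for the ideal
      -- form. The short lists contain the values below 60 and below 300.
      unary? ideal? : Bool
      unary? = U.Cover.cover e (1 ≤ᵇ_) 20 2 60 (2000 ∷ [])
      ideal? = V.Cover.cover e (inR? k excl) 42 37 300 (200 ∷ 800 ∷ 3000 ∷ 20000 ∷ [])

      standard : 4 ℕ.* N ≡ suc d → Tr d ≡ 1ℚ → Nm d ≡ ℤ→ℚ (+ N) → + k ℤ.* + C ≡ c₂ ℤ.* c₂ ℤ.+ c₂ ℤ.+ + N → Minimal (e ℕ.+ 4) →
        T unary? → T ideal? → T (exact? d k {{k≢0}} c₂ excl C M k≥1 C≥1 disc) → T (reduced-forms? d N k c₂ (ℤ.- (+ 1 ℤ.+ c₂))) →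
        Certificate (row d k {{k≢0}} c₂ (ℤ.- (+ 1 ℤ.+ c₂)) excl (e ℕ.+ 4))
      standard 4N Tr≡1 Nm≡N D minimal tu ti te tr = record
        { N = N ; C = C ; 4N = 4N ; Tr≡1 = Tr≡1 ; Nm≡N = Nm≡N ; k≥1 = k≥1 ; g≥1 = ℕₚ.≤-trans (s≤s z≤n) (ℕₚ.m≤n+m 4 e) ; disc = D ; opposite = refl
        ; unary    = λ r r≥1 → U.Cover.covers e (1 ≤ᵇ_) 20 2 60 (2000 ∷ []) tu r (ℕₚ.≤⇒≤ᵇ r≥1)
        ; ideal    = λ r h → V.Cover.covers e (inR? k excl) 42 37 300 (200 ∷ 800 ∷ 3000 ∷ 20000 ∷ []) ti r (inR-complete k excl r h)
        ; closed   = exact-sound d k {{k≢0}} c₂ excl C M k≥1 C≥1 disc te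
        ; minimal  = minimal
        ; reduced  = reduced-forms d N k c₂ (ℤ.- (+ 1 ℤ.+ c₂)) tr
        }

      -- 7 is not a sum of three norms, since N ≥ 8.
      seven : T (Exact.shortest? d 1 N (+ 0) (s≤s z≤n) N≥1 discᵤ 3 7 3 1) → Minimal 4
      seven h = inj₁ (7 , s≤s z≤n , Exact.shortest-sound d 1 N (+ 0) (s≤s z≤n) N≥1 discᵤ 3 7 3 1 h)

-- The rows with four or five summands.

module Rows where

  open Certificates

  -- After the exclusions come the number `e` of additional summands, `N`, `C`, and `M`, the largest
  -- exclusion. The final underscores stand for Boolean tests that evaluate to true.
  certificate-31 : Certificate (row 31 2 (+ 0) (-[1+ 0 ]) (3 ∷ []) 4)
  certificate-31 = standard 31 2 (+ 0) (3 ∷ []) 0 8 4 3 (s≤s z≤n) (s≤s z≤n) (s≤s z≤n) refl refl refl refl refl refl (seven 31 2 (+ 0) (3 ∷ []) 0 8 4 3 (s≤s z≤n) (s≤s z≤n) (s≤s z≤n) refl refl _) _ _ _ _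

  certificate-59 : Certificate (row 59 3 (+ 0) (-[1+ 0 ]) (4 ∷ []) 4)
  certificate-59 = standard 59 3 (+ 0) (4 ∷ []) 0 15 5 4 (s≤s z≤n) (s≤s z≤n) (s≤s z≤n) refl refl refl refl refl refl (seven 59 3 (+ 0) (4 ∷ []) 0 15 5 4 (s≤s z≤n) (s≤s z≤n) (s≤s z≤n) refl refl _) _ _ _ _

  certificate-83 : Certificate (row 83 3 (+ 0) (-[1+ 0 ]) (4 ∷ 5 ∷ 8 ∷ []) 4)
  certificate-83 = standard 83 3 (+ 0) (4 ∷ 5 ∷ 8 ∷ []) 0 21 7 8 (s≤s z≤n) (s≤s z≤n) (s≤s z≤n) refl refl refl refl refl refl (seven 83 3 (+ 0) (4 ∷ 5 ∷ 8 ∷ []) 0 21 7 8 (s≤s z≤n) (s≤s z≤n) (s≤s z≤n) refl refl _) _ _ _ _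

  certificate-107 : Certificate (row 107 3 (+ 0) (-[1+ 0 ]) (4 ∷ 5 ∷ 7 ∷ 8 ∷ 10 ∷ []) 4)
  certificate-107 = standard 107 3 (+ 0) (4 ∷ 5 ∷ 7 ∷ 8 ∷ 10 ∷ []) 0 27 9 10 (s≤s z≤n) (s≤s z≤n) (s≤s z≤n) refl refl refl refl refl refl (seven 107 3 (+ 0) (4 ∷ 5 ∷ 7 ∷ 8 ∷ 10 ∷ []) 0 27 9 10 (s≤s z≤n) (s≤s z≤n) (s≤s z≤n) refl refl _) _ _ _ _

  certificate-139 : Certificate (row 139 5 (+ 0) (-[1+ 0 ]) (6 ∷ 8 ∷ 9 ∷ []) 4)
  certificate-139 = standard 139 5 (+ 0) (6 ∷ 8 ∷ 9 ∷ []) 0 35 7 9 (s≤s z≤n) (s≤s z≤n) (s≤s z≤n) refl refl refl refl refl refl (seven 139 5 (+ 0) (6 ∷ 8 ∷ 9 ∷ []) 0 35 7 9 (s≤s z≤n) (s≤s z≤n) (s≤s z≤n) refl refl _) _ _ _ _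

  certificate-211 : Certificate (row 211 5 (+ 1) (-[1+ 1 ]) (6 ∷ 7 ∷ 8 ∷ 9 ∷ 12 ∷ 14 ∷ 17 ∷ []) 4)
  certificate-211 = standard 211 5 (+ 1) (6 ∷ 7 ∷ 8 ∷ 9 ∷ 12 ∷ 14 ∷ 17 ∷ []) 0 53 11 17 (s≤s z≤n) (s≤s z≤n) (s≤s z≤n) refl refl refl refl refl refl (seven 211 5 (+ 1) (6 ∷ 7 ∷ 8 ∷ 9 ∷ 12 ∷ 14 ∷ 17 ∷ []) 0 53 11 17 (s≤s z≤n) (s≤s z≤n) (s≤s z≤n) refl refl _) _ _ _ _

  certificate-283 : Certificate (row 283 7 (+ 2) (-[1+ 2 ]) (8 ∷ 9 ∷ 10 ∷ 12 ∷ 15 ∷ 16 ∷ 17 ∷ 19 ∷ []) 4)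
  certificate-283 = standard 283 7 (+ 2) (8 ∷ 9 ∷ 10 ∷ 12 ∷ 15 ∷ 16 ∷ 17 ∷ 19 ∷ []) 0 71 11 19 (s≤s z≤n) (s≤s z≤n) (s≤s z≤n) refl refl refl refl refl refl (seven 283 7 (+ 2) (8 ∷ 9 ∷ 10 ∷ 12 ∷ 15 ∷ 16 ∷ 17 ∷ 19 ∷ []) 0 71 11 19 (s≤s z≤n) (s≤s z≤n) (s≤s z≤n) refl refl _) _ _ _ _

  certificate-307 : Certificate (row 307 7 (+ 0) (-[1+ 0 ]) (8 ∷ 9 ∷ 10 ∷ 12 ∷ 13 ∷ 15 ∷ 16 ∷ 20 ∷ 23 ∷ 27 ∷ []) 4)
  certificate-307 = standard 307 7 (+ 0) (8 ∷ 9 ∷ 10 ∷ 12 ∷ 13 ∷ 15 ∷ 16 ∷ 20 ∷ 23 ∷ 27 ∷ []) 0 77 11 27 (s≤s z≤n) (s≤s z≤n) (s≤s z≤n) refl refl refl refl refl refl (seven 307 7 (+ 0) (8 ∷ 9 ∷ 10 ∷ 12 ∷ 13 ∷ 15 ∷ 16 ∷ 20 ∷ 23 ∷ 27 ∷ []) 0 77 11 27 (s≤s z≤n) (s≤s z≤n) (s≤s z≤n) refl refl _) _ _ _ _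

  certificate-331 : Certificate (row 331 5 (+ 1) (-[1+ 1 ]) (6 ∷ 7 ∷ 8 ∷ 9 ∷ 11 ∷ 12 ∷ 13 ∷ 14 ∷ 16 ∷ 18 ∷ 21 ∷ 23 ∷ 26 ∷ 28 ∷ 33 ∷ []) 4)
  certificate-331 = standard 331 5 (+ 1) (6 ∷ 7 ∷ 8 ∷ 9 ∷ 11 ∷ 12 ∷ 13 ∷ 14 ∷ 16 ∷ 18 ∷ 21 ∷ 23 ∷ 26 ∷ 28 ∷ 33 ∷ []) 0 83 17 33 (s≤s z≤n) (s≤s z≤n) (s≤s z≤n) refl refl refl refl refl refl (seven 331 5 (+ 1) (6 ∷ 7 ∷ 8 ∷ 9 ∷ 11 ∷ 12 ∷ 13 ∷ 14 ∷ 16 ∷ 18 ∷ 21 ∷ 23 ∷ 26 ∷ 28 ∷ 33 ∷ []) 0 83 17 33 (s≤s z≤n) (s≤s z≤n) (s≤s z≤n) refl refl _) _ _ _ _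

  certificate-379 : Certificate (row 379 5 (+ 0) (-[1+ 0 ]) (6 ∷ 7 ∷ 8 ∷ 9 ∷ 11 ∷ 12 ∷ 13 ∷ 14 ∷ 16 ∷ 17 ∷ 18 ∷ 21 ∷ 22 ∷ 26 ∷ 27 ∷ 31 ∷ 32 ∷ 36 ∷ []) 4)
  certificate-379 = standard 379 5 (+ 0) (6 ∷ 7 ∷ 8 ∷ 9 ∷ 11 ∷ 12 ∷ 13 ∷ 14 ∷ 16 ∷ 17 ∷ 18 ∷ 21 ∷ 22 ∷ 26 ∷ 27 ∷ 31 ∷ 32 ∷ 36 ∷ []) 0 95 19 36 (s≤s z≤n) (s≤s z≤n) (s≤s z≤n) refl refl refl refl refl refl (seven 379 5 (+ 0) (6 ∷ 7 ∷ 8 ∷ 9 ∷ 11 ∷ 12 ∷ 13 ∷ 14 ∷ 16 ∷ 17 ∷ 18 ∷ 21 ∷ 22 ∷ 26 ∷ 27 ∷ 31 ∷ 32 ∷ 36 ∷ []) 0 95 19 36 (s≤s z≤n) (s≤s z≤n) (s≤s z≤n) refl refl _) _ _ _ _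

  certificate-499 : Certificate (row 499 5 (+ 0) (-[1+ 0 ]) (6 ∷ 7 ∷ 8 ∷ 9 ∷ 11 ∷ 12 ∷ 13 ∷ 14 ∷ 16 ∷ 17 ∷ 18 ∷ 19 ∷ 21 ∷ 22 ∷ 23 ∷ 24 ∷ 26 ∷ 27 ∷ 28 ∷ 32 ∷ 33 ∷ 37 ∷ 38 ∷ 42 ∷ []) 4)
  certificate-499 = standard 499 5 (+ 0) (6 ∷ 7 ∷ 8 ∷ 9 ∷ 11 ∷ 12 ∷ 13 ∷ 14 ∷ 16 ∷ 17 ∷ 18 ∷ 19 ∷ 21 ∷ 22 ∷ 23 ∷ 24 ∷ 26 ∷ 27 ∷ 28 ∷ 32 ∷ 33 ∷ 37 ∷ 38 ∷ 42 ∷ []) 0 125 25 42 (s≤s z≤n) (s≤s z≤n) (s≤s z≤n) refl refl refl refl refl refl (seven 499 5 (+ 0) (6 ∷ 7 ∷ 8 ∷ 9 ∷ 11 ∷ 12 ∷ 13 ∷ 14 ∷ 16 ∷ 17 ∷ 18 ∷ 19 ∷ 21 ∷ 22 ∷ 23 ∷ 24 ∷ 26 ∷ 27 ∷ 28 ∷ 32 ∷ 33 ∷ 37 ∷ 38 ∷ 42 ∷ []) 0 125 25 42 (s≤s z≤n) (s≤s z≤n) (s≤s z≤n) refl refl _) _ _ _ _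

  certificate-547 : Certificate (row 547 11 (+ 2) (-[1+ 2 ]) (12 ∷ 14 ∷ 15 ∷ 16 ∷ 17 ∷ 18 ∷ 20 ∷ 21 ∷ 23 ∷ 25 ∷ 27 ∷ 28 ∷ 31 ∷ 34 ∷ 36 ∷ []) 4)
  certificate-547 = standard 547 11 (+ 2) (12 ∷ 14 ∷ 15 ∷ 16 ∷ 17 ∷ 18 ∷ 20 ∷ 21 ∷ 23 ∷ 25 ∷ 27 ∷ 28 ∷ 31 ∷ 34 ∷ 36 ∷ []) 0 137 13 36 (s≤s z≤n) (s≤s z≤n) (s≤s z≤n) refl refl refl refl refl refl (seven 547 11 (+ 2) (12 ∷ 14 ∷ 15 ∷ 16 ∷ 17 ∷ 18 ∷ 20 ∷ 21 ∷ 23 ∷ 25 ∷ 27 ∷ 28 ∷ 31 ∷ 34 ∷ 36 ∷ []) 0 137 13 36 (s≤s z≤n) (s≤s z≤n) (s≤s z≤n) refl refl _) _ _ _ _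

  certificate-643 : Certificate (row 643 7 (+ 0) (-[1+ 0 ]) (8 ∷ 9 ∷ 10 ∷ 11 ∷ 12 ∷ 13 ∷ 15 ∷ 16 ∷ 17 ∷ 18 ∷ 19 ∷ 20 ∷ 22 ∷ 24 ∷ 25 ∷ 26 ∷ 27 ∷ 32 ∷ 33 ∷ 34 ∷ 39 ∷ 40 ∷ 41 ∷ 47 ∷ 48 ∷ 55 ∷ []) 4)
  certificate-643 = standard 643 7 (+ 0) (8 ∷ 9 ∷ 10 ∷ 11 ∷ 12 ∷ 13 ∷ 15 ∷ 16 ∷ 17 ∷ 18 ∷ 19 ∷ 20 ∷ 22 ∷ 24 ∷ 25 ∷ 26 ∷ 27 ∷ 32 ∷ 33 ∷ 34 ∷ 39 ∷ 40 ∷ 41 ∷ 47 ∷ 48 ∷ 55 ∷ []) 0 161 23 55 (s≤s z≤n) (s≤s z≤n) (s≤s z≤n) refl refl refl refl refl refl (seven 643 7 (+ 0) (8 ∷ 9 ∷ 10 ∷ 11 ∷ 12 ∷ 13 ∷ 15 ∷ 16 ∷ 17 ∷ 18 ∷ 19 ∷ 20 ∷ 22 ∷ 24 ∷ 25 ∷ 26 ∷ 27 ∷ 32 ∷ 33 ∷ 34 ∷ 39 ∷ 40 ∷ 41 ∷ 47 ∷ 48 ∷ 55 ∷ []) 0 161 23 55 (s≤s z≤n) (s≤s z≤n) (s≤s z≤n) refl refl _) _ _ _ _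

  certificate-883 : Certificate (row 883 13 (+ 0) (-[1+ 0 ]) (14 ∷ 15 ∷ 16 ∷ 18 ∷ 19 ∷ 20 ∷ 21 ∷ 22 ∷ 23 ∷ 24 ∷ 25 ∷ 27 ∷ 28 ∷ 32 ∷ 33 ∷ 35 ∷ 36 ∷ 37 ∷ 38 ∷ 40 ∷ 41 ∷ 45 ∷ 49 ∷ 50 ∷ 53 ∷ 54 ∷ 66 ∷ []) 4)
  certificate-883 = standard 883 13 (+ 0) (14 ∷ 15 ∷ 16 ∷ 18 ∷ 19 ∷ 20 ∷ 21 ∷ 22 ∷ 23 ∷ 24 ∷ 25 ∷ 27 ∷ 28 ∷ 32 ∷ 33 ∷ 35 ∷ 36 ∷ 37 ∷ 38 ∷ 40 ∷ 41 ∷ 45 ∷ 49 ∷ 50 ∷ 53 ∷ 54 ∷ 66 ∷ []) 0 221 17 66 (s≤s z≤n) (s≤s z≤n) (s≤s z≤n) refl refl refl refl refl refl (seven 883 13 (+ 0) (14 ∷ 15 ∷ 16 ∷ 18 ∷ 19 ∷ 20 ∷ 21 ∷ 22 ∷ 23 ∷ 24 ∷ 25 ∷ 27 ∷ 28 ∷ 32 ∷ 33 ∷ 35 ∷ 36 ∷ 37 ∷ 38 ∷ 40 ∷ 41 ∷ 45 ∷ 49 ∷ 50 ∷ 53 ∷ 54 ∷ 66 ∷ []) 0 221 17 66 (s≤s z≤n) (s≤s z≤n) (s≤s z≤n) refl refl _) _ _ _ _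

  -- `81 = 13 + 13 + 13 + 19 + 23` is in `R` but is not a sum of four values of `13X² + 9XY + 19Y²`,
  -- so here the lower bound comes from a nonprincipal lattice. The box of radius 2 contains all
  -- relevant arguments since `4 · 19 · 81 < 907 · 9`.
  certificate-907 : Certificate (row 907 13 (+ 4) (-[1+ 4 ]) (14 ∷ 15 ∷ 16 ∷ 17 ∷ 18 ∷ 20 ∷ 21 ∷ 22 ∷ 24 ∷ 25 ∷ 27 ∷ 28 ∷ 29 ∷ 30 ∷ 31 ∷ 33 ∷ 34 ∷ 35 ∷ 37 ∷ 40 ∷ 43 ∷ 44 ∷ 47 ∷ 48 ∷ 50 ∷ 56 ∷ 63 ∷ []) 5)
  certificate-907 = standard 907 13 (+ 4) (14 ∷ 15 ∷ 16 ∷ 17 ∷ 18 ∷ 20 ∷ 21 ∷ 22 ∷ 24 ∷ 25 ∷ 27 ∷ 28 ∷ 29 ∷ 30 ∷ 31 ∷ 33 ∷ 34 ∷ 35 ∷ 37 ∷ 40 ∷ 43 ∷ 44 ∷ 47 ∷ 48 ∷ 50 ∷ 56 ∷ 63 ∷ []) 1 227 19 63 (s≤s z≤n) (s≤s z≤n) (s≤s z≤n) refl refl refl refl refl refl (inj₂ (81 , inR-sound 13 (14 ∷ 15 ∷ 16 ∷ 17 ∷ 18 ∷ 20 ∷ 21 ∷ 22 ∷ 24 ∷ 25 ∷ 27 ∷ 28 ∷ 29 ∷ 30 ∷ 31 ∷ 33 ∷ 34 ∷ 35 ∷ 37 ∷ 40 ∷ 43 ∷ 44 ∷ 47 ∷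 48 ∷ 50 ∷ 56 ∷ 63 ∷ []) 81 _ , Exact.shortest-sound 907 13 19 (+ 4) (s≤s z≤n) (s≤s z≤n) refl 4 81 2 2 _)) _ _ _ _

-- The row of discriminant -23, with three summands.

module TwentyThree where

  open import Data.Nat.DivMod using (_%_; _/_)
  open Parity using (par; par-+; half; half-double)
  open ThreeSquares using (three-odd-squares)
  open Presentations using (SumOf; QF; sumZ)
  open Searches
  open Certificates using (Certificate; exact-sound; reduced-forms; module Exact)
  open import Data.Bool.Base using (T)

  triple : ∀ a b c {r} (u v w : ℤ × ℤ) → QF a b c u ℤ.+ QF a b c v ℤ.+ QF a b c w ≡ + r → SumOf a b c 3 r
  triple a b c {r} u v w h = f , trans (s (QF a b c u) (QF a b c v) (QF a b c w)) h
    where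
    f : Fin 3 → ℤ × ℤ
    f Fin.zero = u
    f (Fin.suc Fin.zero) = v
    f (Fin.suc (Fin.suc Fin.zero)) = w
    s : ∀ x y z → x ℤ.+ (y ℤ.+ (z ℤ.+ + 0)) ≡ x ℤ.+ y ℤ.+ z
    s = solve-∀

  half-even : ∀ x → par x ≡ false → Σ ℤ λ h → x ≡ + 2 ℤ.* h
  half-even x e = half x , trans (sym (half-double x e)) (r (half x))
    where
    r : ∀ h → h ℤ.+ h ≡ + 2 ℤ.* h
    r = solve-∀

  half-odd : ∀ x → par x ≡ true → Σ ℤ λ h → x ≡ + 2 ℤ.* h ℤ.+ + 1
  half-odd x e = let (h , q) = half-even (x ℤ.- + 1) (trans (par-+ x (ℤ.- + 1)) (cong (_xor true) e)) in h , trans (r x) (cong (ℤ._+ + 1) q)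
    where
    r : ∀ x → x ≡ (x ℤ.- + 1) ℤ.+ + 1
    r = solve-∀

  -- Up to sign an odd number is `1 (mod 4)`.
  quarter-odd : ∀ x → par x ≡ true → Σ ℤ λ t → x ℤ.* x ≡ (+ 4 ℤ.* t ℤ.+ + 1) ℤ.* (+ 4 ℤ.* t ℤ.+ + 1)
  quarter-odd x e = go (half-odd x e)
    where
    go : (Σ ℤ λ h → x ≡ + 2 ℤ.* h ℤ.+ + 1) → Σ ℤ λ t → x ℤ.* x ≡ (+ 4 ℤ.* t ℤ.+ + 1) ℤ.* (+ 4 ℤ.* t ℤ.+ + 1)
    go (h , refl) = by (par h) refl
      where
      r₀ : ∀ t → (+ 2 ℤ.* (+ 2 ℤ.* t) ℤ.+ + 1) ℤ.* (+ 2 ℤ.* (+ 2 ℤ.* t) ℤ.+ + 1) ≡ (+ 4 ℤ.* t ℤ.+ + 1) ℤ.* (+ 4 ℤ.* t ℤ.+ + 1)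
      r₀ = solve-∀
      r₁ : ∀ t → (+ 2 ℤ.* (+ 2 ℤ.* t ℤ.+ + 1) ℤ.+ + 1) ℤ.* (+ 2 ℤ.* (+ 2 ℤ.* t ℤ.+ + 1) ℤ.+ + 1) ≡ (+ 4 ℤ.* (ℤ.- (t ℤ.+ + 1)) ℤ.+ + 1) ℤ.* (+ 4 ℤ.* (ℤ.- (t ℤ.+ + 1)) ℤ.+ + 1)
      r₁ = solve-∀
      by : ∀ p → par h ≡ p → Σ ℤ λ t → (+ 2 ℤ.* h ℤ.+ + 1) ℤ.* (+ 2 ℤ.* h ℤ.+ + 1) ≡ (+ 4 ℤ.* t ℤ.+ + 1) ℤ.* (+ 4 ℤ.* t ℤ.+ + 1)
      by true  q = let (t , e) = half-odd h q in ℤ.- (t ℤ.+ + 1) , trans (cong (λ h → (+ 2 ℤ.* h ℤ.+ + 1) ℤ.* (+ 2 ℤ.* h ℤ.+ + 1)) e) (r₁ t)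
      by false q = let (t , e) = half-even h q in t , trans (cong (λ h → (+ 2 ℤ.* h ℤ.+ + 1) ℤ.* (+ 2 ℤ.* h ℤ.+ + 1)) e) (r₀ t)

  -- 8 (2 t² + t + 3) = (4 t + 1)² + 23.
  ideal-large : ∀ j → SumOf (+ 2) (+ 0) (+ 3) 3 (j ℕ.+ 9)
  ideal-large j = go (three-odd-squares j)
    where
    go : (Σ ℤ λ x → Σ ℤ λ y → Σ ℤ λ z → x ℤ.* x ℤ.+ y ℤ.* y ℤ.+ z ℤ.* z ≡ + 8 ℤ.* + j ℤ.+ + 3 × par x ≡ true × par y ≡ true × par z ≡ true) → SumOf (+ 2) (+ 0) (+ 3) 3 (j ℕ.+ 9)
    go (x , y , z , e , px , py , pz) = finish (quarter-odd x px) (quarter-odd y py) (quarter-odd z pz)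
      where
      r : ∀ t u v → + 8 ℤ.* ((+ 2 ℤ.* (t ℤ.* t) ℤ.+ (+ 2 ℤ.* + 0 ℤ.+ + 1) ℤ.* (t ℤ.* + 1) ℤ.+ + 3 ℤ.* (+ 1 ℤ.* + 1)) ℤ.+ (+ 2 ℤ.* (u ℤ.* u) ℤ.+ (+ 2 ℤ.* + 0 ℤ.+ + 1) ℤ.* (u ℤ.* + 1) ℤ.+ + 3 ℤ.* (+ 1 ℤ.* + 1)) ℤ.+ (+ 2 ℤ.* (v ℤ.* v) ℤ.+ (+ 2 ℤ.* + 0 ℤ.+ + 1) ℤ.* (v ℤ.* + 1) ℤ.+ + 3 ℤ.* (+ 1 ℤ.* + 1)))
        ≡ (+ 4 ℤ.* t ℤ.+ + 1) ℤ.* (+ 4 ℤ.* t ℤ.+ + 1) ℤ.+ (+ 4 ℤ.* u ℤ.+ + 1) ℤ.* (+ 4 ℤ.* u ℤ.+ + 1) ℤ.+ (+ 4 ℤ.* v ℤ.+ + 1) ℤ.* (+ 4 ℤ.* v ℤ.+ + 1) ℤ.+ + 69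
      r = solve-∀
      s : ∀ j → + 8 ℤ.* j ℤ.+ + 3 ℤ.+ + 69 ≡ + 8 ℤ.* (j ℤ.+ + 9)
      s = solve-∀
      finish : (Σ ℤ λ t → x ℤ.* x ≡ (+ 4 ℤ.* t ℤ.+ + 1) ℤ.* (+ 4 ℤ.* t ℤ.+ + 1)) → (Σ ℤ λ t → y ℤ.* y ≡ (+ 4 ℤ.* t ℤ.+ + 1) ℤ.* (+ 4 ℤ.* t ℤ.+ + 1)) → (Σ ℤ λ t → z ℤ.* z ≡ (+ 4 ℤ.* t ℤ.+ + 1) ℤ.* (+ 4 ℤ.* t ℤ.+ + 1)) → SumOf (+ 2) (+ 0) (+ 3) 3 (j ℕ.+ 9)
      finish (t , et) (u , eu) (v , ev) = triple (+ 2) (+ 0) (+ 3) (t , + 1) (u , + 1) (v , + 1)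
        (ℤₚ.*-cancelˡ-≡ (+ 8) _ _ (trans (r t u v) (trans (cong (ℤ._+ + 69) (trans (cong₂ ℤ._+_ (cong₂ ℤ._+_ (sym et) (sym eu)) (sym ev)) e)) (s (+ j)))))

  -- 4 (h² + h + 6) = (2 h + 1)² + 23.
  unary-even : ∀ j → SumOf (+ 1) (+ 0) (+ 6) 3 (2 ℕ.* j ℕ.+ 18)
  unary-even j = go (three-odd-squares j)
    where
    go : (Σ ℤ λ x → Σ ℤ λ y → Σ ℤ λ z → x ℤ.* x ℤ.+ y ℤ.* y ℤ.+ z ℤ.* z ≡ + 8 ℤ.* + j ℤ.+ + 3 × par x ≡ true × par y ≡ true × par z ≡ true) → SumOf (+ 1) (+ 0) (+ 6) 3 (2 ℕ.* j ℕ.+ 18)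
    go (x , y , z , e , px , py , pz) = finish (half-odd x px) (half-odd y py) (half-odd z pz)
      where
      r : ∀ t u v → + 4 ℤ.* ((+ 1 ℤ.* (t ℤ.* t) ℤ.+ (+ 2 ℤ.* + 0 ℤ.+ + 1) ℤ.* (t ℤ.* + 1) ℤ.+ + 6 ℤ.* (+ 1 ℤ.* + 1)) ℤ.+ (+ 1 ℤ.* (u ℤ.* u) ℤ.+ (+ 2 ℤ.* + 0 ℤ.+ + 1) ℤ.* (u ℤ.* + 1) ℤ.+ + 6 ℤ.* (+ 1 ℤ.* + 1)) ℤ.+ (+ 1 ℤ.* (v ℤ.* v) ℤ.+ (+ 2 ℤ.* + 0 ℤ.+ + 1) ℤ.* (v ℤ.* + 1) ℤ.+ + 6 ℤ.* (+ 1 ℤ.* + 1)))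
        ≡ (+ 2 ℤ.* t ℤ.+ + 1) ℤ.* (+ 2 ℤ.* t ℤ.+ + 1) ℤ.+ (+ 2 ℤ.* u ℤ.+ + 1) ℤ.* (+ 2 ℤ.* u ℤ.+ + 1) ℤ.+ (+ 2 ℤ.* v ℤ.+ + 1) ℤ.* (+ 2 ℤ.* v ℤ.+ + 1) ℤ.+ + 69
      r = solve-∀
      s : ∀ j → + 8 ℤ.* j ℤ.+ + 3 ℤ.+ + 69 ≡ + 4 ℤ.* (+ 2 ℤ.* j ℤ.+ + 18)
      s = solve-∀
      square : ∀ {x t} → x ≡ t → t ℤ.* t ≡ x ℤ.* x
      square refl = refl
      finish : (Σ ℤ λ t → x ≡ + 2 ℤ.* t ℤ.+ + 1) → (Σ ℤ λ t → y ≡ + 2 ℤ.* t ℤ.+ + 1) → (Σ ℤ λ t → z ≡ + 2 ℤ.* t ℤ.+ + 1) → SumOf (+ 1) (+ 0) (+ 6) 3 (2 ℕ.* j ℕ.+ 18)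
      finish (t , et) (u , eu) (v , ev) = triple (+ 1) (+ 0) (+ 6) (t , + 1) (u , + 1) (v , + 1)
        (ℤₚ.*-cancelˡ-≡ (+ 4) _ _ (trans (r t u v) (trans (cong (ℤ._+ + 69) (trans (cong₂ ℤ._+_ (cong₂ ℤ._+_ (square et) (square eu)) (square ev)) e)) (trans (s (+ j)) (cong (λ t → + 4 ℤ.* (t ℤ.+ + 18)) (sym (ℤₚ.pos-* 2 j)))))))

  -- The norm of (X - Y) + 2 Y ω is X² + 23 Y².
  unary-odd : ∀ p q r j → SumOf (+ 1) (+ 0) (+ 6) 3 (8 ℕ.* j ℕ.+ 3 ℕ.+ 23 ℕ.* (p ℕ.* p ℕ.+ q ℕ.* q ℕ.+ r ℕ.* r))
  unary-odd p q r j = go (three-odd-squares j)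
    where
    s : ∀ X Y Z p q r → (+ 1 ℤ.* ((X ℤ.- p) ℤ.* (X ℤ.- p)) ℤ.+ (+ 2 ℤ.* + 0 ℤ.+ + 1) ℤ.* ((X ℤ.- p) ℤ.* (+ 2 ℤ.* p)) ℤ.+ + 6 ℤ.* (+ 2 ℤ.* p ℤ.* (+ 2 ℤ.* p)))
                    ℤ.+ (+ 1 ℤ.* ((Y ℤ.- q) ℤ.* (Y ℤ.- q)) ℤ.+ (+ 2 ℤ.* + 0 ℤ.+ + 1) ℤ.* ((Y ℤ.- q) ℤ.* (+ 2 ℤ.* q)) ℤ.+ + 6 ℤ.* (+ 2 ℤ.* q ℤ.* (+ 2 ℤ.* q)))
                    ℤ.+ (+ 1 ℤ.* ((Z ℤ.- r) ℤ.* (Z ℤ.- r)) ℤ.+ (+ 2 ℤ.* + 0 ℤ.+ + 1) ℤ.* ((Z ℤ.- r) ℤ.* (+ 2 ℤ.* r)) ℤ.+ + 6 ℤ.* (+ 2 ℤ.* r ℤ.* (+ 2 ℤ.* r)))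
        ≡ (X ℤ.* X ℤ.+ Y ℤ.* Y ℤ.+ Z ℤ.* Z) ℤ.+ + 23 ℤ.* (p ℤ.* p ℤ.+ q ℤ.* q ℤ.+ r ℤ.* r)
    s = solve-∀
    cast : (+ 8 ℤ.* + j ℤ.+ + 3) ℤ.+ + 23 ℤ.* (+ p ℤ.* + p ℤ.+ + q ℤ.* + q ℤ.+ + r ℤ.* + r) ≡ + (8 ℕ.* j ℕ.+ 3 ℕ.+ 23 ℕ.* (p ℕ.* p ℕ.+ q ℕ.* q ℕ.+ r ℕ.* r))
    cast = cong₂ ℤ._+_ (cong (ℤ._+ + 3) (sym (ℤₚ.pos-* 8 j))) (trans (cong (+ 23 ℤ.*_) (cong₂ ℤ._+_ (cong₂ ℤ._+_ (sym (ℤₚ.pos-* p p)) (sym (ℤₚ.pos-* q q))) (sym (ℤₚ.pos-* r r)))) (sym (ℤₚ.pos-* 23 (p ℕ.* p ℕ.+ q ℕ.* q ℕ.+ r ℕ.* r))))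
    go : (Σ ℤ λ x → Σ ℤ λ y → Σ ℤ λ z → x ℤ.* x ℤ.+ y ℤ.* y ℤ.+ z ℤ.* z ≡ + 8 ℤ.* + j ℤ.+ + 3 × par x ≡ true × par y ≡ true × par z ≡ true) → SumOf (+ 1) (+ 0) (+ 6) 3 (8 ℕ.* j ℕ.+ 3 ℕ.+ 23 ℕ.* (p ℕ.* p ℕ.+ q ℕ.* q ℕ.+ r ℕ.* r))
    go (x , y , z , e , _) = triple (+ 1) (+ 0) (+ 6) (x ℤ.- + p , + 2 ℤ.* + p) (y ℤ.- + q , + 2 ℤ.* + q) (z ℤ.- + r , + 2 ℤ.* + r)
      (trans (s x y z (+ p) (+ q) (+ r)) (trans (cong (ℤ._+ + 23 ℤ.* (+ p ℤ.* + p ℤ.+ + q ℤ.* + q ℤ.+ + r ℤ.* + r)) e) cast))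

  module U = Form 23 1 6 (+ 0) (s≤s z≤n) (s≤s z≤n) refl
  module V = Form 23 2 3 (+ 0) (s≤s z≤n) (s≤s z≤n) refl

  unary-small? : U.Candidates → ℕ → Bool
  unary-small? cs i = U.search? cs 1 3 (suc i) ∨ U.search? cs 3 3 (suc i)

  unary-small : ∀ i → i ℕ.< 159 → SumOf (+ 1) (+ 0) (+ 6) 3 (suc i)
  unary-small i i<159 = go (∨-T {U.search? cs 1 3 (suc i)} (every<-sound (unary-small? cs) 159 checked i<159))
    where
    cs : U.Candidates
    cs = U.candidates 13 6
    checked : T ((λ cs → every< (unary-small? cs) 159) (U.candidates 13 6))
    checked = _
    go : T (U.search? cs 1 3 (suc i)) ⊎ T (U.search? cs 3 3 (suc i)) → SumOf (+ 1) (+ 0) (+ 6) 3 (suc i)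
    go (inj₁ t) = U.search-sound cs 1 3 (suc i) t
    go (inj₂ t) = U.search-sound cs 3 3 (suc i) t

  -- Even numbers come from `unary-even`. The odd residues 1, 3, 5, 7 modulo 8 come from
  -- `8j + 3 + 23q` with `q = 2, 0, 6, 4`, each a sum of three squares. The largest offset is
  -- `3 + 138 = 141`, which lies below 160.
  unary-large : ∀ s → s ℕ.< 8 → ∀ j → SumOf (+ 1) (+ 0) (+ 6) 3 (160 ℕ.+ (s ℕ.+ j ℕ.* 8))
  unary-large = go
    where
    S : ℕ → Set
    S = SumOf (+ 1) (+ 0) (+ 6) 3
    even : ∀ a j → S (2 ℕ.* (a ℕ.+ 4 ℕ.* j) ℕ.+ 18) → S (18 ℕ.+ 2 ℕ.* a ℕ.+ j ℕ.* 8)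
    even a j = subst S (r a j)
      where
      r : ∀ a j → 2 ℕ.* (a ℕ.+ 4 ℕ.* j) ℕ.+ 18 ≡ 18 ℕ.+ 2 ℕ.* a ℕ.+ j ℕ.* 8
      r = solveℕ
    odd : ∀ a j c → S (8 ℕ.* (a ℕ.+ j) ℕ.+ 3 ℕ.+ c) → S (8 ℕ.* a ℕ.+ 3 ℕ.+ c ℕ.+ j ℕ.* 8)
    odd a j c = subst S (r a j c)
      where
      r : ∀ a j c → 8 ℕ.* (a ℕ.+ j) ℕ.+ 3 ℕ.+ c ≡ 8 ℕ.* a ℕ.+ 3 ℕ.+ c ℕ.+ j ℕ.* 8
      r = solveℕ
    go : ∀ s → s ℕ.< 8 → ∀ j → S (160 ℕ.+ (s ℕ.+ j ℕ.* 8))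
    go 0 _ j = even 71 j (unary-even (71 ℕ.+ 4 ℕ.* j))
    go 1 _ j = odd 14 j 46 (unary-odd 1 1 0 (14 ℕ.+ j))
    go 2 _ j = even 72 j (unary-even (72 ℕ.+ 4 ℕ.* j))
    go 3 _ j = odd 20 j 0 (unary-odd 0 0 0 (20 ℕ.+ j))
    go 4 _ j = even 73 j (unary-even (73 ℕ.+ 4 ℕ.* j))
    go 5 _ j = odd 3 j 138 (unary-odd 2 1 1 (3 ℕ.+ j))
    go 6 _ j = even 74 j (unary-even (74 ℕ.+ 4 ℕ.* j))
    go 7 _ j = odd 9 j 92 (unary-odd 2 0 0 (9 ℕ.+ j))
    go (suc (suc (suc (suc (suc (suc (suc (suc s)))))))) (s≤s (s≤s (s≤s (s≤s (s≤s (s≤s (s≤s (s≤s ())))))))) j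

  unary-23 : ∀ r → 1 ℕ.≤ r → SumOf (+ 1) (+ 0) (+ 6) 3 r
  unary-23 (suc i) _ = by (ℕₚ.<-≤-connex i 159)
    where
    by : i ℕ.< 159 ⊎ 159 ℕ.≤ i → SumOf (+ 1) (+ 0) (+ 6) 3 (suc i)
    by (inj₁ h) = unary-small i h
    by (inj₂ h) = subst (SumOf (+ 1) (+ 0) (+ 6) 3) (trans (cong (160 ℕ.+_) (sym (ℕD.m≡m%n+[m/n]*n (i ℕ.∸ 159) 8))) (cong suc (ℕₚ.m+[n∸m]≡n h)))
      (unary-large ((i ℕ.∸ 159) % 8) (ℕD.m%n<n (i ℕ.∸ 159) 8) ((i ℕ.∸ 159) / 8))

  ideal-23 : ∀ r → 2 ℕ.≤ r → SumOf (+ 2) (+ 0) (+ 3) 3 r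
  ideal-23 r 2≤r = by (ℕₚ.<-≤-connex r 9)
    where
    cs : V.Candidates
    cs = V.candidates 2 2
    p : ℕ → Bool
    p i = V.search? cs 3 3 (2 ℕ.+ i)
    by : r ℕ.< 9 ⊎ 9 ℕ.≤ r → SumOf (+ 2) (+ 0) (+ 3) 3 r
    by (inj₁ h) = subst (SumOf (+ 2) (+ 0) (+ 3) 3) (ℕₚ.m+[n∸m]≡n 2≤r)
      (V.search-sound cs 3 3 (2 ℕ.+ (r ℕ.∸ 2)) (every<-sound p 7 _ (ℕₚ.+-cancelˡ-< 2 _ _ (subst (ℕ._< 9) (sym (ℕₚ.m+[n∸m]≡n 2≤r)) h))))
    by (inj₂ h) = subst (SumOf (+ 2) (+ 0) (+ 3) 3) (ℕₚ.m∸n+n≡m h) (ideal-large (r ℕ.∸ 9))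

  -- The lower bound uses 3, which is not a sum of two norms, because a norm with `Y ≠ 0` is at
  -- least 6. As there are no exclusions, `M` is `k = 2`.
  certificate-23 : Certificate (row 23 2 (+ 0) (-[1+ 0 ]) [] 3)
  certificate-23 = record
    { N = 6 ; C = 3 ; 4N = refl ; Tr≡1 = refl ; Nm≡N = refl ; k≥1 = s≤s z≤n ; g≥1 = s≤s z≤n ; disc = refl ; opposite = refl
    ; unary    = unary-23
    ; ideal    = λ r h → ideal-23 r (proj₁ h)
    ; closed   = exact-sound 23 2 (+ 0) [] 3 2 (s≤s z≤n) (s≤s z≤n) refl _
    ; minimal  = inj₁ (3 , s≤s z≤n , Exact.shortest-sound 23 1 6 (+ 0) (s≤s z≤n) (s≤s z≤n) refl 2 3 3 1 _)
    ; reduced  = reduced-forms 23 6 2 (+ 0) (-[1+ 0 ]) _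
    }

-- From binary forms back to Hermitian lattices.

open import Data.Rational.Base using (_+_; _*_; -_; _-_; _/_)
open Rationals
open QuadraticField
open Hermite
open Multiples
open Principal
open GaussReduction
open Presentations
open Searches using (reflect)
open Certificates using (Certificate)
open Rows
open TwentyThree using (certificate-23)

module Unaries (d N : ℕ) (Tr≡1 : Tr d ≡ 1ℚ) (Nm≡N : Nm d ≡ ℤ→ℚ (+ N)) (4N : 4 ℕ.* N ≡ suc d) where
  open Field d
  open Algebra d
  open Lattices d
  open Reduction d N Tr≡1 Nm≡N 4N
  open Reduce d N Tr≡1 Nm≡N 4N
  open Present d N Tr≡1 Nm≡N 4N
  open Representations d N Tr≡1 Nm≡N 4N

  -- A presentation with `α = 1`, where the ideal is `J a b` itself; the lattices listed in the
  -- theorem are of this kind.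
  record Model (K : Unary) (a : ℕ) (b c : ℤ) (r : ℕ) : Set where
    field
      a≥1   : 1 ℕ.≤ a
      r≥1   : 1 ℕ.≤ r
      disc  : Discriminant (+ a) b c
      to    : ∀ x → x ∈ᴵ ideal K → J (+ a) b x
      from  : ∀ x → J (+ a) b x → x ∈ᴵ ideal K
      value : hv K * ⌈ + a ⌉ ≡ ⌈ + r ⌉

  model-presentation : ∀ {K a b c r} → Model K a b c r → Presentation K a b c r
  model-presentation {K} {a} {b} {c} {r} M = presentation (Model.a≥1 M) (Model.r≥1 M) (Model.disc M)
    (multiple unit-1 (λ x h → subst (J (+ a) b) (sym (·-identityˡ x)) (Model.to M x h)) (λ x h → Model.from M x (subst (J (+ a) b) (·-identityˡ x) h)))
    (trans (cong (_* ⌈ + a ⌉) (trans (cong (_* hv K) n-1) (ℚₚ.*-identityˡ (hv K)))) (Model.value M))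

  -- Multiplication by `α⁻¹` carries the ideal of `L` onto `J a b`. The equal scales force
  -- `hv K = n(α) hv L`, so `h` is preserved.
  isometric-model : ∀ {L K a b c r} → Presentation L a b c r → Model K a b c r → Isometric L K
  isometric-model {L} {K} {a@(suc _)} {b} {c} {r} (presentation _ _ _ (multiple {α} u to from) value) M =
    (λ x → α′ · x) , (λ x h → Model.from M _ (to x h)) , (λ x y _ _ → ·-distribˡ α′ x y) , (λ k x _ _ → rotate k x) ,
    (λ x y _ _ e → trans (sym (Unit.cancel u x)) (trans (cong (α ·_) e) (Unit.cancel u y))) ,
    (λ y h → α · y , from (α · y) (subst (J (+ a) b) (sym (Unit.cancel′ u y)) (Model.to M y h)) , Unit.cancel′ u y) ,
    (λ x y _ _ → trans (hU-norm K α′ x y) (cong (λ t → (x · conj y) · ι t) norm))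
    where
    open ≡-Reasoning
    α′ : E
    α′ = Unit.inv u
    rotate : ∀ k x → α′ · (k · x) ≡ k · (α′ · x)
    rotate k x = trans (sym (·-assoc α′ k x)) (trans (cong (_· x) (·-comm α′ k)) (·-assoc k α′ x))
    A≢0 : ⌈ + a ⌉ ≢ 0ℚ
    A≢0 = ⌈⌉-nonzero {+ a} λ ()
    hvK : hv K ≡ n α * hv L
    hvK = *-cancelℚ A≢0 (trans (ℚₚ.*-comm ⌈ + a ⌉ (hv K)) (trans (trans (Model.value M) (sym value)) (ℚₚ.*-comm (n α * hv L) ⌈ + a ⌉)))
    norm : n α′ * hv K ≡ hv L
    norm = begin
      n α′ * hv K          ≡⟨ cong (n α′ *_) hvK ⟩
      n α′ * (n α * hv L)  ≡⟨ r₁ (n α′) (n α) (hv L) ⟩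
      n α * n α′ * hv L    ≡⟨ cong (_* hv L) (Unit.norms u) ⟩
      1ℚ * hv L            ≡⟨ ℚₚ.*-identityˡ (hv L) ⟩
      hv L                 ∎
      where
      r₁ : ∀ s t h → s * (t * h) ≡ t * s * h
      r₁ = solve-∀-over ℚ-ring

  isometric-represented : ∀ {L K m} → Isometric L K → RepresentedBy K m → RepresentedBy L m
  isometric-represented {L} {K} {m} (f , f∈ , f+ , f· , f-inj , _ , fh) (g , g𝒪 , g+ , g· , g-inj , gh) =
    (λ x → g (f x)) , (λ x h → g𝒪 (f x) (f∈ x h)) ,
    (λ x y h k i → trans (cong (λ t → g t i) (f+ x y h k)) (g+ (f x) (f y) (f∈ x h) (f∈ y k) i)) ,
    (λ c x o h i → trans (cong (λ t → g t i) (f· c x o h)) (g· c (f x) o (f∈ x h) i)) ,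
    (λ x y h k e → f-inj x y h k (g-inj (f x) (f y) (f∈ x h) (f∈ y k) e)) ,
    (λ x y h k → trans (gh (f x) (f y) (f∈ x h) (f∈ y k)) (fh x y h k))

  norm-natural : ∀ p q → Σ ℕ λ s → nℤ p q ≡ + s
  norm-natural p q = go (nℤ p q) (4n p q)
    where
    W = + 2 ℤ.* p ℤ.+ q
    go : ∀ t → + 4 ℤ.* t ≡ W ℤ.* W ℤ.+ + d ℤ.* (q ℤ.* q) → Σ ℕ λ s → t ≡ + s
    go (+ s) _ = s , refl
    go -[1+ s ] e = ⊥-elim (absurd (trans e (cong₂ ℤ._+_ (square-abs W) (trans (cong (+ d ℤ.*_) (square-abs q)) (sym (ℤₚ.pos-* d (ℤ.∣ q ∣ ℕ.* ℤ.∣ q ∣)))))))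
      where
      absurd : ∀ {m} → + 4 ℤ.* -[1+ s ] ≡ + m → ⊥
      absurd ()

  𝒪-+ : ∀ {x y} → Is𝒪 x → Is𝒪 y → Is𝒪 (x +E y)
  𝒪-+ {x} {y} p q = let (a , b , e) = 𝒪-int p ; (c , f , g) = 𝒪-int q in int-𝒪 (a ℤ.+ c) (b ℤ.+ f) (trans (cong₂ _+E_ e g) (⟪⟫-+ a b c f))

  𝒪-conj : ∀ {x} → Is𝒪 x → Is𝒪 (conj x)
  𝒪-conj p = let (a , b , e) = 𝒪-int p in int-𝒪 (a ℤ.+ b) (ℤ.- b) (trans (cong conj e) (⟪⟫-conj a b))

  hI-𝒪 : ∀ m (u v : Fin m → E) → (∀ i → Is𝒪 (u i)) → (∀ i → Is𝒪 (v i)) → Is𝒪 (hI m u v)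
  hI-𝒪 zero    u v _ _ = 𝒪-0
  hI-𝒪 (suc m) u v p q = 𝒪-+ (𝒪-· (p Fin.zero) (𝒪-conj (q Fin.zero))) (hI-𝒪 m (λ i → u (Fin.suc i)) (λ i → v (Fin.suc i)) (λ i → p (Fin.suc i)) (λ i → q (Fin.suc i)))

  hI-natural : ∀ m (u : Fin m → E) → (∀ i → Is𝒪 (u i)) → Σ ℕ λ s → hI m u u ≡ ι ⌈ + s ⌉
  hI-natural zero    u _ = 0 , refl
  hI-natural (suc m) u p = first (𝒪-int (p Fin.zero)) (hI-natural m (λ i → u (Fin.suc i)) (λ i → p (Fin.suc i)))
    where
    first : (Σ ℤ λ a → Σ ℤ λ b → u Fin.zero ≡ ⟪ a , b ⟫) → (Σ ℕ λ s → hI m (λ i → u (Fin.suc i)) (λ i → u (Fin.suc i)) ≡ ι ⌈ + s ⌉) → Σ ℕ λ s → hI (suc m) u u ≡ ι ⌈ + s ⌉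
    first (a , b , e) (s , q) = proj₁ (norm-natural a b) ℕ.+ s , trans (cong₂ _+E_ head q) (cong (_, 0ℚ) (sym (ℤ→ℚ-+ (+ proj₁ (norm-natural a b)) (+ s))))
      where
      head : u Fin.zero · conj (u Fin.zero) ≡ ι ⌈ + proj₁ (norm-natural a b) ⌉
      head = trans (cong (λ t → t · conj t) e) (trans (x·conj ⟪ a , b ⟫) (cong ι (trans (n-int a b) (cong ⌈_⌉ (proj₂ (norm-natural a b))))))

  -- `h` is pulled back from a sum of norms, so it is integral, and natural on the diagonal. It
  -- vanishes only at zero because `hv` is nonzero and the norm is anisotropic.
  represented-positive : ∀ {K m} → hv K ≢ 0ℚ → RepresentedBy K m → PosDefIntegral K
  represented-positive {K} {m} hv≢0 (f , f𝒪 , _ , _ , _ , fh) =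
    (λ x h x≢0 → positive x h x≢0 (hI-natural m (f x) (f𝒪 x h))) ,
    (λ x y h k → subst Is𝒪 (fh x y h k) (hI-𝒪 m (f x) (f y) (f𝒪 x h) (f𝒪 y k)))
    where
    positive : ∀ x → x ∈ᴵ ideal K → x ≢ 0E → (Σ ℕ λ s → hI m (f x) (f x) ≡ ι ⌈ + s ⌉) → Σ ℕ λ s → (0 ℕ.< s) × (hU K x x ≡ ι (ℕ→ℚ s))
    positive x h x≢0 (suc s , e) = suc s , s≤s z≤n , trans (sym (fh x x h h)) e
    positive x h x≢0 (zero , e) = ⊥-elim (x≢0 (n-zero x (*-zero-cancel hv≢0 (trans (ℚₚ.*-comm (hv K) (n x)) (cong proj₁
      (trans (sym (ι-· (n x) (hv K))) (trans (cong (_· ι (hv K)) (sym (x·conj x))) (trans (sym (fh x x h h)) e))))))))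

  model-nonzero : ∀ {K a b c r} → Model K a b c r → hv K ≢ 0ℚ
  model-nonzero {K} {a} {r = r} M e = ℕₚ.<⇒≢ (Model.r≥1 M) (sym (ℤₚ.+-injective (ℤ→ℚ-injective (trans (sym (Model.value M)) (trans (cong (_* ⌈ + a ⌉) e) (ℚₚ.*-zeroˡ ⌈ + a ⌉))))))

  model-represented : ∀ {K a b c r m} → Model K a b c r → SumOf (+ a) b c m r → RepresentedBy K m
  model-represented {m = m} M = sum-represented {m = m} (model-presentation M)

  model-InS : ∀ {K a b c r m} → Model K a b c r → 1 ℕ.≤ m → SumOf (+ a) b c m r → InS K
  model-InS {K} {m = m} M m≥1 S = represented-positive {K} {m} (model-nonzero M) (model-represented {m = m} M S) , m , m≥1 , model-represented {m = m} M S

module RowProof (ρ : Row) (cert : Certificate ρ) where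
  open Row ρ
  open Certificate cert using (N; C; 4N; Tr≡1; Nm≡N)
  module Cert = Certificate cert
  open Field d
  open Algebra d
  open Reduction d N Tr≡1 Nm≡N 4N
  open Present d N Tr≡1 Nm≡N 4N
  open Representations d N Tr≡1 Nm≡N 4N
  open Unaries d N Tr≡1 Nm≡N 4N

  L₁-model : ∀ r → 1 ℕ.≤ r → Model (L₁ ρ r) 1 (+ 0) (+ N) r
  L₁-model r r≥1 = record
    { a≥1 = s≤s z≤n ; r≥1 = r≥1 ; disc = ℤₚ.*-identityˡ (+ N)
    ; to = to ; from = from ; value = ℚₚ.*-identityʳ ⌈ + r ⌉ }
    where
    ones : ∀ q p → p ≡ p ℤ.* + 1 ℤ.+ q ℤ.* + 0
    ones = solve-∀
    ·-identityʳ : ∀ x → x · 1E ≡ x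
    ·-identityʳ x = trans (·-comm x 1E) (·-identityˡ x)
    to : ∀ x → x ∈ᴵ ideal𝒪 ρ → J (+ 1) (+ 0) x
    to x (c , o , e) = let (p , q , f) = 𝒪-int o in p , q , trans (-E-zero {x} {c · 1E} e) (trans (·-identityʳ c) (trans f (cong (λ t → ⟪ t , q ⟫) (ones q p))))
    from : ∀ x → J (+ 1) (+ 0) x → x ∈ᴵ ideal𝒪 ρ
    from x (p , q , e) = x , int-𝒪 (p ℤ.* + 1 ℤ.+ q ℤ.* + 0) q e , trans (cong (λ t → x -E t) (·-identityʳ x)) (-E-self x)

  conjugate : ∀ {c} → c ≡ c₂ ⊎ c ≡ c₃ → + k ℤ.* + C ≡ c ℤ.* c ℤ.+ c ℤ.+ + N
  conjugate (inj₁ refl) = Cert.disc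
  conjugate {c} (inj₂ refl) = trans Cert.disc (trans (r c₂ (+ N)) (cong (λ t → t ℤ.* t ℤ.+ t ℤ.+ + N) (sym Cert.opposite)))
    where
    r : ∀ c N → c ℤ.* c ℤ.+ c ℤ.+ N ≡ (ℤ.- (+ 1 ℤ.+ c)) ℤ.* (ℤ.- (+ 1 ℤ.+ c)) ℤ.+ (ℤ.- (+ 1 ℤ.+ c)) ℤ.+ N
    r = solve-∀

  from-c₂ : ∀ {c m r} → c ≡ c₂ ⊎ c ≡ c₃ → SumOf (+ k) c₂ (+ C) m r → SumOf (+ k) c (+ C) m r
  from-c₂ (inj₁ refl) S = S
  from-c₂ {m = m} {r} (inj₂ refl) S = subst (λ t → SumOf (+ k) t (+ C) m r) (sym Cert.opposite) (reflect (+ k) c₂ (+ C) {m} {r} S)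

  to-c₂ : ∀ {c m r} → c ≡ c₂ ⊎ c ≡ c₃ → SumOf (+ k) c (+ C) m r → SumOf (+ k) c₂ (+ C) m r
  to-c₂ (inj₁ refl) S = S
  to-c₂ {m = m} {r} (inj₂ refl) S = subst (λ t → SumOf (+ k) t (+ C) m r) (trans (cong (λ t → ℤ.- (+ 1 ℤ.+ t)) Cert.opposite) (s c₂)) (reflect (+ k) c₃ (+ C) {m} {r} S)
    where
    s : ∀ c → ℤ.- (+ 1 ℤ.+ (ℤ.- (+ 1 ℤ.+ c))) ≡ c
    s = solve-∀

  Lⱼ-model : ∀ c r → c ≡ c₂ ⊎ c ≡ c₃ → 1 ℕ.≤ r → Model (Lⱼ ρ c r) k c (+ C) r
  Lⱼ-model c r cc r≥1 = record
    { a≥1 = Cert.k≥1 ; r≥1 = r≥1 ; disc = conjugate cc ; to = to ; from = from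
    ; value = trans (ℚₚ.*-comm ((+ r) / k) ⌈ + k ⌉) (/-cancel k (+ r)) }
    where
    open ≡-Reasoning
    -- The product of the second generator with `ω` falls back into `J k c` because `kC` is the norm
    -- of `c + ω`; this produces the term with `C`.
    combination : ∀ s t u v → (⟪ s , t ⟫ · ⟪ + k , + 0 ⟫) +E (⟪ u , v ⟫ · ⟪ c , + 1 ⟫)
                  ≡ ⟪ (s ℤ.- t ℤ.* c ℤ.- v ℤ.* + C) ℤ.* + k ℤ.+ (t ℤ.* + k ℤ.+ v ℤ.* c ℤ.+ u ℤ.+ v) ℤ.* c , t ℤ.* + k ℤ.+ v ℤ.* c ℤ.+ u ℤ.+ v ⟫
    combination s t u v = trans (cong₂ _+E_ (⟪⟫-· s t (+ k) (+ 0)) (⟪⟫-· u v c (+ 1)))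
      (trans (⟪⟫-+ (s ℤ.* + k ℤ.- + N ℤ.* (t ℤ.* + 0)) (s ℤ.* + 0 ℤ.+ t ℤ.* + k ℤ.+ t ℤ.* + 0) (u ℤ.* c ℤ.- + N ℤ.* (v ℤ.* + 1)) (u ℤ.* + 1 ℤ.+ v ℤ.* c ℤ.+ v ℤ.* + 1))
        (cong₂ ⟪_,_⟫ (trans (r₁ (+ k) (+ N) c s t u v) (trans (cong (λ w → (s ℤ.- t ℤ.* c) ℤ.* + k ℤ.- v ℤ.* w ℤ.+ (t ℤ.* + k ℤ.+ v ℤ.* c ℤ.+ u ℤ.+ v) ℤ.* c) (sym (conjugate cc))) (r₂ (+ k) (+ C) c s t u v)))
          (r₃ (+ k) c s t u v)))
      where
      r₁ : ∀ k N c s t u v → (s ℤ.* k ℤ.- N ℤ.* (t ℤ.* + 0)) ℤ.+ (u ℤ.* c ℤ.- N ℤ.* (v ℤ.* + 1)) ≡ (s ℤ.- t ℤ.* c) ℤ.* k ℤ.- v ℤ.* (c ℤ.* c ℤ.+ c ℤ.+ N) ℤ.+ (t ℤ.* k ℤ.+ v ℤ.* c ℤ.+ u ℤ.+ v) ℤ.* c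
      r₁ = solve-∀
      r₂ : ∀ k C c s t u v → (s ℤ.- t ℤ.* c) ℤ.* k ℤ.- v ℤ.* (k ℤ.* C) ℤ.+ (t ℤ.* k ℤ.+ v ℤ.* c ℤ.+ u ℤ.+ v) ℤ.* c ≡ (s ℤ.- t ℤ.* c ℤ.- v ℤ.* C) ℤ.* k ℤ.+ (t ℤ.* k ℤ.+ v ℤ.* c ℤ.+ u ℤ.+ v) ℤ.* c
      r₂ = solve-∀
      r₃ : ∀ k c s t u v → (s ℤ.* + 0 ℤ.+ t ℤ.* k ℤ.+ t ℤ.* + 0) ℤ.+ (u ℤ.* + 1 ℤ.+ v ℤ.* c ℤ.+ v ℤ.* + 1) ≡ t ℤ.* k ℤ.+ v ℤ.* c ℤ.+ u ℤ.+ v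
      r₃ = solve-∀
    to : ∀ x → x ∈ᴵ idealU ρ c → J (+ k) c x
    to x (c₁ , o₁ , e₁ , o₂ , h) = let (s , t , p) = 𝒪-int o₁ ; (u , v , q) = 𝒪-int o₂ in
      s ℤ.- t ℤ.* c ℤ.- v ℤ.* + C , t ℤ.* + k ℤ.+ v ℤ.* c ℤ.+ u ℤ.+ v , (begin
        x                                                          ≡⟨ -E-cancel x (c₁ · ⟪ + k , + 0 ⟫) ⟨
        (x -E (c₁ · ⟪ + k , + 0 ⟫)) +E (c₁ · ⟪ + k , + 0 ⟫)        ≡⟨ cong (_+E (c₁ · ⟪ + k , + 0 ⟫)) (-E-zero {x -E (c₁ · ⟪ + k , + 0 ⟫)} {e₁ · ⟪ c , + 1 ⟫} h) ⟩
        (e₁ · ⟪ c , + 1 ⟫) +E (c₁ · ⟪ + k , + 0 ⟫)                 ≡⟨ +E-comm (e₁ · ⟪ c , + 1 ⟫) (c₁ · ⟪ + k , + 0 ⟫) ⟩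
        (c₁ · ⟪ + k , + 0 ⟫) +E (e₁ · ⟪ c , + 1 ⟫)                 ≡⟨ cong₂ (λ y z → (y · ⟪ + k , + 0 ⟫) +E (z · ⟪ c , + 1 ⟫)) p q ⟩
        (⟪ s , t ⟫ · ⟪ + k , + 0 ⟫) +E (⟪ u , v ⟫ · ⟪ c , + 1 ⟫)   ≡⟨ combination s t u v ⟩
        ⟪ (s ℤ.- t ℤ.* c ℤ.- v ℤ.* + C) ℤ.* + k ℤ.+ (t ℤ.* + k ℤ.+ v ℤ.* c ℤ.+ u ℤ.+ v) ℤ.* c , t ℤ.* + k ℤ.+ v ℤ.* c ℤ.+ u ℤ.+ v ⟫ ∎)
    from : ∀ x → J (+ k) c x → x ∈ᴵ idealU ρ c
    from x (p , q , e) = ⟪ p , + 0 ⟫ , ((p , refl) , (+ 0 , refl)) , ⟪ q , + 0 ⟫ , ((q , refl) , (+ 0 , refl)) ,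
      trans (cong (λ y → y -E (⟪ q , + 0 ⟫ · ⟪ c , + 1 ⟫)) difference) (-E-self (⟪ q , + 0 ⟫ · ⟪ c , + 1 ⟫))
      where
      split : x ≡ (⟪ q , + 0 ⟫ · ⟪ c , + 1 ⟫) +E (⟪ p , + 0 ⟫ · ⟪ + k , + 0 ⟫)
      split = trans e (trans (cong₂ ⟪_,_⟫ (r₁ (+ k) (+ C) c p q) (r₂ (+ k) c q)) (trans (sym (combination p (+ 0) q (+ 0))) (+E-comm (⟪ p , + 0 ⟫ · ⟪ + k , + 0 ⟫) (⟪ q , + 0 ⟫ · ⟪ c , + 1 ⟫))))
        where
        r₁ : ∀ k C c p q → p ℤ.* k ℤ.+ q ℤ.* c ≡ (p ℤ.- + 0 ℤ.* c ℤ.- + 0 ℤ.* C) ℤ.* k ℤ.+ (+ 0 ℤ.* k ℤ.+ + 0 ℤ.* c ℤ.+ q ℤ.+ + 0) ℤ.* c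
        r₁ = solve-∀
        r₂ : ∀ k c q → q ≡ + 0 ℤ.* k ℤ.+ + 0 ℤ.* c ℤ.+ q ℤ.+ + 0
        r₂ = solve-∀
      difference : x -E (⟪ p , + 0 ⟫ · ⟪ + k , + 0 ⟫) ≡ ⟪ q , + 0 ⟫ · ⟪ c , + 1 ⟫
      difference = trans (cong (λ y → y -E (⟪ p , + 0 ⟫ · ⟪ + k , + 0 ⟫)) split) (+E-cancel (⟪ q , + 0 ⟫ · ⟪ c , + 1 ⟫) (⟪ p , + 0 ⟫ · ⟪ + k , + 0 ⟫))

  Listed : Unary → Set
  Listed L = (Σ ℕ λ r → (1 ℕ.≤ r) × Isometric L (L₁ ρ r))
           ⊎ (Σ ℤ λ c → (c ≡ c₂ ⊎ c ≡ c₃) × Σ ℕ λ r → InR ρ r × Isometric L (Lⱼ ρ c r))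

  -- For `a = 1` every integral shift of `b` is a translation, so `b` becomes 0 and the ideal a
  -- multiple of `𝒪`.
  principal : ∀ L → PosDefIntegral L → ∀ b → Multiple (_∈ᴵ ideal L) (+ 1) b → Listed L
  principal L pos b M = let (r , P) = present L 1 (+ 0) (+ N) (s≤s z≤n) (ℤₚ.*-identityˡ (+ N)) M₀ pos
    in inj₁ (r , Presentation.r≥1 P , isometric-model P (L₁-model r (Presentation.r≥1 P)))
    where
    s : ∀ b → b ℤ.+ (ℤ.- b) ℤ.* + 1 ≡ + 0
    s = solve-∀
    M₀ : Multiple (_∈ᴵ ideal L) (+ 1) (+ 0)
    M₀ = subst (Multiple (_∈ᴵ ideal L) (+ 1)) (s b) (translate (+ 1) b (ℤ.- b) M)

  -- Representability makes the scale `r` a sum of values, and the closure of `R` then places it in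
  -- `R`. The closure is certified for `c₂`, hence the reflection for the conjugate ideal.
  non-principal : ∀ L → PosDefIntegral L → ∀ {m} → RepresentedBy L m → ∀ c → c ≡ c₂ ⊎ c ≡ c₃ → Multiple (_∈ᴵ ideal L) (+ k) c → Listed L
  non-principal L pos {m} rep c cc M = let (r , P) = present L k c (+ C) Cert.k≥1 (conjugate cc) M pos
    in inj₂ (c , cc , r , Cert.closed m r (Presentation.r≥1 P) (to-c₂ cc (represented-sum P rep)) , isometric-model P (Lⱼ-model c r cc (Presentation.r≥1 P)))

  classify : ∀ L → InS L → Listed L
  classify L (pos , m , _ , rep) = go (reduce-ideal (ideal L))
    where
    go : Reduced (_∈ᴵ ideal L) → Listed L
    go (reduced (suc a) b c _ D centre a≤c small M) = by (Cert.reduced a b c D centre a≤c small)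
      where
      by : a ≡ 0 ⊎ (suc a ≡ k × (b ≡ c₂ ⊎ b ≡ c₃)) → Listed L
      by (inj₁ e) = principal L pos b (subst (λ t → Multiple (_∈ᴵ ideal L) (+ suc t) b) e M)
      by (inj₂ (e , bb)) = non-principal L pos rep b bb (subst (λ t → Multiple (_∈ᴵ ideal L) (+ t) b) e M)

  R-positive : ∀ {r} → InR ρ r → 1 ℕ.≤ r
  R-positive h = ℕₚ.≤-trans Cert.k≥1 (proj₁ h)

  listed-represented : ∀ L → Listed L → RepresentedBy L g
  listed-represented L (inj₁ (r , r≥1 , iso)) = isometric-represented {L} {L₁ ρ r} {g} iso (model-represented {m = g} (L₁-model r r≥1) (Cert.unary r r≥1))
  listed-represented L (inj₂ (c , cc , r , h , iso)) = isometric-represented {L} {Lⱼ ρ c r} {g} iso (model-represented {m = g} (Lⱼ-model c r cc (R-positive h)) (from-c₂ cc (Cert.ideal r h)))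

  -- The lattice with the scale from `minimal` lies in the set, so it is represented with `g′`
  -- summands, and the certificate bounds that number from below.
  least : ∀ g′ → (∀ L → InS L → RepresentedBy L g′) → g ℕ.≤ g′
  least g′ all = by Cert.minimal
    where
    by : (Σ ℕ λ r → 1 ℕ.≤ r × (∀ m → SumOf (+ 1) (+ 0) (+ N) m r → g ℕ.≤ m)) ⊎ (Σ ℕ λ r → InR ρ r × (∀ m → SumOf (+ k) c₂ (+ C) m r → g ℕ.≤ m)) → g ℕ.≤ g′
    by (inj₁ (r , r≥1 , h)) = let M = L₁-model r r≥1 in
      h g′ (represented-sum {m = g′} (model-presentation M) (all (L₁ ρ r) (model-InS {m = g} M Cert.g≥1 (Cert.unary r r≥1))))
    by (inj₂ (r , rR , h)) = let M = Lⱼ-model c₂ r (inj₁ refl) (R-positive rR) in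
      h g′ (represented-sum {m = g′} (model-presentation M) (all (Lⱼ ρ c₂ r) (model-InS {m = g} M Cert.g≥1 (Cert.ideal r rR))))

  row-statement : RowStatement ρ
  row-statement =
    (λ L pos → classify L , λ l → pos , g , Cert.g≥1 , listed-represented L l) ,
    (Cert.g≥1 , (λ L S → listed-represented L (classify L S)) , λ g′ _ all → least g′ all)

theorem2 : (ρ : Row) → ρ ∈ table → RowStatement ρ
theorem2 ρ (here refl) = RowProof.row-statement ρ certificate-23
theorem2 ρ (there (here refl)) = RowProof.row-statement ρ certificate-31
theorem2 ρ (there (there (here refl))) = RowProof.row-statement ρ certificate-59
theorem2 ρ (there (there (there (here refl)))) = RowProof.row-statement ρ certificate-83
theorem2 ρ (there (there (there (there (here refl))))) = RowProof.row-statement ρ certificate-107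
theorem2 ρ (there (there (there (there (there (here refl)))))) = RowProof.row-statement ρ certificate-139
theorem2 ρ (there (there (there (there (there (there (here refl))))))) = RowProof.row-statement ρ certificate-211
theorem2 ρ (there (there (there (there (there (there (there (here refl)))))))) = RowProof.row-statement ρ certificate-283
theorem2 ρ (there (there (there (there (there (there (there (there (here refl))))))))) = RowProof.row-statement ρ certificate-307
theorem2 ρ (there (there (there (there (there (there (there (there (there (here refl)))))))))) = RowProof.row-statement ρ certificate-331
theorem2 ρ (there (there (there (there (there (there (there (there (there (there (here refl))))))))))) = RowProof.row-statement ρ certificate-379
theorem2 ρ (there (there (there (there (there (there (there (there (there (there (there (here refl)))))))))))) = RowProof.row-statement ρ certificate-499
theorem2 ρ (there (there (there (there (there (there (there (there (there (there (there (there (here refl))))))))))))) = RowProof.row-statement ρ certificate-547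
theorem2 ρ (there (there (there (there (there (there (there (there (there (there (there (there (there (here refl)))))))))))))) = RowProof.row-statement ρ certificate-643
theorem2 ρ (there (there (there (there (there (there (there (there (there (there (there (there (there (there (here refl))))))))))))))) = RowProof.row-statement ρ certificate-883
theorem2 ρ (there (there (there (there (there (there (there (there (there (there (there (there (there (there (there (here refl)))))))))))))))) = RowProof.row-statement ρ certificate-907
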